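{- Let $n\ge2$, let $\widetilde C_n$ have generators $r_0,\dots,r_n$, and for a homomorphism $\phi:\widetilde C_n\to W$ put $U^W_{\widetilde C_n}(q):=\sum_{w\in\widetilde C_n}q^{\ell_W(\phi(w))}$ with $\ell_W$ the length function of $W$. In each case below, $i$ ranges over $1\le i\le n-1$. \begin{enumerate} \item $\phi:\widetilde C_n\to\widetilde A_{2n+1}$, $\phi(r_0)=s_0s_{2n+1}s_0$, $\phi(r_n)=s_ns_{n+1}s_n$, $\phi(r_i)=s_is_{2n+1-i}$: $U=[n+1]_{ -q}[n+1]_{(-1)^{n+1}q}\displaystyle\prod_{\substack{k=1\\k\ne n+1}}^{2n+1}\frac{[k]_{(-1)^kq}}{1+(-q)^k}$. \item $\phi:\widetilde C_n\to\widetilde A_{2n}$, $\phi(r_0)=s_0s_{2n}s_0$, $\phi(r_n)=s_n$, $\phi(r_i)=s_is_{2n-i}$: $U=\displaystyle\prod_{k=1}^{2n}\frac{[k+1]_{(-1)^{k+1}q}}{1+(-q)^k}$. \item $\phi:\widetilde C_n\to\widetilde A_{2n-1}$, $\phi(r_0)=s_0$, $\phi(r_n)=s_n$, $\phi(r_i)=s_is_{2n-i}$: $U=\displaystyle\prod_{k=2}^{2n}\frac{[k]_{(-1)^kq}}{1+(-q)^{k-1}}$. \item $\phi:\widetilde C_n\to\widetilde B_{n+1}$, $\phi(r_j)=s_j$ for $0\le j\le n-1$, $\phi(r_n)=s_ns_{n+1}$: $U=\displaystyle\frac{[2]_q[3]_{ -q}[4]_q[2]_{ -q^{n+1}}}{(1-q)(1-q^3)(1-q^5)}\prod_{k=3}^{n}\frac{[2k+1]_q-q^k}{1-q^{2k+1}}$.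 \item $\phi:\widetilde C_n\to\widetilde D_{n+2}$, $\phi(r_0)=s_0s_1$, $\phi(r_n)=s_{n+1}s_{n+2}$, $\phi(r_i)=s_{i+1}$: $U=[2]_q[3]_{ -q}[4]_q\displaystyle\left(\prod_{k=3}^{n}\left([2k+1]_q-q^k\right)\right)\prod_{k=1}^{n}\frac{1+q^{k+1}}{1-q^{n+k+2}}$. \item $\phi:\widetilde C_n\to\widetilde C_{2n+1}$, $\phi(r_j)=s_js_{2n+1-j}$ for $0\le j\le n-1$, $\phi(r_n)=s_ns_{n+1}s_n$: $U=\displaystyle\left(\prod_{k=1}^{2n+1}[k]_{(-1)^kq}\right)\prod_{k=1}^{n}\frac{1+q^{2k}}{1-q^{2(n+k)+1}}$. \item $\phi:\widetilde C_n\to\widetilde C_{2n}$, $\phi(r_j)=s_js_{2n-j}$ for $0\le j\le n-1$, $\phi(r_n)=s_n$: $U=\displaystyle\left(\prod_{k=1}^{2n}[k]_{(-1)^kq}\right)\prod_{k=1}^{n}\frac{1+q^{2k}}{1-q^{2(n+k)-1}}$. \end{enumerate}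
   Context: $[k]_q:=1+q+\cdots+q^{k-1}$, and $[k]_{x}$ denotes the same polynomial evaluated at $x$. All groups are Coxeter groups: generators are involutions and pairs of distinct generators not listed commute. $\widetilde C_N$ ($N\ge2$): generators $s_0,\dots,s_N$ with $(s_0s_1)^4=(s_{N-1}s_N)^4=e$ and $(s_is_{i+1})^3=e$ for $1\le i\le N-2$ (for $\widetilde C_n$ itself the generators are called $r_0,\dots,r_n$). $\widetilde A_N$ ($N\ge2$): generators $s_0,\dots,s_N$, indices mod $N+1$, with $(s_is_{i+1})^3=e$. $\widetilde B_N$ ($N\ge3$): generators $s_0,\dots,s_N$ with $(s_0s_1)^4=e$, $(s_is_{i+1})^3=e$ for $1\le i\le N-3$, $(s_{N-2}s_{N-1})^3=(s_{N-2}s_N)^3=e$. $\widetilde D_N$ ($N\ge4$): generators $s_0,\dots,s_N$ with $(s_0s_2)^3=(s_1s_2)^3=e$, $(s_is_{i+1})^3=e$ for $2\le i\le N-3$, $(s_{N-2}s_{N-1})^3=(s_{N-2}s_N)^3=e$. In each part the assignment on generators extends to an injective group homomorphism (a folding subgroup). -}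

module Defs where

open import Data.Bool using (Bool; true; false; if_then_else_; _∧_; _∨_)
open import Data.Nat using (ℕ; zero; suc; _+_; _*_; _∸_; _≤_; _≡ᵇ_; _≤ᵇ_; _⊓_; _⊔_)
open import Data.Nat.DivMod using (_mod_)
open import Data.Fin using (Fin; toℕ)
open import Data.List using (List; []; _∷_; _++_; length; map; concatMap; upTo; foldr; zipWith)
open import Data.List.Relation.Unary.All using (All)
open import Data.List.Relation.Unary.Any using (Any)
open import Data.List.Relation.Unary.AllPairs using (AllPairs)
open import Data.Integer as ℤ using (ℤ; +_)
open import Data.Product using (Σ; _×_)
open import Relation.Binary.PropositionalEquality using (_≡_)
open import Relation.Nullary using (¬_)

-- Coxeter groups, presented by a Coxeter matrix on k generators.
-- Elements are words modulo the congruence generated by the relators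
-- (s_i s_j)^{m(i,j)} = e  (with m(i,i) = 1, i.e. s_i s_i = e).
-- Since all generators are involutions, this monoid presentation
-- presents the Coxeter group.

CoxMatrix : ℕ → Set
CoxMatrix k = Fin k → Fin k → ℕ

Word : ℕ → Set
Word k = List (Fin k)

alt : ∀ {k} → Fin k → Fin k → ℕ → Word k
alt i j zero    = []
alt i j (suc l) = i ∷ alt j i l

data CoxEq {k : ℕ} (M : CoxMatrix k) : Word k → Word k → Set where
  rel   : ∀ u v i j → CoxEq M (u ++ alt i j (2 * M i j) ++ v) (u ++ v)
  ≈refl  : ∀ {u} → CoxEq M u u
  ≈sym   : ∀ {u v} → CoxEq M u v → CoxEq M v u
  ≈trans : ∀ {u v w} → CoxEq M u v → CoxEq M v w → CoxEq M u w

HasLength : ∀ {k} → CoxMatrix k → Word k → ℕ → Set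
HasLength M x m =
  Σ (Word _) (λ y → length y ≡ m × CoxEq M y x)
  × (∀ y → CoxEq M y x → m ≤ length y)

mkM : ∀ {k} → (ℕ → ℕ → ℕ) → CoxMatrix k
mkM e i j = if toℕ i ≡ᵇ toℕ j then 1 else e (toℕ i ⊓ toℕ j) (toℕ i ⊔ toℕ j)

Ct : (N : ℕ) → CoxMatrix (suc N)
Ct N = mkM λ lo hi →
  if hi ≡ᵇ suc lo then (if (lo ≡ᵇ 0) ∨ (hi ≡ᵇ N) then 4 else 3) else 2

At : (N : ℕ) → CoxMatrix (suc N)
At N = mkM λ lo hi →
  if (hi ≡ᵇ suc lo) ∨ ((lo ≡ᵇ 0) ∧ (hi ≡ᵇ N)) then 3 else 2

Bt : (N : ℕ) → CoxMatrix (suc N)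
Bt N = mkM λ lo hi →
  if (lo ≡ᵇ 0) ∧ (hi ≡ᵇ 1) then 4
  else if ((hi ≡ᵇ suc lo) ∧ (1 ≤ᵇ lo) ∧ (lo ≤ᵇ N ∸ 3))
          ∨ ((lo ≡ᵇ N ∸ 2) ∧ ((hi ≡ᵇ N ∸ 1) ∨ (hi ≡ᵇ N)))
       then 3 else 2

Dt : (N : ℕ) → CoxMatrix (suc N)
Dt N = mkM λ lo hi →
  if ((hi ≡ᵇ 2) ∧ ((lo ≡ᵇ 0) ∨ (lo ≡ᵇ 1)))
     ∨ ((hi ≡ᵇ suc lo) ∧ (2 ≤ᵇ lo) ∧ (lo ≤ᵇ N ∸ 3))
     ∨ ((lo ≡ᵇ N ∸ 2) ∧ ((hi ≡ᵇ N ∸ 1) ∨ (hi ≡ᵇ N)))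
  then 3 else 2

-- a word of W = generators indexed 0..N, written with natural-number
-- indices (all indices used below are in range, so `mod` is the identity)
gens : (N : ℕ) → List ℕ → Word (suc N)
gens N = map (λ a → a mod suc N)

hom : ∀ {k l} → (Fin k → Word l) → Word k → Word l
hom φ = concatMap φ

φ1 : (n : ℕ) → Fin (suc n) → Word (suc (2 * n + 1))
φ1 n r = gens (2 * n + 1) (f (toℕ r))
  where f : ℕ → List ℕ
        f j = if j ≡ᵇ 0 then 0 ∷ (2 * n + 1) ∷ 0 ∷ []
              else if j ≡ᵇ n then n ∷ (n + 1) ∷ n ∷ []
              else j ∷ (2 * n + 1 ∸ j) ∷ []

φ2 : (n : ℕ) → Fin (suc n) → Word (suc (2 * n))
φ2 n r = gens (2 * n) (f (toℕ r))
  where f : ℕ → List ℕ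
        f j = if j ≡ᵇ 0 then 0 ∷ (2 * n) ∷ 0 ∷ []
              else if j ≡ᵇ n then n ∷ []
              else j ∷ (2 * n ∸ j) ∷ []

φ3 : (n : ℕ) → Fin (suc n) → Word (suc (2 * n ∸ 1))
φ3 n r = gens (2 * n ∸ 1) (f (toℕ r))
  where f : ℕ → List ℕ
        f j = if j ≡ᵇ 0 then 0 ∷ []
              else if j ≡ᵇ n then n ∷ []
              else j ∷ (2 * n ∸ j) ∷ []

φ4 : (n : ℕ) → Fin (suc n) → Word (suc (n + 1))
φ4 n r = gens (n + 1) (f (toℕ r))
  where f : ℕ → List ℕ
        f j = if j ≡ᵇ n then n ∷ (n + 1) ∷ [] else j ∷ []

φ5 : (n : ℕ) → Fin (suc n) → Word (suc (n + 2))
φ5 n r = gens (n + 2) (f (toℕ r))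
  where f : ℕ → List ℕ
        f j = if j ≡ᵇ 0 then 0 ∷ 1 ∷ []
              else if j ≡ᵇ n then (n + 1) ∷ (n + 2) ∷ []
              else (j + 1) ∷ []

φ6 : (n : ℕ) → Fin (suc n) → Word (suc (2 * n + 1))
φ6 n r = gens (2 * n + 1) (f (toℕ r))
  where f : ℕ → List ℕ
        f j = if j ≡ᵇ n then n ∷ (n + 1) ∷ n ∷ []
              else j ∷ (2 * n + 1 ∸ j) ∷ []

φ7 : (n : ℕ) → Fin (suc n) → Word (suc (2 * n))
φ7 n r = gens (2 * n) (f (toℕ r))
  where f : ℕ → List ℕ
        f j = if j ≡ᵇ n then n ∷ [] else j ∷ (2 * n ∸ j) ∷ []

CountClasses : {A : Set} → (A → A → Set) → (A → Set) → ℕ → Set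
CountClasses {A} R P N =
  Σ (List A) λ ws → length ws ≡ N × All P ws
    × AllPairs (λ a b → ¬ R a b) ws × (∀ w → P w → Any (R w) ws)

Series : Set
Series = ℕ → ℤ

sumℤ : List ℤ → ℤ
sumℤ = foldr ℤ._+_ (+ 0)

cst : ℤ → Series
cst c zero    = c
cst c (suc m) = + 0

𝟙 : Series
𝟙 = cst (+ 1)

q : Series
q 1 = + 1
q _ = + 0

infixl 6 _⊕_ _⊖_
infixl 7 _⊗_
_⊕_ : Series → Series → Series
(f ⊕ g) m = f m ℤ.+ g m

⊝_ : Series → Series
(⊝ f) m = ℤ.- f m

_⊖_ : Series → Series → Series
f ⊖ g = f ⊕ (⊝ g)

_⊗_ : Series → Series → Series
(f ⊗ g) m = sumℤ (map (λ i → f i ℤ.* g (m ∸ i)) (upTo (suc m)))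

infixr 8 _^s_
_^s_ : Series → ℕ → Series
f ^s zero  = 𝟙
f ^s suc k = f ⊗ (f ^s k)

_·_ : ℤ → Series → Series
(c · f) m = c ℤ.* f m

sgn : ℕ → ℤ
sgn k = ℤ.-[1+ 0 ] ℤ.^ k

-- the list a, a+1, ..., b  (empty if b < a)
range : ℕ → ℕ → List ℕ
range a b = map (λ i → a + i) (upTo (suc b ∸ a))

prodR : ℕ → ℕ → (ℕ → Series) → Series
prodR a b F = foldr (λ k acc → F k ⊗ acc) 𝟙 (range a b)

qint : ℕ → Series → Series
qint k x = foldr (λ j acc → (x ^s j) ⊕ acc) (cst (+ 0)) (upTo k)

-- multiplicative inverse of a series with constant term 1:
-- b_0 = 1, b_m = - Σ_{i=1}^{m} f_i b_{m-i}.
-- invList f m = b_m ∷ b_{m-1} ∷ ... ∷ b_0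
invList : Series → ℕ → List ℤ
invList f zero    = + 1 ∷ []
invList f (suc m) =
  ℤ.- sumℤ (zipWith ℤ._*_ (map f (range 1 (suc m))) prev) ∷ prev
  where prev = invList f m

inv : Series → Series
inv f m with invList f m
... | b ∷ _ = b
... | []    = + 0

infixl 7 _⊘_
_⊘_ : Series → Series → Series
f ⊘ g = f ⊗ inv g

GrowthIs : (n : ℕ) {l : ℕ} (MW : CoxMatrix l) (φ : Fin (suc n) → Word l)
           (F : Series) → Set
GrowthIs n MW φ F = ∀ m → Σ ℕ λ N →
  CountClasses (CoxEq (Ct n)) (λ w → HasLength MW (hom φ w) m) N
  × F m ≡ + N

sq : ℕ → Series
sq k = sgn k · q

U1 : ℕ → Series
U1 n = qint (n + 1) (⊝ q) ⊗ qint (n + 1) (sq (n + 1))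
       ⊗ prodR 1 (2 * n + 1) (λ k →
           if k ≡ᵇ n + 1 then 𝟙
           else qint k (sq k) ⊘ (𝟙 ⊕ ((⊝ q) ^s k)))

U2 : ℕ → Series
U2 n = prodR 1 (2 * n) (λ k → qint (k + 1) (sq (k + 1)) ⊘ (𝟙 ⊕ ((⊝ q) ^s k)))

U3 : ℕ → Series
U3 n = prodR 2 (2 * n) (λ k → qint k (sq k) ⊘ (𝟙 ⊕ ((⊝ q) ^s (k ∸ 1))))

U4 : ℕ → Series
U4 n = (qint 2 q ⊗ qint 3 (⊝ q) ⊗ qint 4 q ⊗ qint 2 (⊝ (q ^s (n + 1))))
       ⊘ ((𝟙 ⊖ q) ⊗ (𝟙 ⊖ q ^s 3) ⊗ (𝟙 ⊖ q ^s 5))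
       ⊗ prodR 3 n (λ k → (qint (2 * k + 1) q ⊖ q ^s k) ⊘ (𝟙 ⊖ q ^s (2 * k + 1)))

U5 : ℕ → Series
U5 n = qint 2 q ⊗ qint 3 (⊝ q) ⊗ qint 4 q
       ⊗ prodR 3 n (λ k → qint (2 * k + 1) q ⊖ q ^s k)
       ⊗ prodR 1 n (λ k → (𝟙 ⊕ q ^s (k + 1)) ⊘ (𝟙 ⊖ q ^s (n + k + 2)))

U6 : ℕ → Series
U6 n = prodR 1 (2 * n + 1) (λ k → qint k (sq k))
       ⊗ prodR 1 n (λ k → (𝟙 ⊕ q ^s (2 * k)) ⊘ (𝟙 ⊖ q ^s (2 * (n + k) + 1)))

U7 : ℕ → Series
U7 n = prodR 1 (2 * n) (λ k → qint k (sq k))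
       ⊗ prodR 1 n (λ k → (𝟙 ⊕ q ^s (2 * k)) ⊘ (𝟙 ⊖ q ^s (2 * (n + k) ∸ 1)))

{-# OPTIONS --safe #-}

-- In every case a generator of C̃_n maps to a word of W whose length A, T or B depends only on whether
-- the generator is r_0, a middle one or r_n, and the numbers games of the two groups correspond under
-- the folding. Firing only positive values lengthens words in both games, so the length in W of the
-- image of w is the sum of the weights of the letters of a reduced word of w, and U is a weighted
-- growth series of C̃_n alone.
--
-- That series is the product of the one of the parabolic subgroup generated by r_0, …, r_{n-1}, which is
-- ∏ (1 + q^(A+iT)) [i+1]_{q^T} over i < n, and the one of its minimal coset representatives. These are in
-- bijection with the points of ℤⁿ, a point being weighted by the walls that separate it from the base
-- alcove. Counting points by inserting coordinates of larger and larger level gives a multiple sum,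
-- and peeling off the zeros instead gives a recursion that is solved, by a q-Chu-Vandermonde sum, by
-- ∏ (1 + q^(B+iT)) / (1 - q^(A+B+(n-1+i)T)). Each of the seven formulas is this product rewritten.

module Submission where

open import Data.Nat using (ℕ; _≤_; _+_; _*_; _∸_)
open import Data.Product using (_×_)
open import Algebra.Bundles using (CommutativeRing; RawRing)
import Algebra.Solver.Ring as RingSolver
import Algebra.Solver.Ring.AlmostCommutativeRing as ACR
open import Data.Bool using (Bool; true; false; not; if_then_else_; _∧_; _∨_; T)
import Data.Bool.Properties as Bool
open import Data.Empty using (⊥; ⊥-elim)
open import Data.Fin using (Fin; toℕ)
import Data.Fin.Properties as Fin
open import Data.Integer as ℤ using (ℤ; +_; -[1+_])
import Data.Integer.Properties as ℤ
open import Data.List using (List; []; _∷_; map; applyUpTo; upTo; zipWith; foldr; _++_; length; cartesianProductWith; replicate)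
import Data.List.Properties as List
open import Data.List.Relation.Unary.All as All using (All; []; _∷_)
import Data.List.Relation.Unary.All.Properties as All
open import Data.List.Relation.Unary.AllPairs as AllPairs using (AllPairs; []; _∷_)
import Data.List.Relation.Unary.AllPairs.Properties as AllPairs
open import Data.List.Relation.Unary.Any as Any using (Any; here; there)
import Data.List.Relation.Unary.Any.Properties as Any
open import Data.Maybe using (Maybe; just; nothing; is-just)
import Data.Nat as ℕ
open import Data.Nat using (zero; suc; _<_; z≤n; s≤s; _≡ᵇ_; _<ᵇ_; _⊓_; _⊔_; _≤ᵇ_)
open import Data.Nat.DivMod as ℕ using (_mod_)
open import Data.Nat.ListAction using (sum)
import Data.Nat.Properties as ℕ
open import Data.Product using (Σ; ∃; _,_; proj₁; proj₂)
open import Data.Sum using (_⊎_; inj₁; inj₂)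
open import Data.Unit using (⊤; tt)
import Data.Vec as Vec
open import Data.Vec.N-ary using (N-ary; _$ⁿ_; Eq; curryⁿ; curryⁿ-cong)
open import Function using (_∘_; id)
open import Function.Bundles using (Equivalence)
open import Level using (0ℓ)
open import Relation.Binary using (IsEquivalence; tri<; tri≈; tri>)
open import Relation.Binary.Consequences using (dec⇒weaklyDec)
open import Relation.Binary.Definitions using (WeaklyDecidable)
open import Relation.Binary.PropositionalEquality
import Relation.Binary.Reasoning.Setoid as SetoidReasoning
open import Relation.Nullary using (yes; no; ¬_)

-- `HasLength` is a minimum over all words of W, so each length needs a certificate of minimality.
-- The numbers game supplies it: from a strictly positive start, a word that fires only positive
-- values is determined, up to the relations, by the state it reaches, and no equal word is shorter.
-- The same uniqueness makes the action faithful, so no relation of C̃_n has to be verified in W by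
-- hand. Starts with zeros are needed for cosets; whether a firing lengthens is shown not to depend
-- on the start.
--
-- The order 0, 1, -1, 2, -2, ... of the integers makes the lattice points countable: the number of
-- pair walls of a coordinate of top level with a lower one depends only on the level and on which
-- of the two stands first. So inserting a level contributes a Gaussian binomial coefficient. The
-- resulting sum has no visible closed form, whereas the recursion by zeros has one. The two are
-- compared for a bounded number K of levels, by commuting the removal of the top level with that of
-- the zeros, and K peelings already fix all coefficients up to degree K.

module RingTactic {r₁ r₂ r₃ r₄} (Coeff : RawRing r₁ r₄) (R : ACR.AlmostCommutativeRing r₂ r₃)
                  (ι : Coeff ACR.-Raw-AlmostCommutative⟶ R) (ι≟ : WeaklyDecidable (ACR.Induced-equivalence ι)) where

  open ACR.AlmostCommutativeRing R using (_≈_) renaming (sym to ≈-sym; trans to ≈-trans)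
  open RingSolver Coeff R ι ι≟ hiding (solve)
  open RingSolver Coeff R ι ι≟ public using (con; _:+_; _:*_; _:-_; :-_; _:=_)

  normal-equal : ∀ {n} (p r : Polynomial n) → T (is-just (normalise p ≟N normalise r)) → ∀ ρ → ⟦ p ⟧ ρ ≈ ⟦ r ⟧ ρ
  normal-equal p r e ρ = ≈-trans (≈-sym (correct p ρ)) (≈-trans (equal (normalise p ≟N normalise r) e) (correct r ρ))
    where
    equal : (d : Maybe (normalise p ≈N normalise r)) → T (is-just d) → ⟦ normalise p ⟧N ρ ≈ ⟦ normalise r ⟧N ρ
    equal (just d) _ = ⟦ d ⟧N-cong ρ

  -- Normal forms are compared as data, which is far cheaper for Agda than comparing their meanings,
  -- as the solve of the library does.
  solve : ∀ n (f : N-ary n (Polynomial n) (Polynomial n × Polynomial n)) →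
          (let p , r = f $ⁿ Vec.map var (Vec.allFin n)) →
          {T (is-just (normalise p ≟N normalise r))} → Eq n _≈_ (curryⁿ ⟦ p ⟧) (curryⁿ ⟦ r ⟧)
  solve n f {e} = curryⁿ-cong _≈_ ⟦ proj₁ pr ⟧ ⟦ proj₂ pr ⟧ (normal-equal (proj₁ pr) (proj₂ pr) e)
    where pr = f $ⁿ Vec.map var (Vec.allFin n)

module ℕSolver = RingTactic _ (ACR.fromCommutativeSemiring ℕ.+-*-commutativeSemiring)
  (ACR.-raw-almostCommutative⟶ _) (dec⇒weaklyDec ℕ._≟_)
module ℤSolver = RingTactic _ (ACR.fromCommutativeRing ℤ.+-*-commutativeRing)
  (ACR.-raw-almostCommutative⟶ _) (dec⇒weaklyDec ℤ._≟_)

module N = ℕSolver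

-- Exponents for the coordinates of a lattice point

bit : Bool → ℕ
bit true  = 1
bit false = 0

triangle : ℕ → ℕ
triangle zero    = 0
triangle (suc m) = m ℕ.+ triangle m

-- The first K terms of B, A, B, A, ... added up: a coordinate of level K has met walls of weight B
-- and of weight A in turn.
levelCost : ℕ → ℕ → ℕ → ℕ
levelCost A B zero    = 0
levelCost A B (suc K) = B ℕ.+ levelCost B A K

-- What m coordinates of level K + 1 cost beside r lower ones, as far as it does not depend on their
-- order: their own walls, K + 1 walls for each of the `triangle m` pairs among them, K walls for
-- each mixed pair. The one further wall of some mixed pairs is left to the Gaussian binomial.
topCost : (A T B K m r : ℕ) → ℕ
topCost A T B K m r = m ℕ.* levelCost A B (suc K) ℕ.+ T ℕ.* (suc K ℕ.* triangle m ℕ.+ K ℕ.* (m ℕ.* r))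

-- Finite sums over an abstract commutative ring

module Sums (R : CommutativeRing 0ℓ 0ℓ)
            (ι : CommutativeRing.rawRing ℤ.+-*-commutativeRing
                 ACR.-Raw-AlmostCommutative⟶ ACR.fromCommutativeRing R) where

  module SR = CommutativeRing R
  module ≋-Reasoning = SetoidReasoning SR.setoid
  open SR public using () renaming
    ( Carrier to Elem ; _≈_ to _≋_ ; _+_ to _⊕_ ; _*_ to _⊗_ ; -_ to ⊝_ ; _-_ to _⊖_
    ; refl to ≋-refl ; sym to ≋-sym ; trans to ≋-trans ; +-cong to ⊕-cong ; *-cong to ⊗-cong)

  ≡⇒≋ : ∀ {f g} → f ≡ g → f ≋ g
  ≡⇒≋ refl = ≋-refl

  ⊗-congˡ : ∀ h {f g} → f ≋ g → h ⊗ f ≋ h ⊗ g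
  ⊗-congˡ h = SR.*-congˡ

  ⊗-congʳ : ∀ h {f g} → f ≋ g → f ⊗ h ≋ g ⊗ h
  ⊗-congʳ h = SR.*-congʳ

  ⊕-congˡ : ∀ h {f g} → f ≋ g → h ⊕ f ≋ h ⊕ g
  ⊕-congˡ h = SR.+-congˡ

  𝟘 𝟙 : Elem
  𝟘 = ACR._-Raw-AlmostCommutative⟶_.⟦_⟧ ι (+ 0)
  𝟙 = ACR._-Raw-AlmostCommutative⟶_.⟦_⟧ ι (+ 1)

  ι≟ : ∀ a b → Maybe (ACR._-Raw-AlmostCommutative⟶_.⟦_⟧ ι a ≋ ACR._-Raw-AlmostCommutative⟶_.⟦_⟧ ι b)
  ι≟ a b with a ℤ.≟ b
  ... | yes refl = just ≋-refl
  ... | no _ = nothing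

  module SeriesSolver = RingTactic (CommutativeRing.rawRing ℤ.+-*-commutativeRing)
    (ACR.fromCommutativeRing R) ι ι≟

  ⊗-identityˡ : ∀ f → 𝟙 ⊗ f ≋ f
  ⊗-identityˡ = solve 1 (λ f → con (+ 1) :* f := f)
    where open SeriesSolver

  ⊗-identityʳ : ∀ f → f ⊗ 𝟙 ≋ f
  ⊗-identityʳ = solve 1 (λ f → f :* con (+ 1) := f)
    where open SeriesSolver

  ⊕-identityˡ : ∀ f → 𝟘 ⊕ f ≋ f
  ⊕-identityˡ = solve 1 (λ f → con (+ 0) :+ f := f)
    where open SeriesSolver

  ⊕-identityʳ : ∀ f → f ⊕ 𝟘 ≋ f
  ⊕-identityʳ = solve 1 (λ f → f :+ con (+ 0) := f)
    where open SeriesSolver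

  ⊗-zeroʳ : ∀ f → f ⊗ 𝟘 ≋ 𝟘
  ⊗-zeroʳ = solve 1 (λ f → f :* con (+ 0) := con (+ 0))
    where open SeriesSolver

  ΣS : ℕ → (ℕ → Elem) → Elem
  ΣS zero    F = 𝟘
  ΣS (suc n) F = F 0 ⊕ ΣS n (F ∘ suc)

  ΣS-cong : ∀ n {F G} → (∀ i → i < n → F i ≋ G i) → ΣS n F ≋ ΣS n G
  ΣS-cong zero    e = ≋-refl
  ΣS-cong (suc n) e = ⊕-cong (e 0 (s≤s z≤n)) (ΣS-cong n λ i i<n → e (suc i) (s≤s i<n))

  ΣS-+ : ∀ m n F → ΣS (m ℕ.+ n) F ≋ ΣS m F ⊕ ΣS n (λ i → F (m ℕ.+ i))
  ΣS-+ zero n F = ≋-sym (⊕-identityˡ _)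
  ΣS-+ (suc m) n F = ≋-trans (⊕-congˡ (F 0) (ΣS-+ m n (F ∘ suc)))
    (≋-sym (SR.+-assoc (F 0) (ΣS m (F ∘ suc)) (ΣS n (λ i → F (suc m ℕ.+ i)))))

  ΣS-⊗ : ∀ n h F → ΣS n (λ i → h ⊗ F i) ≋ h ⊗ ΣS n F
  ΣS-⊗ zero h F = ≋-sym (⊗-zeroʳ h)
  ΣS-⊗ (suc n) h F = ≋-trans (⊕-congˡ (h ⊗ F 0) (ΣS-⊗ n h (F ∘ suc)))
    (≋-sym (SR.distribˡ h (F 0) (ΣS n (F ∘ suc))))

  -- antidiagonal sums

  Σ+ : ℕ → (ℕ → ℕ → Elem) → Elem
  Σ+ zero    F = F 0 0
  Σ+ (suc n) F = F 0 (suc n) ⊕ Σ+ n (F ∘ suc)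

  ΣS-Σ+ : ∀ n F → ΣS (suc n) (λ r → F r (n ∸ r)) ≋ Σ+ n F
  ΣS-Σ+ zero    F = ⊕-identityʳ (F 0 0)
  ΣS-Σ+ (suc n) F = ⊕-congˡ (F 0 (suc n)) (ΣS-Σ+ n (F ∘ suc))

  Σ+-cong : ∀ n {F G} → (∀ r z → r ℕ.+ z ≡ n → F r z ≋ G r z) → Σ+ n F ≋ Σ+ n G
  Σ+-cong zero    e = e 0 0 refl
  Σ+-cong (suc n) e = ⊕-cong (e 0 (suc n) refl) (Σ+-cong n λ r z p → e (suc r) z (cong suc p))

  interchange : ∀ a b c d → (a ⊕ b) ⊕ (c ⊕ d) ≋ (a ⊕ c) ⊕ (b ⊕ d)
  interchange = solve 4 (λ a b c d → (a :+ b) :+ (c :+ d) := (a :+ c) :+ (b :+ d))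
    where open SeriesSolver

  Σ+-⊕ : ∀ n F G → Σ+ n (λ r z → F r z ⊕ G r z) ≋ Σ+ n F ⊕ Σ+ n G
  Σ+-⊕ zero    F G = ≋-refl
  Σ+-⊕ (suc n) F G = ≋-trans (⊕-congˡ (F 0 (suc n) ⊕ G 0 (suc n)) (Σ+-⊕ n (F ∘ suc) (G ∘ suc)))
    (interchange (F 0 (suc n)) (G 0 (suc n)) (Σ+ n (F ∘ suc)) (Σ+ n (G ∘ suc)))

  Σ+-⊗ : ∀ n h F → Σ+ n (λ r z → h ⊗ F r z) ≋ h ⊗ Σ+ n F
  Σ+-⊗ zero    h F = ≋-refl
  Σ+-⊗ (suc n) h F = ≋-trans (⊕-congˡ (h ⊗ F 0 (suc n)) (Σ+-⊗ n h (F ∘ suc)))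
    (≋-sym (SR.distribˡ h (F 0 (suc n)) (Σ+ n (F ∘ suc))))

  Σ+-last : ∀ n F → Σ+ (suc n) F ≋ Σ+ n (λ r z → F r (suc z)) ⊕ F (suc n) 0
  Σ+-last zero    F = ≋-refl
  Σ+-last (suc n) F = ≋-trans (⊕-congˡ (F 0 (suc (suc n))) (Σ+-last n (F ∘ suc)))
    (≋-sym (SR.+-assoc (F 0 (suc (suc n))) (Σ+ n (λ r z → F (suc r) (suc z))) (F (suc (suc n)) 0)))

  -- Both sides run over all triples m + r + z = n.
  Σ+-assoc : ∀ n (f : ℕ → ℕ → ℕ → Elem) →
    Σ+ n (λ m y → Σ+ y (λ r z → f m r z)) ≋ Σ+ n (λ s z → Σ+ s (λ m r → f m r z))
  Σ+-assoc zero    f = ≋-refl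
  Σ+-assoc (suc n) f = begin
    (f 0 0 (suc n) ⊕ Σ+ n (f 0 ∘ suc)) ⊕ Σ+ n (λ m y → Σ+ y (f (suc m)))
      ≈⟨ ⊕-congˡ _ (Σ+-assoc n (f ∘ suc)) ⟩
    (f 0 0 (suc n) ⊕ Σ+ n (f 0 ∘ suc)) ⊕ Σ+ n (λ s z → Σ+ s (λ m r → f (suc m) r z))
      ≈⟨ SR.+-assoc (f 0 0 (suc n)) (Σ+ n (f 0 ∘ suc)) _ ⟩
    f 0 0 (suc n) ⊕ (Σ+ n (f 0 ∘ suc) ⊕ Σ+ n (λ s z → Σ+ s (λ m r → f (suc m) r z)))
      ≈⟨ ⊕-congˡ (f 0 0 (suc n)) (Σ+-⊕ n (f 0 ∘ suc) (λ s z → Σ+ s (λ m r → f (suc m) r z))) ⟨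
    f 0 0 (suc n) ⊕ Σ+ n (λ s z → f 0 (suc s) z ⊕ Σ+ s (λ m r → f (suc m) r z)) ∎
    where open ≋-Reasoning

-- Gaussian binomials and the two multiple sums

module QBinomial (R : CommutativeRing 0ℓ 0ℓ)
                 (ι : CommutativeRing.rawRing ℤ.+-*-commutativeRing
                      ACR.-Raw-AlmostCommutative⟶ ACR.fromCommutativeRing R)
                 (X : ℕ → CommutativeRing.Carrier R) (T : ℕ) where
  open Sums R ι

  -- With `X a` read as q^a, this is [m] at q^T.
  tint : ℕ → Elem
  tint m = ΣS m (λ j → X (j ℕ.* T))

  -- All that the identities ask of the powers q^a. Cancellation of q-integers takes the place of
  -- division by q-factorials, so no field of fractions is needed.
  record Exponential : Set where
    field
      X-zero      : X 0 ≋ 𝟙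
      X-+         : ∀ a b → X (a ℕ.+ b) ≋ X a ⊗ X b
      tint-cancel : ∀ m {f g} → tint (suc m) ⊗ f ≋ tint (suc m) ⊗ g → f ≋ g

  -- The Gaussian binomial coefficient (m + r choose m), by either of the two Pascal rules.
  gauss : Bool → ℕ → ℕ → Elem
  gauss b zero    zero    = 𝟙
  gauss b (suc m) zero    = X (T ℕ.* (bit b ℕ.* 0)) ⊗ gauss b m zero
  gauss b zero    (suc r) = X (T ℕ.* (bit (not b) ℕ.* 0)) ⊗ gauss b zero r
  gauss b (suc m) (suc r) = X (T ℕ.* (bit b ℕ.* suc r)) ⊗ gauss b m (suc r)
                          ⊕ X (T ℕ.* (bit (not b) ℕ.* suc m)) ⊗ gauss b (suc m) r

  -- the products (-q^c; q^T)_n and (q^c; q^T)_n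

  plus minus : ℕ → ℕ → Elem
  plus c zero    = 𝟙
  plus c (suc n) = (𝟙 ⊕ X c) ⊗ plus (c ℕ.+ T) n
  minus c zero    = 𝟙
  minus c (suc n) = (𝟙 ⊖ X c) ⊗ minus (c ℕ.+ T) n

  -- Inserting the top levels one after the other, and peeling off the zeros.
  outer : ℕ → (ℕ → Bool) → ℕ → ℕ → ℕ → Elem
  outer zero    ε A B n = 𝟙
  outer (suc K) ε A B n = Σ+ n λ m r → X (topCost A T B K m r) ⊗ (gauss (ε K) m r ⊗ outer K ε A B r)

  binom : ℕ → ℕ → Elem
  binom = gauss true

  -- The part of the cost of r nonzero coordinates that disappears when each of their levels drops
  -- by one: a wall of weight B for each coordinate and one of weight T for each pair.
  inner : ℕ → ℕ → ℕ
  inner B r = r ℕ.* B ℕ.+ T ℕ.* triangle r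

  peeled : ℕ → ℕ → ℕ → ℕ → Elem
  peeled zero    A B n = 𝟙
  peeled (suc K) A B n = Σ+ n λ r z → binom r z ⊗ (X (inner B r) ⊗ peeled K (B ℕ.+ z ℕ.* T) (A ℕ.+ z ℕ.* T) r)

-- Equality of the two sums and solution of the recursion

module QIdentities (R : CommutativeRing 0ℓ 0ℓ)
                   (ι : CommutativeRing.rawRing ℤ.+-*-commutativeRing
                        ACR.-Raw-AlmostCommutative⟶ ACR.fromCommutativeRing R)
                   (X : ℕ → CommutativeRing.Carrier R) (T : ℕ)
                   (exponential : QBinomial.Exponential R ι X T) where
  open Sums R ι
  open QBinomial R ι X T
  open Exponential exponential

  X-cong : ∀ {a b} → a ≡ b → X a ≋ X b
  X-cong e = ≡⇒≋ (cong X e)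

  factorial : ℕ → Elem
  factorial zero    = 𝟙
  factorial (suc m) = tint (suc m) ⊗ factorial m

  tint-+ : ∀ m r → tint (m ℕ.+ r) ≋ tint m ⊕ X (m ℕ.* T) ⊗ tint r
  tint-+ m r = ≋-trans (ΣS-+ m r _) (⊕-congˡ (tint m)
    (≋-trans (ΣS-cong r λ i _ → ≋-trans (X-cong (ℕ.*-distribʳ-+ T m i)) (X-+ (m ℕ.* T) (i ℕ.* T)))
             (ΣS-⊗ r (X (m ℕ.* T)) (λ i → X (i ℕ.* T)))))

  T-0 : ∀ b → X (T ℕ.* (b ℕ.* 0)) ≋ 𝟙
  T-0 b = ≋-trans (X-cong (trans (cong (T ℕ.*_) (ℕ.*-zeroʳ b)) (ℕ.*-zeroʳ T))) X-zero

  -- The quotient formula without division. Either Pascal rule leads to it, because [m + r] splits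
  -- as a sum in two ways, with the power of q on either part.
  gauss-factorial : ∀ b m r → gauss b m r ⊗ (factorial m ⊗ factorial r) ≋ factorial (m ℕ.+ r)
  gauss-factorial b zero zero = ≋-trans (⊗-identityˡ (𝟙 ⊗ 𝟙)) (⊗-identityˡ 𝟙)
  gauss-factorial b (suc m) zero = begin
    X (T ℕ.* (bit b ℕ.* 0)) ⊗ gauss b m 0 ⊗ (tint (suc m) ⊗ factorial m ⊗ 𝟙)
      ≈⟨ ⊗-congʳ _ (⊗-congʳ (gauss b m 0) (T-0 (bit b))) ⟩
    𝟙 ⊗ gauss b m 0 ⊗ (tint (suc m) ⊗ factorial m ⊗ 𝟙)
      ≈⟨ solve 3 (λ g t f → con (+ 1) :* g :* (t :* f :* con (+ 1)) := t :* (g :* (f :* con (+ 1))))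
           (gauss b m 0) (tint (suc m)) (factorial m) ⟩
    tint (suc m) ⊗ (gauss b m 0 ⊗ (factorial m ⊗ 𝟙)) ≈⟨ ⊗-congˡ (tint (suc m)) (gauss-factorial b m 0) ⟩
    tint (suc m) ⊗ factorial (m ℕ.+ 0) ≡⟨ cong (λ k → tint (suc k) ⊗ factorial (m ℕ.+ 0)) (ℕ.+-identityʳ m) ⟨
    factorial (suc m ℕ.+ 0) ∎
    where open ≋-Reasoning
          open SeriesSolver
  gauss-factorial b zero (suc r) = begin
    X (T ℕ.* (bit (not b) ℕ.* 0)) ⊗ gauss b 0 r ⊗ (𝟙 ⊗ (tint (suc r) ⊗ factorial r))
      ≈⟨ ⊗-congʳ _ (⊗-congʳ (gauss b 0 r) (T-0 (bit (not b)))) ⟩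
    𝟙 ⊗ gauss b 0 r ⊗ (𝟙 ⊗ (tint (suc r) ⊗ factorial r))
      ≈⟨ solve 3 (λ g t f → con (+ 1) :* g :* (con (+ 1) :* (t :* f)) := t :* (g :* (con (+ 1) :* f)))
           (gauss b 0 r) (tint (suc r)) (factorial r) ⟩
    tint (suc r) ⊗ (gauss b 0 r ⊗ (𝟙 ⊗ factorial r)) ≈⟨ ⊗-congˡ (tint (suc r)) (gauss-factorial b 0 r) ⟩
    factorial (suc r) ∎
    where open ≋-Reasoning
          open SeriesSolver
  gauss-factorial b (suc m) (suc r) = begin
    (x ⊗ g₁ ⊕ y ⊗ g₂) ⊗ (tint (suc m) ⊗ factorial m ⊗ (tint (suc r) ⊗ factorial r))
      ≈⟨ solve 8 (λ x y g₁ g₂ tm tr fm fr → (x :* g₁ :+ y :* g₂) :* (tm :* fm :* (tr :* fr))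
           := x :* tm :* (g₁ :* (fm :* (tr :* fr))) :+ y :* tr :* (g₂ :* (tm :* fm :* fr)))
           x y g₁ g₂ (tint (suc m)) (tint (suc r)) (factorial m) (factorial r) ⟩
    x ⊗ tint (suc m) ⊗ (g₁ ⊗ (factorial m ⊗ factorial (suc r))) ⊕ y ⊗ tint (suc r) ⊗ (g₂ ⊗ (factorial (suc m) ⊗ factorial r))
      ≈⟨ ⊕-cong (⊗-congˡ (x ⊗ tint (suc m)) (gauss-factorial b m (suc r)))
                (⊗-congˡ (y ⊗ tint (suc r)) (≋-trans (gauss-factorial b (suc m) r) (≡⇒≋ (cong factorial (sym (ℕ.+-suc m r)))))) ⟩
    x ⊗ tint (suc m) ⊗ f ⊕ y ⊗ tint (suc r) ⊗ f
      ≈⟨ SR.distribʳ f (x ⊗ tint (suc m)) (y ⊗ tint (suc r)) ⟨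
    (x ⊗ tint (suc m) ⊕ y ⊗ tint (suc r)) ⊗ f ≈⟨ ⊗-congʳ f (pascal b) ⟩
    tint (suc m ℕ.+ suc r) ⊗ f ∎
    where
    open ≋-Reasoning
    open SeriesSolver
    x = X (T ℕ.* (bit b ℕ.* suc r)) ; y = X (T ℕ.* (bit (not b) ℕ.* suc m))
    g₁ = gauss b m (suc r) ; g₂ = gauss b (suc m) r
    f = factorial (m ℕ.+ suc r)
    one : ∀ s → T ℕ.* (1 ℕ.* s) ≡ s ℕ.* T
    one s = trans (cong (T ℕ.*_) (ℕ.*-identityˡ s)) (ℕ.*-comm T s)
    pascal : ∀ b → X (T ℕ.* (bit b ℕ.* suc r)) ⊗ tint (suc m) ⊕ X (T ℕ.* (bit (not b) ℕ.* suc m)) ⊗ tint (suc r)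
                 ≋ tint (suc m ℕ.+ suc r)
    pascal true = begin
      X (T ℕ.* (1 ℕ.* suc r)) ⊗ tint (suc m) ⊕ X (T ℕ.* 0) ⊗ tint (suc r)
        ≈⟨ ⊕-cong (⊗-congʳ _ (X-cong (one (suc r)))) (≋-trans (⊗-congʳ (tint (suc r)) (≋-trans (X-cong (ℕ.*-zeroʳ T)) X-zero)) (⊗-identityˡ _)) ⟩
      X (suc r ℕ.* T) ⊗ tint (suc m) ⊕ tint (suc r) ≈⟨ SR.+-comm _ _ ⟩
      tint (suc r) ⊕ X (suc r ℕ.* T) ⊗ tint (suc m) ≈⟨ tint-+ (suc r) (suc m) ⟨
      tint (suc r ℕ.+ suc m) ≡⟨ cong (tint) (ℕ.+-comm (suc r) (suc m)) ⟩
      tint (suc m ℕ.+ suc r) ∎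
    pascal false = begin
      X (T ℕ.* 0) ⊗ tint (suc m) ⊕ X (T ℕ.* (1 ℕ.* suc m)) ⊗ tint (suc r)
        ≈⟨ ⊕-cong (≋-trans (⊗-congʳ (tint (suc m)) (≋-trans (X-cong (ℕ.*-zeroʳ T)) X-zero)) (⊗-identityˡ _)) (⊗-congʳ _ (X-cong (one (suc m)))) ⟩
      tint (suc m) ⊕ X (suc m ℕ.* T) ⊗ tint (suc r) ≈⟨ tint-+ (suc m) (suc r) ⟨
      tint (suc m ℕ.+ suc r) ∎

  factorial-cancel : ∀ m {f g} → factorial m ⊗ f ≋ factorial m ⊗ g → f ≋ g
  factorial-cancel zero    e = ≋-trans (≋-sym (⊗-identityˡ _)) (≋-trans e (⊗-identityˡ _))
  factorial-cancel (suc m) e = factorial-cancel m (tint-cancel m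
    (≋-trans (≋-sym (SR.*-assoc _ _ _)) (≋-trans e (SR.*-assoc _ _ _))))

  factorial²-cancel : ∀ m r {f g} → factorial m ⊗ factorial r ⊗ f ≋ factorial m ⊗ factorial r ⊗ g → f ≋ g
  factorial²-cancel m r e = factorial-cancel r (factorial-cancel m
    (≋-trans (≋-sym (SR.*-assoc _ _ _)) (≋-trans e (SR.*-assoc _ _ _))))

  factorial³-cancel : ∀ m r z {f g} → factorial m ⊗ factorial r ⊗ factorial z ⊗ f ≋ factorial m ⊗ factorial r ⊗ factorial z ⊗ g → f ≋ g
  factorial³-cancel m r z e = factorial-cancel z (factorial²-cancel m r
    (≋-trans (≋-sym (SR.*-assoc _ _ _)) (≋-trans e (SR.*-assoc _ _ _))))

  -- Which Pascal rule counts the insertions of a level depends on the parity of that level. Both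
  -- rules solve the equation of `gauss-factorial`, and q-factorials cancel, so the parity can be
  -- forgotten.
  gauss-binom : ∀ b m r → gauss b m r ≋ binom m r
  gauss-binom b m r = factorial²-cancel m r
    (≋-trans (SR.*-comm _ (gauss b m r)) (≋-trans (gauss-factorial b m r)
      (≋-trans (≋-sym (gauss-factorial true m r)) (SR.*-comm (binom m r) _))))

  -- Both sides are the q-multinomial coefficient of m, r and z.
  trinomial : ∀ m r z → binom m (r ℕ.+ z) ⊗ binom r z ≋ binom (m ℕ.+ r) z ⊗ binom m r
  trinomial m r z = factorial³-cancel m r z (begin
      factorial m ⊗ factorial r ⊗ factorial z ⊗ (binom m (r ℕ.+ z) ⊗ binom r z)
        ≈⟨ solve 5 (λ a b c d e → a :* b :* c :* (d :* e) := d :* (a :* (e :* (b :* c))))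
             (factorial m) (factorial r) (factorial z) (binom m (r ℕ.+ z)) (binom r z) ⟩
      binom m (r ℕ.+ z) ⊗ (factorial m ⊗ (binom r z ⊗ (factorial r ⊗ factorial z)))
        ≈⟨ ⊗-congˡ (binom m (r ℕ.+ z)) (⊗-congˡ (factorial m) (gauss-factorial true r z)) ⟩
      binom m (r ℕ.+ z) ⊗ (factorial m ⊗ factorial (r ℕ.+ z)) ≈⟨ gauss-factorial true m (r ℕ.+ z) ⟩
      factorial (m ℕ.+ (r ℕ.+ z)) ≡⟨ cong factorial (ℕ.+-assoc m r z) ⟨
      factorial (m ℕ.+ r ℕ.+ z) ≈⟨ gauss-factorial true (m ℕ.+ r) z ⟨
      binom (m ℕ.+ r) z ⊗ (factorial (m ℕ.+ r) ⊗ factorial z)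
        ≈⟨ ⊗-congˡ (binom (m ℕ.+ r) z) (⊗-congʳ (factorial z) (gauss-factorial true m r)) ⟨
      binom (m ℕ.+ r) z ⊗ (binom m r ⊗ (factorial m ⊗ factorial r) ⊗ factorial z)
        ≈⟨ solve 5 (λ a b c d e → d :* (e :* (a :* b) :* c) := a :* b :* c :* (d :* e))
             (factorial m) (factorial r) (factorial z) (binom (m ℕ.+ r) z) (binom m r) ⟩
      factorial m ⊗ factorial r ⊗ factorial z ⊗ (binom (m ℕ.+ r) z ⊗ binom m r) ∎)
    where open ≋-Reasoning
          open SeriesSolver

  -- One Pascal step under the sum: each binomial of row n feeds its two neighbours in row n + 1, so
  -- the weights of those two are collected over it.
  pascal-Σ+ : ∀ n (W : ℕ → ℕ → Elem) → Σ+ (suc n) (λ r z → binom r z ⊗ W r z) ≋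
              Σ+ n (λ r z → binom r z ⊗ (W r (suc z) ⊕ X (z ℕ.* T) ⊗ W (suc r) z))
  pascal-Σ+ n W = begin
    Σ+ (suc n) (λ r z → binom r z ⊗ W r z) ≈⟨ split n ⟩
    Σ+ n (λ r z → binom r z ⊗ W r (suc z)) ⊕ Σ+ n (λ r z → X (z ℕ.* T) ⊗ binom r z ⊗ W (suc r) z)
      ≈⟨ Σ+-⊕ n _ _ ⟨
    Σ+ n (λ r z → binom r z ⊗ W r (suc z) ⊕ X (z ℕ.* T) ⊗ binom r z ⊗ W (suc r) z)
      ≈⟨ Σ+-cong n (λ r z _ → solve 4 (λ b w x w' → b :* w :+ x :* b :* w' := b :* (w :+ x :* w'))
           (binom r z) (W r (suc z)) (X (z ℕ.* T)) (W (suc r) z)) ⟩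
    Σ+ n (λ r z → binom r z ⊗ (W r (suc z) ⊕ X (z ℕ.* T) ⊗ W (suc r) z)) ∎
    where
    open ≋-Reasoning
    open SeriesSolver
    left : ∀ n → binom 0 (suc n) ⊗ W 0 (suc n) ≋ binom 0 n ⊗ W 0 (suc n)
    left n = ⊗-congʳ (W 0 (suc n)) (≋-trans (⊗-congʳ (binom 0 n) (T-0 0)) (⊗-identityˡ (binom 0 n)))
    right : ∀ n → binom (suc n) 0 ⊗ W (suc n) 0 ≋ X 0 ⊗ binom n 0 ⊗ W (suc n) 0
    right n = ⊗-congʳ (W (suc n) 0) (⊗-congʳ (binom n 0) (≋-trans (T-0 1) (≋-sym X-zero)))
    one : ∀ s → T ℕ.* (1 ℕ.* s) ≡ s ℕ.* T
    one s = trans (cong (T ℕ.*_) (ℕ.*-identityˡ s)) (ℕ.*-comm T s)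
    step : ∀ r z → binom (suc r) (suc z) ⊗ W (suc r) (suc z) ≋
      binom (suc r) z ⊗ W (suc r) (suc z) ⊕ X (suc z ℕ.* T) ⊗ binom r (suc z) ⊗ W (suc r) (suc z)
    step r z = ≋-trans (⊗-congʳ (W (suc r) (suc z)) (⊕-cong (⊗-congʳ (binom r (suc z)) (X-cong (one (suc z))))
                 (≋-trans (⊗-congʳ (binom (suc r) z) (≋-trans (X-cong (ℕ.*-zeroʳ T)) X-zero)) (⊗-identityˡ _))))
      (solve 4 (λ x g g' w → (x :* g :+ g') :* w := g' :* w :+ x :* g :* w)
         (X (suc z ℕ.* T)) (binom r (suc z)) (binom (suc r) z) (W (suc r) (suc z)))
    split : ∀ n → Σ+ (suc n) (λ r z → binom r z ⊗ W r z) ≋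
      Σ+ n (λ r z → binom r z ⊗ W r (suc z)) ⊕ Σ+ n (λ r z → X (z ℕ.* T) ⊗ binom r z ⊗ W (suc r) z)
    split zero = ⊕-cong (left 0) (right 0)
    split (suc n) = begin
      binom 0 (suc (suc n)) ⊗ W 0 (suc (suc n)) ⊕ Σ+ (suc n) (λ r z → binom (suc r) z ⊗ W (suc r) z)
        ≈⟨ ⊕-cong (left (suc n)) (Σ+-last n (λ r z → binom (suc r) z ⊗ W (suc r) z)) ⟩
      a ⊕ (Σ+ n (λ r z → binom (suc r) (suc z) ⊗ W (suc r) (suc z)) ⊕ binom (suc (suc n)) 0 ⊗ W (suc (suc n)) 0)
        ≈⟨ ⊕-congˡ a (⊕-cong (≋-trans (Σ+-cong n (λ r z _ → step r z)) (Σ+-⊕ n _ _)) (right (suc n))) ⟩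
      a ⊕ ((b ⊕ c) ⊕ d) ≈⟨ solve 4 (λ a b c d → a :+ ((b :+ c) :+ d) := (a :+ b) :+ (c :+ d)) a b c d ⟩
      (a ⊕ b) ⊕ (c ⊕ d)
        ≈⟨ ⊕-congˡ (a ⊕ b) (Σ+-last n (λ r z → X (z ℕ.* T) ⊗ binom r z ⊗ W (suc r) z)) ⟨
      (a ⊕ b) ⊕ Σ+ (suc n) (λ r z → X (z ℕ.* T) ⊗ binom r z ⊗ W (suc r) z) ∎
      where
      a = binom 0 (suc n) ⊗ W 0 (suc (suc n))
      b = Σ+ n (λ r z → binom (suc r) z ⊗ W (suc r) (suc z))
      c = Σ+ n (λ r z → X (suc z ℕ.* T) ⊗ binom r (suc z) ⊗ W (suc r) (suc z))
      d = X 0 ⊗ binom (suc n) 0 ⊗ W (suc (suc n)) 0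

  plus-+ : ∀ c m n → plus c (m ℕ.+ n) ≋ plus c m ⊗ plus (c ℕ.+ m ℕ.* T) n
  plus-+ c zero n = ≋-trans (≡⇒≋ (cong (λ k → plus k n) (sym (ℕ.+-identityʳ c)))) (≋-sym (⊗-identityˡ _))
  plus-+ c (suc m) n = ≋-trans (⊗-congˡ (𝟙 ⊕ X c) (plus-+ (c ℕ.+ T) m n))
    (≋-trans (≋-sym (SR.*-assoc (𝟙 ⊕ X c) (plus (c ℕ.+ T) m) _))
      (≡⇒≋ (cong (λ k → plus c (suc m) ⊗ plus k n) (ℕ.+-assoc c T (m ℕ.* T)))))

  minus-+ : ∀ c m n → minus c (m ℕ.+ n) ≋ minus c m ⊗ minus (c ℕ.+ m ℕ.* T) n
  minus-+ c zero n = ≋-trans (≡⇒≋ (cong (λ k → minus k n) (sym (ℕ.+-identityʳ c)))) (≋-sym (⊗-identityˡ _))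
  minus-+ c (suc m) n = ≋-trans (⊗-congˡ (𝟙 ⊖ X c) (minus-+ (c ℕ.+ T) m n))
    (≋-trans (≋-sym (SR.*-assoc (𝟙 ⊖ X c) (minus (c ℕ.+ T) m) _))
      (≡⇒≋ (cong (λ k → minus c (suc m) ⊗ minus k n) (ℕ.+-assoc c T (m ℕ.* T)))))

  plus-last : ∀ c n → plus c (suc n) ≋ (𝟙 ⊕ X (c ℕ.+ n ℕ.* T)) ⊗ plus c n
  plus-last c n = ≋-trans (≡⇒≋ (cong (plus c) (ℕ.+-comm 1 n))) (≋-trans (plus-+ c n 1)
    (≋-trans (⊗-congˡ (plus c n) (⊗-identityʳ _)) (SR.*-comm (plus c n) _)))

  minus-last : ∀ c n → minus c (suc n) ≋ (𝟙 ⊖ X (c ℕ.+ n ℕ.* T)) ⊗ minus c n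
  minus-last c n = ≋-trans (≡⇒≋ (cong (minus c) (ℕ.+-comm 1 n))) (≋-trans (minus-+ c n 1)
    (≋-trans (⊗-congˡ (minus c n) (⊗-identityʳ _)) (SR.*-comm (minus c n) _)))

  -- q-Chu-Vandermonde, with e = A + (n - 1) T
  vandermonde : ∀ n A B e → e ℕ.+ T ≡ A ℕ.+ n ℕ.* T →
    Σ+ n (λ r z → binom r z ⊗ (X (inner B r) ⊗ (plus (A ℕ.+ z ℕ.* T) r ⊗ minus (B ℕ.+ e) z))) ≋ plus B n
  vandermonde zero A B e _ = begin
    𝟙 ⊗ (X (T ℕ.* 0) ⊗ (𝟙 ⊗ 𝟙)) ≈⟨ ⊗-congˡ 𝟙 (⊗-congʳ (𝟙 ⊗ 𝟙) (≋-trans (X-cong (ℕ.*-zeroʳ T)) X-zero)) ⟩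
    𝟙 ⊗ (𝟙 ⊗ (𝟙 ⊗ 𝟙)) ≈⟨ solve 0 (con (+ 1) :* (con (+ 1) :* (con (+ 1) :* con (+ 1))) := con (+ 1)) ⟩
    𝟙 ∎
    where open ≋-Reasoning
          open SeriesSolver
  vandermonde (suc n) A B e e+T = begin
    Σ+ (suc n) (λ r z → binom r z ⊗ W r z) ≈⟨ pascal-Σ+ n W ⟩
    Σ+ n (λ r z → binom r z ⊗ (W r (suc z) ⊕ X (z ℕ.* T) ⊗ W (suc r) z)) ≈⟨ Σ+-cong n term ⟩
    Σ+ n (λ r z → (𝟙 ⊕ X (B ℕ.+ n ℕ.* T)) ⊗ (binom r z ⊗ V r z)) ≈⟨ Σ+-⊗ n (𝟙 ⊕ X (B ℕ.+ n ℕ.* T)) _ ⟩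
    (𝟙 ⊕ X (B ℕ.+ n ℕ.* T)) ⊗ Σ+ n (λ r z → binom r z ⊗ V r z)
      -- Raising A by T while n drops by one leaves e unchanged. Hence e is a parameter of its own,
      -- tied to A by an equation without subtraction.
      ≈⟨ ⊗-congˡ (𝟙 ⊕ X (B ℕ.+ n ℕ.* T)) (vandermonde n (A ℕ.+ T) B e (trans e+T (sym (ℕ.+-assoc A T (n ℕ.* T))))) ⟩
    (𝟙 ⊕ X (B ℕ.+ n ℕ.* T)) ⊗ plus B n ≈⟨ plus-last B n ⟨
    plus B (suc n) ∎
    where
    open ≋-Reasoning
    W V : ℕ → ℕ → Elem
    W r z = X (inner B r) ⊗ (plus (A ℕ.+ z ℕ.* T) r ⊗ minus (B ℕ.+ e) z)
    V r z = X (inner B r) ⊗ (plus (A ℕ.+ T ℕ.+ z ℕ.* T) r ⊗ minus (B ℕ.+ e) z)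
    e≡ : e ≡ A ℕ.+ n ℕ.* T
    e≡ = ℕ.+-cancelʳ-≡ T e (A ℕ.+ n ℕ.* T) (trans e+T (trans (cong (A ℕ.+_) (ℕ.+-comm T (n ℕ.* T))) (sym (ℕ.+-assoc A (n ℕ.* T) T))))
    term : ∀ r z → r ℕ.+ z ≡ n → binom r z ⊗ (W r (suc z) ⊕ X (z ℕ.* T) ⊗ W (suc r) z) ≋
           (𝟙 ⊕ X (B ℕ.+ n ℕ.* T)) ⊗ (binom r z ⊗ V r z)
    term r z refl = begin
      binom r z ⊗ (W r (suc z) ⊕ X (z ℕ.* T) ⊗ W (suc r) z)
        ≈⟨ ⊗-congˡ (binom r z) (⊕-cong
             (⊗-congˡ (X (inner B r)) (⊗-cong (≡⇒≋ (cong (λ k → plus k r) (sym (ℕ.+-assoc A T (z ℕ.* T))))) (minus-last (B ℕ.+ e) z)))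
             (⊗-congˡ (X (z ℕ.* T)) (⊗-cong (X-split r)
               (⊗-congʳ (minus (B ℕ.+ e) z) (⊗-congˡ (𝟙 ⊕ X (A ℕ.+ z ℕ.* T)) (≡⇒≋ (cong (λ k → plus k r) shift-eq))))))) ⟩
      binom r z ⊗ (x ⊗ (p ⊗ ((𝟙 ⊖ X (B ℕ.+ e ℕ.+ z ℕ.* T)) ⊗ d)) ⊕ X (z ℕ.* T) ⊗ (x ⊗ X (B ℕ.+ r ℕ.* T) ⊗ ((𝟙 ⊕ X (A ℕ.+ z ℕ.* T)) ⊗ p ⊗ d)))
        ≈⟨ solve 8 (λ b x p d y u v w → b :* (x :* (p :* ((con (+ 1) :- y) :* d)) :+ u :* (x :* v :* ((con (+ 1) :+ w) :* p :* d)))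
             := (con (+ 1) :- y :+ u :* v :+ u :* v :* w) :* (b :* (x :* (p :* d))))
             (binom r z) x p d (X (B ℕ.+ e ℕ.+ z ℕ.* T)) (X (z ℕ.* T)) (X (B ℕ.+ r ℕ.* T)) (X (A ℕ.+ z ℕ.* T)) ⟩
      (𝟙 ⊖ X (B ℕ.+ e ℕ.+ z ℕ.* T) ⊕ X (z ℕ.* T) ⊗ X (B ℕ.+ r ℕ.* T) ⊕ X (z ℕ.* T) ⊗ X (B ℕ.+ r ℕ.* T) ⊗ X (A ℕ.+ z ℕ.* T)) ⊗ (binom r z ⊗ V r z)
        -- The triple product is exactly the power that `minus` subtracted, so the two cancel. What
        -- remains has the exponent B + (r + z) T, which is the same for all terms and comes out of
        -- the sum.
        ≈⟨ ⊗-congʳ (binom r z ⊗ V r z) (⊕-cong (⊕-congˡ (𝟙 ⊖ X (B ℕ.+ e ℕ.+ z ℕ.* T)) uv) uvw) ⟩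
      (𝟙 ⊖ X (B ℕ.+ e ℕ.+ z ℕ.* T) ⊕ X (B ℕ.+ (r ℕ.+ z) ℕ.* T) ⊕ X (B ℕ.+ e ℕ.+ z ℕ.* T)) ⊗ (binom r z ⊗ V r z)
        ≈⟨ solve 3 (λ y u v → (con (+ 1) :- y :+ u :+ y) :* v := (con (+ 1) :+ u) :* v)
             (X (B ℕ.+ e ℕ.+ z ℕ.* T)) (X (B ℕ.+ (r ℕ.+ z) ℕ.* T)) (binom r z ⊗ V r z) ⟩
      (𝟙 ⊕ X (B ℕ.+ (r ℕ.+ z) ℕ.* T)) ⊗ (binom r z ⊗ V r z) ∎
      where
      open SeriesSolver
      x = X (inner B r) ; p = plus (A ℕ.+ T ℕ.+ z ℕ.* T) r ; d = minus (B ℕ.+ e) z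
      X-split : ∀ r → X (inner B (suc r)) ≋ X (inner B r) ⊗ X (B ℕ.+ r ℕ.* T)
      X-split r = ≋-trans (X-cong (N.solve 4 (λ r b t s → (b N.:+ r N.:* b) N.:+ t N.:* (r N.:+ s) N.:= (r N.:* b N.:+ t N.:* s) N.:+ (b N.:+ r N.:* t)) r B T (triangle r)))
                          (X-+ (inner B r) (B ℕ.+ r ℕ.* T))
      shift-eq : A ℕ.+ z ℕ.* T ℕ.+ T ≡ A ℕ.+ T ℕ.+ z ℕ.* T
      shift-eq = N.solve 3 (λ a t z → a N.:+ z N.:+ t N.:= a N.:+ t N.:+ z) A T (z ℕ.* T)
      uv : X (z ℕ.* T) ⊗ X (B ℕ.+ r ℕ.* T) ≋ X (B ℕ.+ (r ℕ.+ z) ℕ.* T)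
      uv = ≋-trans (≋-sym (X-+ (z ℕ.* T) (B ℕ.+ r ℕ.* T)))
        (X-cong (N.solve 4 (λ z b r t → z N.:* t N.:+ (b N.:+ r N.:* t) N.:= b N.:+ (r N.:+ z) N.:* t) z B r T))
      uvw : X (z ℕ.* T) ⊗ X (B ℕ.+ r ℕ.* T) ⊗ X (A ℕ.+ z ℕ.* T) ≋ X (B ℕ.+ e ℕ.+ z ℕ.* T)
      uvw = ≋-trans (⊗-congʳ (X (A ℕ.+ z ℕ.* T)) uv) (≋-trans (≋-sym (X-+ (B ℕ.+ (r ℕ.+ z) ℕ.* T) (A ℕ.+ z ℕ.* T)))
        (X-cong (trans (N.solve 5 (λ b r z t a → b N.:+ (r N.:+ z) N.:* t N.:+ (a N.:+ z N.:* t) N.:= b N.:+ (a N.:+ (r N.:+ z) N.:* t) N.:+ z N.:* t) B r z T A)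
          (cong (λ k → B ℕ.+ k ℕ.+ z ℕ.* T) (sym e≡)))))

  triangle-+ : ∀ m r → triangle (m ℕ.+ r) ≡ triangle m ℕ.+ triangle r ℕ.+ m ℕ.* r
  triangle-+ zero r = sym (ℕ.+-identityʳ (triangle r))
  triangle-+ (suc m) r = trans (cong (m ℕ.+ r ℕ.+_) (triangle-+ m r))
    (N.solve 4 (λ m r s t → m N.:+ r N.:+ (s N.:+ t N.:+ m N.:* r) N.:= m N.:+ s N.:+ t N.:+ (r N.:+ m N.:* r))
      m r (triangle m) (triangle r))

  levelCost-+ : ∀ A B c K → levelCost (A ℕ.+ c) (B ℕ.+ c) K ≡ levelCost A B K ℕ.+ K ℕ.* c
  levelCost-+ A B c zero = refl
  levelCost-+ A B c (suc K) = trans (cong (B ℕ.+ c ℕ.+_) (levelCost-+ B A c K))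
    (N.solve 4 (λ b c l k → b N.:+ c N.:+ (l N.:+ k N.:* c) N.:= b N.:+ l N.:+ (c N.:+ k N.:* c)) B c (levelCost B A K) K)

  Agreement : ℕ → (ℕ → Bool) → Set
  Agreement K ε = ∀ A B n → outer K ε A B n ≋ peeled K A B n

  agreement-one : ∀ ε → Agreement 1 ε
  agreement-one ε A B n = Σ+-cong n λ m r _ → begin
      X (topCost A T B 0 m r) ⊗ (gauss (ε 0) m r ⊗ 𝟙)
        ≈⟨ ⊗-cong (X-cong (exponent m r)) (⊗-congʳ 𝟙 (gauss-binom (ε 0) m r)) ⟩
      X (inner B m) ⊗ (binom m r ⊗ 𝟙)
        ≈⟨ solve 2 (λ x b → x :* (b :* con (+ 1)) := b :* (x :* con (+ 1))) (X (inner B m)) (binom m r) ⟩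
      binom m r ⊗ (X (inner B m) ⊗ 𝟙) ∎
    where
    open ≋-Reasoning
    open SeriesSolver
    exponent : ∀ m r → topCost A T B 0 m r ≡ inner B m
    exponent m r = N.solve 4 (λ m b t s → m N.:* (b N.:+ N.con 0) N.:+ t N.:* (N.con 1 N.:* s N.:+ N.con 0)
                                N.:= m N.:* b N.:+ t N.:* s) m B T (triangle m)
  -- Removing the top level and removing the zeros commute. `ih₁` splits off the zeros below the top
  -- level, and the triples (m, r, z) are regrouped by the number s = m + r of nonzero coordinates.
  -- `ih₀` turns the inner factor back into an insertion, now for the exchanged weights B + zT and A
  -- + zT, and `ih₁` for those weights closes the step. Both uses together explain the induction
  -- over two consecutive K.
  agreement-step : ∀ K ε → Agreement K ε → Agreement (suc K) ε → Agreement (suc (suc K)) ε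
  agreement-step K ε ih₀ ih₁ A B n = begin
    Σ+ n (λ m y → X (topCost A T B (suc K) m y) ⊗ (gauss (ε (suc K)) m y ⊗ outer (suc K) ε A B y))
      ≈⟨ Σ+-cong n (λ m y _ → ≋-trans
           (⊗-congˡ (X (topCost A T B (suc K) m y)) (⊗-cong (gauss-binom (ε (suc K)) m y) (ih₁ A B y)))
           (≋-trans (≋-sym (SR.*-assoc _ _ _)) (≋-sym (Σ+-⊗ y _ _)))) ⟩
    Σ+ n (λ m y → Σ+ y (λ r z → X (topCost A T B (suc K) m y) ⊗ binom m y ⊗ (binom r z ⊗ (X (inner B r) ⊗ P r z))))
      ≈⟨ Σ+-cong n (λ m y _ → Σ+-cong y (λ { r z refl → term m r z })) ⟩
    Σ+ n (λ m y → Σ+ y (λ r z → f m r z)) ≈⟨ Σ+-assoc n f ⟩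
    Σ+ n (λ s z → Σ+ s (λ m r → f m r z))
      ≈⟨ Σ+-cong n (λ s z _ → ≋-trans (Σ+-cong s (λ { m r refl → regroup m r z })) (collect s z)) ⟩
    Σ+ n (λ s z → binom s z ⊗ (X (inner B s) ⊗ peeled (suc K) (B ℕ.+ z ℕ.* T) (A ℕ.+ z ℕ.* T) s)) ∎
    where
    open ≋-Reasoning
    open SeriesSolver
    P : ℕ → ℕ → Elem
    P r z = peeled K (B ℕ.+ z ℕ.* T) (A ℕ.+ z ℕ.* T) r
    tc' : ℕ → ℕ → ℕ → ℕ
    tc' m r z = topCost (B ℕ.+ z ℕ.* T) T (A ℕ.+ z ℕ.* T) K m r
    f : ℕ → ℕ → ℕ → Elem
    f m r z = X (inner B (m ℕ.+ r) ℕ.+ tc' m r z) ⊗ (binom (m ℕ.+ r) z ⊗ binom m r) ⊗ P r z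
    exponent : ∀ m r z → topCost A T B (suc K) m (r ℕ.+ z) ℕ.+ inner B r ≡ inner B (m ℕ.+ r) ℕ.+ tc' m r z
    exponent m r z rewrite levelCost-+ B A (z ℕ.* T) (suc K) | triangle-+ m r =
      N.solve 9 (λ m r z t b a l s u → let k = l in
        m N.:* (b N.:+ a) N.:+ t N.:* ((N.con 2 N.:+ k) N.:* s N.:+ (N.con 1 N.:+ k) N.:* (m N.:* (r N.:+ z))) N.:+ (r N.:* b N.:+ t N.:* u)
        N.:= ((m N.:+ r) N.:* b N.:+ t N.:* (s N.:+ u N.:+ m N.:* r)) N.:+
             (m N.:* (a N.:+ (N.con 1 N.:+ k) N.:* (z N.:* t)) N.:+ t N.:* ((N.con 1 N.:+ k) N.:* s N.:+ k N.:* (m N.:* r))))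
        m r z T B (levelCost B A (suc K)) K (triangle m) (triangle r)
    term : ∀ m r z → X (topCost A T B (suc K) m (r ℕ.+ z)) ⊗ binom m (r ℕ.+ z) ⊗ (binom r z ⊗ (X (inner B r) ⊗ P r z)) ≋ f m r z
    term m r z = begin
      X (topCost A T B (suc K) m (r ℕ.+ z)) ⊗ binom m (r ℕ.+ z) ⊗ (binom r z ⊗ (X (inner B r) ⊗ P r z))
        ≈⟨ solve 5 (λ x b c y p → x :* b :* (c :* (y :* p)) := x :* y :* (b :* c) :* p) _ _ _ _ _ ⟩
      X (topCost A T B (suc K) m (r ℕ.+ z)) ⊗ X (inner B r) ⊗ (binom m (r ℕ.+ z) ⊗ binom r z) ⊗ P r z
        ≈⟨ ⊗-congʳ (P r z) (⊗-cong (≋-trans (≋-sym (X-+ _ _)) (X-cong (exponent m r z))) (trinomial m r z)) ⟩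
      f m r z ∎
    regroup : ∀ m r z → f m r z ≋ binom (m ℕ.+ r) z ⊗ X (inner B (m ℕ.+ r)) ⊗
              (X (tc' m r z) ⊗ (gauss (ε K) m r ⊗ outer K ε (B ℕ.+ z ℕ.* T) (A ℕ.+ z ℕ.* T) r))
    regroup m r z = begin
      f m r z ≈⟨ ⊗-congʳ (P r z) (⊗-congʳ _ (X-+ (inner B (m ℕ.+ r)) (tc' m r z))) ⟩
      X (inner B (m ℕ.+ r)) ⊗ X (tc' m r z) ⊗ (binom (m ℕ.+ r) z ⊗ binom m r) ⊗ P r z
        ≈⟨ solve 5 (λ x y b c p → x :* y :* (b :* c) :* p := b :* x :* (y :* (c :* p))) _ _ _ _ _ ⟩
      binom (m ℕ.+ r) z ⊗ X (inner B (m ℕ.+ r)) ⊗ (X (tc' m r z) ⊗ (binom m r ⊗ P r z))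
        -- Without the zeros the top level is one lower, so it must carry the Pascal rule `ε K` in
        -- place of `ε (suc K)`.
        ≈⟨ ⊗-congˡ _ (⊗-congˡ (X (tc' m r z)) (⊗-cong (gauss-binom (ε K) m r)
             (ih₀ (B ℕ.+ z ℕ.* T) (A ℕ.+ z ℕ.* T) r))) ⟨
      binom (m ℕ.+ r) z ⊗ X (inner B (m ℕ.+ r)) ⊗
        (X (tc' m r z) ⊗ (gauss (ε K) m r ⊗ outer K ε (B ℕ.+ z ℕ.* T) (A ℕ.+ z ℕ.* T) r)) ∎
    collect : ∀ s z → Σ+ s (λ m r → binom s z ⊗ X (inner B s) ⊗
                        (X (tc' m r z) ⊗ (gauss (ε K) m r ⊗ outer K ε (B ℕ.+ z ℕ.* T) (A ℕ.+ z ℕ.* T) r)))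
              ≋ binom s z ⊗ (X (inner B s) ⊗ peeled (suc K) (B ℕ.+ z ℕ.* T) (A ℕ.+ z ℕ.* T) s)
    collect s z = ≋-trans (Σ+-⊗ s (binom s z ⊗ X (inner B s)) _) (≋-trans (SR.*-assoc _ _ _)
      (⊗-congˡ (binom s z) (⊗-congˡ (X (inner B s)) (ih₁ (B ℕ.+ z ℕ.* T) (A ℕ.+ z ℕ.* T) s))))

  outer≋peeled : ∀ K ε → Agreement K ε
  outer≋peeled K ε = proj₁ (both K)
    where
    both : ∀ K → Agreement K ε × Agreement (suc K) ε
    both zero    = (λ _ _ _ → ≋-refl) , agreement-one ε
    both (suc K) = proj₂ (both K) , agreement-step K ε (proj₁ (both K)) (proj₂ (both K))

  -- The abstract ring has no division, so inverses of the products `minus c n` with c ≥ 1 are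
  -- handed in; for power series these products have constant term 1.
  module Quotient (minus⁻¹ : ℕ → ℕ → Elem)
                  (minus-inverse : ∀ c n → 1 ≤ c → minus c n ⊗ minus⁻¹ c n ≋ 𝟙) where

    quotient : ℕ → ℕ → ℕ → Elem
    quotient A B n = plus B n ⊗ minus⁻¹ (A ℕ.+ B ℕ.+ (n ∸ 1) ℕ.* T) n

    quotient-zero : ∀ A B → 1 ≤ B → quotient A B 0 ≋ 𝟙
    quotient-zero A B 1≤B = minus-inverse (A ℕ.+ B ℕ.+ 0) 0 (ℕ.≤-trans 1≤B (ℕ.≤-trans (ℕ.m≤n+m B A) (ℕ.m≤m+n (A ℕ.+ B) 0)))

    -- The denominators of all summands divide `minus D n` with D = A + B + (n - 1) T. Over this
    -- common denominator the summand for z keeps the factor `minus D z`, and the sum is the one of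
    -- `vandermonde`.
    quotient-peeled : ∀ A B n → 1 ≤ A → 1 ≤ B → quotient A B n ≋
      Σ+ n (λ r z → binom r z ⊗ (X (inner B r) ⊗ quotient (B ℕ.+ z ℕ.* T) (A ℕ.+ z ℕ.* T) r))
    quotient-peeled A B zero 1≤A 1≤B = begin
      quotient A B 0 ≈⟨ quotient-zero A B 1≤B ⟩
      𝟙 ≈⟨ solve 0 (con (+ 1) :* (con (+ 1) :* con (+ 1)) := con (+ 1)) ⟨
      𝟙 ⊗ (𝟙 ⊗ 𝟙) ≈⟨ ⊗-congˡ 𝟙 (⊗-cong (≋-trans (X-cong (ℕ.*-zeroʳ T)) X-zero)
                                       (quotient-zero (B ℕ.+ 0) (A ℕ.+ 0) (ℕ.≤-trans 1≤A (ℕ.m≤m+n A 0)))) ⟨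
      𝟙 ⊗ (X (T ℕ.* 0) ⊗ quotient (B ℕ.+ 0) (A ℕ.+ 0) 0) ∎
      where open ≋-Reasoning
            open SeriesSolver
    quotient-peeled A B n@(suc n-1) 1≤A 1≤B = ≋-sym (begin
      Σ+ n (λ r z → binom r z ⊗ (X (inner B r) ⊗ quotient (B ℕ.+ z ℕ.* T) (A ℕ.+ z ℕ.* T) r))
        ≈⟨ Σ+-cong n (λ r z r+z≡n → ≋-trans (⊗-congˡ (binom r z) (⊗-congˡ (X (inner B r)) (⊗-congˡ (plus (A ℕ.+ z ℕ.* T) r) (reduce r z r+z≡n))))
             (solve 5 (λ b x p d u → b :* (x :* (p :* (d :* u))) := u :* (b :* (x :* (p :* d)))) _ _ _ _ _)) ⟩
      Σ+ n (λ r z → minus⁻¹ D n ⊗ (binom r z ⊗ (X (inner B r) ⊗ (plus (A ℕ.+ z ℕ.* T) r ⊗ minus D z))))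
        ≈⟨ Σ+-⊗ n (minus⁻¹ D n) (λ r z → binom r z ⊗ (X (inner B r) ⊗ (plus (A ℕ.+ z ℕ.* T) r ⊗ minus D z))) ⟩
      minus⁻¹ D n ⊗ Σ+ n (λ r z → binom r z ⊗ (X (inner B r) ⊗ (plus (A ℕ.+ z ℕ.* T) r ⊗ minus D z)))
        ≡⟨ cong (λ c → minus⁻¹ D n ⊗ Σ+ n (λ r z → binom r z ⊗ (X (inner B r) ⊗ (plus (A ℕ.+ z ℕ.* T) r ⊗ minus c z)))) D≡ ⟩
      minus⁻¹ D n ⊗ Σ+ n (λ r z → binom r z ⊗ (X (inner B r) ⊗ (plus (A ℕ.+ z ℕ.* T) r ⊗ minus (B ℕ.+ e) z)))
        ≈⟨ ⊗-congˡ (minus⁻¹ D n) (vandermonde n A B e (trans (ℕ.+-assoc A (n-1 ℕ.* T) T) (cong (A ℕ.+_) (ℕ.+-comm (n-1 ℕ.* T) T)))) ⟩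
      minus⁻¹ D n ⊗ plus B n ≈⟨ SR.*-comm _ _ ⟩
      quotient A B n ∎)
      where
      open ≋-Reasoning
      open SeriesSolver
      D e : ℕ
      D = A ℕ.+ B ℕ.+ n-1 ℕ.* T
      e = A ℕ.+ n-1 ℕ.* T
      D≡ : D ≡ B ℕ.+ e
      D≡ = N.solve 3 (λ a b t → a N.:+ b N.:+ t N.:= b N.:+ (a N.:+ t)) A B (n-1 ℕ.* T)
      c : ℕ → ℕ → ℕ
      c r z = (B ℕ.+ z ℕ.* T) ℕ.+ (A ℕ.+ z ℕ.* T) ℕ.+ (r ∸ 1) ℕ.* T
      1≤c : ∀ r z → 1 ≤ c r z
      1≤c r z = ℕ.≤-trans 1≤B (ℕ.≤-trans (ℕ.m≤m+n B (z ℕ.* T)) (ℕ.≤-trans (ℕ.m≤m+n _ _) (ℕ.m≤m+n _ _)))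
      same-minus : ∀ r z → r ℕ.+ z ≡ n → minus (c r z) r ≋ minus (D ℕ.+ z ℕ.* T) r
      -- For r = 0 the truncated `r ∸ 1` spoils the equality of the starting exponents, but both
      -- products are empty.
      same-minus zero    z _ = ≋-refl
      same-minus (suc r) z refl = ≡⇒≋ (cong (λ k → minus k (suc r))
        (N.solve 5 (λ a b r z t → b N.:+ z N.:* t N.:+ (a N.:+ z N.:* t) N.:+ r N.:* t
                              N.:= a N.:+ b N.:+ (r N.:+ z) N.:* t N.:+ z N.:* t) A B r z T))
      reduce : ∀ r z → r ℕ.+ z ≡ n → minus⁻¹ (c r z) r ≋ minus D z ⊗ minus⁻¹ D n
      reduce r z r+z≡n = begin
        u ≈⟨ ⊗-identityʳ u ⟨
        u ⊗ 𝟙 ≈⟨ ⊗-congˡ u (minus-inverse D n (ℕ.≤-trans 1≤B (ℕ.≤-trans (ℕ.m≤n+m B A) (ℕ.m≤m+n (A ℕ.+ B) _)))) ⟨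
        u ⊗ (minus D n ⊗ minus⁻¹ D n)
          ≈⟨ ⊗-congˡ u (⊗-congʳ (minus⁻¹ D n) (≋-trans (≡⇒≋ (cong (minus D) (trans (sym r+z≡n) (ℕ.+-comm r z))))
               (≋-trans (minus-+ D z r) (⊗-congˡ (minus D z) (≋-sym (same-minus r z r+z≡n)))))) ⟩
        u ⊗ (minus D z ⊗ minus (c r z) r ⊗ minus⁻¹ D n)
          ≈⟨ solve 4 (λ u d m i → u :* (d :* m :* i) := (m :* u) :* (d :* i)) u (minus D z) (minus (c r z) r) (minus⁻¹ D n) ⟩
        (minus (c r z) r ⊗ u) ⊗ (minus D z ⊗ minus⁻¹ D n) ≈⟨ ⊗-congʳ _ (minus-inverse (c r z) r (1≤c r z)) ⟩
        𝟙 ⊗ (minus D z ⊗ minus⁻¹ D n) ≈⟨ ⊗-identityˡ _ ⟩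
        minus D z ⊗ minus⁻¹ D n ∎
        where u = minus⁻¹ (c r z) r

-- The ring of formal power series

open import Defs

infix 4 _≋_
-- A record instead of the bare function type, so that both series can be inferred from a proof.
record _≋_ (f g : Series) : Set where
  constructor pointwise
  field at : ∀ m → f m ≡ g m
open _≋_ public

≋-refl : ∀ {f} → f ≋ f
≋-refl .at m = refl

≋-sym : ∀ {f g} → f ≋ g → g ≋ f
≋-sym e .at m = sym (at e m)

≋-trans : ∀ {f g h} → f ≋ g → g ≋ h → f ≋ h
≋-trans e e' .at m = trans (at e m) (at e' m)

≡⇒≋ : ∀ {f g} → f ≡ g → f ≋ g
≡⇒≋ refl = ≋-refl

shift : Series → Series
shift f m = f (suc m)

⊗-unfold : ∀ f g m → (f ⊗ g) m ≡ sumℤ (applyUpTo (λ i → f i ℤ.* g (m ∸ i)) (suc m))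
⊗-unfold f g m = cong sumℤ (List.map-upTo (λ i → f i ℤ.* g (m ∸ i)) (suc m))

⊗-zero : ∀ f g → (f ⊗ g) 0 ≡ f 0 ℤ.* g 0
⊗-zero f g = ℤ.+-identityʳ (f 0 ℤ.* g 0)

-- Splitting off the constant term of the left factor makes convolution recursive in the degree; the
-- ring laws below are inductions along this recursion.
⊗-suc : ∀ f g m → (f ⊗ g) (suc m) ≡ f 0 ℤ.* g (suc m) ℤ.+ (shift f ⊗ g) m
⊗-suc f g m = trans (⊗-unfold f g (suc m))
  (cong (ℤ._+_ (f 0 ℤ.* g (suc m))) (sym (⊗-unfold (shift f) g m)))

⊗-cong-at : ∀ {f f' g g'} m → f ≋ f' → g ≋ g' → (f ⊗ g) m ≡ (f' ⊗ g') m
⊗-cong-at {f} {f'} {g} {g'} zero e e' = begin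
  (f ⊗ g) 0 ≡⟨ ⊗-zero f g ⟩ f 0 ℤ.* g 0 ≡⟨ cong₂ ℤ._*_ (at e 0) (at e' 0) ⟩
  f' 0 ℤ.* g' 0 ≡⟨ ⊗-zero f' g' ⟨ (f' ⊗ g') 0 ∎
  where open ≡-Reasoning
⊗-cong-at {f} {f'} {g} {g'} (suc m) e e' = begin
  (f ⊗ g) (suc m) ≡⟨ ⊗-suc f g m ⟩
  f 0 ℤ.* g (suc m) ℤ.+ (shift f ⊗ g) m
    ≡⟨ cong₂ ℤ._+_ (cong₂ ℤ._*_ (at e 0) (at e' (suc m)))
                   (⊗-cong-at m (pointwise (at e ∘ suc)) e') ⟩
  f' 0 ℤ.* g' (suc m) ℤ.+ (shift f' ⊗ g') m ≡⟨ ⊗-suc f' g' m ⟨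
  (f' ⊗ g') (suc m) ∎
  where open ≡-Reasoning

⊗-cong : ∀ {f f' g g'} → f ≋ f' → g ≋ g' → f ⊗ g ≋ f' ⊗ g'
⊗-cong e e' .at m = ⊗-cong-at m e e'

⊗-congˡ : ∀ h {f g} → f ≋ g → h ⊗ f ≋ h ⊗ g
⊗-congˡ h e .at m = ⊗-cong-at {f = h} m ≋-refl e

⊗-congʳ : ∀ h {f g} → f ≋ g → f ⊗ h ≋ g ⊗ h
⊗-congʳ h e .at m = ⊗-cong-at {g = h} m e ≋-refl

⊕-congˡ : ∀ h {f g} → f ≋ g → h ⊕ f ≋ h ⊕ g
⊕-congˡ h e .at m = cong (ℤ._+_ (h m)) (at e m)

⊕-congʳ : ∀ h {f g} → f ≋ g → f ⊕ h ≋ g ⊕ h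
⊕-congʳ h e .at m = cong (ℤ._+ h m) (at e m)

⊕-cong : ∀ {f f' g g'} → f ≋ f' → g ≋ g' → f ⊕ g ≋ f' ⊕ g'
⊕-cong e e' .at m = cong₂ ℤ._+_ (at e m) (at e' m)

⊝-cong : ∀ {f f'} → f ≋ f' → ⊝ f ≋ ⊝ f'
⊝-cong e .at m = cong ℤ.-_ (at e m)

⊗-distribʳ-at : ∀ h f g m → ((f ⊕ g) ⊗ h) m ≡ (f ⊗ h) m ℤ.+ (g ⊗ h) m
⊗-distribʳ-at h f g zero = begin
  ((f ⊕ g) ⊗ h) 0 ≡⟨ ⊗-zero (f ⊕ g) h ⟩
  (f 0 ℤ.+ g 0) ℤ.* h 0 ≡⟨ ℤ.*-distribʳ-+ (h 0) (f 0) (g 0) ⟩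
  f 0 ℤ.* h 0 ℤ.+ g 0 ℤ.* h 0 ≡⟨ cong₂ ℤ._+_ (⊗-zero f h) (⊗-zero g h) ⟨
  (f ⊗ h) 0 ℤ.+ (g ⊗ h) 0 ∎
  where open ≡-Reasoning
⊗-distribʳ-at h f g (suc m) = begin
  ((f ⊕ g) ⊗ h) (suc m) ≡⟨ ⊗-suc (f ⊕ g) h m ⟩
  (f 0 ℤ.+ g 0) ℤ.* h (suc m) ℤ.+ ((shift f ⊕ shift g) ⊗ h) m
    ≡⟨ cong (ℤ._+_ ((f 0 ℤ.+ g 0) ℤ.* h (suc m))) (⊗-distribʳ-at h (shift f) (shift g) m) ⟩
  (f 0 ℤ.+ g 0) ℤ.* h (suc m) ℤ.+ ((shift f ⊗ h) m ℤ.+ (shift g ⊗ h) m)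
    ≡⟨ solve 5 (λ a b c d e → (a :+ b) :* c :+ (d :+ e) := (a :* c :+ d) :+ (b :* c :+ e))
         (f 0) (g 0) (h (suc m)) ((shift f ⊗ h) m) ((shift g ⊗ h) m) ⟩
  (f 0 ℤ.* h (suc m) ℤ.+ (shift f ⊗ h) m) ℤ.+ (g 0 ℤ.* h (suc m) ℤ.+ (shift g ⊗ h) m)
    ≡⟨ cong₂ ℤ._+_ (⊗-suc f h m) (⊗-suc g h m) ⟨
  (f ⊗ h) (suc m) ℤ.+ (g ⊗ h) (suc m) ∎
  where open ≡-Reasoning
        open ℤSolver

·-⊗-at : ∀ c f g m → ((c · f) ⊗ g) m ≡ c ℤ.* (f ⊗ g) m
·-⊗-at c f g zero = begin
  ((c · f) ⊗ g) 0 ≡⟨ ⊗-zero (c · f) g ⟩ c ℤ.* f 0 ℤ.* g 0 ≡⟨ ℤ.*-assoc c (f 0) (g 0) ⟩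
  c ℤ.* (f 0 ℤ.* g 0) ≡⟨ cong (ℤ._*_ c) (⊗-zero f g) ⟨ c ℤ.* (f ⊗ g) 0 ∎
  where open ≡-Reasoning
·-⊗-at c f g (suc m) = begin
  ((c · f) ⊗ g) (suc m) ≡⟨ ⊗-suc (c · f) g m ⟩
  c ℤ.* f 0 ℤ.* g (suc m) ℤ.+ ((c · shift f) ⊗ g) m
    ≡⟨ cong₂ ℤ._+_ (ℤ.*-assoc c (f 0) (g (suc m))) (·-⊗-at c (shift f) g m) ⟩
  c ℤ.* (f 0 ℤ.* g (suc m)) ℤ.+ c ℤ.* (shift f ⊗ g) m
    ≡⟨ ℤ.*-distribˡ-+ c (f 0 ℤ.* g (suc m)) ((shift f ⊗ g) m) ⟨
  c ℤ.* (f 0 ℤ.* g (suc m) ℤ.+ (shift f ⊗ g) m) ≡⟨ cong (ℤ._*_ c) (⊗-suc f g m) ⟨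
  c ℤ.* (f ⊗ g) (suc m) ∎
  where open ≡-Reasoning

⊗-assoc-at : ∀ f g h m → ((f ⊗ g) ⊗ h) m ≡ (f ⊗ (g ⊗ h)) m
⊗-assoc-at f g h zero = begin
  ((f ⊗ g) ⊗ h) 0 ≡⟨ ⊗-zero (f ⊗ g) h ⟩ (f ⊗ g) 0 ℤ.* h 0 ≡⟨ cong (ℤ._* h 0) (⊗-zero f g) ⟩
  f 0 ℤ.* g 0 ℤ.* h 0 ≡⟨ ℤ.*-assoc (f 0) (g 0) (h 0) ⟩
  f 0 ℤ.* (g 0 ℤ.* h 0) ≡⟨ cong (ℤ._*_ (f 0)) (⊗-zero g h) ⟨ f 0 ℤ.* (g ⊗ h) 0 ≡⟨ ⊗-zero f (g ⊗ h) ⟨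
  (f ⊗ (g ⊗ h)) 0 ∎
  where open ≡-Reasoning
⊗-assoc-at f g h (suc m) = begin
  ((f ⊗ g) ⊗ h) (suc m) ≡⟨ ⊗-suc (f ⊗ g) h m ⟩
  (f ⊗ g) 0 ℤ.* h (suc m) ℤ.+ (shift (f ⊗ g) ⊗ h) m
    ≡⟨ cong₂ ℤ._+_ (cong (ℤ._* h (suc m)) (⊗-zero f g))
         (⊗-cong-at {g = h} m (pointwise {g = (f 0 · shift g) ⊕ (shift f ⊗ g)} (⊗-suc f g)) ≋-refl) ⟩
  f 0 ℤ.* g 0 ℤ.* h (suc m) ℤ.+ (((f 0 · shift g) ⊕ (shift f ⊗ g)) ⊗ h) m
    ≡⟨ cong (ℤ._+_ (f 0 ℤ.* g 0 ℤ.* h (suc m)))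
         (trans (⊗-distribʳ-at h (f 0 · shift g) (shift f ⊗ g) m)
           (cong₂ ℤ._+_ (·-⊗-at (f 0) (shift g) h m) (⊗-assoc-at (shift f) g h m))) ⟩
  f 0 ℤ.* g 0 ℤ.* h (suc m) ℤ.+ (f 0 ℤ.* (shift g ⊗ h) m ℤ.+ (shift f ⊗ (g ⊗ h)) m)
    ≡⟨ solve 5 (λ a b c d e → a :* b :* c :+ (a :* d :+ e) := a :* (b :* c :+ d) :+ e)
         (f 0) (g 0) (h (suc m)) ((shift g ⊗ h) m) ((shift f ⊗ (g ⊗ h)) m) ⟩
  f 0 ℤ.* (g 0 ℤ.* h (suc m) ℤ.+ (shift g ⊗ h) m) ℤ.+ (shift f ⊗ (g ⊗ h)) m
    ≡⟨ cong (λ x → f 0 ℤ.* x ℤ.+ (shift f ⊗ (g ⊗ h)) m) (⊗-suc g h m) ⟨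
  f 0 ℤ.* (g ⊗ h) (suc m) ℤ.+ (shift f ⊗ (g ⊗ h)) m ≡⟨ ⊗-suc f (g ⊗ h) m ⟨
  (f ⊗ (g ⊗ h)) (suc m) ∎
  where open ≡-Reasoning
        open ℤSolver

⊗-sucʳ : ∀ f g m → (f ⊗ g) (suc m) ≡ f (suc m) ℤ.* g 0 ℤ.+ (f ⊗ shift g) m
⊗-sucʳ f g zero = begin
  (f ⊗ g) 1 ≡⟨ ⊗-suc f g 0 ⟩ f 0 ℤ.* g 1 ℤ.+ (shift f ⊗ g) 0
    ≡⟨ cong₂ ℤ._+_ (sym (⊗-zero f (shift g))) (⊗-zero (shift f) g) ⟩
  (f ⊗ shift g) 0 ℤ.+ f 1 ℤ.* g 0 ≡⟨ ℤ.+-comm ((f ⊗ shift g) 0) (f 1 ℤ.* g 0) ⟩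
  f 1 ℤ.* g 0 ℤ.+ (f ⊗ shift g) 0 ∎
  where open ≡-Reasoning
⊗-sucʳ f g (suc m) = begin
  (f ⊗ g) (suc (suc m)) ≡⟨ ⊗-suc f g (suc m) ⟩
  f 0 ℤ.* g (suc (suc m)) ℤ.+ (shift f ⊗ g) (suc m)
    ≡⟨ cong (ℤ._+_ (f 0 ℤ.* g (suc (suc m)))) (⊗-sucʳ (shift f) g m) ⟩
  f 0 ℤ.* g (suc (suc m)) ℤ.+ (f (suc (suc m)) ℤ.* g 0 ℤ.+ (shift f ⊗ shift g) m)
    ≡⟨ solve 3 (λ a b c → a :+ (b :+ c) := b :+ (a :+ c))
         (f 0 ℤ.* g (suc (suc m))) (f (suc (suc m)) ℤ.* g 0) ((shift f ⊗ shift g) m) ⟩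
  f (suc (suc m)) ℤ.* g 0 ℤ.+ (f 0 ℤ.* g (suc (suc m)) ℤ.+ (shift f ⊗ shift g) m)
    ≡⟨ cong (ℤ._+_ (f (suc (suc m)) ℤ.* g 0)) (⊗-suc f (shift g) m) ⟨
  f (suc (suc m)) ℤ.* g 0 ℤ.+ (f ⊗ shift g) (suc m) ∎
  where open ≡-Reasoning
        open ℤSolver

⊗-comm-at : ∀ f g m → (f ⊗ g) m ≡ (g ⊗ f) m
⊗-comm-at f g zero = trans (⊗-zero f g) (trans (ℤ.*-comm (f 0) (g 0)) (sym (⊗-zero g f)))
⊗-comm-at f g (suc m) = begin
  (f ⊗ g) (suc m) ≡⟨ ⊗-suc f g m ⟩
  f 0 ℤ.* g (suc m) ℤ.+ (shift f ⊗ g) m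
    ≡⟨ cong₂ ℤ._+_ (ℤ.*-comm (f 0) (g (suc m))) (⊗-comm-at (shift f) g m) ⟩
  g (suc m) ℤ.* f 0 ℤ.+ (g ⊗ shift f) m ≡⟨ ⊗-sucʳ g f m ⟨
  (g ⊗ f) (suc m) ∎
  where open ≡-Reasoning

𝟘 : Series
𝟘 = cst (+ 0)

𝟘-at : ∀ m → 𝟘 m ≡ + 0
𝟘-at zero = refl
𝟘-at (suc m) = refl

𝟘-⊗-at : ∀ {z} f m → (∀ i → z i ≡ + 0) → (z ⊗ f) m ≡ + 0
𝟘-⊗-at {z} f zero e = trans (⊗-zero z f) (trans (cong (ℤ._* f 0) (e 0)) (ℤ.*-zeroˡ (f 0)))
𝟘-⊗-at {z} f (suc m) e = trans (⊗-suc z f m)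
  (cong₂ ℤ._+_ (trans (cong (ℤ._* f (suc m)) (e 0)) (ℤ.*-zeroˡ (f (suc m)))) (𝟘-⊗-at f m (e ∘ suc)))

cst-⊗-at : ∀ c f m → (cst c ⊗ f) m ≡ c ℤ.* f m
cst-⊗-at c f zero = ⊗-zero (cst c) f
cst-⊗-at c f (suc m) = trans (⊗-suc (cst c) f m)
  (trans (cong (ℤ._+_ (c ℤ.* f (suc m))) (𝟘-⊗-at {shift (cst c)} f m (λ _ → refl))) (ℤ.+-identityʳ _))

seriesRing : CommutativeRing _ _
seriesRing = record
  { Carrier = Series ; _≈_ = _≋_ ; _+_ = _⊕_ ; _*_ = _⊗_ ; -_ = ⊝_ ; 0# = 𝟘 ; 1# = 𝟙
  ; isCommutativeRing = record
    { isRing = record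
      { +-isAbelianGroup = record
        { isGroup = record
          { isMonoid = record
            { isSemigroup = record
              { isMagma = record
                { isEquivalence = record { refl = ≋-refl ; sym = ≋-sym ; trans = ≋-trans }
                ; ∙-cong = ⊕-cong }
              ; assoc = λ f g h → pointwise λ m → ℤ.+-assoc (f m) (g m) (h m) }
            ; identity = (λ f → pointwise λ m → trans (cong (ℤ._+ f m) (𝟘-at m)) (ℤ.+-identityˡ (f m)))
                       , (λ f → pointwise λ m → trans (cong (ℤ._+_ (f m)) (𝟘-at m)) (ℤ.+-identityʳ (f m))) }
          ; inverse = (λ f → pointwise λ m → trans (ℤ.+-inverseˡ (f m)) (sym (𝟘-at m)))
                    , (λ f → pointwise λ m → trans (ℤ.+-inverseʳ (f m)) (sym (𝟘-at m)))
          ; ⁻¹-cong = ⊝-cong }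
        ; comm = λ f g → pointwise λ m → ℤ.+-comm (f m) (g m) }
      ; *-cong = ⊗-cong
      ; *-assoc = λ f g h → pointwise (⊗-assoc-at f g h)
      ; *-identity = ⊗-identityˡ
                   , (λ f → ≋-trans (pointwise (⊗-comm-at f 𝟙)) (⊗-identityˡ f))
      ; distrib = (λ f g h → ≋-trans (pointwise (⊗-comm-at f (g ⊕ h)))
                     (≋-trans (pointwise (⊗-distribʳ-at f g h))
                       (⊕-cong (pointwise (⊗-comm-at g f)) (pointwise (⊗-comm-at h f)))))
                , (λ h f g → pointwise (⊗-distribʳ-at h f g)) }
    ; *-comm = λ f g → pointwise (⊗-comm-at f g) } }
  where
  ⊗-identityˡ : ∀ f → 𝟙 ⊗ f ≋ f
  ⊗-identityˡ f .at m = trans (cst-⊗-at (+ 1) f m) (ℤ.*-identityˡ (f m))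

cst-morphism : CommutativeRing.rawRing ℤ.+-*-commutativeRing
               ACR.-Raw-AlmostCommutative⟶ ACR.fromCommutativeRing seriesRing
cst-morphism = record
  { ⟦_⟧ = cst
  ; +-homo = λ a b → pointwise λ { zero → refl ; (suc m) → refl }
  ; *-homo = λ a b → pointwise λ { zero → sym (cst-⊗-at a (cst b) zero)
                                 ; (suc m) → sym (trans (cst-⊗-at a (cst b) (suc m)) (ℤ.*-zeroʳ a)) }
  ; -‿homo = λ a → pointwise λ { zero → refl ; (suc m) → refl }
  ; 0-homo = ≋-refl
  ; 1-homo = ≋-refl }

cst≟ : ∀ a b → Maybe (cst a ≋ cst b)
cst≟ a b with a ℤ.≟ b
... | yes refl = just ≋-refl
... | no _ = nothing

module SeriesSolver = RingTactic (CommutativeRing.rawRing ℤ.+-*-commutativeRing)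
  (ACR.fromCommutativeRing seriesRing) cst-morphism cst≟

module SR = CommutativeRing seriesRing
module ≋-Reasoning = SetoidReasoning SR.setoid

-- inverses

inv-suc : ∀ f m → inv f (suc m) ≡ ℤ.- sumℤ (zipWith ℤ._*_ (map f (range 1 (suc m))) (invList f m))
inv-suc f m = refl

invList-applyUpTo : ∀ f m → invList f m ≡ applyUpTo (λ i → inv f (m ∸ i)) (suc m)
invList-applyUpTo f zero = refl
invList-applyUpTo f (suc m) = cong (inv f (suc m) ∷_) (invList-applyUpTo f m)

zipWith-applyUpTo : ∀ (h : ℤ → ℤ → ℤ) (u v : ℕ → ℤ) n →
  zipWith h (applyUpTo u n) (applyUpTo v n) ≡ applyUpTo (λ i → h (u i) (v i)) n
zipWith-applyUpTo h u v zero = refl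
zipWith-applyUpTo h u v (suc n) = cong (h (u 0) (v 0) ∷_) (zipWith-applyUpTo h (u ∘ suc) (v ∘ suc) n)

inv-recurrence : ∀ f m → inv f (suc m) ≡ ℤ.- (shift f ⊗ inv f) m
inv-recurrence f m = trans (inv-suc f m) (cong (ℤ.-_ ∘ sumℤ) (begin
  zipWith ℤ._*_ (map f (range 1 (suc m))) (invList f m)
    ≡⟨ cong₂ (zipWith ℤ._*_)
         (trans (sym (List.map-∘ (upTo (suc m)))) (List.map-upTo (shift f) (suc m)))
         (invList-applyUpTo f m) ⟩
  zipWith ℤ._*_ (applyUpTo (shift f) (suc m)) (applyUpTo (λ i → inv f (m ∸ i)) (suc m))
    ≡⟨ zipWith-applyUpTo ℤ._*_ (shift f) (λ i → inv f (m ∸ i)) (suc m) ⟩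
  applyUpTo (λ i → shift f i ℤ.* inv f (m ∸ i)) (suc m)
    ≡⟨ List.map-upTo (λ i → shift f i ℤ.* inv f (m ∸ i)) (suc m) ⟨
  map (λ i → shift f i ℤ.* inv f (m ∸ i)) (upTo (suc m)) ∎))
  where open ≡-Reasoning

⊗-inverseʳ : ∀ f → f 0 ≡ + 1 → f ⊗ inv f ≋ 𝟙
⊗-inverseʳ f e .at zero = trans (⊗-zero f (inv f)) (cong (ℤ._* + 1) e)
⊗-inverseʳ f e .at (suc m) = begin
  (f ⊗ inv f) (suc m) ≡⟨ ⊗-suc f (inv f) m ⟩
  f 0 ℤ.* inv f (suc m) ℤ.+ s ≡⟨ cong₂ (λ x y → x ℤ.* y ℤ.+ s) e (inv-recurrence f m) ⟩
  + 1 ℤ.* ℤ.- s ℤ.+ s ≡⟨ cong (ℤ._+ s) (ℤ.*-identityˡ (ℤ.- s)) ⟩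
  ℤ.- s ℤ.+ s ≡⟨ ℤ.+-inverseˡ s ⟩ + 0 ∎
  where open ≡-Reasoning
        s = (shift f ⊗ inv f) m

⊗-cancelˡ : ∀ h {f g} → h 0 ≡ + 1 → h ⊗ f ≋ h ⊗ g → f ≋ g
⊗-cancelˡ h {f} {g} e eq = begin
  f ≈⟨ expand f ⟩ inv h ⊗ (h ⊗ f) ≈⟨ ⊗-congˡ (inv h) eq ⟩ inv h ⊗ (h ⊗ g) ≈⟨ expand g ⟨ g ∎
  where
  open ≋-Reasoning
  expand : ∀ k → k ≋ inv h ⊗ (h ⊗ k)
  expand k = begin
    k ≈⟨ SR.*-identityˡ k ⟨ 𝟙 ⊗ k ≈⟨ ⊗-congʳ k (⊗-inverseʳ h e) ⟨ h ⊗ inv h ⊗ k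
      ≈⟨ ⊗-congʳ k (SR.*-comm h (inv h)) ⟩ inv h ⊗ h ⊗ k ≈⟨ SR.*-assoc (inv h) h k ⟩
    inv h ⊗ (h ⊗ k) ∎

-- monomials

q-⊗-zero : ∀ f → (q ⊗ f) 0 ≡ + 0
q-⊗-zero f = trans (⊗-zero q f) (ℤ.*-zeroˡ (f 0))

q-⊗-suc : ∀ f m → (q ⊗ f) (suc m) ≡ f m
q-⊗-suc f m = begin
  (q ⊗ f) (suc m) ≡⟨ ⊗-suc q f m ⟩ + 0 ℤ.* f (suc m) ℤ.+ (shift q ⊗ f) m
    ≡⟨ cong₂ ℤ._+_ (ℤ.*-zeroˡ (f (suc m))) (⊗-cong-at m shift-q (≋-refl {f})) ⟩
  + 0 ℤ.+ (𝟙 ⊗ f) m ≡⟨ ℤ.+-identityˡ ((𝟙 ⊗ f) m) ⟩ (𝟙 ⊗ f) m ≡⟨ at (SR.*-identityˡ f) m ⟩ f m ∎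
  where
  open ≡-Reasoning
  shift-q : shift q ≋ 𝟙
  shift-q .at zero = refl
  shift-q .at (suc m) = refl

^s-+ : ∀ f a b → f ^s (a ℕ.+ b) ≋ f ^s a ⊗ f ^s b
^s-+ f zero b = ≋-sym (SR.*-identityˡ (f ^s b))
^s-+ f (suc a) b = ≋-trans (⊗-congˡ f (^s-+ f a b)) (≋-sym (SR.*-assoc f (f ^s a) (f ^s b)))

-- The numbers game

Pos Neg : ℤ → Set
Pos x = + 0 ℤ.< x
Neg x = x ℤ.< + 0

neg⇒pos- : ∀ {x} → Neg x → Pos (ℤ.- x)
neg⇒pos- = ℤ.neg-mono-<

pos⇒neg- : ∀ {x} → Pos x → Neg (ℤ.- x)
pos⇒neg- = ℤ.neg-mono-<

neg-+ : ∀ {x y} → Neg x → Neg y → Neg (x ℤ.+ y)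
neg-+ = ℤ.+-mono-<

pos⇒¬neg : ∀ {x} → Pos x → ¬ Neg x
pos⇒¬neg p n = ℤ.<-asym p n

-- In every case αβ = 4 cos²(π/m), the condition for two firings to generate a dihedral group with
-- rotation of order m. For m = 4 there are two integral solutions, one for each orientation of the
-- bond.
data Bond (m : ℕ) (α β : ℤ) : Set where
  bond2  : m ≡ 2 → α ≡ + 0 → β ≡ + 0 → Bond m α β
  bond3  : m ≡ 3 → α ≡ + 1 → β ≡ + 1 → Bond m α β
  bond4  : m ≡ 4 → α ≡ + 1 → β ≡ + 2 → Bond m α β
  bond4′ : m ≡ 4 → α ≡ + 2 → β ≡ + 1 → Bond m α β

-- `A` is minus a Cartan matrix: -2 on the diagonal and non-negative elsewhere.
data Compatible {k} (M : CoxMatrix k) (A : Fin k → Fin k → ℤ) (i j : Fin k) : Set where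
  same     : i ≡ j → M i j ≡ 1 → A i j ≡ -[1+ 1 ] → Compatible M A i j
  bonded   : i ≢ j → Bond (M i j) (A i j) (A j i) → Compatible M A i j

-- The numbers game of Mozes: a state assigns an integer to each generator, and firing s
-- negates the value at s and adds multiples of the old value to the neighbours of s.
module Game {k : ℕ} (M : CoxMatrix k) (A : Fin k → Fin k → ℤ)
            (compatible : ∀ i j → Compatible M A i j) where

  State : Set
  State = Fin k → ℤ

  infix 4 _≈_
  _≈_ : Word k → Word k → Set
  _≈_ = CoxEq M

  fire : Fin k → State → State
  fire s d j = d j ℤ.+ A s j ℤ.* d s

  -- The last letter is fired first, so that concatenation of words becomes a left action on states.
  play : Word k → State → State
  play []      d = d
  play (s ∷ w) d = fire s (play w d)

  fire-cong : ∀ s {d e} → d ≗ e → fire s d ≗ fire s e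
  fire-cong s eq j = cong₂ (λ x y → x ℤ.+ A s j ℤ.* y) (eq j) (eq s)

  play-cong : ∀ w {d e} → d ≗ e → play w d ≗ play w e
  play-cong []      eq = eq
  play-cong (s ∷ w) eq = fire-cong s (play-cong w eq)

  play-++ : ∀ u v d → play (u ++ v) d ≡ play u (play v d)
  play-++ []      v d = refl
  play-++ (s ∷ u) v d = cong (fire s) (play-++ u v d)

  play-linear : ∀ w c d e → play w (λ i → d i ℤ.+ c ℤ.* e i) ≗ λ i → play w d i ℤ.+ c ℤ.* play w e i
  play-linear []      c d e i = refl
  play-linear (s ∷ w) c d e i =
    trans (fire-cong s (play-linear w c d e) i)
      (solve 6 (λ a b c x y z → (x :+ c :* y) :+ a :* (b :+ c :* z)
                              := (x :+ a :* b) :+ c :* (y :+ a :* z))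
        (A s i) (play w d s) c (play w d i) (play w e i) (play w e s))
    where open ℤSolver

  A-diagonal : ∀ s → A s s ≡ -[1+ 1 ]
  A-diagonal s with compatible s s
  ... | same _ _ e = e
  ... | bonded ne _ = ⊥-elim (ne refl)

  fire-self : ∀ s d → fire s d s ≡ ℤ.- d s
  fire-self s d = trans (cong (λ a → d s ℤ.+ a ℤ.* d s) (A-diagonal s))
    (solve 1 (λ x → x :+ con -[1+ 1 ] :* x := :- x) (d s))
    where open ℤSolver

  fire-involutive : ∀ s d → fire s (fire s d) ≗ d
  fire-involutive s d j = trans (cong (λ x → fire s d j ℤ.+ A s j ℤ.* x) (fire-self s d))
    (solve 3 (λ x a y → x :+ a :* y :+ a :* (:- y) := x) (d j) (A s j) (d s))
    where open ℤSolver

  -- Values at i and j, and at a third generator t, along a play of i and j.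
  module Dihedral (i j t : Fin k) where

    record Values (d : State) (x y e : ℤ) : Set where
      constructor values
      field
        at-i : d i ≡ x
        at-j : d j ≡ y
        at-t : d t ≡ e
    open Values public

    after-i : ∀ {d x y e α} → A i j ≡ α → Values d x y e →
              Values (fire i d) (ℤ.- x) (y ℤ.+ α ℤ.* x) (e ℤ.+ A i t ℤ.* x)
    after-i {d} refl (values refl refl refl) = values (fire-self i d) refl refl

    after-j : ∀ {d x y e β} → A j i ≡ β → Values d x y e →
              Values (fire j d) (x ℤ.+ β ℤ.* y) (ℤ.- y) (e ℤ.+ A j t ℤ.* y)
    after-j {d} refl (values refl refl refl) = values refl (fire-self j d) refl

  -- Along the relator the values fired at i add up to zero, and so do those fired at j. The
  -- observed value therefore returns to its start whatever its coefficients are, and t may be i or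
  -- j itself.
  play-relator : ∀ i j d → play (alt i j (2 ℕ.* M i j)) d ≗ d
  play-relator i j d t with compatible i j
  ... | same refl m _ rewrite m = fire-involutive i d t
  ... | bonded _ (bond2 m α β) rewrite m =
        trans (at-t (after-i α (after-j β (after-i α (after-j β (values {d} refl refl refl))))))
          (solve 5 (λ x y e p q →
             let x₁ = x :+ con (+ 0) :* y ; y₁ = :- y ; e₁ = e :+ q :* y
                 x₂ = :- x₁ ; y₂ = y₁ :+ con (+ 0) :* x₁ ; e₂ = e₁ :+ p :* x₁
                 x₃ = x₂ :+ con (+ 0) :* y₂ ; e₃ = e₂ :+ q :* y₂
             in e₃ :+ p :* x₃ := e) (d i) (d j) (d t) (A i t) (A j t))
    where open Dihedral i j t
          open ℤSolver
  ... | bonded _ (bond3 m α β) rewrite m =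
        trans (at-t (after-i α (after-j β (after-i α (after-j β (after-i α (after-j β
                (values {d} refl refl refl))))))))
          (solve 5 (λ x y e p q →
             let x₁ = x :+ con (+ 1) :* y ; y₁ = :- y ; e₁ = e :+ q :* y
                 x₂ = :- x₁ ; y₂ = y₁ :+ con (+ 1) :* x₁ ; e₂ = e₁ :+ p :* x₁
                 x₃ = x₂ :+ con (+ 1) :* y₂ ; y₃ = :- y₂ ; e₃ = e₂ :+ q :* y₂
                 x₄ = :- x₃ ; y₄ = y₃ :+ con (+ 1) :* x₃ ; e₄ = e₃ :+ p :* x₃
                 x₅ = x₄ :+ con (+ 1) :* y₄ ; e₅ = e₄ :+ q :* y₄
             in e₅ :+ p :* x₅ := e) (d i) (d j) (d t) (A i t) (A j t))
    where open Dihedral i j t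
          open ℤSolver
  ... | bonded _ (bond4 m α β) rewrite m =
        trans (at-t (after-i α (after-j β (after-i α (after-j β (after-i α (after-j β (after-i α (after-j β
                (values {d} refl refl refl))))))))))
          (solve 5 (λ x y e p q →
             let x₁ = x :+ con (+ 2) :* y ; y₁ = :- y ; e₁ = e :+ q :* y
                 x₂ = :- x₁ ; y₂ = y₁ :+ con (+ 1) :* x₁ ; e₂ = e₁ :+ p :* x₁
                 x₃ = x₂ :+ con (+ 2) :* y₂ ; y₃ = :- y₂ ; e₃ = e₂ :+ q :* y₂
                 x₄ = :- x₃ ; y₄ = y₃ :+ con (+ 1) :* x₃ ; e₄ = e₃ :+ p :* x₃
                 x₅ = x₄ :+ con (+ 2) :* y₄ ; y₅ = :- y₄ ; e₅ = e₄ :+ q :* y₄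
                 x₆ = :- x₅ ; y₆ = y₅ :+ con (+ 1) :* x₅ ; e₆ = e₅ :+ p :* x₅
                 x₇ = x₆ :+ con (+ 2) :* y₆ ; e₇ = e₆ :+ q :* y₆
             in e₇ :+ p :* x₇ := e) (d i) (d j) (d t) (A i t) (A j t))
    where open Dihedral i j t
          open ℤSolver
  ... | bonded _ (bond4′ m α β) rewrite m =
        trans (at-t (after-i α (after-j β (after-i α (after-j β (after-i α (after-j β (after-i α (after-j β
                (values {d} refl refl refl))))))))))
          (solve 5 (λ x y e p q →
             let x₁ = x :+ con (+ 1) :* y ; y₁ = :- y ; e₁ = e :+ q :* y
                 x₂ = :- x₁ ; y₂ = y₁ :+ con (+ 2) :* x₁ ; e₂ = e₁ :+ p :* x₁
                 x₃ = x₂ :+ con (+ 1) :* y₂ ; y₃ = :- y₂ ; e₃ = e₂ :+ q :* y₂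
                 x₄ = :- x₃ ; y₄ = y₃ :+ con (+ 2) :* x₃ ; e₄ = e₃ :+ p :* x₃
                 x₅ = x₄ :+ con (+ 1) :* y₄ ; y₅ = :- y₄ ; e₅ = e₄ :+ q :* y₄
                 x₆ = :- x₅ ; y₆ = y₅ :+ con (+ 2) :* x₅ ; e₆ = e₅ :+ p :* x₅
                 x₇ = x₆ :+ con (+ 1) :* y₆ ; e₇ = e₆ :+ q :* y₆
             in e₇ :+ p :* x₇ := e) (d i) (d j) (d t) (A i t) (A j t))
    where open Dihedral i j t
          open ℤSolver

  play-≈ : ∀ {u v} → u ≈ v → ∀ d → play u d ≗ play v d
  play-≈ (rel u v i j) d t = begin
    play (u ++ alt i j (2 ℕ.* M i j) ++ v) d t ≡⟨ cong (λ e → e t) (play-++ u _ d) ⟩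
    play u (play (alt i j (2 ℕ.* M i j) ++ v) d) t
      ≡⟨ cong (λ e → play u e t) (play-++ (alt i j (2 ℕ.* M i j)) v d) ⟩
    play u (play (alt i j (2 ℕ.* M i j)) (play v d)) t
      ≡⟨ play-cong u (play-relator i j (play v d)) t ⟩
    play u (play v d) t ≡⟨ cong (λ e → e t) (play-++ u v d) ⟨
    play (u ++ v) d t ∎
    where open ≡-Reasoning
  play-≈ ≈refl d t = refl
  play-≈ (≈sym e) d t = sym (play-≈ e d t)
  play-≈ (≈trans e e') d t = trans (play-≈ e d t) (play-≈ e' d t)

  ∷-cong : ∀ s {u v} → u ≈ v → s ∷ u ≈ s ∷ v
  ∷-cong s (rel u v i j) = rel (s ∷ u) v i j
  ∷-cong s ≈refl = ≈refl
  ∷-cong s (≈sym e) = ≈sym (∷-cong s e)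
  ∷-cong s (≈trans e e') = ≈trans (∷-cong s e) (∷-cong s e')

  ++-congˡ : ∀ w {u v} → u ≈ v → w ++ u ≈ w ++ v
  ++-congˡ []      e = e
  ++-congˡ (s ∷ w) e = ∷-cong s (++-congˡ w e)

  ++-congʳ : ∀ w {u v} → u ≈ v → u ++ w ≈ v ++ w
  ++-congʳ w (rel u v i j) = subst₂ _≈_
    (sym (trans (List.++-assoc u _ w) (cong (u ++_) (List.++-assoc (alt i j (2 ℕ.* M i j)) v w))))
    (sym (List.++-assoc u v w)) (rel u (v ++ w) i j)
  ++-congʳ w ≈refl = ≈refl
  ++-congʳ w (≈sym e) = ≈sym (++-congʳ w e)
  ++-congʳ w (≈trans e e') = ≈trans (++-congʳ w e) (++-congʳ w e')

  relator : ∀ {m} i j w → M i j ≡ m → alt i j (2 ℕ.* m) ++ w ≈ w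
  relator i j w refl = rel [] w i j

  M-diagonal : ∀ s → M s s ≡ 1
  M-diagonal s with compatible s s
  ... | same _ m _ = m
  ... | bonded ne _ = ⊥-elim (ne refl)

  cancel : ∀ s w → s ∷ s ∷ w ≈ w
  cancel s w = relator s s w (M-diagonal s)

  ∷-cancel : ∀ s {u v} → s ∷ u ≈ s ∷ v → u ≈ v
  ∷-cancel s {u} {v} e = ≈trans (≈sym (cancel s u)) (≈trans (∷-cong s e) (cancel s v))

  ++-cancel : ∀ w {u v} → w ++ u ≈ w ++ v → u ≈ v
  ++-cancel []      e = e
  ++-cancel (s ∷ w) e = ++-cancel w (∷-cancel s e)

  braid2 : ∀ i j w → M i j ≡ 2 → i ∷ j ∷ w ≈ j ∷ i ∷ w
  braid2 i j w m = ≈trans (≈sym (∷-cong i (∷-cong j (≈trans (∷-cong i (cancel j (i ∷ w))) (cancel i w)))))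
    (relator i j (j ∷ i ∷ w) m)

  braid3 : ∀ i j w → M i j ≡ 3 → i ∷ j ∷ i ∷ w ≈ j ∷ i ∷ j ∷ w
  braid3 i j w m = ≈trans
    (≈sym (∷-cong i (∷-cong j (∷-cong i (≈trans (∷-cong j (≈trans (∷-cong i (cancel j (i ∷ j ∷ w)))
      (cancel i (j ∷ w)))) (cancel j w))))))
    (relator i j (j ∷ i ∷ j ∷ w) m)

  braid4 : ∀ i j w → M i j ≡ 4 → i ∷ j ∷ i ∷ j ∷ w ≈ j ∷ i ∷ j ∷ i ∷ w
  braid4 i j w m = ≈trans
    (≈sym (∷-cong i (∷-cong j (∷-cong i (∷-cong j (≈trans (∷-cong i (≈trans (∷-cong j (≈trans
      (∷-cong i (cancel j (i ∷ j ∷ i ∷ w))) (cancel i (j ∷ i ∷ w)))) (cancel j (i ∷ w)))) (cancel i w)))))))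
    (relator i j (j ∷ i ∷ j ∷ i ∷ w) m)

  -- Only generators in `I` are fired, and only there must the start be non-negative. This serves
  -- both the whole group and its parabolic subgroups.
  module Plays (I : Fin k → Set) (ω : State) (dominant : ∀ s → I s → ¬ Neg (ω s)) where

    data Up : Word k → Set where
      []  : Up []
      _∷_ : ∀ {s w} → I s × Pos (play w ω s) → Up w → Up (s ∷ w)

    record Descent (s : Fin k) (w : Word k) : Set where
      constructor descent
      field
        rest    : Word k
        up      : Up rest
        shorter : length w ≡ suc (length rest)
        factors : s ∷ rest ≈ w

      state : play rest ω ≗ fire s (play w ω)
      state t = trans (sym (fire-involutive s (play rest ω) t))
                      (fire-cong s (play-≈ factors ω) t)
    open Descent

    bound : ∀ {n w s} (δ : Descent s w) → length w ≤ n → length (rest δ) ≤ n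
    bound δ le = ℕ.≤-trans (ℕ.n≤1+n _) (subst (_≤ _) (shorter δ) le)

    head-neg : ∀ {s w} → Up (s ∷ w) → Neg (play (s ∷ w) ω s)
    head-neg {s} {w} ((_ , p) ∷ _) = subst Neg (sym (fire-self s (play w ω))) (pos⇒neg- p)

    module Pair (i j : Fin k) where
      open Dihedral i j i public

      peel-i : ∀ {w x y e α} (δ : Descent i w) → A i j ≡ α → Values (play w ω) x y e →
               Values (play (rest δ) ω) (ℤ.- x) (y ℤ.+ α ℤ.* x) (e ℤ.+ A i i ℤ.* x)
      peel-i δ eq v = values (trans (state δ i) (at-i v')) (trans (state δ j) (at-j v'))
                             (trans (state δ i) (at-t v'))
        where v' = after-i eq v

      peel-j : ∀ {w x y e β} (δ : Descent j w) → A j i ≡ β → Values (play w ω) x y e →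
               Values (play (rest δ) ω) (x ℤ.+ β ℤ.* y) (ℤ.- y) (e ℤ.+ A j i ℤ.* y)
      peel-j δ eq v = values (trans (state δ i) (at-i v')) (trans (state δ j) (at-j v'))
                             (trans (state δ i) (at-t v'))
        where v' = after-j eq v

    neg-at : ∀ {a b c} → a ≡ b → b ≡ c → Neg c → Neg a
    neg-at refl refl n = n

    pos-at : ∀ {a b c} → a ≡ b → b ≡ ℤ.- c → Neg c → Pos a
    pos-at refl refl n = neg⇒pos- n

    -- Strong convergence: if s₀ and s can both be undone, then so can the longest element
    -- of the dihedral group they generate, and the two ways of undoing it agree by a braid.
    descend : ∀ n s w → length w ≤ n → I s → Up w → Neg (play w ω s) → Descent s w
    descend n s [] _ is [] neg = ⊥-elim (dominant s is neg)
    descend (suc n) s (s₀ ∷ w₁) (s≤s le) is up₀@((is₀ , p₀) ∷ up₁) neg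
      with compatible s₀ s
    ... | same refl _ _ = descent w₁ up₁ refl ≈refl
    ... | bonded _ (bond2 m α β) = descent (s₀ ∷ rest δ)
            ((is₀ , pos-at (at-i v₂) (solve 2 (λ x y → (:- x) :+ con (+ 0) :* (y :+ con (+ 0) :* x) := :- x) x y) nx) ∷ up δ)
            (cong suc (shorter δ))
            (≈trans (≈sym (braid2 s₀ s _ m)) (∷-cong s₀ (factors δ)))
      where
      open Pair s₀ s
      open ℤSolver
      x = play (s₀ ∷ w₁) ω s₀ ; y = play (s₀ ∷ w₁) ω s ; nx = head-neg up₀
      δ₀ = descent {s₀} {s₀ ∷ w₁} w₁ up₁ refl ≈refl
      v₁ = peel-i δ₀ α (values refl refl refl)
      δ = descend n s w₁ le is up₁ (neg-at (at-j v₁) (solve 2 (λ x y → y :+ con (+ 0) :* x := y) x y) neg)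
      v₂ = peel-j δ β v₁
    ... | bonded _ (bond3 m α β) = descent (s₀ ∷ s ∷ rest δ₂)
            ( (is₀ , pos-at (at-i v₄) (solve 2 (λ x y →
                  let x₂ = (:- x) :+ con (+ 1) :* (y :+ con (+ 1) :* x) ; y₂ = :- (y :+ con (+ 1) :* x)
                      x₃ = :- x₂ ; y₃ = y₂ :+ con (+ 1) :* x₂
                  in x₃ :+ con (+ 1) :* y₃ := :- (x :+ y)) x y) (neg-+ nx neg))
            ∷ (is , pos-at (at-j v₃) (solve 2 (λ x y →
                  let x₂ = (:- x) :+ con (+ 1) :* (y :+ con (+ 1) :* x) ; y₂ = :- (y :+ con (+ 1) :* x)
                  in y₂ :+ con (+ 1) :* x₂ := :- x) x y) nx)
            ∷ up δ₂)
            (cong suc (trans (shorter δ₁) (cong suc (shorter δ₂))))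
            (≈trans (≈sym (braid3 s₀ s _ m)) (∷-cong s₀ (≈trans (∷-cong s (factors δ₂)) (factors δ₁))))
      where
      open Pair s₀ s
      open ℤSolver
      x = play (s₀ ∷ w₁) ω s₀ ; y = play (s₀ ∷ w₁) ω s ; nx = head-neg up₀
      δ₀ = descent {s₀} {s₀ ∷ w₁} w₁ up₁ refl ≈refl
      v₁ = peel-i δ₀ α (values refl refl refl)
      -- With x and y the negative values at `s₀` and `s`: before `s₀` was fired they were -x and x
      -- + y, so `s` can be undone; this leaves y and -(x + y), so `s₀` can be undone next. The
      -- bonds of order 4 need one more round of the same kind.
      δ₁ = descend n s w₁ le is up₁ (neg-at (at-j v₁) (solve 2 (λ x y → y :+ con (+ 1) :* x := x :+ y) x y) (neg-+ nx neg))
      v₂ = peel-j δ₁ β v₁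
      δ₂ = descend n s₀ (rest δ₁) (bound δ₁ le) is₀ (up δ₁) (neg-at (at-i v₂)
             (solve 2 (λ x y → (:- x) :+ con (+ 1) :* (y :+ con (+ 1) :* x) := y) x y) neg)
      v₃ = peel-i δ₂ α v₂
      v₄ = after-j β v₃
    ... | bonded _ (bond4 m α β) = descent (s₀ ∷ s ∷ s₀ ∷ rest δ₃)
            ( (is₀ , pos-at (at-i v₆) (solve 2 (λ x y →
                  let x₁ = :- x ; y₁ = y :+ con (+ 1) :* x
                      x₂ = x₁ :+ con (+ 2) :* y₁ ; y₂ = :- y₁
                      x₃ = :- x₂ ; y₃ = y₂ :+ con (+ 1) :* x₂
                      x₄ = x₃ :+ con (+ 2) :* y₃ ; y₄ = :- y₃
                      x₅ = :- x₄ ; y₅ = y₄ :+ con (+ 1) :* x₄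
                  in x₅ :+ con (+ 2) :* y₅ := :- ((x :+ y) :+ y)) x y) (neg-+ (neg-+ nx neg) neg))
            ∷ (is , pos-at (at-j v₅) (solve 2 (λ x y →
                  let x₁ = :- x ; y₁ = y :+ con (+ 1) :* x
                      x₂ = x₁ :+ con (+ 2) :* y₁ ; y₂ = :- y₁
                      x₃ = :- x₂ ; y₃ = y₂ :+ con (+ 1) :* x₂
                      x₄ = x₃ :+ con (+ 2) :* y₃ ; y₄ = :- y₃
                  in y₄ :+ con (+ 1) :* x₄ := :- (x :+ y)) x y) (neg-+ nx neg))
            ∷ (is₀ , pos-at (at-i v₄) (solve 2 (λ x y →
                  let x₁ = :- x ; y₁ = y :+ con (+ 1) :* x
                      x₂ = x₁ :+ con (+ 2) :* y₁ ; y₂ = :- y₁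
                      x₃ = :- x₂ ; y₃ = y₂ :+ con (+ 1) :* x₂
                  in x₃ :+ con (+ 2) :* y₃ := :- x) x y) nx)
            ∷ up δ₃)
            (cong suc (trans (shorter δ₁) (cong suc (trans (shorter δ₂) (cong suc (shorter δ₃))))))
            (≈trans (≈sym (braid4 s₀ s _ m)) (∷-cong s₀
              (≈trans (∷-cong s (≈trans (∷-cong s₀ (factors δ₃)) (factors δ₂))) (factors δ₁))))
      where
      open Pair s₀ s
      open ℤSolver
      x = play (s₀ ∷ w₁) ω s₀ ; y = play (s₀ ∷ w₁) ω s ; nx = head-neg up₀
      δ₀ = descent {s₀} {s₀ ∷ w₁} w₁ up₁ refl ≈refl
      v₁ = peel-i δ₀ α (values refl refl refl)
      δ₁ = descend n s w₁ le is up₁ (neg-at (at-j v₁)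
             (solve 2 (λ x y → y :+ con (+ 1) :* x := x :+ y) x y) (neg-+ nx neg))
      v₂ = peel-j δ₁ β v₁
      δ₂ = descend n s₀ (rest δ₁) (bound δ₁ le) is₀ (up δ₁) (neg-at (at-i v₂)
             (solve 2 (λ x y → (:- x) :+ con (+ 2) :* (y :+ con (+ 1) :* x) := (x :+ y) :+ y) x y)
             (neg-+ (neg-+ nx neg) neg))
      v₃ = peel-i δ₂ α v₂
      δ₃ = descend n s (rest δ₂) (bound δ₂ (bound δ₁ le)) is (up δ₂) (neg-at (at-j v₃)
             (solve 2 (λ x y →
                  let x₁ = :- x ; y₁ = y :+ con (+ 1) :* x
                      x₂ = x₁ :+ con (+ 2) :* y₁ ; y₂ = :- y₁
                  in y₂ :+ con (+ 1) :* x₂ := y) x y) neg)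
      v₄ = peel-j δ₃ β v₃
      v₅ = after-i α v₄
      v₆ = after-j β v₅
    ... | bonded _ (bond4′ m α β) = descent (s₀ ∷ s ∷ s₀ ∷ rest δ₃)
            ( (is₀ , pos-at (at-i v₆) (solve 2 (λ x y →
                  let x₁ = :- x ; y₁ = y :+ con (+ 2) :* x
                      x₂ = x₁ :+ con (+ 1) :* y₁ ; y₂ = :- y₁
                      x₃ = :- x₂ ; y₃ = y₂ :+ con (+ 2) :* x₂
                      x₄ = x₃ :+ con (+ 1) :* y₃ ; y₄ = :- y₃
                      x₅ = :- x₄ ; y₅ = y₄ :+ con (+ 2) :* x₄
                  in x₅ :+ con (+ 1) :* y₅ := :- (x :+ y)) x y) (neg-+ nx neg))
            ∷ (is , pos-at (at-j v₅) (solve 2 (λ x y →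
                  let x₁ = :- x ; y₁ = y :+ con (+ 2) :* x
                      x₂ = x₁ :+ con (+ 1) :* y₁ ; y₂ = :- y₁
                      x₃ = :- x₂ ; y₃ = y₂ :+ con (+ 2) :* x₂
                      x₄ = x₃ :+ con (+ 1) :* y₃ ; y₄ = :- y₃
                  in y₄ :+ con (+ 2) :* x₄ := :- (x :+ (x :+ y))) x y) (neg-+ nx (neg-+ nx neg)))
            ∷ (is₀ , pos-at (at-i v₄) (solve 2 (λ x y →
                  let x₁ = :- x ; y₁ = y :+ con (+ 2) :* x
                      x₂ = x₁ :+ con (+ 1) :* y₁ ; y₂ = :- y₁
                      x₃ = :- x₂ ; y₃ = y₂ :+ con (+ 2) :* x₂
                  in x₃ :+ con (+ 1) :* y₃ := :- x) x y) nx)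
            ∷ up δ₃)
            (cong suc (trans (shorter δ₁) (cong suc (trans (shorter δ₂) (cong suc (shorter δ₃))))))
            (≈trans (≈sym (braid4 s₀ s _ m)) (∷-cong s₀
              (≈trans (∷-cong s (≈trans (∷-cong s₀ (factors δ₃)) (factors δ₂))) (factors δ₁))))
      where
      open Pair s₀ s
      open ℤSolver
      x = play (s₀ ∷ w₁) ω s₀ ; y = play (s₀ ∷ w₁) ω s ; nx = head-neg up₀
      δ₀ = descent {s₀} {s₀ ∷ w₁} w₁ up₁ refl ≈refl
      v₁ = peel-i δ₀ α (values refl refl refl)
      δ₁ = descend n s w₁ le is up₁ (neg-at (at-j v₁)
             (solve 2 (λ x y → y :+ con (+ 2) :* x := x :+ (x :+ y)) x y) (neg-+ nx (neg-+ nx neg)))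
      v₂ = peel-j δ₁ β v₁
      δ₂ = descend n s₀ (rest δ₁) (bound δ₁ le) is₀ (up δ₁) (neg-at (at-i v₂)
             (solve 2 (λ x y → (:- x) :+ con (+ 1) :* (y :+ con (+ 2) :* x) := x :+ y) x y)
             (neg-+ nx neg))
      v₃ = peel-i δ₂ α v₂
      δ₃ = descend n s (rest δ₂) (bound δ₂ (bound δ₁ le)) is (up δ₂) (neg-at (at-j v₃)
             (solve 2 (λ x y →
                  let x₁ = :- x ; y₁ = y :+ con (+ 2) :* x
                      x₂ = x₁ :+ con (+ 1) :* y₁ ; y₂ = :- y₁
                  in y₂ :+ con (+ 2) :* x₂ := y) x y) neg)
      v₄ = peel-j δ₃ β v₃
      v₅ = after-i α v₄
      v₆ = after-j β v₅

    descent-at : ∀ {s w} → I s → Up w → Neg (play w ω s) → Descent s w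
    descent-at is u neg = descend _ _ _ ℕ.≤-refl is u neg

-- Coset representatives and reduced words

module Parabolic {k : ℕ} (M : CoxMatrix k) (A : Fin k → Fin k → ℤ)
                 (compatible : ∀ i j → Compatible M A i j) where
  open Game M A compatible

  module Coset (I : Fin k → Set) (ω : State) (dominant : ∀ s → I s → ¬ Neg (ω s)) where
    open Plays I ω dominant
    open Descent

    Stabiliser : Fin k → Set
    Stabiliser s = I s × ω s ≡ + 0

    record Commutes (s : Fin k) (w : Word k) : Set where
      constructor commutes
      field
        other   : Fin k
        stab    : Stabiliser other
        through : s ∷ w ≈ w ++ (other ∷ [])
    open Commutes

    -- A zero at s means that s fixes the state reached by w, so the conjugate of s by w fixes ω.
    -- That this conjugate is a generator follows by the dihedral cases of `descend` with value 0 at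
    -- s: one undoing fewer, and a zero is found again in a shorter word.
    zero-at : ∀ n s w → length w ≤ n → I s → Up w → play w ω s ≡ + 0 → Commutes s w
    zero-at n s [] _ is [] z = commutes s (is , z) ≈refl
    zero-at (suc n) s (s₀ ∷ w₁) (s≤s le) is up₀@((is₀ , p₀) ∷ up₁) z
      with compatible s₀ s
    ... | same refl _ _ = ⊥-elim (ℤ.<⇒≢ (head-neg up₀) z)
    ... | bonded _ (bond2 m α β) = commutes (other γ) (stab γ)
            (≈trans (≈sym (braid2 s₀ s w₁ m)) (∷-cong s₀ (through γ)))
      where
      open Pair s₀ s
      open ℤSolver
      x = play (s₀ ∷ w₁) ω s₀
      δ₀ = descent {s₀} {s₀ ∷ w₁} w₁ up₁ refl ≈refl
      v₁ = peel-i δ₀ α (values refl z refl)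
      γ = zero-at n s w₁ le is up₁ (trans (at-j v₁) (solve 1 (λ x → con (+ 0) :+ con (+ 0) :* x := con (+ 0)) x))
    ... | bonded _ (bond3 m α β) = commutes (other γ) (stab γ)
            (≈trans (∷-cong s (∷-cong s₀ (≈sym (factors δ₁))))
            (≈trans (≈sym (braid3 s₀ s _ m))
            (∷-cong s₀ (≈trans (∷-cong s (through γ)) (++-congʳ (other γ ∷ []) (factors δ₁))))))
      where
      open Pair s₀ s
      open ℤSolver
      x = play (s₀ ∷ w₁) ω s₀
      δ₀ = descent {s₀} {s₀ ∷ w₁} w₁ up₁ refl ≈refl
      v₁ = peel-i δ₀ α (values refl z refl)
      δ₁ = descend n s w₁ le is up₁ (neg-at (at-j v₁)
             (solve 1 (λ x → con (+ 0) :+ con (+ 1) :* x := x) x) (head-neg up₀))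
      v₂ = peel-j δ₁ β v₁
      γ = zero-at n s₀ (rest δ₁) (bound δ₁ le) is₀ (up δ₁) (trans (at-i v₂)
             (solve 1 (λ x → (:- x) :+ con (+ 1) :* (con (+ 0) :+ con (+ 1) :* x) := con (+ 0)) x))
    ... | bonded _ (bond4 m α β) = commutes (other γ) (stab γ)
            (≈trans (∷-cong s (∷-cong s₀ (≈sym (≈trans (∷-cong s (factors δ₂)) (factors δ₁)))))
            (≈trans (≈sym (braid4 s₀ s _ m))
            (∷-cong s₀ (≈trans (∷-cong s (∷-cong s₀ (through γ)))
              (++-congʳ (other γ ∷ []) (≈trans (∷-cong s (factors δ₂)) (factors δ₁)))))))
      where
      open Pair s₀ s
      open ℤSolver
      x = play (s₀ ∷ w₁) ω s₀
      δ₀ = descent {s₀} {s₀ ∷ w₁} w₁ up₁ refl ≈refl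
      v₁ = peel-i δ₀ α (values refl z refl)
      δ₁ = descend n s w₁ le is up₁ (neg-at (at-j v₁)
             (solve 1 (λ x → con (+ 0) :+ con (+ 1) :* x := x) x) (head-neg up₀))
      v₂ = peel-j δ₁ β v₁
      δ₂ = descend n s₀ (rest δ₁) (bound δ₁ le) is₀ (up δ₁) (neg-at (at-i v₂)
             (solve 1 (λ x → (:- x) :+ con (+ 2) :* (con (+ 0) :+ con (+ 1) :* x) := x) x) (head-neg up₀))
      v₃ = peel-i δ₂ α v₂
      γ = zero-at n s (rest δ₂) (bound δ₂ (bound δ₁ le)) is (up δ₂) (trans (at-j v₃)
             (solve 1 (λ x →
                let y₁ = con (+ 0) :+ con (+ 1) :* x ; x₂ = (:- x) :+ con (+ 2) :* y₁
                in (:- y₁) :+ con (+ 1) :* x₂ := con (+ 0)) x))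
    ... | bonded _ (bond4′ m α β) = commutes (other γ) (stab γ)
            (≈trans (∷-cong s (∷-cong s₀ (≈sym (≈trans (∷-cong s (factors δ₂)) (factors δ₁)))))
            (≈trans (≈sym (braid4 s₀ s _ m))
            (∷-cong s₀ (≈trans (∷-cong s (∷-cong s₀ (through γ)))
              (++-congʳ (other γ ∷ []) (≈trans (∷-cong s (factors δ₂)) (factors δ₁)))))))
      where
      open Pair s₀ s
      open ℤSolver
      x = play (s₀ ∷ w₁) ω s₀
      δ₀ = descent {s₀} {s₀ ∷ w₁} w₁ up₁ refl ≈refl
      v₁ = peel-i δ₀ α (values refl z refl)
      δ₁ = descend n s w₁ le is up₁ (neg-at (at-j v₁)
             (solve 1 (λ x → con (+ 0) :+ con (+ 2) :* x := x :+ x) x)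
             (neg-+ (head-neg up₀) (head-neg up₀)))
      v₂ = peel-j δ₁ β v₁
      δ₂ = descend n s₀ (rest δ₁) (bound δ₁ le) is₀ (up δ₁) (neg-at (at-i v₂)
             (solve 1 (λ x → (:- x) :+ con (+ 1) :* (con (+ 0) :+ con (+ 2) :* x) := x) x) (head-neg up₀))
      v₃ = peel-i δ₂ α v₂
      γ = zero-at n s (rest δ₂) (bound δ₂ (bound δ₁ le)) is (up δ₂) (trans (at-j v₃)
             (solve 1 (λ x →
                let y₁ = con (+ 0) :+ con (+ 2) :* x ; x₂ = (:- x) :+ con (+ 1) :* y₁
                in (:- y₁) :+ con (+ 2) :* x₂ := con (+ 0)) x))

    record Factorisation (w : Word k) : Set where
      constructor factorisation
      field
        rep     : Word k
        tail    : Word k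
        rep-up  : Up rep
        tail-in : All Stabiliser tail
        equal   : rep ++ tail ≈ w
        short   : length rep ≤ length w

    -- A new first letter extends the representative, shortens it, or passes through it into the
    -- tail, according to the sign of the value at that letter.
    factorise : ∀ w → All I w → Factorisation w
    factorise [] [] = factorisation [] [] [] [] ≈refl z≤n
    factorise (s ∷ w) (is ∷ iw) with factorise w iw
    ... | factorisation g u up-g u-in eq le with ℤ.<-cmp (+ 0) (play g ω s)
    ...   | tri< p _ _ = factorisation (s ∷ g) u ((is , p) ∷ up-g) u-in (∷-cong s eq) (s≤s le)
    ...   | tri> _ _ neg = factorisation (rest δ) u (up δ) u-in
              (≈trans (≈trans (≈sym (cancel s _)) (∷-cong s (++-congʳ u (factors δ)))) (∷-cong s eq))
              (ℕ.≤-trans (bound δ ℕ.≤-refl) (ℕ.m≤n⇒m≤1+n le))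
      where δ = descent-at is up-g neg
    ...   | tri≈ _ z _ = factorisation g (other γ ∷ u) up-g (stab γ ∷ u-in)
              (≈trans (≈sym (≈trans (++-congʳ u (through γ))
                (subst ((g ++ other γ ∷ []) ++ u ≈_) (List.++-assoc g (other γ ∷ []) u) ≈refl))) (∷-cong s eq))
              (ℕ.m≤n⇒m≤1+n le)
      where γ = zero-at (length g) s g ℕ.≤-refl is up-g (sym z)

    -- The first letter of g has a negative value in the common state, so it can be undone in g' as
    -- well; then induct. When g is used up, g' must be empty, since a nonempty g' would leave a
    -- negative value and ω has none on `I`.
    up-unique : ∀ {g g'} → Up g → Up g' → play g ω ≗ play g' ω → g ≈ g' × length g ≡ length g'
    up-unique {[]} {[]} _ _ _ = ≈refl , refl
    up-unique {[]} {s ∷ g'} _ up'@((is , _) ∷ _) eq =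
      ⊥-elim (dominant s is (subst Neg (sym (eq s)) (head-neg up')))
    up-unique {s ∷ g} {g'} up-sg@((is , _) ∷ up-g) up' eq = result
      where
      δ = descent-at is up' (subst Neg (eq s) (head-neg up-sg))
      ih = up-unique up-g (up δ) λ t → begin
        play g ω t ≡⟨ fire-involutive s (play g ω) t ⟨
        fire s (play (s ∷ g) ω) t ≡⟨ fire-cong s eq t ⟩
        fire s (play g' ω) t ≡⟨ state δ t ⟨
        play (rest δ) ω t ∎
        where open ≡-Reasoning
      result : s ∷ g ≈ g' × suc (length g) ≡ length g'
      result = ≈trans (∷-cong s (proj₁ ih)) (factors δ) , trans (cong suc (proj₂ ih)) (sym (shorter δ))

    stabiliser-fixes : ∀ {u} → All Stabiliser u → play u ω ≗ ω
    stabiliser-fixes [] t = refl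
    stabiliser-fixes {s ∷ u} ((_ , z) ∷ u-in) t = begin
      fire s (play u ω) t ≡⟨ fire-cong s (stabiliser-fixes u-in) t ⟩
      ω t ℤ.+ A s t ℤ.* ω s ≡⟨ cong (λ x → ω t ℤ.+ A s t ℤ.* x) z ⟩
      ω t ℤ.+ A s t ℤ.* + 0 ≡⟨ cong (ℤ._+_ (ω t)) (ℤ.*-zeroʳ (A s t)) ⟩
      ω t ℤ.+ + 0 ≡⟨ ℤ.+-identityʳ (ω t) ⟩ ω t ∎
      where open ≡-Reasoning

  HasLength-resp : ∀ {x y m} → x ≈ y → HasLength M x m → HasLength M y m
  HasLength-resp e ((w , l , eq) , min) = (w , l , ≈trans eq e) , λ v ev → min v (≈trans ev (≈sym e))

  HasLength-unique : ∀ {x m m'} → HasLength M x m → HasLength M x m' → m ≡ m'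
  HasLength-unique ((w , l , e) , min) ((w' , l' , e') , min') =
    ℕ.≤-antisym (subst (_ ≤_) l' (min w' e')) (subst (_ ≤_) l (min' w e))

  -- A strictly positive start has no stabilising generator. The tail of a factorisation is then
  -- empty and coset representatives are reduced words of the group.
  module Strict (ρ : State) (strict : ∀ s → Pos (ρ s)) where

    ρ-dominant : ∀ s → ⊤ → ¬ Neg (ρ s)
    ρ-dominant s _ = pos⇒¬neg (strict s)

    open Plays (λ _ → ⊤) ρ ρ-dominant public
    open Coset (λ _ → ⊤) ρ ρ-dominant public

    all⊤ : ∀ (w : Word k) → All (λ _ → ⊤) w
    all⊤ [] = []
    all⊤ (s ∷ w) = tt ∷ all⊤ w

    reduce : ∀ w → Σ (Word k) λ g → Up g × g ≈ w × length g ≤ length w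
    reduce w with factorise w (all⊤ w)
    ... | factorisation g [] up-g _ eq le = g , up-g , subst (_≈ w) (List.++-identityʳ g) eq , le
    ... | factorisation g (s ∷ u) _ ((_ , z) ∷ _) _ _ = ⊥-elim (ℤ.<⇒≢ (strict s) (sym z))

    -- Any competitor reduces to a word that fires only positive values and is not longer;
    -- uniqueness gives that word the length of g.
    up-HasLength : ∀ {g} → Up g → HasLength M g (length g)
    up-HasLength {g} up-g = (g , refl , ≈refl) , shortest
      where
      shortest : ∀ y → y ≈ g → length g ≤ length y
      shortest y e with reduce y
      ... | g' , up' , e' , le =
            subst (_≤ length y) (sym (proj₂ (up-unique up-g up' (play-≈ (≈sym (≈trans e' e)) ρ)))) le

    HasLength-exists : ∀ w → Σ ℕ (HasLength M w)
    HasLength-exists w with reduce w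
    ... | g , up-g , e , _ = length g , HasLength-resp e (up-HasLength up-g)

    faithful : ∀ u v → play u ρ ≗ play v ρ → u ≈ v
    faithful u v eq with reduce u | reduce v
    ... | g , up-g , e , _ | g' , up-g' , e' , _ =
      ≈trans (≈sym e) (≈trans (proj₁ (up-unique up-g up-g' λ t →
        trans (play-≈ e ρ t) (trans (eq t) (sym (play-≈ e' ρ t))))) e')

    nonzero : ∀ {g} → Up g → ∀ s → play g ρ s ≢ + 0
    nonzero up-g s z with zero-at _ s _ ℕ.≤-refl tt up-g z
    ... | commutes s' (_ , z') _ = ℤ.<⇒≢ (strict s') (sym z')

  ρ₁ : State
  ρ₁ _ = + 1

  ρ₁-strict : ∀ s → Pos (ρ₁ s)
  ρ₁-strict s = ℤ.+<+ (s≤s z≤n)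

  open Strict ρ₁ ρ₁-strict

  module Shifted (c : ℕ) (ω : State) (ω≥0 : ∀ t → ¬ Neg (ω t)) where
    ρ : State
    ρ t = ρ₁ t ℤ.+ + c ℤ.* ω t

    strict : ∀ t → Pos (ρ t)
    strict t = ℤ.+-mono-<-≤ (ρ₁-strict t)
      (subst (ℤ._≤ + c ℤ.* ω t) (ℤ.*-zeroʳ (+ c)) (ℤ.*-monoˡ-≤-nonNeg (+ c) (ℤ.≮⇒≥ (ω≥0 t))))

    module S = Strict ρ strict

    -- Undoing s shortens g, a fact about the group alone. A positive value at s for the start ρ
    -- would make s lengthen the same element; a zero is impossible for a strict start.
    sign : ∀ {g} s → Up g → Neg (play g ρ₁ s) → Neg (play g ρ s)
    sign {g} s up-g neg with ℤ.<-cmp (+ 0) (play g ρ s) | S.reduce g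
    ... | tri> _ _ neg' | _ = neg'
    ... | tri≈ _ z _ | ĝ , up-ĝ , e , _ = ⊥-elim (S.nonzero up-ĝ s (trans (play-≈ e ρ s) (sym z)))
    ... | tri< p _ _ | ĝ , up-ĝ , e , _ = ⊥-elim (ℕ.<-irrefl refl (begin-strict
      length (rest δ) <⟨ ℕ.≤-reflexive (sym (shorter δ)) ⟩
      length g        ≡⟨ HasLength-unique (HasLength-resp (≈sym e) (up-HasLength up-g)) (S.up-HasLength up-ĝ) ⟩
      length ĝ        ≤⟨ ℕ.n≤1+n _ ⟩
      suc (length ĝ)  ≤⟨ proj₂ (S.up-HasLength ((tt , subst Pos (sym (play-≈ e ρ s)) p) S.∷ up-ĝ))
                          (rest δ) (≈trans (≈sym (cancel s _)) (∷-cong s (≈trans (factors δ) (≈sym e)))) ⟩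
      length (rest δ) ∎))
      where
      open Descent
      open ℕ.≤-Reasoning
      δ = descent-at tt up-g neg

  -- Whether firing s lengthens g does not depend on the strictly dominant start, so it can be
  -- tested on ρ₁ + c ω for c large.
  sign-independent : ∀ {g} s → Up g → Neg (play g ρ₁ s) →
                     ∀ ω → (∀ t → ¬ Neg (ω t)) → ¬ Pos (play g ω s)
  sign-independent {g} s up-g neg ω ω≥0 pos =
    ℤ.<⇒≱ (Shifted.sign c ω ω≥0 s up-g neg) (subst (+ 0 ℤ.≤_) (sym (play-linear g (+ c) ρ₁ ω s)) nonneg)
    where
    a = play g ρ₁ s
    c = ℤ.∣ a ∣
    neg-abs : ∀ {x} → Neg x → x ℤ.+ + ℤ.∣ x ∣ ≡ + 0
    neg-abs {+ n} (ℤ.+<+ ())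
    neg-abs { -[1+ n ] } _ = ℤ.+-inverseˡ (+ suc n)
    nonneg : + 0 ℤ.≤ a ℤ.+ + c ℤ.* play g ω s
    nonneg = subst (ℤ._≤ a ℤ.+ + c ℤ.* play g ω s) (neg-abs neg)
      (ℤ.+-monoʳ-≤ a (subst (ℤ._≤ + c ℤ.* play g ω s) (ℤ.*-identityʳ (+ c))
        (ℤ.*-monoˡ-≤-nonNeg (+ c) (ℤ.i<j⇒suc[i]≤j pos))))

  -- ω may vanish at some generators, so words fired from it need not be reduced. The sign at s is
  -- therefore transferred to the strict start `ρ₁`, where it decides the length.
  lengthen : ∀ {y m} s ω → (∀ t → ¬ Neg (ω t)) → HasLength M y m → Pos (play y ω s) → HasLength M (s ∷ y) (suc m)
  lengthen {y} {m} s ω ω≥0 hl pos with reduce y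
  ... | g , up-g , e , _ with ℤ.<-cmp (+ 0) (play g ρ₁ s)
  ...   | tri> _ _ neg = ⊥-elim (sign-independent s up-g neg ω ω≥0 (subst Pos (sym (play-≈ e ω s)) pos))
  ...   | tri≈ _ z _ = ⊥-elim (nonzero up-g s (sym z))
  ...   | tri< p _ _ = HasLength-resp (∷-cong s e)
            (subst (HasLength M (s ∷ g)) (cong suc (HasLength-unique (HasLength-resp e (up-HasLength up-g)) hl))
              (up-HasLength ((tt , p) ∷ up-g)))

  []-HasLength : HasLength M [] 0
  []-HasLength = ([] , refl , ≈refl) , λ _ _ → z≤n

-- Lengths of folded words

module Folding {k l} {MC : CoxMatrix k} {AC} (compC : ∀ i j → Compatible MC AC i j)
               {MW : CoxMatrix l} {AW} (compW : ∀ i j → Compatible MW AW i j)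
               (φ : Fin k → Word l) where
  module C = Game MC AC compC
  module W where
    open Game MW AW compW public
    open Parabolic MW AW compW public

  Ascends : Word l → W.State → Set
  Ascends []      d = ⊤
  Ascends (s ∷ u) d = Pos (W.play u d s) × Ascends u d

  record IsFolding (ι : C.State → W.State) : Set where
    field
      equivariant : ∀ r d → W.play (φ r) (ι d) ≗ ι (C.fire r d)
      ι-cong      : ∀ {d e} → d ≗ e → ι d ≗ ι e
      ι-strict    : ∀ {d} → (∀ t → Pos (d t)) → ∀ t → Pos (ι d t)
      ι-dominant  : ∀ {d} → (∀ t → ¬ Neg (d t)) → ∀ t → ¬ Neg (ι d t)
      ascends     : ∀ r d → Pos (d r) → Ascends (φ r) (ι d)

  module FoldedLength {ι} (isFolding : IsFolding ι) where
    open IsFolding isFolding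

    HL : Word k → ℕ → Set
    HL w = HasLength MW (hom φ w)

    hom-play : ∀ w d → W.play (hom φ w) (ι d) ≗ ι (C.play w d)
    hom-play [] d t = refl
    hom-play (r ∷ w) d t = begin
      W.play (φ r ++ hom φ w) (ι d) t       ≡⟨ cong (λ e → e t) (W.play-++ (φ r) (hom φ w) (ι d)) ⟩
      W.play (φ r) (W.play (hom φ w) (ι d)) t ≡⟨ W.play-cong (φ r) (hom-play w d) t ⟩
      W.play (φ r) (ι (C.play w d)) t       ≡⟨ equivariant r (C.play w d) t ⟩
      ι (C.fire r (C.play w d)) t ∎
      where open ≡-Reasoning

    -- No relator is checked in W. The images of u and v act alike on the image of a strictly
    -- positive state, which is again strictly positive, and from such a state the action of W is
    -- faithful.
    hom-≈ : ∀ {u v} → CoxEq MC u v → CoxEq MW (hom φ u) (hom φ v)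
    hom-≈ {u} {v} e = W.Strict.faithful (ι (λ _ → + 1)) (ι-strict (λ _ → ℤ.+<+ (s≤s z≤n))) _ _ λ t →
      trans (hom-play u _ t) (trans (ι-cong (C.play-≈ e _) t) (sym (hom-play v _ t)))

    HL-resp : ∀ {u v m} → CoxEq MC u v → HL u m → HL v m
    HL-resp e = W.HasLength-resp (hom-≈ e)

    HL-unique : ∀ {u m m'} → HL u m → HL u m' → m ≡ m'
    HL-unique = W.HasLength-unique

    HL-exists : ∀ u → ∃ (HL u)
    HL-exists u = W.Strict.HasLength-exists W.ρ₁ W.ρ₁-strict (hom φ u)

    HL-[] : HL [] 0
    HL-[] = W.[]-HasLength

    -- A positive value at r makes every letter of φ r fire a positive value in turn, so each of
    -- them lengthens by one.
    HL-step : ∀ {w m} r ω → (∀ t → ¬ Neg (ω t)) → HL w m → Pos (C.play w ω r) →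
              HL (r ∷ w) (length (φ r) ℕ.+ m)
    HL-step {w} {m} r ω ω≥0 hl pos = go (φ r) (ascends r (C.play w ω) pos)
      where
      go : ∀ u → Ascends u (ι (C.play w ω)) → HasLength MW (u ++ hom φ w) (length u ℕ.+ m)
      go [] _ = hl
      go (s ∷ u) (p , a) = W.lengthen s (ι ω) (ι-dominant ω≥0) (go u a)
        (subst Pos (sym (trans (cong (λ e → e s) (W.play-++ u (hom φ w) (ι ω)))
                               (W.play-cong u (hom-play w ω) s))) p)

-- Generating functions of weighted sets

open Sums seriesRing cst-morphism public using (ΣS; ΣS-cong; ΣS-+; ΣS-⊗; Σ+; ΣS-Σ+)

record Counted {X : Set} (_≈_ : X → X → Set) (P : X → Set) (z : ℤ) : Set where
  constructor counted
  field
    elements : List X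
    size     : z ≡ + length elements
    sound    : All P elements
    distinct : AllPairs (λ x y → ¬ x ≈ y) elements
    complete : ∀ x → P x → Any (x ≈_) elements

-- F is the generating function of X up to ≈, where V x m says that x has weight m.
GF : {X : Set} (_≈_ : X → X → Set) (V : X → ℕ → Set) (F : Series) → Set
GF _≈_ V F = ∀ m → Counted _≈_ (λ x → V x m) (F m)

GF-≋ : ∀ {X : Set} {_≈_ : X → X → Set} {V F G} → F ≋ G → GF _≈_ V F → GF _≈_ V G
GF-≋ e gf m with gf m
... | counted xs s p d c = counted xs (trans (sym (at e m)) s) p d c

module _ {X Y : Set} {_≈_ : X → X → Set} {_∼_ : Y → Y → Set} (isEquivalence : IsEquivalence _∼_) where
  private module ∼ = IsEquivalence isEquivalence

  map-counted : ∀ {P Q z} (f : X → Y) → (∀ {x x'} → x ≈ x' → f x ∼ f x') →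
    (∀ {x} → P x → Q (f x)) →
    (∀ {x x'} → P x → P x' → f x ∼ f x' → x ≈ x') →
    (∀ {y} → Q y → ∃ λ x → P x × y ∼ f x) →
    Counted _≈_ P z → Counted _∼_ Q z
  map-counted {P} {Q} f f-cong sd inj cpl (counted xs s p d c) = counted (map f xs)
    (trans s (cong +_ (sym (List.length-map f xs))))
    (All.map⁺ (All.map sd p))
    (distinct-map p d)
    (λ y qy → let (x , px , eq) = cpl qy in Any.map⁺ (Any.map (λ e → ∼.trans eq (f-cong e)) (c x px)))
    where
    distinct-map : ∀ {xs} → All P xs → AllPairs (λ x y → ¬ x ≈ y) xs → AllPairs (λ x y → ¬ x ∼ y) (map f xs)
    distinct-map [] [] = []
    distinct-map (px ∷ ps) (x≉ ∷ ds) =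
      All.map⁺ (All.zipWith (λ { (px' , ne) eq → ne (inj px px' eq) }) (ps , x≉)) ∷ distinct-map ps ds

module _ {Z : Set} {_≈_ : Z → Z → Set} where

  union-counted : ∀ n {P : Z → Set} {P' : ℕ → Z → Set} {z : ℕ → ℤ} →
    (∀ {i x} → i < n → P' i x → P x) →
    (∀ {i j x y} → i < n → j < n → P' i x → P' j y → x ≈ y → i ≡ j) →
    (∀ {x} → P x → ∃ λ i → i < n × P' i x) →
    (∀ i → i < n → Counted _≈_ (P' i) (z i)) → Counted _≈_ P (sumℤ (applyUpTo z n))
  union-counted zero sd sep cpl cs =
    counted [] refl [] [] (λ x px → ⊥-elim (ℕ.n≮0 (proj₁ (proj₂ (cpl px)))))
  union-counted (suc n) {P} {P'} {z} sd sep cpl cs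
    with cs 0 (s≤s z≤n)
       | union-counted n {λ x → ∃ λ i → i < n × P' (suc i) x} {P' ∘ suc} {z ∘ suc} (λ i<n p → _ , i<n , p)
           (λ lt lt' p p' e → ℕ.suc-injective (sep (s≤s lt) (s≤s lt') p p' e)) id (λ i i<n → cs (suc i) (s≤s i<n))
  ... | counted xs s p d c | counted ys s' p' d' c' = counted (xs ++ ys)
          (trans (cong₂ ℤ._+_ s s') (cong +_ (sym (List.length-++ xs))))
          (All.++⁺ (All.map (sd (s≤s z≤n)) p) (All.map (λ { (i , i<n , q) → sd (s≤s i<n) q }) p'))
          (AllPairs.++⁺ d d' (All.map (λ px → All.map (λ { (_ , i<n , py) e → ℕ.0≢1+n (sep (s≤s z≤n) (s≤s i<n) px py e) }) p') p))
          complete-++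
    where
    complete-++ : ∀ x → P x → Any (x ≈_) (xs ++ ys)
    complete-++ x px with cpl px
    ... | zero  , _ , q = Any.++⁺ˡ (c x q)
    ... | suc i , s≤s i<n , q = Any.++⁺ʳ xs (c' x (i , i<n , q))

  GF-union : ∀ n {V : Z → ℕ → Set} {V' : ℕ → Z → ℕ → Set} {F : ℕ → Series} →
    (∀ {i x m} → i < n → V' i x m → V x m) →
    (∀ {i j x y m} → i < n → j < n → V' i x m → V' j y m → x ≈ y → i ≡ j) →
    (∀ {x m} → V x m → ∃ λ i → i < n × V' i x m) →
    (∀ i → i < n → GF _≈_ (V' i) (F i)) → GF _≈_ V (ΣS n F)
  GF-union n {V} {V'} {F} sd sep cpl gfs m = subst (Counted _≈_ (λ x → V x m)) (sym (ΣS-at n F m))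
    (union-counted n sd sep cpl (λ i i<n → gfs i i<n m))
    where
    ΣS-at : ∀ n F m → ΣS n F m ≡ sumℤ (applyUpTo (λ i → F i m) n)
    ΣS-at zero F m = 𝟘-at m
    ΣS-at (suc n) F m = cong (ℤ._+_ (F 0 m)) (ΣS-at n (F ∘ suc) m)

length-cartesianProductWith : ∀ {X Y Z : Set} (f : X → Y → Z) xs ys →
  length (cartesianProductWith f xs ys) ≡ length xs ℕ.* length ys
length-cartesianProductWith f [] ys = refl
length-cartesianProductWith f (x ∷ xs) ys =
  trans (List.length-++ (map (f x) ys))
        (cong₂ ℕ._+_ (List.length-map (f x) ys) (length-cartesianProductWith f xs ys))

module _ {X Y Z : Set} {_≈X_ : X → X → Set} {_≈Y_ : Y → Y → Set} {_≈_ : Z → Z → Set}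
         (isEquivalence : IsEquivalence _≈_) (f : X → Y → Z)
         (f-cong : ∀ {x x' y y'} → x ≈X x' → y ≈Y y' → f x y ≈ f x' y') where
  private module ≈ = IsEquivalence isEquivalence

  product-counted : ∀ {P Q R a b} →
    (∀ {x y} → P x → Q y → R (f x y)) →
    (∀ {x x' y y'} → P x → P x' → Q y → Q y' → f x y ≈ f x' y' → x ≈X x' × y ≈Y y') →
    (∀ {z} → R z → ∃ λ x → ∃ λ y → P x × Q y × z ≈ f x y) →
    Counted _≈X_ P a → Counted _≈Y_ Q b → Counted _≈_ R (a ℤ.* b)
  product-counted {P} {Q} {R} sd sep cpl (counted xs s p d c) (counted ys s' p' d' c') =
    counted (cartesianProductWith f xs ys)
      (trans (cong₂ ℤ._*_ s s')
        (trans (sym (ℤ.pos-* (length xs) (length ys)))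
               (cong +_ (sym (length-cartesianProductWith f xs ys)))))
      (sound× p)
      (distinct× p d)
      (λ z rz → let (x , y , px , qy , eq) = cpl rz in
        Any.map (≈.trans eq) (complete× (c x px) (c' y qy)))
    where
    sound× : ∀ {xs} → All P xs → All R (cartesianProductWith f xs ys)
    sound× [] = []
    sound× (px ∷ ps) = All.++⁺ (All.map⁺ (All.map (sd px) p')) (sound× ps)

    row : ∀ {x} {zs} → P x → All Q zs → AllPairs (λ y y' → ¬ y ≈Y y') zs → AllPairs (λ u v → ¬ u ≈ v) (map (f x) zs)
    row px [] [] = []
    row px (qy ∷ qs) (y≉ ∷ ds) =
      All.map⁺ (All.zipWith (λ { (qy' , ne) e → ne (proj₂ (sep px px qy qy' e)) }) (qs , y≉)) ∷ row px qs ds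

    apart : ∀ {x y xs} → P x → Q y → All P xs → All (λ x' → ¬ x ≈X x') xs →
            All (λ v → ¬ f x y ≈ v) (cartesianProductWith f xs ys)
    apart px qy [] [] = []
    apart px qy (px' ∷ ps) (ne ∷ nes) =
      All.++⁺ (All.map⁺ (All.map (λ qy' e → ne (proj₁ (sep px px' qy qy' e))) p')) (apart px qy ps nes)

    distinct× : ∀ {xs} → All P xs → AllPairs (λ x x' → ¬ x ≈X x') xs →
                AllPairs (λ u v → ¬ u ≈ v) (cartesianProductWith f xs ys)
    distinct× [] [] = []
    distinct× (px ∷ ps) (x≉ ∷ ds) =
      AllPairs.++⁺ (row px p' d') (distinct× ps ds) (All.map⁺ (All.map (λ qy → apart px qy ps x≉) p'))

    complete× : ∀ {x y xs} → Any (x ≈X_) xs → Any (y ≈Y_) ys → Any (f x y ≈_) (cartesianProductWith f xs ys)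
    complete× (here e) ay = Any.++⁺ˡ (Any.map⁺ (Any.map (f-cong e) ay))
    complete× {xs = x₀ ∷ xs} (there a) ay = Any.++⁺ʳ (map (f x₀) ys) (complete× a ay)

  -- The weight of the first component cuts the product into one piece for each summand of the
  -- convolution. The pieces are disjoint because that weight is well defined up to equivalence.
  GF-product : ∀ {V : X → ℕ → Set} {V' : Y → ℕ → Set} {V″ : Z → ℕ → Set} {F G} →
    (∀ {x y a b} → V x a → V' y b → V″ (f x y) (a ℕ.+ b)) →
    (∀ {x x' y y' a a' b b'} → V x a → V x' a' → V' y b → V' y' b' → f x y ≈ f x' y' → x ≈X x' × y ≈Y y') →
    (∀ {x x' a a'} → V x a → V x' a' → x ≈X x' → a ≡ a') →
    (∀ {z m} → V″ z m → ∃ λ x → ∃ λ y → ∃ λ a → ∃ λ b → V x a × V' y b × a ℕ.+ b ≡ m × z ≈ f x y) →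
    GF _≈X_ V F → GF _≈Y_ V' G → GF _≈_ V″ (F ⊗ G)
  GF-product {V} {V'} {V″} {F} {G} sd sep uniq cpl gf gf' m =
    subst (Counted _≈_ (λ z → V″ z m)) (sym (⊗-unfold F G m))
      (union-counted (suc m) {P' = Piece}
        (λ _ → proj₁)
        (λ { _ _ (_ , x , y , vx , vy , e) (_ , x' , y' , vx' , vy' , e') z≈z' →
             uniq vx vx' (proj₁ (sep vx vx' vy vy' (≈.trans (≈.sym e) (≈.trans z≈z' e')))) })
        (λ { {z} v → let (x , y , a , b , vx , vy , a+b≡m , e) = cpl v in
             a , s≤s (ℕ.≤-trans (ℕ.m≤m+n a b) (ℕ.≤-reflexive a+b≡m)) ,
             v , x , y , vx , subst (V' y) (trans (sym (ℕ.m+n∸m≡n a b)) (cong (_∸ a) a+b≡m)) vy , e })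
        λ i i≤m → product-counted {R = Piece i}
          (λ { {x} {y} vx vy → subst (V″ _) (ℕ.m+[n∸m]≡n (ℕ.≤-pred i≤m)) (sd vx vy) , x , y , vx , vy , ≈.refl })
          (λ vx vx' vy vy' → sep vx vx' vy vy')
          (λ { (_ , x , y , vx , vy , e) → x , y , vx , vy , e })
          (gf i) (gf' (m ∸ i)))
    where
    Piece : ℕ → Z → Set
    Piece i z = V″ z m × ∃ λ x → ∃ λ y → V x i × V' y (m ∸ i) × z ≈ f x y

-- boolean tests

≡ᵇ-yes : ∀ {a b} → a ≡ b → (a ≡ᵇ b) ≡ true
≡ᵇ-yes {a} {b} e = Equivalence.to Bool.T-≡ (ℕ.≡⇒≡ᵇ a b e)

≡ᵇ-no : ∀ {a b} → a ≢ b → (a ≡ᵇ b) ≡ false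
≡ᵇ-no {a} {b} ne with a ≡ᵇ b in eq
... | false = refl
... | true = ⊥-elim (ne (ℕ.≡ᵇ⇒≡ a b (subst T (sym eq) _)))

<ᵇ-yes : ∀ {a b} → a < b → (a <ᵇ b) ≡ true
<ᵇ-yes lt = Equivalence.to Bool.T-≡ (ℕ.<⇒<ᵇ lt)

<ᵇ-no : ∀ {a b} → b ≤ a → (a <ᵇ b) ≡ false
<ᵇ-no {a} {b} le with a <ᵇ b in eq
... | false = refl
... | true = ⊥-elim (ℕ.<⇒≱ (ℕ.<ᵇ⇒< a b (subst T (sym eq) _)) le)

-- Cartan coefficients

-- Bonds of order 4 are oriented by h: h i j says that firing i adds twice its value to j.
coefficient : ℕ → Bool → ℤ
coefficient 1 _ = -[1+ 1 ]
coefficient 2 _ = + 0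
coefficient 3 _ = + 1
coefficient _ b = if b then + 2 else + 1

mℕ : (ℕ → ℕ → ℕ) → ℕ → ℕ → ℕ
mℕ e i j = if i ≡ᵇ j then 1 else e (i ⊓ j) (i ⊔ j)

cartanℕ : (ℕ → ℕ → ℕ) → (ℕ → ℕ → Bool) → ℕ → ℕ → ℤ
cartanℕ e h i j = coefficient (mℕ e i j) (h i j)

cartan : ∀ {k} → (ℕ → ℕ → ℕ) → (ℕ → ℕ → Bool) → Fin k → Fin k → ℤ
cartan e h i j = cartanℕ e h (toℕ i) (toℕ j)

mℕ-< : ∀ e {i j} → i < j → mℕ e i j ≡ e i j
mℕ-< e {i} {j} lt rewrite ≡ᵇ-no (ℕ.<⇒≢ lt) | ℕ.m≤n⇒m⊓n≡m (ℕ.<⇒≤ lt) | ℕ.m≤n⇒m⊔n≡n (ℕ.<⇒≤ lt) = refl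

mℕ-> : ∀ e {i j} → j < i → mℕ e i j ≡ e j i
mℕ-> e {i} {j} lt rewrite ≡ᵇ-no (ℕ.>⇒≢ lt) | ℕ.m≥n⇒m⊓n≡n (ℕ.<⇒≤ lt) | ℕ.m≥n⇒m⊔n≡m (ℕ.<⇒≤ lt) = refl

cartan-diagonal : ∀ e h i → cartanℕ e h i i ≡ -[1+ 1 ]
cartan-diagonal e h i rewrite ≡ᵇ-yes {i} refl = refl

cartan-< : ∀ e h {i j} → i < j → cartanℕ e h i j ≡ coefficient (e i j) (h i j)
cartan-< e h {i} {j} lt = cong (λ m → coefficient m (h i j)) (mℕ-< e lt)

cartan-> : ∀ e h {i j} → j < i → cartanℕ e h i j ≡ coefficient (e j i) (h i j)
cartan-> e h {i} {j} lt = cong (λ m → coefficient m (h i j)) (mℕ-> e lt)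

-- On a bond of order 4 exactly one of the two directions carries the coefficient 2.
data BondOrder (b b' : Bool) : ℕ → Set where
  two   : BondOrder b b' 2
  three : BondOrder b b' 3
  four  : b ≡ not b' → BondOrder b b' 4

BondOrder-sym : ∀ {b b' m} → BondOrder b b' m → BondOrder b' b m
BondOrder-sym two = two
BondOrder-sym three = three
BondOrder-sym {b} {b'} (four e) = four (trans (sym (Bool.not-involutive b')) (cong not (sym e)))

bond : ∀ {b b' m} → BondOrder b b' m → Bond m (coefficient m b) (coefficient m b')
bond two = bond2 refl refl refl
bond three = bond3 refl refl refl
bond {true} {false} (four e) = bond4′ refl refl refl
bond {false} {true} (four e) = bond4 refl refl refl
bond {true} {true} (four ())
bond {false} {false} (four ())

cartan-compatible : ∀ {k} e h → (∀ {i j} → i < j → j < k → BondOrder (h i j) (h j i) (e i j)) →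
                    ∀ (i j : Fin k) → Compatible (mkM e) (cartan e h) i j
cartan-compatible e h bo i j with ℕ.<-cmp (toℕ i) (toℕ j)
... | tri≈ _ eq _ with Fin.toℕ-injective eq
...   | refl = same refl (cong (λ b → if b then 1 else e (toℕ i ⊓ toℕ i) (toℕ i ⊔ toℕ i)) (≡ᵇ-yes {toℕ i} refl))
                    (cartan-diagonal e h (toℕ i))
cartan-compatible e h bo i j | tri< lt ne _ = bonded (ne ∘ cong toℕ)
  (subst₂ (Bond (mkM e i j)) refl (sym (cartan-> e h lt))
    (subst₂ (λ m α → Bond m α (coefficient (e (toℕ i) (toℕ j)) (h (toℕ j) (toℕ i)))) (sym (mℕ-< e lt))
      (sym (cartan-< e h lt)) (bond (bo lt (Fin.toℕ<n j)))))
cartan-compatible e h bo i j | tri> _ ne lt = bonded (ne ∘ cong toℕ)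
  (subst₂ (Bond (mkM e i j)) refl (sym (cartan-< e h lt))
    (subst₂ (λ m α → Bond m α (coefficient (e (toℕ j) (toℕ i)) (h (toℕ j) (toℕ i)))) (sym (mℕ-> e lt))
      (sym (cartan-> e h lt)) (bond (BondOrder-sym (bo lt (Fin.toℕ<n i))))))

-- the group C̃_n

eC : ℕ → ℕ → ℕ → ℕ
eC N lo hi = if hi ≡ᵇ suc lo then (if (lo ≡ᵇ 0) ∨ (hi ≡ᵇ N) then 4 else 3) else 2

<ᵇ-antisym : ∀ {i j} → i < j → (i <ᵇ j) ≡ not (j <ᵇ i)
<ᵇ-antisym lt rewrite <ᵇ-yes lt | <ᵇ-no (ℕ.<⇒≤ lt) = refl

-- Both double bonds point towards the higher index. This is the orientation obeyed by the functions
-- x₁, x₂ - x₁, ..., 1 - 2xₙ, which become the states of the game.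
aC : ∀ n → Fin (suc n) → Fin (suc n) → ℤ
aC n = cartan (eC n) _<ᵇ_

aCℕ : ℕ → ℕ → ℕ → ℤ
aCℕ n = cartanℕ (eC n) _<ᵇ_

eC-order : ∀ N {b b'} i j → b ≡ not b' → BondOrder b b' (eC N i j)
eC-order N i j e with j ≡ᵇ suc i
... | false = two
... | true with (i ≡ᵇ 0) ∨ (j ≡ᵇ N)
...   | false = three
...   | true = four e

C-compatible : ∀ n (i j : Fin (suc n)) → Compatible (Ct n) (aC n) i j
C-compatible n = cartan-compatible (eC n) _<ᵇ_ λ {i} {j} lt _ → eC-order n i j (<ᵇ-antisym lt)

eC-far : ∀ n {i j} → suc i < j → eC n i j ≡ 2
eC-far n lt rewrite ≡ᵇ-no (ℕ.>⇒≢ lt) = refl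

aC-far< : ∀ n {i j} → suc i < j → aCℕ n i j ≡ + 0
aC-far< n {i} {j} lt = trans (cartan-< (eC n) _<ᵇ_ (ℕ.<-trans (ℕ.n<1+n i) lt))
  (cong (λ m → coefficient m (i <ᵇ j)) (eC-far n lt))

aC-far> : ∀ n {i j} → suc j < i → aCℕ n i j ≡ + 0
aC-far> n {i} {j} lt = trans (cartan-> (eC n) _<ᵇ_ (ℕ.<-trans (ℕ.n<1+n j) lt))
  (cong (λ m → coefficient m (i <ᵇ j)) (eC-far n lt))

aC-down : ∀ n j → aCℕ n (suc j) j ≡ + 1
aC-down n j = trans (cartan-> (eC n) _<ᵇ_ (ℕ.n<1+n j)) lemma
  where
  lemma : coefficient (eC n j (suc j)) (suc j <ᵇ j) ≡ + 1
  lemma rewrite ≡ᵇ-yes {j} refl | <ᵇ-no (ℕ.n≤1+n j) with (j ≡ᵇ 0) ∨ (suc j ≡ᵇ n)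
  ... | true = refl
  ... | false = refl

aC-up : ∀ n j → aCℕ n j (suc j) ≡ (if (j ≡ᵇ 0) ∨ (suc j ≡ᵇ n) then + 2 else + 1)
aC-up n j = trans (cartan-< (eC n) _<ᵇ_ (ℕ.n<1+n j)) lemma
  where
  lemma : coefficient (eC n j (suc j)) (j <ᵇ suc j) ≡ (if (j ≡ᵇ 0) ∨ (suc j ≡ᵇ n) then + 2 else + 1)
  lemma rewrite ≡ᵇ-yes {j} refl | <ᵇ-yes (ℕ.n<1+n j) with (j ≡ᵇ 0) ∨ (suc j ≡ᵇ n)
  ... | true = refl
  ... | false = refl

aC-up-middle : ∀ n j → suc (suc j) < n → aCℕ n (suc j) (suc (suc j)) ≡ + 1
aC-up-middle n j lt = trans (aC-up n (suc j)) (cong (if_then + 2 else + 1) (≡ᵇ-no (ℕ.<⇒≢ lt)))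

aC-up-last : ∀ j → aCℕ (suc j) j (suc j) ≡ + 2
aC-up-last j = trans (aC-up (suc j) j)
  (cong (if_then + 2 else + 1) (trans (cong ((j ≡ᵇ 0) ∨_) (≡ᵇ-yes {j} refl)) (Bool.∨-zeroʳ (j ≡ᵇ 0))))

toℕ-mod : ∀ {p n} → p ≤ n → toℕ (p mod suc n) ≡ p
toℕ-mod {p} {n} le = trans (Fin.toℕ-fromℕ< _) (ℕ.m<n⇒m%n≡m (s≤s le))

-- weight enumeration along a parabolic subgroup

X : ℕ → Series
X = q ^s_

X-diagonal : ∀ c → X c c ≡ + 1
X-diagonal zero = refl
X-diagonal (suc c) = trans (q-⊗-suc (X c) c) (X-diagonal c)

X-off : ∀ {c m} → c ≢ m → X c m ≡ + 0
X-off {zero} {zero} ne = ⊥-elim (ne refl)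
X-off {zero} {suc m} ne = refl
X-off {suc c} {zero} ne = q-⊗-zero (X c)
X-off {suc c} {suc m} ne = trans (q-⊗-suc (X c) m) (X-off (ne ∘ cong suc))

GF-singleton : ∀ {Z : Set} {_≈_ : Z → Z → Set} → (∀ {x} → x ≈ x) → ∀ w c → GF _≈_ (λ x m → x ≡ w × c ≡ m) (X c)
GF-singleton {_≈_ = _≈_} ≈-refl w c m with c ℕ.≟ m
... | yes refl = counted (w ∷ []) (X-diagonal c) ((refl , refl) ∷ []) ([] ∷ [])
                   (λ { x (refl , _) → here ≈-refl })
... | no ne = counted [] (X-off ne) [] [] (λ { x (_ , e) → ⊥-elim (ne e) })

module Enumeration {k : ℕ} (M : CoxMatrix k) (A : Fin k → Fin k → ℤ)
  (compatible : ∀ i j → Compatible M A i j) (L : Fin k → ℕ) (HL : Word k → ℕ → Set)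
  (HL-resp : ∀ {u v m} → CoxEq M u v → HL u m → HL v m)
  (HL-unique : ∀ {u m m'} → HL u m → HL u m' → m ≡ m')
  (HL-exists : ∀ u → ∃ (HL u))
  (HL-[] : HL [] 0)
  (HL-step : ∀ {w m} r ω → (∀ t → ¬ Neg (ω t)) → HL w m → Pos (Game.play M A compatible w ω r) →
             HL (r ∷ w) (L r ℕ.+ m))
  where
  open Game M A compatible
  open Parabolic M A compatible

  ≈-isEquivalence : IsEquivalence _≈_
  ≈-isEquivalence = record { refl = ≈refl ; sym = ≈sym ; trans = ≈trans }

  weight : Word k → ℕ
  weight w = sum (map L w)

  Within : (Fin k → Set) → Word k → ℕ → Set
  Within I w m = All I w × HL w m

  module Stage (I : Fin k → Set) (ω : State) (ω≥0 : ∀ t → ¬ Neg (ω t)) where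
    open Plays I ω (λ s _ → ω≥0 s) public
    open Coset I ω (λ s _ → ω≥0 s) public

    -- u fixes ω, so the letters of g fire the same positive values with u behind them as without
    -- it. Each adds its weight to the length of u.
    up-Within : ∀ {g u b} → Up g → Within Stabiliser u b → Within I (g ++ u) (weight g ℕ.+ b)
    up-Within [] (u-in , hl) = All.map proj₁ u-in , hl
    up-Within {s ∷ g} {u} {b} ((is , pos) ∷ up-g) (u-in , hl) with up-Within up-g (u-in , hl)
    ... | gu-in , hl' = is ∷ gu-in , subst (HL (s ∷ g ++ u)) (sym (ℕ.+-assoc (L s) (weight g) b))
          (HL-step s ω ω≥0 hl' (subst Pos (sym (trans (cong (λ e → e s) (play-++ g u ω))
             (play-cong g (stabiliser-fixes u-in) s))) pos))

    up-HL : ∀ {g} → Up g → HL g (weight g)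
    up-HL {g} up-g = subst₂ HL (List.++-identityʳ g) (ℕ.+-identityʳ (weight g))
      (proj₂ (up-Within up-g ([] , HL-[])))

    UpWeight : Word k → ℕ → Set
    UpWeight g m = Up g × weight g ≡ m

    -- The factorisation of a parabolic subgroup into minimal coset representatives and stabiliser,
    -- with additive lengths.
    parabolic-step : ∀ {Z F} → GF _≈_ UpWeight Z → GF _≈_ (Within Stabiliser) F → GF _≈_ (Within I) (Z ⊗ F)
    parabolic-step = GF-product ≈-isEquivalence _++_
      (λ {g} {g'} {u} {u'} e e' → ≈trans (++-congʳ u e) (++-congˡ g' e'))
      (λ { (up-g , refl) v → up-Within up-g v })
      separate
      (λ { (up-g , refl) (up-g' , refl) e → HL-unique (HL-resp e (up-HL up-g)) (up-HL up-g') })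
      split
      where
      separate : ∀ {g g' u u' a a' b b'} → UpWeight g a → UpWeight g' a' → Within Stabiliser u b →
                 Within Stabiliser u' b' → g ++ u ≈ g' ++ u' → g ≈ g' × u ≈ u'
      separate {g} {g'} {u} {u'} (up-g , _) (up-g' , _) (u-in , _) (u'-in , _) e =
        g≈g' , ++-cancel g (≈trans e (++-congʳ u' (≈sym g≈g')))
        where
        state-++ : ∀ g {u} → All Stabiliser u → play (g ++ u) ω ≗ play g ω
        state-++ g {u} u-in t = trans (cong (λ e → e t) (play-++ g u ω)) (play-cong g (stabiliser-fixes u-in) t)
        g≈g' = proj₁ (up-unique up-g up-g' λ t →
          trans (sym (state-++ g u-in t)) (trans (play-≈ e ω t) (state-++ g' u'-in t)))
      split : ∀ {w m} → Within I w m → ∃ λ g → ∃ λ u → ∃ λ a → ∃ λ b →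
              UpWeight g a × Within Stabiliser u b × a ℕ.+ b ≡ m × w ≈ g ++ u
      split {w} (w-in , hl) with factorise w w-in
      ... | factorisation g u up-g u-in e _ with HL-exists u
      ...   | b , hl-u = g , u , weight g , b , (up-g , refl) , (u-in , hl-u) ,
              HL-unique (HL-resp e (proj₂ (up-Within up-g (u-in , hl-u)))) hl , ≈sym e

  Within-⇔ : ∀ {I J F} → (∀ {s} → I s → J s) → (∀ {s} → J s → I s) →
             GF _≈_ (Within I) F → GF _≈_ (Within J) F
  Within-⇔ to from gf m = map-counted ≈-isEquivalence id id
    (λ (w-in , hl) → All.map to w-in , hl) (λ _ _ e → e)
    (λ (w-in , hl) → _ , (All.map from w-in , hl) , ≈refl) (gf m)

  Within-none : ∀ {I} → (∀ s → ¬ I s) → GF _≈_ (Within I) 𝟙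
  Within-none none zero = counted ([] ∷ []) refl (([] , HL-[]) ∷ []) ([] ∷ [])
    (λ { [] _ → here ≈refl ; (s ∷ w) (is ∷ _ , _) → ⊥-elim (none s is) })
  Within-none none (suc m) = counted [] refl [] []
    (λ { [] (_ , hl) → ⊥-elim (ℕ.0≢1+n (HL-unique HL-[] hl)) ; (s ∷ w) (is ∷ _ , _) → ⊥-elim (none s is) })

Lℕ : (n A T B : ℕ) → ℕ → ℕ
Lℕ n A T B j = if j ≡ᵇ 0 then A else if j ≡ᵇ n then B else T

Lℕ-middle : ∀ n A T B {j} → suc j < n → Lℕ n A T B (suc j) ≡ T
Lℕ-middle n A T B lt rewrite ≡ᵇ-no (ℕ.<⇒≢ lt) = refl

open QBinomial seriesRing cst-morphism X public using (tint; gauss; outer; peeled; plus; minus; binom; inner)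

-- The weighted Poincaré polynomial of the finite group of type B, built by adding one middle
-- generator at a time.
seriesB : (A T : ℕ) → ℕ → Series
seriesB A T zero    = 𝟙
seriesB A T (suc k) = (𝟙 ⊕ X (A ℕ.+ k ℕ.* T)) ⊗ tint T (suc k) ⊗ seriesB A T k

-- All that is remembered of the big group. Beyond this interface the seven foldings differ only in
-- the three weights.
record GroupLength (n : ℕ) (A T B : ℕ) (HL : Word (suc n) → ℕ → Set) : Set where
  field
    HL-resp   : ∀ {u v m} → CoxEq (Ct n) u v → HL u m → HL v m
    HL-unique : ∀ {u m m'} → HL u m → HL u m' → m ≡ m'
    HL-exists : ∀ u → ∃ (HL u)
    HL-[]     : HL [] 0
    HL-step   : ∀ {w m} r ω → (∀ t → ¬ Neg (ω t)) → HL w m →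
                Pos (Game.play (Ct n) (aC n) (C-compatible n) w ω r) →
                HL (r ∷ w) (Lℕ n A T B (toℕ r) ℕ.+ m)

module FiniteParabolic {n : ℕ} {A T B : ℕ} {HL : Word (suc n) → ℕ → Set}
                       (groupLength : GroupLength n A T B HL) where
  open GroupLength groupLength
  open Game (Ct n) (aC n) (C-compatible n)
  open Enumeration (Ct n) (aC n) (C-compatible n) (Lℕ n A T B ∘ toℕ) HL
                   HL-resp HL-unique HL-exists HL-[] HL-step public

  module Orbit (k : ℕ) (k<n : k < n) where

    -- The fundamental weight at k: among the generators 0, ..., k it is fixed by all but the last,
    -- so its orbit carries the step from k to k + 1 generators.
    ω : State
    ω t = if toℕ t ≡ᵇ k then + 1 else + 0

    ω≥0 : ∀ t → ¬ Neg (ω t)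
    ω≥0 t with toℕ t ≡ᵇ k
    ... | true = λ { (ℤ.+<+ ()) }
    ... | false = λ { (ℤ.+<+ ()) }

    I : Fin (suc n) → Set
    I s = toℕ s < suc k

    open Stage I ω ω≥0

    -- Values outside `I` are left free. For p = k this includes the value at p + 1, so `second`
    -- asks for membership.
    record Shape (p : ℕ) (a b : ℤ) (d : State) : Set where
      constructor shape
      field
        first  : ∀ t → toℕ t ≡ p → d t ≡ a
        second : ∀ t → toℕ t ≡ suc p → I t → d t ≡ b
        others : ∀ t → I t → toℕ t ≢ p → toℕ t ≢ suc p → d t ≡ + 0
    open Shape

    fired : ∀ {d a b c} s t → aC n s t ≡ a → d t ≡ b → d s ≡ c → fire s d t ≡ b ℤ.+ a ℤ.* c
    fired s t refl refl refl = refl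

    aC-at : ∀ {i j c} (s t : Fin (suc n)) → toℕ s ≡ i → toℕ t ≡ j → aCℕ n i j ≡ c → aC n s t ≡ c
    aC-at s t refl refl e = e

    unaffected : ∀ {d p a b} s t → toℕ s ≡ p → toℕ t ≢ p → suc (toℕ t) ≢ p → toℕ t ≢ suc p →
                 d t ≡ a → d s ≡ b → fire s d t ≡ a
    unaffected {d} {p} {a} {b} s t es ne₁ ne₂ ne₃ dt ds =
      trans (fired {d} s t (aC-at s t es refl far) dt ds) (trans (cong (ℤ._+_ a) (ℤ.*-zeroˡ b)) (ℤ.+-identityʳ a))
      where
      far : aCℕ n p (toℕ t) ≡ + 0
      far with ℕ.<-cmp (toℕ t) p
      ... | tri< lt _ _ = aC-far> n (ℕ.≤∧≢⇒< lt ne₂)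
      ... | tri≈ _ e _ = ⊥-elim (ne₁ e)
      ... | tri> _ _ gt = aC-far< n (ℕ.≤∧≢⇒< gt (ne₃ ∘ sym))

    p≢p+1 : ∀ {p} → p ≢ suc p
    p≢p+1 = ℕ.<⇒≢ (ℕ.n<1+n _)

    p≢p+2 : ∀ {p} → p ≢ suc (suc p)
    p≢p+2 = ℕ.<⇒≢ (ℕ.m≤n⇒m≤1+n (ℕ.n<1+n _))

    -- On the first k + 1 generators the orbit of ω is that of a coordinate vector under
    -- signed permutations: fire k, …, 1, then 0, then 1, …, k.
    falling : ∀ {p d} s → toℕ s ≡ suc p → suc p ≤ k → Shape (suc p) (+ 1) (-[1+ 0 ]) d →
              Shape p (+ 1) (-[1+ 0 ]) (fire s d)
    falling {p} {d} s es le sh = shape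
      (λ t et → fired {d} s t (aC-at s t es et (aC-down n p))
        (others sh t (subst (_< suc k) (sym et) (ℕ.m≤n⇒m≤1+n le)) (λ e → p≢p+1 (trans (sym et) e))
          (λ e → p≢p+2 (trans (sym et) e))) (first sh s es))
      (λ t et _ → fired {d} s t (aC-at s t es et (cartan-diagonal (eC n) ℕ._<ᵇ_ (suc p))) (first sh t et) (first sh s es))
      (λ t it ne₁ ne₂ → other t it ne₁ ne₂)
      where
      other : ∀ t → I t → toℕ t ≢ p → toℕ t ≢ suc p → fire s d t ≡ + 0
      other t it ne₁ ne₂ with toℕ t ℕ.≟ suc (suc p)
      ... | yes et = fired {d} s t (aC-at s t es et (aC-up-middle n p (ℕ.≤-<-trans (ℕ.≤-pred (subst (_< suc k) et it)) k<n)))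
                       (second sh t et it) (first sh s es)
      ... | no ne₃ = unaffected {d} s t es ne₂ (ne₁ ∘ ℕ.suc-injective) ne₃ (others sh t it ne₂ ne₃) (first sh s es)

    turning : ∀ {d} s → toℕ s ≡ 0 → Shape 0 (+ 1) (-[1+ 0 ]) d → Shape 0 (-[1+ 0 ]) (+ 1) (fire s d)
    turning {d} s es sh = shape
      (λ t et → fired {d} s t (aC-at s t es et (cartan-diagonal (eC n) ℕ._<ᵇ_ 0)) (first sh t et) (first sh s es))
      -- The double bond from 0 to 1 turns -1 into -1 + 2 = 1.
      (λ t et it → fired {d} s t (aC-at s t es et (aC-up n 0)) (second sh t et it) (first sh s es))
      (λ t it ne₁ ne₂ → unaffected {d} s t es ne₁ (λ ()) ne₂ (others sh t it ne₁ ne₂) (first sh s es))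

    rising : ∀ {p d} s → toℕ s ≡ suc p → suc p ≤ k → Shape p (-[1+ 0 ]) (+ 1) d →
             Shape (suc p) (-[1+ 0 ]) (+ 1) (fire s d)
    rising {p} {d} s es le sh = shape
      (λ t et → fired {d} s t (aC-at s t es et (cartan-diagonal (eC n) ℕ._<ᵇ_ (suc p))) (second sh t et (subst (_< suc k) (sym et) (s≤s le))) ds)
      (λ t et it → fired {d} s t (aC-at s t es et (aC-up-middle n p (ℕ.≤-<-trans (ℕ.≤-pred (subst (_< suc k) et it)) k<n)))
        (others sh t it (λ e → p≢p+2 (trans (sym e) et)) (λ e → p≢p+1 (trans (sym e) et))) ds)
      (λ t it ne₁ ne₂ → other t it ne₁ ne₂)
      where
      ds : d s ≡ + 1
      ds = second sh s es (subst (_< suc k) (sym es) (s≤s le))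
      other : ∀ t → I t → toℕ t ≢ suc p → toℕ t ≢ suc (suc p) → fire s d t ≡ + 0
      other t it ne₁ ne₂ with toℕ t ℕ.≟ p
      ... | yes et = fired {d} s t (aC-at s t es et (aC-down n p)) (first sh t et) ds
      ... | no ne₃ = unaffected {d} s t es ne₁ (ne₃ ∘ ℕ.suc-injective) ne₂ (others sh t it ne₃ ne₁) ds

    Falling Rising : ℕ → State → Set
    Falling p = Shape p (+ 1) (-[1+ 0 ])
    Rising p = Shape p (-[1+ 0 ]) (+ 1)

    falling-pos : ∀ {p d} t → I t → Falling p d → Pos (d t) → toℕ t ≡ p
    falling-pos {p} t it sh pos with toℕ t ℕ.≟ p | toℕ t ℕ.≟ suc p
    ... | yes e | _ = e
    ... | no _ | yes e = ⊥-elim (pos⇒¬neg pos (subst Neg (sym (second sh t e it)) ℤ.-<+))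
    ... | no ne | no ne' = ⊥-elim (ℤ.<⇒≢ pos (sym (others sh t it ne ne')))

    rising-pos : ∀ {p d} t → I t → Rising p d → Pos (d t) → toℕ t ≡ suc p
    rising-pos {p} t it sh pos with toℕ t ℕ.≟ p | toℕ t ℕ.≟ suc p
    ... | yes e | _ = ⊥-elim (pos⇒¬neg pos (subst Neg (sym (first sh t e)) ℤ.-<+))
    ... | no _ | yes e = e
    ... | no ne | no ne' = ⊥-elim (ℤ.<⇒≢ pos (sym (others sh t it ne ne')))

    -- This is |k - i|, the sequence k, ..., 1, 0, 1, ..., k.
    letter : ℕ → ℕ
    letter i = (k ∸ i) ℕ.+ (i ∸ k)

    word : ℕ → Word (suc n)
    word zero    = []
    word (suc i) = (letter i mod suc n) ∷ word i

    letter-falling : ∀ {p j} → p ℕ.+ j ≡ k → letter j ≡ p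
    letter-falling {p} {j} refl = trans (cong₂ ℕ._+_ (ℕ.m+n∸n≡m p j) (ℕ.m≤n⇒m∸n≡0 (ℕ.m≤n+m j p))) (ℕ.+-identityʳ p)

    letter-rising : ∀ p → letter (k ℕ.+ p) ≡ p
    letter-rising p = cong₂ ℕ._+_ (ℕ.m≤n⇒m∸n≡0 (ℕ.m≤m+n k p)) (ℕ.m+n∸m≡n k p)

    toℕ-letter : ∀ {i p} → letter i ≡ p → p ≤ k → toℕ (letter i mod suc n) ≡ p
    toℕ-letter refl le = toℕ-mod (ℕ.≤-trans le (ℕ.<⇒≤ k<n))

    word-falling : ∀ j p → p ℕ.+ j ≡ k → Falling p (play (word j) ω)
    word-falling zero p e with trans (sym (ℕ.+-identityʳ p)) e
    ... | refl = shape (λ t et → cong (if_then + 1 else + 0) (≡ᵇ-yes et))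
                       (λ t et it → ⊥-elim (ℕ.<-irrefl et it))
                       (λ t it ne _ → cong (if_then + 1 else + 0) (≡ᵇ-no ne))
    word-falling (suc j) p e = falling (letter j mod suc n) (toℕ-letter {j} (letter-falling e') le) le (word-falling j (suc p) e')
      where
      e' : suc p ℕ.+ j ≡ k
      e' = trans (sym (ℕ.+-suc p j)) e
      le : suc p ≤ k
      le = ℕ.≤-trans (ℕ.m≤m+n (suc p) j) (ℕ.≤-reflexive e')

    word-rising : ∀ p → p ≤ k → Rising p (play (word (suc k ℕ.+ p)) ω)
    word-rising zero _ = subst (λ i → Rising 0 (play (word (suc i)) ω)) (sym (ℕ.+-identityʳ k))
      (turning (letter k mod suc n) (toℕ-letter {k} (letter-falling {0} {k} refl) z≤n) (word-falling k 0 refl))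
    word-rising (suc p) le = subst (λ i → Rising (suc p) (play (word (suc i)) ω)) (sym (ℕ.+-suc k p))
      (rising (letter (suc k ℕ.+ p) mod suc n)
        (toℕ-letter {suc k ℕ.+ p} (trans (cong letter (sym (ℕ.+-suc k p))) (letter-rising (suc p))) le) le
        (word-rising p (ℕ.<⇒≤ le)))

    data Index : ℕ → Set where
      fall : ∀ {j} p → p ℕ.+ j ≡ k → Index j
      rise : ∀ p → p ≤ k → Index (suc k ℕ.+ p)

    index : ∀ i → i < suc k ℕ.+ suc k → Index i
    index i lt with i ℕ.≤? k
    ... | yes le = fall (k ∸ i) (ℕ.m∸n+n≡m le)
    ... | no nle = subst Index (ℕ.m+[n∸m]≡n (ℕ.≰⇒> nle)) (rise (i ∸ suc k)
            (ℕ.≤-pred (subst (suc (i ∸ suc k) ≤_) (ℕ.m+n∸m≡n (suc k) (suc k))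
              (ℕ.∸-monoˡ-< lt (ℕ.≰⇒> nle)))))

    N : ℕ
    N = suc k ℕ.+ suc k

    word-up-head : ∀ i → suc i < N → Index i →
                   I (letter i mod suc n) × Pos (play (word i) ω (letter i mod suc n))
    word-up-head i lt (fall p e) = subst (_< suc k) (sym eq) (s≤s le) ,
        subst Pos (sym (first (word-falling i p e) _ eq)) (ℤ.+<+ (s≤s z≤n))
      where
      le : p ≤ k
      le = ℕ.≤-trans (ℕ.m≤m+n p i) (ℕ.≤-reflexive e)
      eq = toℕ-letter {i} (letter-falling e) le
    word-up-head i lt (rise p le) = it ,
        subst Pos (sym (second (word-rising p le) _ eq it)) (ℤ.+<+ (s≤s z≤n))
      where
      sp≤k : suc p ≤ k
      sp≤k = ℕ.≤-pred (ℕ.+-cancelˡ-< (suc k) (suc p) (suc k) (subst (_< N) (sym (ℕ.+-suc (suc k) p)) lt))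
      eq : toℕ (letter (suc k ℕ.+ p) mod suc n) ≡ suc p
      eq = toℕ-letter {suc k ℕ.+ p} (trans (cong letter (sym (ℕ.+-suc k p))) (letter-rising (suc p))) sp≤k
      it = subst (_< suc k) (sym eq) (s≤s sp≤k)

    word-up : ∀ i → i < N → Up (word i)
    word-up zero    _  = []
    word-up (suc i) lt = word-up-head i lt (index i (ℕ.<⇒≤ lt)) ∷ word-up i (ℕ.<⇒≤ lt)

    -- In each state of the orbit at most one generator of `I` has a positive value, so there is
    -- never a choice of how to go on.
    up-word : ∀ {g} → Up g → ∃ λ i → i < N × g ≡ word i
    up-word [] = 0 , s≤s z≤n , refl
    up-word {s ∷ g} ((is , pos) ∷ up-g) with up-word up-g
    ... | i , lt , refl with index i lt
    ...   | fall p e = suc i , s≤s i≤ , cong (_∷ word i) (Fin.toℕ-injective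
              (trans (falling-pos s is (word-falling i p e) pos) (sym (toℕ-letter {i} (letter-falling e)
                (ℕ.≤-trans (ℕ.m≤m+n p i) (ℕ.≤-reflexive e))))))
      where
      i≤ : i < k ℕ.+ suc k
      i≤ = ℕ.≤-<-trans (subst (i ≤_) e (ℕ.m≤n+m i p)) (subst (k <_) (sym (ℕ.+-suc k k)) (s≤s (ℕ.m≤m+n k k)))
    ...   | rise p le = suc i , subst (_< N) (ℕ.+-suc (suc k) p) (ℕ.+-monoʳ-< (suc k) (s≤s sp≤k)) ,
              cong (_∷ word i) (Fin.toℕ-injective (trans es (sym (toℕ-letter {i}
                (trans (cong letter (sym (ℕ.+-suc k p))) (letter-rising (suc p))) sp≤k))))
      where
      es : toℕ s ≡ suc p
      es = rising-pos s is (word-rising p le) pos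
      sp≤k : suc p ≤ k
      sp≤k = ℕ.≤-pred (subst (_< suc k) es is)

    length-word : ∀ i → length (word i) ≡ i
    length-word zero = refl
    length-word (suc i) = cong suc (length-word i)

    Lₖ : ∀ {i p} → letter i ≡ suc p → suc p ≤ k → Lℕ n A T B (toℕ (letter i mod suc n)) ≡ T
    Lₖ {i} e le = trans (cong (Lℕ n A T B) (toℕ-letter {i} e le)) (Lℕ-middle n A T B (ℕ.≤-<-trans le k<n))

    weight-falling : ∀ j p → p ℕ.+ j ≡ k → weight (word j) ≡ j ℕ.* T
    weight-falling zero p e = refl
    weight-falling (suc j) p e = cong₂ ℕ._+_
      (Lₖ {j} {p} (letter-falling e') (ℕ.≤-trans (ℕ.m≤m+n (suc p) j) (ℕ.≤-reflexive e')))
      (weight-falling j (suc p) e')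
      where
      e' : suc p ℕ.+ j ≡ k
      e' = trans (sym (ℕ.+-suc p j)) e

    weight-rising : ∀ p → p ≤ k → weight (word (suc k ℕ.+ p)) ≡ (A ℕ.+ k ℕ.* T) ℕ.+ p ℕ.* T
    weight-rising zero _ = trans (cong (λ i → weight (word (suc i))) (ℕ.+-identityʳ k))
      (trans (cong₂ ℕ._+_ (cong (Lℕ n A T B) (toℕ-letter {k} (letter-falling {0} {k} refl) z≤n)) (weight-falling k 0 refl))
             (sym (ℕ.+-identityʳ _)))
    weight-rising (suc p) le = trans (cong (λ i → weight (word (suc i))) (ℕ.+-suc k p))
      (trans (cong₂ ℕ._+_ (Lₖ {suc k ℕ.+ p} {p} (trans (cong letter (sym (ℕ.+-suc k p))) (letter-rising (suc p))) le)
                          (weight-rising p (ℕ.<⇒≤ le)))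
             (trans (sym (ℕ.+-assoc T (A ℕ.+ k ℕ.* T) (p ℕ.* T)))
               (trans (cong (ℕ._+ p ℕ.* T) (ℕ.+-comm T (A ℕ.+ k ℕ.* T))) (ℕ.+-assoc (A ℕ.+ k ℕ.* T) T (p ℕ.* T)))))

    orbit-GF : GF _≈_ UpWeight (ΣS N (X ∘ weight ∘ word))
    orbit-GF = GF-union N {V' = λ i g m → g ≡ word i × weight (word i) ≡ m}
      (λ { {i} lt (refl , e) → word-up i lt , e })
      -- Words of the orbit are told apart by their lengths, which `up-unique` makes invariants of
      -- the coset.
      (λ { {i} {j} lt lt' (refl , _) (refl , _) e →
           trans (sym (length-word i)) (trans (proj₂ (up-unique (word-up i lt) (word-up j lt') (play-≈ e ω))) (length-word j)) })
      (λ { (up-g , refl) → let (i , lt , eq) = up-word up-g in i , lt , eq , cong weight (sym eq) })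
      (λ i lt → GF-singleton ≈refl (word i) (weight (word i)))

    orbit-series : ΣS N (X ∘ weight ∘ word) ≋ (𝟙 ⊕ X (A ℕ.+ k ℕ.* T)) ⊗ tint T (suc k)
    orbit-series = begin
      ΣS N (X ∘ weight ∘ word) ≈⟨ ΣS-+ (suc k) (suc k) (X ∘ weight ∘ word) ⟩
      ΣS (suc k) (X ∘ weight ∘ word) ⊕ ΣS (suc k) (λ p → X (weight (word (suc k ℕ.+ p))))
        ≈⟨ ⊕-cong (ΣS-cong (suc k) λ j lt → ≡⇒≋ (cong X (weight-falling j (k ∸ j) (ℕ.m∸n+n≡m (ℕ.≤-pred lt)))))
                  (≋-trans (ΣS-cong (suc k) λ p lt → ≋-trans (≡⇒≋ (cong X (weight-rising p (ℕ.≤-pred lt))))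
                                                           (^s-+ q (A ℕ.+ k ℕ.* T) (p ℕ.* T)))
                           (ΣS-⊗ (suc k) (X (A ℕ.+ k ℕ.* T)) (λ p → X (p ℕ.* T)))) ⟩
      tint T (suc k) ⊕ X (A ℕ.+ k ℕ.* T) ⊗ tint T (suc k)
        ≈⟨ solve 2 (λ a b → b :+ a :* b := (con (+ 1) :+ a) :* b) (X (A ℕ.+ k ℕ.* T)) (tint T (suc k)) ⟩
      (𝟙 ⊕ X (A ℕ.+ k ℕ.* T)) ⊗ tint T (suc k) ∎
      where open ≋-Reasoning
            open SeriesSolver

    Stabiliser⇔ : (∀ {s} → Stabiliser s → toℕ s < k) × (∀ {s} → toℕ s < k → Stabiliser s)
    Stabiliser⇔ = (λ { {s} (is , z) → ℕ.≤∧≢⇒< (ℕ.≤-pred is) λ e →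
                       ℤ.<⇒≢ (ℤ.+<+ (s≤s z≤n)) (trans (sym z) (cong (if_then + 1 else + 0) (≡ᵇ-yes e))) })
                , (λ { {s} lt → ℕ.m≤n⇒m≤1+n lt , cong (if_then + 1 else + 0) (≡ᵇ-no (ℕ.<⇒≢ lt)) })

  parabolic-GF : ∀ k → k ≤ n → GF _≈_ (Within (λ s → toℕ s < k)) (seriesB A T k)
  parabolic-GF zero _ = Within-none (λ s ())
  parabolic-GF (suc k) le = GF-≋ (⊗-congʳ (seriesB A T k) orbit-series)
    (Stage.parabolic-step I ω ω≥0 orbit-GF
      (Within-⇔ (proj₂ Stabiliser⇔) (proj₁ Stabiliser⇔) (parabolic-GF k (ℕ.<⇒≤ le))))
    where open Orbit k le

-- points of ℤⁿ

-- The numbers x₁ - p, x₂ - x₁, …, 1 - 2 xₙ at a point x of ℤⁿ.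
value : ℤ → List ℤ → ℕ → ℤ
value p []       zero    = + 1 ℤ.- + 2 ℤ.* p
value p []       (suc j) = + 0
value p (x ∷ xs) zero    = x ℤ.- p
value p (x ∷ xs) (suc j) = value x xs j

moveTail : ℕ → List ℤ → List ℤ
moveTail i       []           = []
moveTail zero    (x ∷ [])     = (+ 1 ℤ.- x) ∷ []
moveTail zero    (x ∷ y ∷ zs) = y ∷ x ∷ zs
moveTail (suc i) (x ∷ zs)     = x ∷ moveTail i zs

-- The affine reflection action of C̃_n, with base alcove 0 < x₁ < ... < xₙ < 1/2.
move : ℕ → List ℤ → List ℤ
move zero    []       = []
move zero    (x ∷ xs) = (ℤ.- x) ∷ xs
move (suc i) z        = moveTail i z

length-moveTail : ∀ i z → length (moveTail i z) ≡ length z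
length-moveTail i       []           = refl
length-moveTail zero    (x ∷ [])     = refl
length-moveTail zero    (x ∷ y ∷ zs) = refl
length-moveTail (suc i) (x ∷ zs)     = cong suc (length-moveTail i zs)

length-move : ∀ i z → length (move i z) ≡ length z
length-move zero    []       = refl
length-move zero    (x ∷ xs) = refl
length-move (suc i) z        = length-moveTail i z

1-1- : ∀ x → + 1 ℤ.- (+ 1 ℤ.- x) ≡ x
1-1- = solve 1 (λ x → con (+ 1) :- (con (+ 1) :- x) := x)
  where open ℤSolver

moveTail-involutive : ∀ i z → moveTail i (moveTail i z) ≡ z
moveTail-involutive i       []           = refl
moveTail-involutive zero    (x ∷ [])     = cong (_∷ []) (1-1- x)
moveTail-involutive zero    (x ∷ y ∷ zs) = refl
moveTail-involutive (suc i) (x ∷ zs)     = cong (x ∷_) (moveTail-involutive i zs)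

move-involutive : ∀ i z → move i (move i z) ≡ z
move-involutive zero    []       = refl
move-involutive zero    (x ∷ xs) = cong (_∷ xs) (ℤ.neg-involutive x)
move-involutive (suc i) z        = moveTail-involutive i z

module _ where
  open ℤSolver

  value-before : ∀ i p z {j} → j < i → value p (moveTail i z) j ≡ value p z j
  value-before (suc i) p []       lt = refl
  value-before (suc i) p (x ∷ zs) {zero}  lt = refl
  value-before (suc i) p (x ∷ zs) {suc j} (s≤s lt) = value-before i x zs lt

  value-left : ∀ i p z → i < length z → value p (moveTail i z) i ≡ value p z i ℤ.+ value p z (suc i)
  value-left zero    p (x ∷ [])     lt =
    solve 2 (λ x p → con (+ 1) :- x :- p := x :- p :+ (con (+ 1) :- con (+ 2) :* x)) x p
  value-left zero    p (x ∷ y ∷ zs) lt = solve 3 (λ x y p → y :- p := x :- p :+ (y :- x)) x y p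
  value-left (suc i) p (x ∷ zs)     (s≤s lt) = value-left i x zs lt

  value-at : ∀ i p z → i < length z → value p (moveTail i z) (suc i) ≡ ℤ.- value p z (suc i)
  value-at zero    p (x ∷ [])     lt =
    solve 1 (λ x → con (+ 1) :- con (+ 2) :* (con (+ 1) :- x) := :- (con (+ 1) :- con (+ 2) :* x)) x
  value-at zero    p (x ∷ y ∷ zs) lt = solve 2 (λ x y → x :- y := :- (y :- x)) x y
  value-at (suc i) p (x ∷ zs)     (s≤s lt) = value-at i x zs lt

  value-right : ∀ i p z → suc (suc i) < length z →
    value p (moveTail i z) (suc (suc i)) ≡ value p z (suc (suc i)) ℤ.+ value p z (suc i)
  value-right zero    p (x ∷ y ∷ w ∷ zs) lt = solve 3 (λ x y w → w :- x := w :- y :+ (y :- x)) x y w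
  value-right zero    p (x ∷ y ∷ []) (s≤s (s≤s ()))
  value-right zero    p (x ∷ []) (s≤s ())
  value-right (suc i) p (x ∷ zs) (s≤s lt) = value-right i x zs lt

  value-right-end : ∀ i p z → suc (suc i) ≡ length z →
    value p (moveTail i z) (suc (suc i)) ≡ value p z (suc (suc i)) ℤ.+ + 2 ℤ.* value p z (suc i)
  value-right-end zero    p (x ∷ y ∷ []) e =
    solve 2 (λ x y → con (+ 1) :- con (+ 2) :* x := con (+ 1) :- con (+ 2) :* y :+ con (+ 2) :* (y :- x)) x y
  value-right-end (suc i) p (x ∷ zs)     e = value-right-end i x zs (ℕ.suc-injective e)

  value-after : ∀ i p z {j} → suc (suc i) < j → value p (moveTail i z) j ≡ value p z j
  value-after i       p []                               lt = refl
  value-after zero    p (x ∷ [])         {suc (suc j)}       lt = refl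
  value-after zero    p (x ∷ [])         {suc zero} (s≤s ())
  value-after zero    p (x ∷ y ∷ [])     {suc (suc (suc j))} lt = refl
  value-after zero    p (x ∷ y ∷ zs)     {suc zero} (s≤s ())
  value-after zero    p (x ∷ y ∷ [])     {suc (suc zero)} (s≤s (s≤s ()))
  value-after zero    p (x ∷ y ∷ w ∷ zs) {suc (suc (suc j))} lt = refl
  value-after zero    p (x ∷ y ∷ w ∷ zs) {suc (suc zero)} (s≤s (s≤s ()))
  value-after (suc i) p (x ∷ zs)         {suc j} (s≤s lt) = value-after i x zs lt

  *1 : ∀ a b → a ℤ.+ b ≡ a ℤ.+ + 1 ℤ.* b
  *1 = solve 2 (λ a b → a :+ b := a :+ con (+ 1) :* b)

  *0 : ∀ a b → a ≡ a ℤ.+ + 0 ℤ.* b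
  *0 = solve 2 (λ a b → a := a :+ con (+ 0) :* b)

  *-2 : ∀ a → ℤ.- a ≡ a ℤ.+ -[1+ 1 ] ℤ.* a
  *-2 = solve 1 (λ a → :- a := a :+ con -[1+ 1 ] :* a)

  -- The bridge from geometry to the game: the values are the simple affine roots at z, and
  -- reflecting the point in a wall fires the corresponding generator.
  value-move : ∀ n z → length z ≡ n → 2 ≤ n → ∀ i j → i ≤ n → j ≤ n →
    value (+ 0) (move i z) j ≡ value (+ 0) z j ℤ.+ aCℕ n i j ℤ.* value (+ 0) z i
  value-move n (x ∷ y ∷ zs) l 2≤n zero zero _ _ =
    solve 1 (λ x → :- x :- con (+ 0) := x :- con (+ 0) :+ con -[1+ 1 ] :* (x :- con (+ 0))) x
  value-move n (x ∷ y ∷ zs) l 2≤n zero (suc zero) _ _ =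
    trans (solve 2 (λ x y → y :- (:- x) := y :- x :+ con (+ 2) :* (x :- con (+ 0))) x y)
          (cong (λ a → y ℤ.- x ℤ.+ a ℤ.* (x ℤ.- + 0)) (sym (aC-up n 0)))
  value-move n (x ∷ y ∷ zs) l 2≤n zero (suc (suc j)) _ _ =
    trans (*0 _ (x ℤ.- + 0)) (cong (λ a → value y zs j ℤ.+ a ℤ.* (x ℤ.- + 0)) (sym (aC-far< n {0} {suc (suc j)} (s≤s (s≤s z≤n)))))
  value-move n [] refl () _ _ _ _
  value-move n (x ∷ []) refl (s≤s ()) _ _ _ _
  value-move n z l 2≤n (suc i) j i<n j≤n = trans lhs (cong (λ a → v j ℤ.+ a ℤ.* v (suc i)) (sym (proj₂ near)))
    where
    v = value (+ 0) z
    near : ∃ λ a → aCℕ n (suc i) j ≡ a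
    near = _ , refl
    i<l = subst (i <_) (sym l) i<n
    lhs : value (+ 0) (moveTail i z) j ≡ v j ℤ.+ aCℕ n (suc i) j ℤ.* v (suc i)
    lhs with ℕ.<-cmp j i
    ... | tri< lt _ _ = trans (value-before i (+ 0) z lt) (trans (*0 (v j) (v (suc i)))
            (cong (λ a → v j ℤ.+ a ℤ.* v (suc i)) (sym (aC-far> n (s≤s lt)))))
    ... | tri≈ _ refl _ = trans (value-left i (+ 0) z i<l) (trans (*1 (v i) (v (suc i)))
            (cong (λ a → v i ℤ.+ a ℤ.* v (suc i)) (sym (aC-down n i))))
    ... | tri> _ _ gt with ℕ.<-cmp j (suc i)
    ...   | tri< lt _ _ = ⊥-elim (ℕ.<⇒≱ lt gt)
    ...   | tri≈ _ refl _ = trans (value-at i (+ 0) z i<l) (trans (*-2 (v (suc i)))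
            (cong (λ a → v (suc i) ℤ.+ a ℤ.* v (suc i)) (sym (cartan-diagonal (eC n) ℕ._<ᵇ_ (suc i)))))
    ...   | tri> _ _ gt' with ℕ.<-cmp j (suc (suc i))
    ...     | tri< lt _ _ = ⊥-elim (ℕ.<⇒≱ lt gt')
    ...     | tri> _ _ gt″ = trans (value-after i (+ 0) z gt″) (trans (*0 (v j) (v (suc i)))
            (cong (λ a → v j ℤ.+ a ℤ.* v (suc i)) (sym (aC-far< n gt″))))
    ...     | tri≈ _ refl _ with ℕ.m≤n⇒m<n∨m≡n j≤n
    ...       | inj₁ lt = trans (value-right i (+ 0) z (subst (suc (suc i) <_) (sym l) lt))
                  (trans (*1 (v (suc (suc i))) (v (suc i)))
                    (cong (λ a → v (suc (suc i)) ℤ.+ a ℤ.* v (suc i)) (sym (aC-up-middle n i lt))))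
    ...       | inj₂ refl = trans (value-right-end i (+ 0) z (sym l))
                  (cong (λ a → v (suc (suc i)) ℤ.+ a ℤ.* v (suc i)) (sym (aC-up-last (suc i))))

  ℤ-cancel : ∀ {x x' p} → x ℤ.- p ≡ x' ℤ.- p → x ≡ x'
  ℤ-cancel {x} {x'} {p} e = trans (sub x p) (trans (cong (ℤ._+ p) e) (sym (sub x' p)))
    where
    sub : ∀ x p → x ≡ x ℤ.- p ℤ.+ p
    sub = solve 2 (λ x p → x := x :- p :+ p)

  value-injective : ∀ p z z' → length z ≡ length z' → (∀ j → j < length z → value p z j ≡ value p z' j) → z ≡ z'
  value-injective p [] [] _ _ = refl
  value-injective p (x ∷ z) (x' ∷ z') l e with ℤ-cancel {x} {x'} {p} (e 0 (s≤s z≤n))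
  ... | refl = cong (x ∷_) (value-injective x z z' (ℕ.suc-injective l) λ j lt → e (suc j) (s≤s lt))

  -- A point without negative values satisfies 0 ≤ x₁ ≤ ... ≤ xₙ ≤ 1/2, and the origin is the only
  -- such integral point. The coordinate p before the list makes the induction possible.
  zeros : ∀ p z → ¬ Neg p → (∀ j → j ≤ length z → ¬ Neg (value p z j)) → p ≡ + 0 × z ≡ replicate (length z) (+ 0)
  zeros (+ zero) [] _ _ = refl , refl
  zeros (+ suc p) [] _ h = ⊥-elim (h 0 z≤n (subst Neg
    (solve 1 (λ p → (:- p) :+ (:- p) :- con (+ 1) := con (+ 1) :- con (+ 2) :* (con (+ 1) :+ p)) (+ p))
    (ℤ.≤-<-trans (ℤ.+-monoˡ-≤ (-[1+ 0 ]) (ℤ.+-mono-≤ (ℤ.neg-mono-≤ (ℤ.+≤+ (z≤n {p}))) (ℤ.neg-mono-≤ (ℤ.+≤+ (z≤n {p}))))) ℤ.-<+)))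
  zeros -[1+ p ] _ np _ = ⊥-elim (np ℤ.-<+)
  zeros p (x ∷ z) np h = p≡0 , cong₂ _∷_ x≡0 (proj₂ ih)
    where
    p≤x : p ℤ.≤ x
    p≤x = ℤ.0≤i-j⇒j≤i (ℤ.≮⇒≥ (h 0 z≤n))
    ih = zeros x z (λ nx → np (ℤ.≤-<-trans p≤x nx)) (λ j le → h (suc j) (s≤s le))
    x≡0 = proj₁ ih
    p≡0 : p ≡ + 0
    p≡0 = ℤ.≤-antisym (subst (p ℤ.≤_) x≡0 p≤x) (ℤ.≮⇒≥ np)

  value-replicate : ∀ m j → j < m → value (+ 0) (replicate m (+ 0)) j ≡ + 0
  value-replicate (suc m) zero    lt = refl
  value-replicate (suc m) (suc j) (s≤s lt) = value-replicate m j lt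

  value-replicate-end : ∀ m → value (+ 0) (replicate m (+ 0)) m ≡ + 1
  value-replicate-end zero    = refl
  value-replicate-end (suc m) = value-replicate-end m

-- the number of walls crossed on the way from the base alcove to a point

-- The number of integers strictly between d and an infinitesimal positive number.
between : ℤ → ℕ
between (+ zero)  = 0
between (+ suc d) = d
between -[1+ d ]  = suc d

-- The walls y - x = k and x + y = k that strictly separate the point from the base alcove.
pairCost : ℤ → ℤ → ℕ
pairCost x y = between (y ℤ.- x) ℕ.+ between (x ℤ.+ y)

between-reflect : ∀ d → between (+ 1 ℤ.- d) ≡ between d
between-reflect (+ zero)          = refl
between-reflect (+ suc zero)      = refl
between-reflect (+ suc (suc d))   = refl
between-reflect -[1+ d ]          = refl

between-negate : ∀ {d} → Pos d → between (ℤ.- d) ≡ suc (between d)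
between-negate {+ suc zero}    _ = refl
between-negate {+ suc (suc d)} _ = refl
between-negate {+ zero} (ℤ.+<+ ())

pair-negate : ∀ x y → pairCost (ℤ.- x) y ≡ pairCost x y
pair-negate x y = trans (cong₂ (λ a b → between a ℕ.+ between b)
    (solve 2 (λ x y → y :- (:- x) := x :+ y) x y) (solve 2 (λ x y → :- x :+ y := y :- x) x y))
  (ℕ.+-comm (between (x ℤ.+ y)) (between (y ℤ.- x)))
  where open ℤSolver

pair-reflect : ∀ x y → pairCost x (+ 1 ℤ.- y) ≡ pairCost x y
pair-reflect x y = trans (cong₂ (λ a b → between a ℕ.+ between b)
    (solve 2 (λ x y → con (+ 1) :- y :- x := con (+ 1) :- (x :+ y)) x y)
    (solve 2 (λ x y → x :+ (con (+ 1) :- y) := con (+ 1) :- (y :- x)) x y))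
  (trans (cong₂ ℕ._+_ (between-reflect (x ℤ.+ y)) (between-reflect (y ℤ.- x)))
         (ℕ.+-comm (between (x ℤ.+ y)) (between (y ℤ.- x))))
  where open ℤSolver

-- Only the wall y = x is crossed.
pair-swap : ∀ x y → Neg (y ℤ.- x) → pairCost x y ≡ suc (pairCost y x)
pair-swap x y neg = cong₂ ℕ._+_
  (trans (cong between (solve 2 (λ x y → y :- x := :- (x :- y)) x y))
         (between-negate (subst Pos (solve 2 (λ x y → :- (y :- x) := x :- y) x y) (neg⇒pos- neg))))
  (cong between (ℤ.+-comm x y))
  where open ℤSolver

pairs : ℤ → List ℤ → ℕ
pairs x []       = 0
pairs x (y ∷ ys) = pairCost x y ℕ.+ pairs x ys

pairs-moveTail : ∀ i x z → pairs x (moveTail i z) ≡ pairs x z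
pairs-moveTail i       x []           = refl
pairs-moveTail zero    x (y ∷ [])     = cong (ℕ._+ 0) (pair-reflect x y)
pairs-moveTail zero    x (y ∷ w ∷ zs) = solve 3 (λ a b c → b :+ (a :+ c) := a :+ (b :+ c))
                                              (pairCost x y) (pairCost x w) (pairs x zs)
  where open ℕSolver
pairs-moveTail (suc i) x (y ∷ zs)     = cong (pairCost x y ℕ.+_) (pairs-moveTail i x zs)

pairs-negate : ∀ x z → pairs (ℤ.- x) z ≡ pairs x z
pairs-negate x []       = refl
pairs-negate x (y ∷ ys) = cong₂ ℕ._+_ (pair-negate x y) (pairs-negate x ys)

module Cost (A T B : ℕ) where
  -- Walls at integers have weight A, walls at half-integers have weight B; those strictly between
  -- the coordinate and the base alcove are counted.
  own : ℤ → ℕ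
  own (+ zero)  = 0
  own (+ suc d) = suc d ℕ.* B ℕ.+ d ℕ.* A
  own -[1+ d ]  = suc d ℕ.* (A ℕ.+ B)

  cost : List ℤ → ℕ
  cost []       = 0
  cost (x ∷ xs) = own x ℕ.+ T ℕ.* pairs x xs ℕ.+ cost xs

  own-negate : ∀ {x} → Neg x → A ℕ.+ own (ℤ.- x) ≡ own x
  own-negate {+ x} (ℤ.+<+ ())
  own-negate { -[1+ d ] } _ = solve 3 (λ a b d → a :+ ((con 1 :+ d) :* b :+ d :* a) := (con 1 :+ d) :* (a :+ b)) A B d
    where open ℕSolver

  own-reflect : ∀ {x} → Neg (+ 1 ℤ.- + 2 ℤ.* x) → B ℕ.+ own (+ 1 ℤ.- x) ≡ own x
  own-reflect {+ zero} (ℤ.+<+ ())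
  own-reflect {+ suc zero} _ = solve 2 (λ a b → b :+ con 0 := con 1 :* b :+ con 0 :* a) A B
    where open ℕSolver
  own-reflect {+ suc (suc d)} _ = solve 3 (λ a b d → b :+ (con 1 :+ d) :* (a :+ b)
      := (con 2 :+ d) :* b :+ (con 1 :+ d) :* a) A B d
    where open ℕSolver
  own-reflect { -[1+ d ] } (ℤ.+<+ ())

  -- Exactly one wall is crossed, the one of the generator. The contributions of all other walls are
  -- permuted or kept, by the symmetries of `pairCost` and `own`.
  cost-moveTail : ∀ i p z → suc i ≤ length z → Neg (value p z (suc i)) →
    (if suc i ≡ᵇ length z then B else T) ℕ.+ cost (moveTail i z) ≡ cost z
  cost-moveTail zero p (x ∷ []) le neg = trans
    (solve 3 (λ b o t → b :+ (o :+ t :* con 0 :+ con 0) := (b :+ o) :+ t :* con 0 :+ con 0) B (own (+ 1 ℤ.- x)) T)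
    (cong (λ a → a ℕ.+ T ℕ.* 0 ℕ.+ 0) (own-reflect {x} neg))
    where open ℕSolver
  cost-moveTail zero p (x ∷ y ∷ zs) le neg rewrite pair-swap x y neg =
    solve 7 (λ t ox oy pyx px py c → t :+ (oy :+ t :* (pyx :+ py) :+ (ox :+ t :* px :+ c))
        := ox :+ t :* (con 1 :+ pyx :+ px) :+ (oy :+ t :* py :+ c))
      T (own x) (own y) (pairCost y x) (pairs x zs) (pairs y zs) (cost zs)
    where open ℕSolver
  cost-moveTail (suc i) p (x ∷ zs) (s≤s le) neg = trans
    (solve 3 (λ a b c → a :+ (b :+ c) := b :+ (a :+ c))
      (if suc i ≡ᵇ length zs then B else T) (own x ℕ.+ T ℕ.* pairs x (moveTail i zs)) (cost (moveTail i zs)))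
    (cong₂ (λ a b → own x ℕ.+ T ℕ.* a ℕ.+ b) (pairs-moveTail i x zs) (cost-moveTail i x zs le neg))
    where open ℕSolver

  cost-move : ∀ n i z → 2 ≤ n → length z ≡ n → i ≤ n → Neg (value (+ 0) z i) →
    Lℕ n A T B i ℕ.+ cost (move i z) ≡ cost z
  cost-move n zero [] () refl _ _
  cost-move n zero (x ∷ xs) _ l _ neg = trans
    (solve 4 (λ a o p c → a :+ (o :+ p :+ c) := (a :+ o) :+ p :+ c) A (own (ℤ.- x)) (T ℕ.* pairs (ℤ.- x) xs) (cost xs))
    (cong₂ (λ a b → a ℕ.+ T ℕ.* b ℕ.+ cost xs) (own-negate (subst Neg (ℤ.+-identityʳ x) neg)) (pairs-negate x xs))
    where open ℕSolver
  cost-move n (suc i) z _ refl i<n neg = cost-moveTail i (+ 0) z i<n neg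

module Affine {n A T B : ℕ} (2≤n : 2 ≤ n) (1≤A : 1 ≤ A) (1≤T : 1 ≤ T) (1≤B : 1 ≤ B)
              {HL : Word (suc n) → ℕ → Set} (groupLength : GroupLength n A T B HL) where
  open GroupLength groupLength
  open Game (Ct n) (aC n) (C-compatible n)
  open FiniteParabolic groupLength
  open Cost A T B

  Point : List ℤ → ℕ → Set
  Point z m = length z ≡ n × cost z ≡ m

  state : List ℤ → State
  state z t = value (+ 0) z (toℕ t)

  origin : List ℤ
  origin = replicate n (+ 0)

  length-origin : length origin ≡ n
  length-origin = List.length-replicate n

  ω : State
  ω = state origin

  ω-end : ∀ t → toℕ t ≡ n → ω t ≡ + 1
  ω-end t e = trans (cong (value (+ 0) origin) e) (value-replicate-end n)

  ω-zero : ∀ t → toℕ t < n → ω t ≡ + 0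
  ω-zero t lt = value-replicate n (toℕ t) lt

  end-or-not : ∀ (t : Fin (suc n)) → toℕ t ≡ n ⊎ toℕ t < n
  end-or-not t with toℕ t ℕ.≟ n
  ... | yes e = inj₁ e
  ... | no ne = inj₂ (ℕ.≤∧≢⇒< (ℕ.≤-pred (Fin.toℕ<n t)) ne)

  ω≥0 : ∀ t → ¬ Neg (ω t)
  ω≥0 t neg with end-or-not t
  ... | inj₁ e with subst Neg (ω-end t e) neg
  ...   | ℤ.+<+ ()
  ω≥0 t neg | inj₂ lt with subst Neg (ω-zero t lt) neg
  ...   | ℤ.+<+ ()

  I : Fin (suc n) → Set
  I s = toℕ s < suc n

  open Stage I ω ω≥0

  point : Word (suc n) → List ℤ
  point []      = origin
  point (s ∷ w) = move (toℕ s) (point w)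

  length-point : ∀ w → length (point w) ≡ n
  length-point []      = length-origin
  length-point (s ∷ w) = trans (length-move (toℕ s) (point w)) (length-point w)

  state-move : ∀ s z → length z ≡ n → state (move (toℕ s) z) ≗ fire s (state z)
  state-move s z l t = value-move n z l 2≤n (toℕ s) (toℕ t) (ℕ.≤-pred (Fin.toℕ<n s)) (ℕ.≤-pred (Fin.toℕ<n t))

  state-point : ∀ w → state (point w) ≗ play w ω
  state-point []      t = refl
  state-point (s ∷ w) t = trans (state-move s (point w) (length-point w) t) (fire-cong s (state-point w) t)

  cost-descent : ∀ s z → length z ≡ n → Neg (state z s) → Lℕ n A T B (toℕ s) ℕ.+ cost (move (toℕ s) z) ≡ cost z
  cost-descent s z l neg = cost-move n (toℕ s) z 2≤n l (ℕ.≤-pred (Fin.toℕ<n s)) neg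

  cost-origin : cost origin ≡ 0
  cost-origin = go n
    where
    pairs-zero : ∀ m → pairs (+ 0) (replicate m (+ 0)) ≡ 0
    pairs-zero zero    = refl
    pairs-zero (suc m) = pairs-zero m
    go : ∀ m → cost (replicate m (+ 0)) ≡ 0
    go zero    = refl
    go (suc m) rewrite pairs-zero m | ℕ.*-zeroʳ T = go m

  up-cost : ∀ {g} → Up g → cost (point g) ≡ weight g
  up-cost [] = cost-origin
  up-cost {s ∷ g} ((_ , pos) ∷ up-g) = trans (sym (cost-descent s (move (toℕ s) z) (length-point (s ∷ g)) neg))
      (cong (Lℕ n A T B (toℕ s) ℕ.+_) (trans (cong cost (move-involutive (toℕ s) z)) (up-cost up-g)))
    where
    z = point g
    neg : Neg (state (move (toℕ s) z) s)
    neg = subst Neg (sym (trans (state-point (s ∷ g) s) (fire-self s (play g ω)))) (pos⇒neg- pos)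

  1≤L : ∀ i → 1 ≤ Lℕ n A T B i
  1≤L i with i ≡ᵇ 0
  ... | true = 1≤A
  ... | false with i ≡ᵇ n
  ...   | true = 1≤B
  ...   | false = 1≤T

  -- Every lattice point lies in the orbit of the origin: a negative value can be undone, which
  -- lowers the cost by a weight of at least 1, and a point without negative values is the origin.
  up-exists : ∀ fuel z → cost z ≤ fuel → length z ≡ n → ∃ λ g → Up g × point g ≡ z
  up-exists fuel z le l with Fin.any? (λ t → state z t ℤ.<? + 0)
  ... | no none = [] , [] , sym (trans (proj₂ (zeros (+ 0) z (λ { (ℤ.+<+ ()) }) nonneg)) (cong (λ m → replicate m (+ 0)) l))
    where
    nonneg : ∀ j → j ≤ length z → ¬ Neg (value (+ 0) z j)
    nonneg j j≤ neg = none (t , subst (Neg ∘ value (+ 0) z) (sym eq) neg)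
      where
      t = Data.Fin.fromℕ< (s≤s (subst (j ≤_) l j≤))
      eq : toℕ t ≡ j
      eq = Fin.toℕ-fromℕ< _
  up-exists zero z le l | yes (s , neg) = ⊥-elim (ℕ.<⇒≱ (1≤L (toℕ s))
    (ℕ.≤-trans (ℕ.m≤m+n _ _) (ℕ.≤-trans (ℕ.≤-reflexive (cost-descent s z l neg)) le)))
  up-exists (suc fuel) z le l | yes (s , neg)
    with up-exists fuel (move (toℕ s) z)
           (ℕ.≤-pred (ℕ.≤-trans (ℕ.+-monoˡ-≤ _ (1≤L (toℕ s))) (ℕ.≤-trans (ℕ.≤-reflexive (cost-descent s z l neg)) le)))
           (trans (length-move (toℕ s) z) l)
  ... | g , up-g , e = s ∷ g , (Fin.toℕ<n s , pos) ∷ up-g ,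
          trans (cong (move (toℕ s)) e) (move-involutive (toℕ s) z)
    where
    pos : Pos (play g ω s)
    pos = subst Pos (trans (sym (trans (state-move s z l s) (fire-self s (state z))))
            (trans (cong (λ y → state y s) (sym e)) (state-point g s))) (neg⇒pos- neg)

  -- Total on all lists, as `map-counted` expects a function; the default is never met on a list of
  -- length n.
  toWord : List ℤ → Word (suc n)
  toWord z with length z ℕ.≟ n
  ... | yes l = proj₁ (up-exists (cost z) z ℕ.≤-refl l)
  ... | no _  = []

  toWord-up : ∀ z → length z ≡ n → Up (toWord z) × point (toWord z) ≡ z
  toWord-up z l with length z ℕ.≟ n
  ... | yes l' = proj₂ (up-exists (cost z) z ℕ.≤-refl l')
  ... | no nl = ⊥-elim (nl l)

  orbit-counted : ∀ {m c} → Counted _≡_ (λ z → Point z m) c → Counted _≈_ (λ g → UpWeight g m) c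
  orbit-counted = map-counted ≈-isEquivalence toWord (λ { refl → ≈refl })
    (λ { {z} (l , refl) → let (up-g , e) = toWord-up z l in up-g , trans (sym (up-cost up-g)) (cong cost e) })
    (λ { {z} {z'} (l , _) (l' , _) e → value-injective (+ 0) z z' (trans l (sym l')) λ j lt →
         same-value z z' l l' e j (subst (j <_) l lt) })
    (λ { {g} (up-g , refl) → point g , (length-point g , up-cost up-g) ,
         proj₁ (up-unique up-g (proj₁ (toWord-up (point g) (length-point g))) λ t →
           trans (sym (state-point g t)) (trans (cong (λ z → state z t) (sym (proj₂ (toWord-up (point g) (length-point g)))))
             (state-point (toWord (point g)) t))) })
    where
    state-toWord : ∀ z → length z ≡ n → state z ≗ play (toWord z) ω
    state-toWord z l t = trans (cong (λ y → state y t) (sym (proj₂ (toWord-up z l)))) (state-point (toWord z) t)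
    same-value : ∀ z z' → length z ≡ n → length z' ≡ n → toWord z ≈ toWord z' → ∀ j → j < n →
                 value (+ 0) z j ≡ value (+ 0) z' j
    same-value z z' l l' e j lt = subst (λ i → value (+ 0) z i ≡ value (+ 0) z' i) (Fin.toℕ-fromℕ< (ℕ.m≤n⇒m≤1+n lt))
      (trans (state-toWord z l t) (trans (play-≈ e ω t) (sym (state-toWord z' l' t))))
      where t = Data.Fin.fromℕ< (ℕ.m≤n⇒m≤1+n lt)

  growth : ∀ {G} → GF _≡_ Point G → GF _≈_ HL (G ⊗ seriesB A T n)
  growth gf m = map-counted ≈-isEquivalence id id proj₂ (λ _ _ e → e)
    (λ {w} hl → w , (All.universal (λ s → Fin.toℕ<n s) w , hl) , ≈refl)
    (parabolic-step (λ m' → orbit-counted (gf m')) (Within-⇔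
      (λ {s} lt → ℕ.m≤n⇒m≤1+n lt , ω-zero s lt)
      (λ {s} (_ , z) → not-end s z) (parabolic-GF n ℕ.≤-refl)) m)
    where
    not-end : ∀ s → ω s ≡ + 0 → toℕ s < n
    not-end s z with end-or-not s
    ... | inj₂ lt = lt
    ... | inj₁ e = ⊥-elim (ℤ.<⇒≢ (ℤ.+<+ (s≤s z≤n)) (trans (sym z) (ω-end s e)))

GF-⊎ : ∀ {Z : Set} {_≈_ : Z → Z → Set} {V V₁ V₂ : Z → ℕ → Set} {F G} →
  (∀ {x m} → V₁ x m → V x m) → (∀ {x m} → V₂ x m → V x m) →
  (∀ {x y m} → V₁ x m → V₂ y m → ¬ x ≈ y) →
  (∀ {x m} → V x m → V₁ x m ⊎ V₂ x m) →
  GF _≈_ V₁ F → GF _≈_ V₂ G → GF _≈_ V (F ⊕ G)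
GF-⊎ {_≈_ = _≈_} to₁ to₂ apart cover gf₁ gf₂ m with gf₁ m | gf₂ m
... | counted xs s p d c | counted ys s' p' d' c' = counted (xs ++ ys)
  (trans (cong₂ ℤ._+_ s s') (cong +_ (sym (List.length-++ xs))))
  (All.++⁺ (All.map to₁ p) (All.map to₂ p'))
  (AllPairs.++⁺ d d' (All.map (λ v₁ → All.map (apart v₁) p') p))
  (λ x v → cmp x (cover v))
  where
  cmp : ∀ x → _ ⊎ _ → Any.Any (x ≈_) (xs ++ ys)
  cmp x (inj₁ v) = Any.++⁺ˡ (c x v)
  cmp x (inj₂ v) = Any.++⁺ʳ xs (c' x v)

-- Adding c to all weights is a product with a one-element set of weight c.
GF-map : ∀ {Y Z : Set} {V : Y → ℕ → Set} {V' : Z → ℕ → Set} {F} c (f : Y → Z) →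
  (∀ {y a} → V y a → V' (f y) (c ℕ.+ a)) →
  (∀ {y y' a a'} → V y a → V y' a' → f y ≡ f y' → y ≡ y') →
  (∀ {z m} → V' z m → ∃ λ y → ∃ λ a → V y a × c ℕ.+ a ≡ m × z ≡ f y) →
  GF _≡_ V F → GF _≡_ V' (X c ⊗ F)
GF-map {V = V} {V'} c f to inj cover gf = GF-product {_≈X_ = _≡_ {A = ⊤}} isEquivalence (λ _ y → f y) (λ { refl refl → refl })
  (λ { (_ , refl) v → to v })
  (λ { {tt} {tt} _ _ v v' e → refl , inj v v' e })
  (λ { (_ , refl) (_ , refl) _ → refl })
  (λ v → let (y , a , vy , e , eq) = cover v in tt , y , c , a , (refl , refl) , vy , e , eq)
  (GF-singleton refl tt c) gf

-- masks and q-binomial coefficients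

data Mask : ℕ → ℕ → List Bool → Set where
  []     : Mask 0 0 []
  true∷  : ∀ {m r bs} → Mask m r bs → Mask (suc m) r (true ∷ bs)
  false∷ : ∀ {m r bs} → Mask m r bs → Mask m (suc r) (false ∷ bs)

trues falses : List Bool → ℕ
trues []           = 0
trues (true ∷ bs)  = suc (trues bs)
trues (false ∷ bs) = trues bs
falses []           = 0
falses (true ∷ bs)  = falses bs
falses (false ∷ bs) = suc (falses bs)

trues-mask : ∀ {m r bs} → Mask m r bs → trues bs ≡ m
trues-mask []          = refl
trues-mask (true∷ μ)  = cong suc (trues-mask μ)
trues-mask (false∷ μ) = trues-mask μ

falses-mask : ∀ {m r bs} → Mask m r bs → falses bs ≡ r
falses-mask []          = refl
falses-mask (true∷ μ)  = falses-mask μ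
falses-mask (false∷ μ) = cong suc (falses-mask μ)

-- b selects whether a true before a false or a false before a true counts, matching the two Pascal
-- rules of `gauss`.
inversions : Bool → List Bool → ℕ
inversions b []           = 0
inversions b (true ∷ bs)  = bit b ℕ.* falses bs ℕ.+ inversions b bs
inversions b (false ∷ bs) = bit (not b) ℕ.* trues bs ℕ.+ inversions b bs

MaskWeight : ℕ → Bool → ℕ → ℕ → List Bool → ℕ → Set
MaskWeight T b m r bs a = Mask m r bs × T ℕ.* inversions b bs ≡ a

-- The first entry of the mask picks the summand of the Pascal rule; its inversions with the rest
-- depend only on m and r.
gauss-GF : ∀ T b m r → GF _≡_ (MaskWeight T b m r) (gauss T b m r)
gauss-GF T b m r = go m r
  where
  true-GF : ∀ {m r F} → GF _≡_ (MaskWeight T b m r) F →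
            GF _≡_ (λ bs a → MaskWeight T b (suc m) r bs a × ∃ λ bs' → bs ≡ true ∷ bs')
                   (X (T ℕ.* (bit b ℕ.* r)) ⊗ F)
  true-GF {m} {r} = GF-map (T ℕ.* (bit b ℕ.* r)) (true ∷_)
    (λ { {bs} (μ , refl) → (true∷ μ , weight μ) , bs , refl })
    (λ { _ _ refl → refl })
    (λ { ((true∷ μ , refl) , bs , refl) → bs , _ , (μ , refl) , sym (weight μ) , refl })
    where
    weight : ∀ {bs} → Mask m r bs → T ℕ.* inversions b (true ∷ bs) ≡ T ℕ.* (bit b ℕ.* r) ℕ.+ T ℕ.* inversions b bs
    weight {bs} μ = trans (ℕ.*-distribˡ-+ T (bit b ℕ.* falses bs) (inversions b bs))
      (cong (λ x → T ℕ.* (bit b ℕ.* x) ℕ.+ T ℕ.* inversions b bs) (falses-mask μ))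

  false-GF : ∀ {m r F} → GF _≡_ (MaskWeight T b m r) F →
             GF _≡_ (λ bs a → MaskWeight T b m (suc r) bs a × ∃ λ bs' → bs ≡ false ∷ bs')
                    (X (T ℕ.* (bit (not b) ℕ.* m)) ⊗ F)
  false-GF {m} {r} = GF-map (T ℕ.* (bit (not b) ℕ.* m)) (false ∷_)
    (λ { {bs} (μ , refl) → (false∷ μ , weight μ) , bs , refl })
    (λ { _ _ refl → refl })
    (λ { ((false∷ μ , refl) , bs , refl) → bs , _ , (μ , refl) , sym (weight μ) , refl })
    where
    weight : ∀ {bs} → Mask m r bs → T ℕ.* inversions b (false ∷ bs) ≡ T ℕ.* (bit (not b) ℕ.* m) ℕ.+ T ℕ.* inversions b bs
    weight {bs} μ = trans (ℕ.*-distribˡ-+ T (bit (not b) ℕ.* trues bs) (inversions b bs))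
      (cong (λ x → T ℕ.* (bit (not b) ℕ.* x) ℕ.+ T ℕ.* inversions b bs) (trues-mask μ))

  go : ∀ m r → GF _≡_ (MaskWeight T b m r) (gauss T b m r)
  go zero zero a = map-counted isEquivalence id id (λ { (refl , refl) → [] , ℕ.*-zeroʳ T }) (λ _ _ e → e)
    (λ { ([] , refl) → [] , (refl , sym (ℕ.*-zeroʳ T)) , refl }) (GF-singleton {_≈_ = _≡_} refl [] 0 a)
  go (suc m) zero a = map-counted isEquivalence id id proj₁ (λ _ _ e → e)
    (λ { (true∷ μ , e) → _ , ((true∷ μ , e) , _ , refl) , refl }) (true-GF (go m zero) a)
  go zero (suc r) a = map-counted isEquivalence id id proj₁ (λ _ _ e → e)
    (λ { (false∷ μ , e) → _ , ((false∷ μ , e) , _ , refl) , refl }) (false-GF (go zero r) a)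
  go (suc m) (suc r) = GF-⊎ proj₁ proj₁ (λ { (_ , _ , refl) (_ , _ , refl) () })
    (λ { (true∷ μ , e) → inj₁ ((true∷ μ , e) , _ , refl) ; (false∷ μ , e) → inj₂ ((false∷ μ , e) , _ , refl) })
    (true-GF (go m (suc r))) (false-GF (go (suc m) r))

-- levels: the integers in the order 0, 1, -1, 2, -2, …

level : ℤ → ℕ
level (+ zero)  = 0
level (+ suc d) = suc (d ℕ.+ d)
level -[1+ d ]  = suc (suc (d ℕ.+ d))

double-< : ∀ {a d} → a ℕ.+ a < d ℕ.+ d → a < d
double-< {a} {d} lt with a ℕ.<? d
... | yes a<d = a<d
... | no a≮d = ⊥-elim (ℕ.<⇒≱ lt (ℕ.+-mono-≤ (ℕ.≮⇒≥ a≮d) (ℕ.≮⇒≥ a≮d)))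

double-≤ : ∀ {a d} → a ℕ.+ a ≤ d ℕ.+ d → a ≤ d
double-≤ {a} {d} le with a ℕ.≤? d
... | yes a≤d = a≤d
... | no a≰d = ⊥-elim (ℕ.<⇒≱ (ℕ.+-mono-< (ℕ.≰⇒> a≰d) (ℕ.≰⇒> a≰d)) le)

positive-bounds : ∀ d x → level x < suc (d ℕ.+ d) → x ℤ.< + suc d × ℤ.- x ℤ.< + suc d
positive-bounds d (+ zero)  lt = ℤ.+<+ (s≤s z≤n) , ℤ.+<+ (s≤s z≤n)
positive-bounds d (+ suc a) (s≤s lt) = ℤ.+<+ (s≤s (double-< lt)) , ℤ.-<+
positive-bounds d -[1+ a ]  (s≤s lt) = ℤ.-<+ , ℤ.+<+ (s≤s (double-< (ℕ.<-trans (ℕ.n<1+n _) lt)))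

negative-bounds : ∀ d x → level x < suc (suc (d ℕ.+ d)) → -[1+ d ] ℤ.< x × x ℤ.≤ + suc d
negative-bounds d (+ zero)  lt = ℤ.-<+ , ℤ.+≤+ z≤n
negative-bounds d (+ suc a) (s≤s (s≤s le)) = ℤ.-<+ , ℤ.+≤+ (s≤s (double-≤ le))
negative-bounds d -[1+ a ]  (s≤s (s≤s lt)) = ℤ.-<- (double-< lt) , ℤ.-≤+

between-pos : ∀ {z} → Pos z → + between z ≡ z ℤ.- + 1
between-pos {+ suc d} _ = refl
between-pos {+ zero} (ℤ.+<+ ())

between-nonpos : ∀ {z} → z ℤ.≤ + 0 → + between z ≡ ℤ.- z
between-nonpos {+ zero} _ = refl
between-nonpos {+ suc d} (ℤ.+≤+ ())
between-nonpos { -[1+ d ] } _ = refl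

pos-minus : ∀ {x y} → x ℤ.< y → Pos (y ℤ.- x)
pos-minus {x} {y} lt = subst (ℤ._< y ℤ.- x) (ℤ.+-inverseʳ x) (ℤ.+-monoˡ-< (ℤ.- x) lt)

nonpos-minus : ∀ {x y} → x ℤ.≤ y → x ℤ.- y ℤ.≤ + 0
nonpos-minus {x} {y} le = subst (x ℤ.- y ℤ.≤_) (ℤ.+-inverseʳ y) (ℤ.+-monoˡ-≤ (ℤ.- y) le)

-- b tells whether the top letter pays its extra wall for standing before a lower letter (true) or
-- behind it (false).
record TopLetter (K : ℕ) (b : Bool) (y : ℤ) : Set where
  field
    level-top  : level y ≡ suc K
    pair-same  : pairCost y y ≡ suc K
    pair-above : ∀ x → level x ≤ K → pairCost y x ≡ K ℕ.+ bit b
    pair-below : ∀ x → level x ≤ K → pairCost x y ≡ K ℕ.+ bit (not b)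

-- For x of lower level each argument of `between` has a fixed sign, and on each sign `between` is
-- linear. In the sum of the two terms x cancels.
odd-top : ∀ d → TopLetter (d ℕ.+ d) true (+ suc d)
odd-top d = record
  { level-top = refl
  ; pair-same = trans (cong (ℕ._+ (d ℕ.+ suc d)) (cong between (ℤ.+-inverseʳ (+ suc d)))) (ℕ.+-suc d d)
  ; pair-above = λ x le → ℤ.+-injective (let (x<y , -x<y) = positive-bounds d x (s≤s le) in
      trans (cong₂ ℤ._+_ (between-nonpos (nonpos-minus (ℤ.<⇒≤ x<y)))
                         (between-pos {+ suc d ℤ.+ x} (subst (λ z → Pos (+ suc d ℤ.+ z)) (ℤ.neg-involutive x) (pos-minus -x<y))))
            (solve 2 (λ x d → (:- (x :- (con (+ 1) :+ d))) :+ (con (+ 1) :+ d :+ x :- con (+ 1)) := (d :+ d) :+ con (+ 1)) x (+ d)))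
  ; pair-below = λ x le → ℤ.+-injective (let (x<y , -x<y) = positive-bounds d x (s≤s le) in
      trans (cong₂ ℤ._+_ (between-pos (pos-minus x<y))
                         (between-pos {x ℤ.+ + suc d} (subst Pos (trans (cong (ℤ._+_ (+ suc d)) (ℤ.neg-involutive x)) (ℤ.+-comm (+ suc d) x)) (pos-minus -x<y))))
            (solve 2 (λ x d → (con (+ 1) :+ d :- x :- con (+ 1)) :+ (x :+ (con (+ 1) :+ d) :- con (+ 1)) := (d :+ d) :+ con (+ 0)) x (+ d)))
  }
  where open ℤSolver

even-top : ∀ d → TopLetter (suc (d ℕ.+ d)) false -[1+ d ]
even-top d = record
  { level-top = refl
  ; pair-same = cong (ℕ._+ suc (suc (d ℕ.+ d))) (cong between (ℤ.+-inverseʳ -[1+ d ]))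
  ; pair-above = λ x le → ℤ.+-injective (let (y<x , x≤) = negative-bounds d x (s≤s le) in
      trans (cong₂ ℤ._+_ (between-pos (pos-minus y<x))
                         (between-nonpos { -[1+ d ] ℤ.+ x } (subst (ℤ._≤ + 0) (ℤ.+-comm x -[1+ d ]) (nonpos-minus x≤))))
            (solve 2 (λ x d → (x :- (:- (con (+ 1) :+ d)) :- con (+ 1)) :+ (:- ((:- (con (+ 1) :+ d)) :+ x)) := (con (+ 1) :+ (d :+ d)) :+ con (+ 0)) x (+ d)))
  ; pair-below = λ x le → ℤ.+-injective (let (y<x , x≤) = negative-bounds d x (s≤s le) in
      trans (cong₂ ℤ._+_ (between-nonpos (nonpos-minus (ℤ.<⇒≤ y<x)))
                         (between-nonpos {x ℤ.+ -[1+ d ]} (nonpos-minus x≤)))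
            (solve 2 (λ x d → (:- ((:- (con (+ 1) :+ d)) :- x)) :+ (:- (x :+ (:- (con (+ 1) :+ d)))) := (con (+ 1) :+ (d :+ d)) :+ con (+ 1)) x (+ d)))
  }
  where open ℤSolver

halve : ∀ K → (∃ λ d → K ≡ d ℕ.+ d) ⊎ (∃ λ d → K ≡ suc (d ℕ.+ d))
halve zero = inj₁ (0 , refl)
halve (suc K) with halve K
... | inj₁ (d , refl) = inj₂ (d , refl)
... | inj₂ (d , refl) = inj₁ (suc d , cong suc (sym (ℕ.+-suc d d)))

topLetter : ∀ K → ∃ λ b → ∃ λ y → TopLetter K b y
topLetter K with halve K
... | inj₁ (d , refl) = true , + suc d , odd-top d
... | inj₂ (d , refl) = false , -[1+ d ] , even-top d

double-injective : ∀ {a d} → a ℕ.+ a ≡ d ℕ.+ d → a ≡ d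
double-injective e = ℕ.≤-antisym (double-≤ (ℕ.≤-reflexive e)) (double-≤ (ℕ.≤-reflexive (sym e)))

even≢odd : ∀ a d → a ℕ.+ a ≢ suc (d ℕ.+ d)
even≢odd zero    d ()
even≢odd (suc a) zero    e = ℕ.1+n≢0 (trans (sym (ℕ.+-suc a a)) (ℕ.suc-injective e))
even≢odd (suc a) (suc d) e = even≢odd a d
  (ℕ.suc-injective (trans (sym (ℕ.+-suc a a)) (trans (ℕ.suc-injective e) (cong suc (ℕ.+-suc d d)))))

level-injective : ∀ x y → level x ≡ level y → x ≡ y
level-injective (+ zero)  (+ zero)  e = refl
level-injective (+ suc a) (+ suc d) e = cong (+_ ∘ suc) (double-injective (ℕ.suc-injective e))
level-injective -[1+ a ]  -[1+ d ]  e = cong -[1+_] (double-injective (ℕ.suc-injective (ℕ.suc-injective e)))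
level-injective (+ suc a) -[1+ d ]  e = ⊥-elim (even≢odd a d (ℕ.suc-injective e))
level-injective -[1+ d ]  (+ suc a) e = ⊥-elim (even≢odd a d (sym (ℕ.suc-injective e)))
level-injective (+ zero)  (+ suc d) ()
level-injective (+ zero)  -[1+ d ]  ()
level-injective (+ suc a) (+ zero)  ()
level-injective -[1+ a ]  (+ zero)  ()

-- points with bounded levels

merge : ℤ → List Bool → List ℤ → List ℤ
merge y []           w       = w
merge y (true ∷ bs)  w       = y ∷ merge y bs w
-- A default: a mask with as many falses as w has entries never gets here.
merge y (false ∷ bs) []      = []
merge y (false ∷ bs) (x ∷ w) = x ∷ merge y bs w

levelCost-double : ∀ A B d → levelCost A B (d ℕ.+ d) ≡ d ℕ.* (A ℕ.+ B)
levelCost-double A B zero = refl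
levelCost-double A B (suc d) rewrite ℕ.+-suc d d | levelCost-double A B d =
  solve 3 (λ a b c → b :+ (a :+ c) := (a :+ b) :+ c) A B (d ℕ.* (A ℕ.+ B))
  where open ℕSolver

parity : ℕ → Bool
parity K = proj₁ (topLetter K)

module LevelCount (A T B : ℕ) where
  open Cost A T B

  own-level : ∀ x → own x ≡ levelCost A B (level x)
  own-level (+ zero) = refl
  own-level (+ suc d) rewrite levelCost-double B A d =
    solve 3 (λ a b d → (con 1 :+ d) :* b :+ d :* a := b :+ d :* (b :+ a)) A B d
    where open ℕSolver
  own-level -[1+ d ] rewrite levelCost-double A B d =
    solve 3 (λ a b d → (con 1 :+ d) :* (a :+ b) := b :+ (a :+ d :* (a :+ b))) A B d
    where open ℕSolver

  UpTo : ℕ → ℕ → List ℤ → ℕ → Set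
  UpTo K n z c = (length z ≡ n × All (λ x → level x ≤ K) z) × cost z ≡ c

  module Insert {K b y} (top : TopLetter K b y) where
    open TopLetter top

    pairs-above : ∀ {m r bs w} → Mask m r bs → length w ≡ r → All (λ x → level x ≤ K) w →
      pairs y (merge y bs w) ≡ m ℕ.* suc K ℕ.+ r ℕ.* (K ℕ.+ bit b)
    pairs-above {w = []} [] refl [] = refl
    pairs-above (true∷ {m} {r} μ) l h = trans (cong₂ ℕ._+_ pair-same (pairs-above μ l h))
      (sym (ℕ.+-assoc (suc K) (m ℕ.* suc K) (r ℕ.* (K ℕ.+ bit b))))
    pairs-above {w = x ∷ w} (false∷ {m} {r} μ) refl (hx ∷ h) =
      trans (cong₂ ℕ._+_ (pair-above x hx) (pairs-above {w = w} μ refl h))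
        (solve 3 (λ a b c → a :+ (b :+ c) := b :+ (a :+ c)) (K ℕ.+ bit b) (m ℕ.* suc K) (r ℕ.* (K ℕ.+ bit b)))
      where open ℕSolver

    pairs-below : ∀ {m r bs w} x → level x ≤ K → Mask m r bs → length w ≡ r →
      pairs x (merge y bs w) ≡ pairs x w ℕ.+ m ℕ.* (K ℕ.+ bit (not b))
    pairs-below {w = []} x hx [] refl = refl
    pairs-below {w = w} x hx (true∷ {m} μ) l = trans (cong₂ ℕ._+_ (pair-below x hx) (pairs-below x hx μ l))
      (solve 3 (λ a b c → a :+ (b :+ c) := b :+ (a :+ c)) (K ℕ.+ bit (not b)) (pairs x w) (m ℕ.* (K ℕ.+ bit (not b))))
      where open ℕSolver
    pairs-below {w = v ∷ w} x hx (false∷ {m} μ) refl = trans (cong (pairCost x v ℕ.+_) (pairs-below {w = w} x hx μ refl))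
      (sym (ℕ.+-assoc (pairCost x v) (pairs x w) (m ℕ.* (K ℕ.+ bit (not b)))))

    own-top : own y ≡ levelCost A B (suc K)
    own-top = trans (own-level y) (cong (levelCost A B) level-top)

    cost-merge : ∀ {m r bs w} → Mask m r bs → length w ≡ r → All (λ x → level x ≤ K) w →
      cost (merge y bs w) ≡ topCost A T B K m r ℕ.+ (T ℕ.* inversions b bs ℕ.+ cost w)
    cost-merge {w = []} [] refl [] rewrite ℕ.*-zeroʳ K | ℕ.*-zeroʳ T = refl
    cost-merge {bs = _ ∷ bs} {w} (true∷ {m} {r} μ) l h
      rewrite pairs-above μ l h | cost-merge μ l h | own-top | falses-mask μ =
      solve 9 (λ o t k m r β tr i c →
        o :+ t :* (m :* (con 1 :+ k) :+ r :* (k :+ β)) :+ (m :* o :+ t :* ((con 1 :+ k) :* tr :+ k :* (m :* r)) :+ (t :* i :+ c))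
        := (con 1 :+ m) :* o :+ t :* ((con 1 :+ k) :* (m :+ tr) :+ k :* ((con 1 :+ m) :* r)) :+ (t :* (β :* r :+ i) :+ c))
        (levelCost A B (suc K)) T K m r (bit b) (triangle m) (inversions b bs) (cost w)
      where open ℕSolver
    cost-merge {bs = _ ∷ bs} {x ∷ w} (false∷ {m} {r} μ) refl (hx ∷ h)
      rewrite pairs-below {w = w} x hx μ refl | cost-merge {w = w} μ refl h | trues-mask μ =
      solve 11 (λ o t k m r β tr i c ox px →
        ox :+ t :* (px :+ m :* (k :+ β)) :+ (m :* o :+ t :* ((con 1 :+ k) :* tr :+ k :* (m :* r)) :+ (t :* i :+ c))
        := m :* o :+ t :* ((con 1 :+ k) :* tr :+ k :* (m :* (con 1 :+ r))) :+ (t :* (β :* m :+ i) :+ (ox :+ t :* px :+ c)))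
        (levelCost A B (suc K)) T K m (length w) (bit (not b)) (triangle m) (inversions b bs) (cost w) (own x) (pairs x w)
      where open ℕSolver

    length-merge : ∀ {m r bs w} → Mask m r bs → length w ≡ r → length (merge y bs w) ≡ m ℕ.+ r
    length-merge {w = []} [] refl = refl
    length-merge (true∷ μ) l = cong suc (length-merge μ l)
    length-merge {w = x ∷ w} (false∷ {m} {r} μ) refl = trans (cong suc (length-merge {w = w} μ refl)) (sym (ℕ.+-suc m r))

    levels-merge : ∀ {m r bs w} → Mask m r bs → length w ≡ r → All (λ x → level x ≤ K) w →
                   All (λ x → level x ≤ suc K) (merge y bs w)
    levels-merge {w = []} [] refl [] = []
    levels-merge (true∷ μ) l h = ℕ.≤-reflexive level-top ∷ levels-merge μ l h
    levels-merge {w = x ∷ w} (false∷ μ) refl (hx ∷ h) = ℕ.m≤n⇒m≤1+n hx ∷ levels-merge {w = w} μ refl h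

    low≢top : ∀ {x} → level x ≤ K → x ≢ y
    low≢top hx refl = ℕ.<⇒≱ (ℕ.n<1+n K) (subst (_≤ K) level-top hx)

    -- The letters of w have lower level than y, so the mask can be read off from the merged list.
    merge-injective : ∀ {m m' r r' bs bs' w w'} → Mask m r bs → Mask m' r' bs' → length w ≡ r → length w' ≡ r' →
      All (λ x → level x ≤ K) w → All (λ x → level x ≤ K) w' → merge y bs w ≡ merge y bs' w' → bs ≡ bs' × w ≡ w'
    merge-injective {w = []} {[]} [] [] refl refl [] [] e = refl , refl
    merge-injective (true∷ μ) (true∷ μ') l l' h h' e
      with merge-injective μ μ' l l' h h' (List.∷-injectiveʳ e)
    ... | refl , refl = refl , refl
    merge-injective {w = x ∷ w} {x' ∷ w'} (false∷ μ) (false∷ μ') refl refl (_ ∷ h) (_ ∷ h') e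
      with List.∷-injectiveˡ e | merge-injective μ μ' refl refl h h' (List.∷-injectiveʳ e)
    ... | refl | refl , refl = refl , refl
    merge-injective {w' = x ∷ w'} (true∷ μ) (false∷ μ') l refl h (hx ∷ h') e = ⊥-elim (low≢top hx (sym (List.∷-injectiveˡ e)))
    merge-injective {w = x ∷ w} (false∷ μ) (true∷ μ') refl l (hx ∷ h) h' e = ⊥-elim (low≢top hx (List.∷-injectiveˡ e))
    merge-injective {w = []} {[]} [] (true∷ μ) refl l [] h' ()
    merge-injective {w = []} [] (false∷ μ) refl l [] h' e with merge-nonempty μ l h' e
      where
      merge-nonempty : ∀ {m r bs w} → Mask m r bs → length w ≡ suc r → All (λ x → level x ≤ K) w → [] ≡ merge y (false ∷ bs) w → ⊥
      merge-nonempty {w = x ∷ w} μ l h ()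
    ... | ()
    merge-injective {w' = []} (true∷ μ) [] l refl h [] ()
    merge-injective {w = x ∷ w} {w' = []} (false∷ μ) [] l refl h [] ()
    merge-injective {w = []} {x ∷ w'} [] (true∷ μ) refl l [] h' ()

    record Split (z : List ℤ) : Set where
      constructor split
      field
        {m r} : ℕ
        {bs}  : List Bool
        {w}   : List ℤ
        mask  : Mask m r bs
        len   : length w ≡ r
        low   : All (λ x → level x ≤ K) w
        whole : z ≡ merge y bs w

    split-all : ∀ z → All (λ x → level x ≤ suc K) z → Split z
    split-all [] [] = split [] refl [] refl
    split-all (x ∷ z) (hx ∷ h) with split-all z h | ℕ.m≤n⇒m<n∨m≡n hx
    ... | split μ l lo e | inj₁ lt = split {w = x ∷ _} (false∷ μ) (cong suc l) (ℕ.≤-pred lt ∷ lo) (cong (x ∷_) e)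
    ... | split μ l lo e | inj₂ eq = split (true∷ μ) l lo (cong₂ _∷_ (level-injective x y (trans eq (sym level-top))) e)

    Piece : ℕ → ℕ → List ℤ → ℕ → Set
    Piece m r z c = ∃ λ bs → ∃ λ w → (Mask m r bs × (length w ≡ r × All (λ x → level x ≤ K) w) × z ≡ merge y bs w) × cost z ≡ c

    piece-GF : ∀ m r {F} → GF _≡_ (UpTo K r) F → GF _≡_ (Piece m r) (X (topCost A T B K m r) ⊗ (gauss T b m r ⊗ F))
    piece-GF m r gf = GF-map {V = Q} (topCost A T B K m r) id
      (λ { (bs , w , p@(μ , (l , h) , e) , refl) → bs , w , p , trans (cong cost e) (cost-merge μ l h) })
      (λ _ _ e → e)
      (λ { {z} (bs , w , p@(μ , (l , h) , e) , refl) → z , _ , (bs , w , p , refl) ,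
           trans (sym (cost-merge μ l h)) (cong cost (sym e)) , refl })
      (GF-product isEquivalence (merge y) (λ { refl refl → refl }) {V″ = Q}
        (λ { {bs} {w} (μ , refl) ((l , h) , refl) → bs , w , (μ , (l , h) , refl) , refl })
        (λ { (μ , _) (μ' , _) ((l , h) , _) ((l' , h') , _) e → merge-injective μ μ' l l' h h' e })
        (λ { (_ , refl) (_ , refl) refl → refl })
        (λ { (bs , w , (μ , (l , h) , e) , refl) → bs , w , _ , _ , (μ , refl) , ((l , h) , refl) , refl , e })
        (gauss-GF T b m r) gf)
      where
      Q : List ℤ → ℕ → Set
      Q z c = ∃ λ bs → ∃ λ w → (Mask m r bs × (length w ≡ r × All (λ x → level x ≤ K) w) × z ≡ merge y bs w) ×
              T ℕ.* inversions b bs ℕ.+ cost w ≡ c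

    insert-GF : ∀ n {F : ℕ → Series} → (∀ r → GF _≡_ (UpTo K r) (F r)) →
                GF _≡_ (UpTo (suc K) n) (ΣS (suc n) (λ m → X (topCost A T B K m (n ∸ m)) ⊗ (gauss T b m (n ∸ m) ⊗ F (n ∸ m))))
    insert-GF n gfs = GF-union (suc n) {V' = λ m → Piece m (n ∸ m)}
      (λ { m≤n (bs , w , (μ , (l , h) , refl) , c) →
           (trans (length-merge μ l) (ℕ.m+[n∸m]≡n (ℕ.≤-pred m≤n)) , levels-merge μ l h) , c })
      (λ { _ _ (bs , w , (μ , (l , h) , refl) , _) (bs' , w' , (μ' , (l' , h') , refl) , _) e →
           trans (sym (trues-mask μ)) (trans (cong trues (proj₁ (merge-injective μ μ' l l' h h' e))) (trues-mask μ')) })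
      (λ { {z} ((l , h) , c) → pieces z l h c })
      (λ m _ → piece-GF m (n ∸ m) (gfs (n ∸ m)))
      where
      pieces : ∀ z {c} → length z ≡ n → All (λ x → level x ≤ suc K) z → cost z ≡ c → ∃ λ m → m < suc n × Piece m (n ∸ m) z c
      pieces z l h c with split-all z h
      ... | split {m} {r} μ lw low refl with trans (sym l) (length-merge μ lw)
      ...   | refl = m , s≤s (ℕ.m≤m+n m r) , _ , _ ,
                (subst (λ r' → Mask m r' _) (sym (ℕ.m+n∸m≡n m r)) μ ,
                 (trans lw (sym (ℕ.m+n∸m≡n m r)) , low) , refl) , c

  outer-GF : ∀ K n → GF _≡_ (UpTo K n) (outer T K parity A B n)
  outer-GF zero n a = map-counted isEquivalence id id
    (λ { (refl , refl) → (List.length-replicate n , All.replicate⁺ n z≤n) , cost-zero n }) (λ _ _ e → e)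
    (λ { {z} ((l , h) , refl) → replicate n (+ 0) , (refl , sym (trans (cong cost (all-zero z l h)) (cost-zero n))) , all-zero z l h })
    (GF-singleton {_≈_ = _≡_} refl (replicate n (+ 0)) 0 a)
    where
    pairs-zero : ∀ m → pairs (+ 0) (replicate m (+ 0)) ≡ 0
    pairs-zero zero    = refl
    pairs-zero (suc m) = pairs-zero m
    cost-zero : ∀ m → cost (replicate m (+ 0)) ≡ 0
    cost-zero zero    = refl
    cost-zero (suc m) rewrite pairs-zero m | ℕ.*-zeroʳ T = cost-zero m
    all-zero : ∀ z {n} → length z ≡ n → All (λ x → level x ≤ 0) z → z ≡ replicate n (+ 0)
    all-zero [] refl [] = refl
    all-zero (x ∷ z) refl (hx ∷ h) = cong₂ _∷_ (level-injective x (+ 0) (ℕ.n≤0⇒n≡0 hx)) (all-zero z refl h)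
  outer-GF (suc K) n = GF-≋ (ΣS-Σ+ n (λ m r → X (topCost A T B K m r) ⊗ (gauss T (parity K) m r ⊗ outer T K parity A B r)))
    (Insert.insert-GF (proj₂ (proj₂ (topLetter K))) n (outer-GF K))

  level≤cost : 1 ≤ A → 1 ≤ B → ∀ z → All (λ x → level x ≤ cost z) z
  level≤cost 1≤A 1≤B [] = []
  level≤cost 1≤A 1≤B (x ∷ z) =
    ℕ.≤-trans (level≤own A B 1≤A 1≤B (level x)) (ℕ.≤-trans (ℕ.≤-reflexive (sym (own-level x)))
      (ℕ.≤-trans (ℕ.m≤m+n (own x) _) (ℕ.m≤m+n _ (cost z))))
    ∷ All.map (λ le → ℕ.≤-trans le (ℕ.m≤n+m (cost z) _)) (level≤cost 1≤A 1≤B z)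
    where
    level≤own : ∀ A B → 1 ≤ A → 1 ≤ B → ∀ K → K ≤ levelCost A B K
    level≤own A B a b zero    = z≤n
    level≤own A B a b (suc K) = ℕ.+-mono-≤ b (level≤own B A b a K)

  -- Each level costs at least 1, so a point of cost c has levels at most c. The coefficient of
  -- degree c can therefore be taken from the sum over c levels, a different sum for each degree.
  points-GF : 1 ≤ A → 1 ≤ B → ∀ n → GF _≡_ (λ z c → length z ≡ n × cost z ≡ c) (λ c → outer T c parity A B n c)
  points-GF 1≤A 1≤B n c = map-counted isEquivalence id id (λ { ((l , _) , e) → l , e }) (λ _ _ e → e)
    (λ { {z} (l , refl) → z , ((l , level≤cost 1≤A 1≤B z) , refl) , refl }) (outer-GF c n c)

-- The limit of the peeled sums

1≤⇒≢0 : ∀ {c} → 1 ≤ c → c ≢ 0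
1≤⇒≢0 (s≤s _) ()

AgreeUpTo : ℕ → Series → Series → Set
AgreeUpTo M f g = ∀ m → m ≤ M → f m ≡ g m

⊗-agree : ∀ M h f g → AgreeUpTo M f g → AgreeUpTo M (h ⊗ f) (h ⊗ g)
⊗-agree M h f g e zero le = trans (⊗-zero h f) (trans (cong (h 0 ℤ.*_) (e 0 z≤n)) (sym (⊗-zero h g)))
⊗-agree (suc M) h f g e (suc m) (s≤s le) = trans (⊗-suc h f m) (trans
  (cong₂ ℤ._+_ (cong (h 0 ℤ.*_) (e (suc m) (s≤s le)))
               (⊗-agree M (shift h) f g (λ i i≤M → e i (ℕ.m≤n⇒m≤1+n i≤M)) m le))
  (sym (⊗-suc h g m)))

X-agree : ∀ M c f g → 1 ≤ c → AgreeUpTo M f g → AgreeUpTo (suc M) (X c ⊗ f) (X c ⊗ g)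
X-agree M (suc c) f g _ e m le = trans (at (SR.*-assoc q (X c) f) m)
  (trans (q-agree m le) (sym (at (SR.*-assoc q (X c) g) m)))
  where
  q-agree : AgreeUpTo (suc M) (q ⊗ (X c ⊗ f)) (q ⊗ (X c ⊗ g))
  q-agree zero    _        = trans (q-⊗-zero (X c ⊗ f)) (sym (q-⊗-zero (X c ⊗ g)))
  q-agree (suc m) (s≤s le) = trans (q-⊗-suc (X c ⊗ f) m)
    (trans (⊗-agree M (X c) f g e m le) (sym (q-⊗-suc (X c ⊗ g) m)))

Σ+-agree : ∀ M n (F G : ℕ → ℕ → Series) → (∀ r z → AgreeUpTo M (F r z) (G r z)) → AgreeUpTo M (Σ+ n F) (Σ+ n G)
Σ+-agree M zero    F G e m le = e 0 0 m le
Σ+-agree M (suc n) F G e m le = cong₂ ℤ._+_ (e 0 (suc n) m le) (Σ+-agree M n (F ∘ suc) (G ∘ suc) (e ∘ suc) m le)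

module SeriesIdentities (T : ℕ) (1≤T : 1 ≤ T) where

  tint-constant : ∀ m → tint T (suc m) 0 ≡ + 1
  tint-constant m = cong (ℤ._+_ (+ 1)) (go m (X ∘ (ℕ._* T) ∘ suc) (λ i → X-off (1≤⇒≢0 (ℕ.≤-trans 1≤T (ℕ.m≤m+n T (i ℕ.* T))))))
    where
    go : ∀ m F → (∀ i → F i 0 ≡ + 0) → ΣS m F 0 ≡ + 0
    go zero    F e = refl
    go (suc m) F e = cong₂ ℤ._+_ (e 0) (go m (F ∘ suc) (e ∘ suc))

  minus-constant : ∀ c n → 1 ≤ c → minus T c n 0 ≡ + 1
  minus-constant c zero _ = refl
  minus-constant c (suc n) 1≤c = trans (⊗-zero (𝟙 ⊖ X c) (minus T (c ℕ.+ T) n))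
    (cong₂ ℤ._*_ (cong (λ x → + 1 ℤ.+ ℤ.- x) (X-off (1≤⇒≢0 1≤c))) (minus-constant (c ℕ.+ T) n (ℕ.≤-trans 1≤c (ℕ.m≤m+n c T))))

  exponential : QBinomial.Exponential seriesRing cst-morphism X T
  exponential = record { X-zero = ≋-refl ; X-+ = ^s-+ q
                       ; tint-cancel = λ m {f} {g} → ⊗-cancelˡ (tint T (suc m)) (tint-constant m) }

  open QIdentities seriesRing cst-morphism X T exponential public
  open Quotient (λ c n → inv (minus T c n)) (λ c n 1≤c → ⊗-inverseʳ (minus T c n) (minus-constant c n 1≤c)) public

  peeled-zero : ∀ K A B → peeled T K A B 0 ≋ 𝟙
  peeled-zero zero    A B = ≋-refl
  peeled-zero (suc K) A B = ≋-trans (SR.*-identityˡ (X (T ℕ.* 0) ⊗ peeled T K (B ℕ.+ 0) (A ℕ.+ 0) 0))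
    (≋-trans (⊗-cong {X (T ℕ.* 0)} {𝟙} (≡⇒≋ (cong X (ℕ.*-zeroʳ T))) (peeled-zero K (B ℕ.+ 0) (A ℕ.+ 0))) (SR.*-identityˡ 𝟙))

  -- `peeled` and `quotient` obey the same recursion. A term with r > 0 carries a positive power of
  -- q, which gains one degree of agreement for each peeling; the term with r = 0 is the same for
  -- both.
  peeled-limit : ∀ K A B n → 1 ≤ A → 1 ≤ B → AgreeUpTo K (peeled T K A B n) (quotient A B n)
  peeled-limit zero A B n 1≤A 1≤B zero z≤n = sym (trans (⊗-zero (plus T B n) (inv (minus T c n)))
      (cong (ℤ._* + 1) (plus-constant B n 1≤B)))
    where
    c = A ℕ.+ B ℕ.+ (n ∸ 1) ℕ.* T
    plus-constant : ∀ c n → 1 ≤ c → plus T c n 0 ≡ + 1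
    plus-constant c zero _ = refl
    plus-constant c (suc n) 1≤c = trans (⊗-zero (𝟙 ⊕ X c) (plus T (c ℕ.+ T) n))
      (cong₂ ℤ._*_ (cong (ℤ._+_ (+ 1)) (X-off (1≤⇒≢0 1≤c))) (plus-constant (c ℕ.+ T) n (ℕ.≤-trans 1≤c (ℕ.m≤m+n c T))))
  peeled-limit (suc K) A B n 1≤A 1≤B m le = trans
    (Σ+-agree (suc K) n _ _ (λ r z → ⊗-agree (suc K) (binom T r z) _ _ (term r z)) m le)
    (sym (at (quotient-peeled A B n 1≤A 1≤B) m))
    where
    term : ∀ r z → AgreeUpTo (suc K) (X (inner T B r) ⊗ peeled T K (B ℕ.+ z ℕ.* T) (A ℕ.+ z ℕ.* T) r)
                                     (X (inner T B r) ⊗ quotient (B ℕ.+ z ℕ.* T) (A ℕ.+ z ℕ.* T) r)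
    term zero z m _ = at (⊗-congˡ (X (inner T B 0)) (≋-trans (peeled-zero K (B ℕ.+ z ℕ.* T) (A ℕ.+ z ℕ.* T))
      (≋-sym (quotient-zero (B ℕ.+ z ℕ.* T) (A ℕ.+ z ℕ.* T) (ℕ.≤-trans 1≤A (ℕ.m≤m+n A _)))))) m
    term (suc r) z = X-agree K (inner T B (suc r)) _ _ (ℕ.≤-trans 1≤B (ℕ.≤-trans (ℕ.m≤m+n B _) (ℕ.m≤m+n _ _)))
      (peeled-limit K (B ℕ.+ z ℕ.* T) (A ℕ.+ z ℕ.* T) (suc r) (ℕ.≤-trans 1≤B (ℕ.m≤m+n B _)) (ℕ.≤-trans 1≤A (ℕ.m≤m+n A _)))

  lattice-GF : ∀ A B → 1 ≤ A → 1 ≤ B → ∀ n →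
    GF _≡_ (λ z c → length z ≡ n × Cost.cost A T B z ≡ c) (quotient A B n)
  lattice-GF A B 1≤A 1≤B n = GF-≋ (pointwise λ c →
      trans (at (outer≋peeled c parity A B n) c) (peeled-limit c A B n 1≤A 1≤B c ℕ.≤-refl))
    (LevelCount.points-GF A T B 1≤A 1≤B n)

-- Foldings described by blocks of generators

module FoldingBlocks {k l} {MC : CoxMatrix k} {AC} (compC : ∀ i j → Compatible MC AC i j)
                     {MW : CoxMatrix l} {AW} (compW : ∀ i j → Compatible MW AW i j)
                     (φ : Fin k → Word l) (f : Fin l → Fin k) (μ : Fin k → ℕ) (1≤μ : ∀ r → 1 ≤ μ r) where
  open Folding compC compW φ

  -- Equivariance on the level of coefficients: S t is the total multiple of the value on the block
  -- over r that firing the block adds at t.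
  Row : Fin k → (Fin l → ℤ) → Set
  Row r S = ∀ t → + μ r ℤ.* S t ≡ + μ (f t) ℤ.* AC r (f t)

  -- A generator, a commuting pair, or the longest element of a dihedral group of order 6. From
  -- equal values y, the word s s' s fires y, 2y, y, which is 2y in total at each of s and s'; hence
  -- the factor 2 in its row.
  data Block (r : Fin k) : Set where
    single : ∀ s → φ r ≡ s ∷ [] → f s ≡ r → Row r (AW s) → Block r
    pair   : ∀ s s' → φ r ≡ s ∷ s' ∷ [] → f s ≡ r → f s' ≡ r → AW s' s ≡ + 0 →
             Row r (λ t → AW s t ℤ.+ AW s' t) → Block r
    triple : ∀ s s' → φ r ≡ s ∷ s' ∷ s ∷ [] → f s ≡ r → f s' ≡ r → AW s s' ≡ + 1 → AW s' s ≡ + 1 →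
             Row r (λ t → + 2 ℤ.* (AW s t ℤ.+ AW s' t)) → Block r

  -- The scaling by μ reconciles the orientation of the double bonds of C̃_n with the coefficients
  -- that the blocks produce.
  ι : C.State → W.State
  ι d t = + μ (f t) ℤ.* d (f t)

  +μ-pos : ∀ r {x} → Pos x → Pos (+ μ r ℤ.* x)
  +μ-pos r {x} p = subst (ℤ._< + μ r ℤ.* x) (ℤ.*-zeroʳ (+ μ r))
    (ℤ.*-monoˡ-<-pos (+ μ r) {{ℤ.positive (ℤ.+<+ (1≤μ r))}} p)

  module _ (block : ∀ r → Block r) where
    open ℤSolver

    row-sum : ∀ r t {x c d} → x ≡ + μ (f t) ℤ.* AC r (f t) → c ℤ.+ x ℤ.* d ≡ c ℤ.+ + μ (f t) ℤ.* AC r (f t) ℤ.* d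
    row-sum r t refl = refl

    equivariant : ∀ r d → W.play (φ r) (ι d) ≗ ι (C.fire r d)
    equivariant r d t with block r
    ... | single s e refl row rewrite e = begin
          + μ (f t) ℤ.* d (f t) ℤ.+ AW s t ℤ.* (+ μ r ℤ.* d r)
            ≡⟨ solve 4 (λ c a m x → c :+ a :* (m :* x) := c :+ m :* a :* x) (+ μ (f t) ℤ.* d (f t)) (AW s t) (+ μ r) (d r) ⟩
          + μ (f t) ℤ.* d (f t) ℤ.+ + μ r ℤ.* AW s t ℤ.* d r
            ≡⟨ row-sum r t {c = + μ (f t) ℤ.* d (f t)} {d r} (row t) ⟩
          + μ (f t) ℤ.* d (f t) ℤ.+ + μ (f t) ℤ.* AC r (f t) ℤ.* d r
            ≡⟨ solve 4 (λ m x a y → m :* x :+ m :* a :* y := m :* (x :+ a :* y)) (+ μ (f t)) (d (f t)) (AC r (f t)) (d r) ⟩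
          + μ (f t) ℤ.* (d (f t) ℤ.+ AC r (f t) ℤ.* d r) ∎
      where open ≡-Reasoning
    ... | pair s s' e fs fs' a row rewrite e | fs | fs' | a = begin
          + μ (f t) ℤ.* d (f t) ℤ.+ AW s' t ℤ.* y ℤ.+ AW s t ℤ.* (y ℤ.+ + 0 ℤ.* y)
            ≡⟨ solve 5 (λ c a b m x → c :+ b :* (m :* x) :+ a :* (m :* x :+ con (+ 0) :* (m :* x)) := c :+ m :* (a :+ b) :* x)
                 (+ μ (f t) ℤ.* d (f t)) (AW s t) (AW s' t) (+ μ r) (d r) ⟩
          + μ (f t) ℤ.* d (f t) ℤ.+ + μ r ℤ.* (AW s t ℤ.+ AW s' t) ℤ.* d r
            ≡⟨ row-sum r t {c = + μ (f t) ℤ.* d (f t)} {d r} (row t) ⟩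
          + μ (f t) ℤ.* d (f t) ℤ.+ + μ (f t) ℤ.* AC r (f t) ℤ.* d r
            ≡⟨ solve 4 (λ m x a y → m :* x :+ m :* a :* y := m :* (x :+ a :* y)) (+ μ (f t)) (d (f t)) (AC r (f t)) (d r) ⟩
          + μ (f t) ℤ.* (d (f t) ℤ.+ AC r (f t) ℤ.* d r) ∎
      where open ≡-Reasoning
            y = + μ r ℤ.* d r
    ... | triple s s' e fs fs' a a' row rewrite e | fs | fs' | a | a' | W.A-diagonal s = begin
          + μ (f t) ℤ.* d (f t) ℤ.+ AW s t ℤ.* y ℤ.+ AW s' t ℤ.* (y ℤ.+ + 1 ℤ.* y) ℤ.+
              AW s t ℤ.* (y ℤ.+ -[1+ 1 ] ℤ.* y ℤ.+ + 1 ℤ.* (y ℤ.+ + 1 ℤ.* y))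
            ≡⟨ solve 5 (λ c a b m x → let y = m :* x in
                 c :+ a :* y :+ b :* (y :+ con (+ 1) :* y) :+ a :* (y :+ con -[1+ 1 ] :* y :+ con (+ 1) :* (y :+ con (+ 1) :* y))
                 := c :+ m :* (con (+ 2) :* (a :+ b)) :* x)
                 (+ μ (f t) ℤ.* d (f t)) (AW s t) (AW s' t) (+ μ r) (d r) ⟩
          + μ (f t) ℤ.* d (f t) ℤ.+ + μ r ℤ.* (+ 2 ℤ.* (AW s t ℤ.+ AW s' t)) ℤ.* d r
            ≡⟨ row-sum r t {c = + μ (f t) ℤ.* d (f t)} {d r} (row t) ⟩
          + μ (f t) ℤ.* d (f t) ℤ.+ + μ (f t) ℤ.* AC r (f t) ℤ.* d r
            ≡⟨ solve 4 (λ m x a y → m :* x :+ m :* a :* y := m :* (x :+ a :* y)) (+ μ (f t)) (d (f t)) (AC r (f t)) (d r) ⟩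
          + μ (f t) ℤ.* (d (f t) ℤ.+ AC r (f t) ℤ.* d r) ∎
      where open ≡-Reasoning
            y = + μ r ℤ.* d r

    ascends : ∀ r d → Pos (d r) → Ascends (φ r) (ι d)
    ascends r d p with block r
    ... | single s e refl row rewrite e = +μ-pos r p , tt
    ... | pair s s' e fs fs' a row rewrite e | fs | fs' | a =
          subst Pos (solve 1 (λ y → y := y :+ con (+ 0) :* y) (+ μ r ℤ.* d r)) (+μ-pos r p) , +μ-pos r p , tt
    ... | triple s s' e fs fs' a a' row rewrite e | fs | fs' | a | a' | W.A-diagonal s =
          subst Pos (solve 1 (λ y → y := y :+ con -[1+ 1 ] :* y :+ con (+ 1) :* (y :+ con (+ 1) :* y)) (+ μ r ℤ.* d r)) (+μ-pos r p)
        , subst Pos (solve 1 (λ y → y :+ y := y :+ con (+ 1) :* y) (+ μ r ℤ.* d r)) (ℤ.+-mono-< (+μ-pos r p) (+μ-pos r p))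
        , +μ-pos r p , tt

    isFolding : IsFolding ι
    isFolding = record
      { equivariant = equivariant
      ; ι-cong      = λ eq t → cong (+ μ (f t) ℤ.*_) (eq (f t))
      ; ι-strict    = λ pos t → +μ-pos (f t) (pos (f t))
      ; ι-dominant  = λ {d} dom t neg → ℤ.<⇒≱ neg (subst (ℤ._≤ + μ (f t) ℤ.* d (f t)) (ℤ.*-zeroʳ (+ μ (f t)))
                        (ℤ.*-monoˡ-≤-nonNeg (+ μ (f t)) (ℤ.≮⇒≥ (dom (f t)))))
      ; ascends     = ascends }

data Kind : Set where
  one two three : Kind

size : Kind → ℕ
size one   = 1
size two   = 2
size three = 3

letters : ∀ {A : Set} → Kind → A → A → List A
letters one   s s' = s ∷ []
letters two   s s' = s ∷ s' ∷ []
letters three s s' = s ∷ s' ∷ s ∷ []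

-- The generators s and s' of the big group lie over the same generator of C̃_n; the generator
-- over r is α r (and also β r), and μ r rescales the value at r.
module ArmFolding (n : ℕ) (2≤n : 2 ≤ n) (N : ℕ) (e : ℕ → ℕ → ℕ) (h : ℕ → ℕ → Bool)
                  (order : ∀ {i j} → i < j → j < suc N → BondOrder (h i j) (h j i) (e i j)) where

  a : ℕ → ℕ → ℤ
  a = cartanℕ e h

  combined : Kind → ℕ → ℕ → ℕ → ℤ
  combined one   s s' t = a s t
  combined two   s s' t = a s t ℤ.+ a s' t
  combined three s s' t = + 2 ℤ.* (a s t ℤ.+ a s' t)

  Side : Kind → ℕ → ℕ → Set
  Side one   s s' = ⊤
  Side two   s s' = a s' s ≡ + 0
  Side three s s' = a s s' ≡ + 1 × a s' s ≡ + 1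

  choose : ∀ {A : Set} → A → A → A → ℕ → A
  choose x y z r = if r ≡ᵇ 0 then x else if r ≡ᵇ n then z else y

  choose-middle : ∀ {A : Set} {x y z : A} {r} → 1 ≤ r → r < n → choose x y z r ≡ y
  choose-middle {r = suc r} _ lt rewrite ≡ᵇ-no (ℕ.<⇒≢ lt) = refl

  choose-end : ∀ {A : Set} {x y z : A} → choose x y z n ≡ z
  choose-end rewrite ≡ᵇ-no (ℕ.>⇒≢ (ℕ.<-≤-trans (s≤s z≤n) 2≤n)) | ≡ᵇ-yes {n} refl = refl

  -- The condition `Row` for the three sorts of blocks, tested along the arm α: diagonal, neighbours
  -- and far entries of the tridiagonal matrix `aC`, whose entries 2 sit at (0, 1) and (n - 1, n).
  -- The symmetry fields carry it over to β.
  record Rows (α β : ℕ → ℕ) (k₀ kₘ kₙ : Kind) (μ₀ μₘ μₙ : ℕ) : Set where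
    constructor rows
    row : Kind → ℕ → ℕ → ℤ
    row k r = combined k (α r) (β r)
    field
      first-diagonal : row k₀ 0 (α 0) ≡ -[1+ 1 ]
      first-next     : + μ₀ ℤ.* row k₀ 0 (α 1) ≡ + μₘ ℤ.* + 2
      first-far      : ∀ j → 1 < j → j ≤ n → row k₀ 0 (α j) ≡ + 0
      middle-diagonal : ∀ r → 1 ≤ r → r < n → row kₘ r (α r) ≡ -[1+ 1 ]
      middle-first    : + μₘ ℤ.* row kₘ 1 (α 0) ≡ + μ₀
      middle-down     : ∀ p → 1 ≤ p → suc p < n → row kₘ (suc p) (α p) ≡ + 1
      middle-up       : ∀ r → 1 ≤ r → suc r < n → row kₘ r (α (suc r)) ≡ + 1
      middle-last     : ∀ r → 1 ≤ r → suc r ≡ n → + μₘ ℤ.* row kₘ r (α (suc r)) ≡ + μₙ ℤ.* + 2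
      middle-far      : ∀ r j → 1 ≤ r → r < n → j ≤ n → suc r < j ⊎ suc j < r → row kₘ r (α j) ≡ + 0
      last-diagonal   : row kₙ n (α n) ≡ -[1+ 1 ]
      last-previous   : ∀ p → suc p ≡ n → + μₙ ℤ.* row kₙ n (α p) ≡ + μₘ
      last-far        : ∀ j → suc j < n → row kₙ n (α j) ≡ + 0
      first-symmetric  : ∀ j → j ≤ n → row k₀ 0 (β j) ≡ row k₀ 0 (α j)
      middle-symmetric : ∀ r j → 1 ≤ r → r < n → j ≤ n → row kₘ r (β j) ≡ row kₘ r (α j)
      last-symmetric   : ∀ j → j ≤ n → row kₙ n (β j) ≡ row kₙ n (α j)
      first-side       : Side k₀ (α 0) (β 0)
      middle-side      : ∀ r → 1 ≤ r → r < n → Side kₘ (α r) (β r)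
      last-side        : Side kₙ (α n) (β n)

  record Cover (α β fold : ℕ → ℕ) : Set where
    field
      α-bound : ∀ j → j ≤ n → α j ≤ N
      β-bound : ∀ j → j ≤ n → β j ≤ N
      fold-α  : ∀ j → j ≤ n → fold (α j) ≡ j
      fold-β  : ∀ j → j ≤ n → fold (β j) ≡ j
      cover   : ∀ t → t ≤ N → fold t ≤ n × (t ≡ α (fold t) ⊎ t ≡ β (fold t))

  module Fold {α β fold : ℕ → ℕ} {k₀ kₘ kₙ : Kind} {μ₀ μₘ μₙ : ℕ} (1≤μ₀ : 1 ≤ μ₀) (1≤μₘ : 1 ≤ μₘ) (1≤μₙ : 1 ≤ μₙ)
           (rws : Rows α β k₀ kₘ kₙ μ₀ μₘ μₙ) (cvr : Cover α β fold) where
    open Rows rws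
    open Cover cvr

    kind μ : ℕ → _
    kind = choose k₀ kₘ kₙ
    μ    = choose μ₀ μₘ μₙ

    1≤μ : ∀ r → 1 ≤ μ r
    1≤μ r with r ≡ᵇ 0
    ... | true = 1≤μ₀
    ... | false with r ≡ᵇ n
    ...   | true = 1≤μₙ
    ...   | false = 1≤μₘ

    1<n : 1 < n
    1<n = 2≤n

    times-zero : ∀ x y {s c} → s ≡ + 0 → c ≡ + 0 → x ℤ.* s ≡ y ℤ.* c
    times-zero x y refl refl = trans (ℤ.*-zeroʳ x) (sym (ℤ.*-zeroʳ y))

    data Place (r : ℕ) : Set where
      at-first  : r ≡ 0 → Place r
      at-middle : 1 ≤ r → r < n → Place r
      at-last   : r ≡ n → Place r

    place : ∀ r → r ≤ n → Place r
    place zero    _ = at-first refl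
    place (suc r) le with ℕ.m≤n⇒m<n∨m≡n le
    ... | inj₁ lt = at-middle (s≤s z≤n) lt
    ... | inj₂ eq = at-last eq

    Side-at : ∀ r → r ≤ n → Side (kind r) (α r) (β r)
    Side-at r le with place r le
    ... | at-first refl = first-side
    ... | at-middle 1≤r r<n rewrite choose-middle {x = k₀} {kₘ} {kₙ} 1≤r r<n = middle-side r 1≤r r<n
    ... | at-last refl rewrite choose-end {x = k₀} {kₘ} {kₙ} = last-side

    symmetric : ∀ r j → r ≤ n → j ≤ n → row (kind r) r (β j) ≡ row (kind r) r (α j)
    symmetric r j le j≤n with place r le
    ... | at-first refl = first-symmetric j j≤n
    ... | at-middle 1≤r r<n rewrite choose-middle {x = k₀} {kₘ} {kₙ} 1≤r r<n = middle-symmetric r j 1≤r r<n j≤n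
    ... | at-last refl rewrite choose-end {x = k₀} {kₘ} {kₙ} = last-symmetric j j≤n

    diagonal : ∀ r → r ≤ n → row (kind r) r (α r) ≡ -[1+ 1 ]
    diagonal r le with place r le
    ... | at-first refl = first-diagonal
    ... | at-middle 1≤r r<n rewrite choose-middle {x = k₀} {kₘ} {kₙ} 1≤r r<n = middle-diagonal r 1≤r r<n
    ... | at-last refl rewrite choose-end {x = k₀} {kₘ} {kₙ} = last-diagonal

    far : ∀ r j → r ≤ n → j ≤ n → suc r < j ⊎ suc j < r → row (kind r) r (α j) ≡ + 0
    far r j le j≤n f with place r le
    far r j le j≤n (inj₁ lt) | at-first refl = first-far j lt j≤n
    far r j le j≤n f | at-middle 1≤r r<n rewrite choose-middle {x = k₀} {kₘ} {kₙ} 1≤r r<n = middle-far r j 1≤r r<n j≤n f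
    far r j le j≤n (inj₁ lt) | at-last refl = ⊥-elim (ℕ.<⇒≱ lt (ℕ.m≤n⇒m≤1+n j≤n))
    far r j le j≤n (inj₂ lt) | at-last refl rewrite choose-end {x = k₀} {kₘ} {kₙ} = last-far j lt

    up : ∀ r → suc r ≤ n → + μ r ℤ.* row (kind r) r (α (suc r)) ≡ + μ (suc r) ℤ.* aCℕ n r (suc r)
    up zero le = trans first-next (sym (cong₂ (λ m x → + m ℤ.* x) (choose-middle {x = μ₀} {μₘ} {μₙ} {1} (s≤s z≤n) 1<n) (aC-up n 0)))
    up r@(suc r-1) le with ℕ.m≤n⇒m<n∨m≡n le
    ... | inj₁ lt rewrite choose-middle {x = k₀} {kₘ} {kₙ} {r} (s≤s z≤n) le | choose-middle {x = μ₀} {μₘ} {μₙ} {r} (s≤s z≤n) le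
                        | choose-middle {x = μ₀} {μₘ} {μₙ} {suc r} (s≤s z≤n) lt | middle-up r (s≤s z≤n) lt | aC-up-middle n r-1 lt = refl
    ... | inj₂ refl rewrite choose-middle {x = k₀} {kₘ} {kₙ} {r} (s≤s z≤n) le | choose-middle {x = μ₀} {μₘ} {μₙ} {r} (s≤s z≤n) le
                        | choose-end {x = μ₀} {μₘ} {μₙ} | aC-up-last r = middle-last r (s≤s z≤n) refl

    down : ∀ p → suc p ≤ n → + μ (suc p) ℤ.* row (kind (suc p)) (suc p) (α p) ≡ + μ p ℤ.* aCℕ n (suc p) p
    down p le with ℕ.m≤n⇒m<n∨m≡n le
    down zero le | inj₁ lt rewrite choose-middle {x = k₀} {kₘ} {kₙ} {1} (s≤s z≤n) lt | choose-middle {x = μ₀} {μₘ} {μₙ} {1} (s≤s z≤n) lt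
      | aC-down n 0 = trans middle-first (sym (ℤ.*-identityʳ (+ μ₀)))
    down zero le | inj₂ refl = ⊥-elim (ℕ.<⇒≱ 1<n ℕ.≤-refl)
    down p@(suc _) le | inj₁ lt rewrite choose-middle {x = k₀} {kₘ} {kₙ} {suc p} (s≤s z≤n) lt | choose-middle {x = μ₀} {μₘ} {μₙ} {suc p} (s≤s z≤n) lt
      | choose-middle {x = μ₀} {μₘ} {μₙ} {p} (s≤s z≤n) le | middle-down p (s≤s z≤n) lt | aC-down n p = refl
    down p@(suc _) le | inj₂ refl rewrite choose-end {x = k₀} {kₘ} {kₙ} | choose-end {x = μ₀} {μₘ} {μₙ}
      | choose-middle {x = μ₀} {μₘ} {μₙ} {p} (s≤s z≤n) le | aC-down n p = trans (last-previous p refl) (sym (ℤ.*-identityʳ (+ μₘ)))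

    row-arm : ∀ r j → r ≤ n → j ≤ n → + μ r ℤ.* row (kind r) r (α j) ≡ + μ j ℤ.* aCℕ n r j
    row-arm r j r≤n j≤n with ℕ.<-cmp r j
    ... | tri≈ _ refl _ = cong (+ μ r ℤ.*_) (trans (diagonal r r≤n) (sym (cartan-diagonal (eC n) ℕ._<ᵇ_ r)))
    ... | tri< lt _ _ with ℕ.m≤n⇒m<n∨m≡n lt
    ...   | inj₁ lt' = times-zero (+ μ r) (+ μ j) (far r j r≤n j≤n (inj₁ lt')) (aC-far< n lt')
    ...   | inj₂ refl = up r j≤n
    row-arm r j r≤n j≤n | tri> _ _ gt with ℕ.m≤n⇒m<n∨m≡n gt
    ...   | inj₁ gt' = times-zero (+ μ r) (+ μ j) (far r j r≤n j≤n (inj₂ gt')) (aC-far> n gt')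
    ...   | inj₂ refl = down j r≤n

    row-all : ∀ r t → r ≤ n → t ≤ N → + μ r ℤ.* row (kind r) r t ≡ + μ (fold t) ℤ.* aCℕ n r (fold t)
    row-all r t r≤n t≤N with cover t t≤N
    ... | le , inj₁ e = trans (cong (λ x → + μ r ℤ.* row (kind r) r x) e) (row-arm r (fold t) r≤n le)
    ... | le , inj₂ e = trans (cong (λ x → + μ r ℤ.* row (kind r) r x) e)
          (trans (cong (+ μ r ℤ.*_) (symmetric r (fold t) r≤n le)) (row-arm r (fold t) r≤n le))

    W-compatible : ∀ (i j : Fin (suc N)) → Compatible (mkM e) (cartan e h) i j
    W-compatible = cartan-compatible e h order

    r≤n : ∀ (r : Fin (suc n)) → toℕ r ≤ n
    r≤n r = ℕ.≤-pred (Fin.toℕ<n r)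

    module Group (φ : Fin (suc n) → Word (suc N))
                 (φ-letters : ∀ r → φ r ≡ gens N (letters (kind (toℕ r)) (α (toℕ r)) (β (toℕ r)))) where

      fFin : Fin (suc N) → Fin (suc n)
      fFin t = fold (toℕ t) mod suc n

      toℕ-fFin : ∀ t → toℕ (fFin t) ≡ fold (toℕ t)
      toℕ-fFin t = toℕ-mod (proj₁ (cover (toℕ t) (ℕ.≤-pred (Fin.toℕ<n t))))

      open FoldingBlocks (C-compatible n) W-compatible φ fFin (μ ∘ toℕ) (1≤μ ∘ toℕ)

      block : ∀ r → Block r
      block r = go (kind (toℕ r)) refl
        where
        i = toℕ r
        s s' : Fin (suc N)
        s  = α i mod suc N
        s' = β i mod suc N
        es : toℕ s ≡ α i
        es = toℕ-mod (α-bound i (r≤n r))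
        es' : toℕ s' ≡ β i
        es' = toℕ-mod (β-bound i (r≤n r))
        fs : fFin s ≡ r
        fs = Fin.toℕ-injective (trans (toℕ-fFin s) (trans (cong fold es) (fold-α i (r≤n r))))
        fs' : fFin s' ≡ r
        fs' = Fin.toℕ-injective (trans (toℕ-fFin s') (trans (cong fold es') (fold-β i (r≤n r))))
        full : ∀ k → kind i ≡ k → ∀ t → + μ i ℤ.* row k i (toℕ t) ≡ + μ (toℕ (fFin t)) ℤ.* aC n r (fFin t)
        full _ refl t = trans (row-all i (toℕ t) (r≤n r) (ℕ.≤-pred (Fin.toℕ<n t)))
          (cong (λ x → + μ x ℤ.* aCℕ n i x) (sym (toℕ-fFin t)))
        go : ∀ k → kind i ≡ k → Block r
        go one   eq = single s (trans (φ-letters r) (cong (λ k → gens N (letters k (α i) (β i))) eq)) fs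
          λ t → trans (cong (λ x → + μ i ℤ.* a x (toℕ t)) es) (full one eq t)
        go two   eq = pair s s' (trans (φ-letters r) (cong (λ k → gens N (letters k (α i) (β i))) eq)) fs fs'
          (trans (cong₂ a es' es) (subst (λ k → Side k (α i) (β i)) eq (Side-at i (r≤n r))))
          λ t → trans (cong₂ (λ x y → + μ i ℤ.* (a x (toℕ t) ℤ.+ a y (toℕ t))) es es') (full two eq t)
        go three eq = triple s s' (trans (φ-letters r) (cong (λ k → gens N (letters k (α i) (β i))) eq)) fs fs'
          (trans (cong₂ a es es') (proj₁ side)) (trans (cong₂ a es' es) (proj₂ side))
          λ t → trans (cong₂ (λ x y → + μ i ℤ.* (+ 2 ℤ.* (a x (toℕ t) ℤ.+ a y (toℕ t)))) es es') (full three eq t)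
          where side = subst (λ k → Side k (α i) (β i)) eq (Side-at i (r≤n r))

      open Folding (C-compatible n) W-compatible φ
      open FoldedLength (isFolding block)

      length-φ : ∀ r → length (φ r) ≡ Lℕ n (size k₀) (size kₘ) (size kₙ) (toℕ r)
      length-φ r = trans (cong length (φ-letters r)) (trans (List.length-map _ (letters (kind (toℕ r)) _ _))
        (trans (length-letters (kind (toℕ r))) choose-size))
        where
        length-letters : ∀ k {x y : ℕ} → length (letters k x y) ≡ size k
        length-letters one   = refl
        length-letters two   = refl
        length-letters three = refl
        choose-size : size (kind (toℕ r)) ≡ Lℕ n (size k₀) (size kₘ) (size kₙ) (toℕ r)
        choose-size with toℕ r ≡ᵇ 0
        ... | true = refl
        ... | false with toℕ r ≡ᵇ n
        ...   | true = refl
        ...   | false = refl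

      groupLength : GroupLength n (size k₀) (size kₘ) (size kₙ) (λ w m → HasLength (mkM e) (hom φ w) m)
      groupLength = record
        { HL-resp   = HL-resp
        ; HL-unique = λ {u} → HL-unique {u}
        ; HL-exists = HL-exists
        ; HL-[]     = HL-[]
        ; HL-step   = λ {w} r ω ω≥0 hl pos → subst (λ x → HasLength (mkM e) (hom φ (r ∷ w)) (x ℕ.+ _)) (length-φ r)
                        (HL-step {w} r ω ω≥0 hl pos)
        }

-- linear diagrams with an optional edge closing the circle

-- i —— i + 1 has coefficient up₀ from 0 to 1 and from N to N - 1, and wrap is the coefficient of {0, N}.
record Linear (N : ℕ) (up₀ wrap : ℤ) (a : ℕ → ℕ → ℤ) : Set where
  field
    diagonal : ∀ i → a i i ≡ -[1+ 1 ]
    up-first : a 0 1 ≡ up₀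
    up       : ∀ i → 1 ≤ i → a i (suc i) ≡ + 1
    down     : ∀ i → suc i < N → a (suc i) i ≡ + 1
    down-last : ∀ i → suc i ≡ N → a (suc i) i ≡ up₀
    closing  : a 0 N ≡ wrap × a N 0 ≡ wrap
    far      : ∀ i j → suc i < j → i ≢ 0 ⊎ j ≢ N → a i j ≡ + 0 × a j i ≡ + 0

  mirror-< : ∀ i j i' j' → 2 ≤ N → i ℕ.+ i' ≡ N → j ℕ.+ j' ≡ N → i < j → a i' j' ≡ a i j × a j' i' ≡ a j i
  mirror-< i j i' j' 2≤N e e' lt with ℕ.m≤n⇒m<n∨m≡n lt
  ... | inj₂ refl = subst (λ k → a k j' ≡ a i (suc i) × a j' k ≡ a (suc i) i) (sym i'≡) (near i j' e')
    where
    i'≡ : i' ≡ suc j'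
    i'≡ = ℕ.+-cancelˡ-≡ i i' (suc j') (trans e (trans (sym e') (sym (ℕ.+-suc i j'))))
    near : ∀ i j' → suc i ℕ.+ j' ≡ N → a (suc j') j' ≡ a i (suc i) × a j' (suc j') ≡ a (suc i) i
    near zero zero eq = ⊥-elim (ℕ.<⇒≱ 2≤N (ℕ.≤-reflexive (sym eq)))
    near zero (suc j') eq = trans (down-last (suc j') eq) (sym up-first) , trans (up (suc j') (s≤s z≤n)) (sym (down 0 2≤N))
    near (suc i) zero eq = trans (down 0 2≤N) (sym (up (suc i) (s≤s z≤n)))
                         , trans up-first (sym (down-last (suc i) (trans (sym (ℕ.+-identityʳ _)) eq)))
    near (suc i) (suc j') eq = trans (down (suc j') (subst (suc (suc j') <_) eq (s≤s (s≤s (ℕ.m≤n+m (suc j') i)))))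
                                     (sym (up (suc i) (s≤s z≤n)))
                             , trans (up (suc j') (s≤s z≤n)) (sym (down (suc i) (subst (suc (suc i) <_) eq (s≤s (s≤s (subst (suc i ≤_) (sym (ℕ.+-suc i j')) (s≤s (ℕ.m≤m+n i j'))))))))
  ... | inj₁ lt' with i ℕ.≟ 0 | j ℕ.≟ N
  ...   | yes refl | yes refl rewrite e | ℕ.+-cancelˡ-≡ j j' 0 (trans e' (sym (ℕ.+-identityʳ j))) =
          trans (proj₂ closing) (sym (proj₁ closing)) , trans (proj₁ closing) (sym (proj₂ closing))
  ...   | no i≢0 | _ = trans (proj₂ mirrored) (sym (proj₁ (far i j lt' (inj₁ i≢0)))) , trans (proj₁ mirrored) (sym (proj₂ (far i j lt' (inj₁ i≢0))))
    where
    sj'<i' : suc j' < i'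
    sj'<i' = ℕ.+-cancelˡ-< i (suc j') i' (subst (i ℕ.+ suc j' <_) (trans e' (sym e))
      (subst (_< j ℕ.+ j') (sym (ℕ.+-suc i j')) (ℕ.+-monoˡ-< j' lt')))
    mirrored = far j' i' sj'<i' (inj₂ λ i'≡N → i≢0 (ℕ.+-cancelʳ-≡ i' i 0 (trans e (sym i'≡N))))
  ...   | yes _ | no j≢N = trans (proj₂ mirrored) (sym (proj₁ (far i j lt' (inj₂ j≢N)))) , trans (proj₁ mirrored) (sym (proj₂ (far i j lt' (inj₂ j≢N))))
    where
    sj'<i' : suc j' < i'
    sj'<i' = ℕ.+-cancelˡ-< i (suc j') i' (subst (i ℕ.+ suc j' <_) (trans e' (sym e))
      (subst (_< j ℕ.+ j') (sym (ℕ.+-suc i j')) (ℕ.+-monoˡ-< j' lt')))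
    mirrored = far j' i' sj'<i' (inj₁ λ { refl → j≢N (trans (sym (ℕ.+-identityʳ j)) e') })

  mirror : ∀ i j i' j' → 2 ≤ N → i ℕ.+ i' ≡ N → j ℕ.+ j' ≡ N → a i' j' ≡ a i j
  mirror i j i' j' 2≤N e e' with ℕ.<-cmp i j
  ... | tri< lt _ _ = proj₁ (mirror-< i j i' j' 2≤N e e' lt)
  ... | tri> _ _ gt = proj₂ (mirror-< j i j' i' 2≤N e' e gt)
  ... | tri≈ _ refl _ with ℕ.+-cancelˡ-≡ i i' j' (trans e (sym e'))
  ...   | refl = trans (diagonal i') (sym (diagonal i))

eA : ℕ → ℕ → ℕ → ℕ
eA N lo hi = if (hi ≡ᵇ suc lo) ∨ ((lo ≡ᵇ 0) ∧ (hi ≡ᵇ N)) then 3 else 2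

hA : ℕ → ℕ → Bool
hA _ _ = false

aA : ℕ → ℕ → ℕ → ℤ
aA N = cartanℕ (eA N) hA

eA-order : ∀ N {b b'} i j → BondOrder b b' (eA N i j)
eA-order N i j with (j ≡ᵇ suc i) ∨ ((i ≡ᵇ 0) ∧ (j ≡ᵇ N))
... | true = three
... | false = two

∧-false : ∀ {i j N} → i ≢ 0 ⊎ j ≢ N → (i ≡ᵇ 0) ∧ (j ≡ᵇ N) ≡ false
∧-false {i} (inj₁ ne) rewrite ≡ᵇ-no ne = refl
∧-false {i} (inj₂ ne) rewrite ≡ᵇ-no ne = Bool.∧-zeroʳ (i ≡ᵇ 0)

circle : ∀ N → 2 ≤ N → Linear N (+ 1) (+ 1) (aA N)
circle N 2≤N = record
  { diagonal  = cartan-diagonal (eA N) hA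
  ; up-first  = proj₁ (near 0)
  ; up        = λ i _ → proj₁ (near i)
  ; down      = λ i _ → proj₂ (near i)
  ; down-last = λ i _ → proj₂ (near i)
  ; closing   = trans (cartan-< (eA N) hA 0<N) (cong (λ m → coefficient m false) closed)
              , trans (cartan-> (eA N) hA 0<N) (cong (λ m → coefficient m false) closed)
  ; far       = λ i j lt ne → trans (cartan-< (eA N) hA (ℕ.<-trans (ℕ.n<1+n i) lt)) (cong (λ m → coefficient m false) (apart i j lt ne))
                            , trans (cartan-> (eA N) hA (ℕ.<-trans (ℕ.n<1+n i) lt)) (cong (λ m → coefficient m false) (apart i j lt ne))
  }
  where
  0<N : 0 < N
  0<N = ℕ.<-≤-trans (s≤s z≤n) 2≤N
  adjacent : ∀ i → eA N i (suc i) ≡ 3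
  adjacent i rewrite ≡ᵇ-yes {i} refl = refl
  near : ∀ i → aA N i (suc i) ≡ + 1 × aA N (suc i) i ≡ + 1
  near i = trans (cartan-< (eA N) hA (ℕ.n<1+n i)) (cong (λ m → coefficient m false) (adjacent i))
         , trans (cartan-> (eA N) hA (ℕ.n<1+n i)) (cong (λ m → coefficient m false) (adjacent i))
  closed : eA N 0 N ≡ 3
  closed rewrite ≡ᵇ-yes {N} refl = cong (if_then 3 else 2) (Bool.∨-zeroʳ (N ≡ᵇ 1))
  apart : ∀ i j → suc i < j → i ≢ 0 ⊎ j ≢ N → eA N i j ≡ 2
  apart i j lt ne rewrite ≡ᵇ-no (ℕ.>⇒≢ lt) | ∧-false ne = refl

-- Both end generators give twice their value to their neighbour. Unlike the orientation of `aC`,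
-- this one is invariant under i ↦ N - i.
hC : ℕ → ℕ → ℕ → Bool
hC N i _ = (i ≡ᵇ 0) ∨ (i ≡ᵇ N)

aW : ℕ → ℕ → ℕ → ℤ
aW N = cartanℕ (eC N) (hC N)

eC-order′ : ∀ N → 2 ≤ N → ∀ {i j} → i < j → j < suc N → BondOrder (hC N i j) (hC N j i) (eC N i j)
eC-order′ N 2≤N {i} {j} lt j≤N with j ℕ.≟ suc i
... | no ne rewrite ≡ᵇ-no ne = two
... | yes refl rewrite ≡ᵇ-yes {i} refl with i ℕ.≟ 0 | suc i ℕ.≟ N
...   | yes refl | no ne rewrite ≡ᵇ-no ne = four refl
...   | yes refl | yes refl = ⊥-elim (ℕ.<⇒≱ 2≤N ℕ.≤-refl)
...   | no ne | yes refl rewrite ≡ᵇ-no ne | ≡ᵇ-yes {i} refl | ≡ᵇ-no {i} {suc i} (ℕ.<⇒≢ (ℕ.n<1+n i)) = four refl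
...   | no ne | no ne' rewrite ≡ᵇ-no ne | ≡ᵇ-no ne' = three

line : ∀ N → 2 ≤ N → Linear N (+ 2) (+ 0) (aW N)
line N 2≤N = record
  { diagonal  = cartan-diagonal (eC N) (hC N)
  ; up-first  = cartan-< (eC N) (hC N) {0} {1} (s≤s z≤n)
  ; up        = λ i 1≤i → trans (cartan-< (eC N) (hC N) (ℕ.n<1+n i)) (ascending i 1≤i)
  ; down      = λ i lt → trans (cartan-> (eC N) (hC N) (ℕ.n<1+n i)) (descending i lt)
  ; down-last = λ i e → trans (cartan-> (eC N) (hC N) (ℕ.n<1+n i)) (last i e)
  ; closing   = trans (cartan-< (eC N) (hC N) 0<N) (cong (λ m → coefficient m (hC N 0 N)) closed)
              , trans (cartan-> (eC N) (hC N) 0<N) (cong (λ m → coefficient m (hC N N 0)) closed)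
  ; far       = λ i j lt _ → trans (cartan-< (eC N) (hC N) (ℕ.<-trans (ℕ.n<1+n i) lt)) (cong (λ m → coefficient m (hC N i j)) (eC-far N lt))
                           , trans (cartan-> (eC N) (hC N) (ℕ.<-trans (ℕ.n<1+n i) lt)) (cong (λ m → coefficient m (hC N j i)) (eC-far N lt))
  }
  where
  0<N : 0 < N
  0<N = ℕ.<-≤-trans (s≤s z≤n) 2≤N
  closed : eC N 0 N ≡ 2
  closed = eC-far N 2≤N
  ascending : ∀ i → 1 ≤ i → coefficient (eC N i (suc i)) (hC N i (suc i)) ≡ + 1
  ascending (suc i) _ rewrite ≡ᵇ-yes {i} refl with suc (suc i) ℕ.≟ N
  ... | yes refl rewrite ≡ᵇ-yes {i} refl | ≡ᵇ-no {i} {suc i} (ℕ.<⇒≢ (ℕ.n<1+n i)) = refl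
  ... | no ne rewrite ≡ᵇ-no ne = refl
  descending : ∀ i → suc i < N → coefficient (eC N i (suc i)) (hC N (suc i) i) ≡ + 1
  descending i lt rewrite ≡ᵇ-yes {i} refl | ≡ᵇ-no (ℕ.<⇒≢ lt) with i ≡ᵇ 0
  ... | true = refl
  ... | false = refl
  last : ∀ i → suc i ≡ N → coefficient (eC N i (suc i)) (hC N (suc i) i) ≡ + 2
  last i refl rewrite ≡ᵇ-yes {i} refl | Bool.∨-zeroʳ (i ≡ᵇ 0) = refl

-- diagrams folded by i ↦ N - i

module Doubled (n : ℕ) (2≤n : 2 ≤ n) (N : ℕ) {up₀ wrap : ℤ} (e : ℕ → ℕ → ℕ) (h : ℕ → ℕ → Bool)
               (order : ∀ {i j} → i < j → j < suc N → BondOrder (h i j) (h j i) (e i j))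
               (linear : Linear N up₀ wrap (cartanℕ e h)) (n+n≤N : n ℕ.+ n ≤ N) where
  open ArmFolding n 2≤n N e h order public
  open Linear linear

  β : ℕ → ℕ
  β j = N ∸ j

  fold : ℕ → ℕ
  fold t with t ℕ.≤? n
  ... | yes _ = t
  ... | no _  = N ∸ t

  n≤N : n ≤ N
  n≤N = ℕ.≤-trans (ℕ.m≤m+n n n) n+n≤N

  n<N : n < N
  n<N = ℕ.<-≤-trans (subst (_< n ℕ.+ n) (ℕ.+-identityʳ n) (ℕ.+-monoʳ-< n (ℕ.<-≤-trans (s≤s z≤n) 2≤n))) n+n≤N

  2≤N : 2 ≤ N
  2≤N = ℕ.≤-trans 2≤n n≤N

  β-sum : ∀ {j} → j ≤ n → j ℕ.+ β j ≡ N
  β-sum le = ℕ.m+[n∸m]≡n (ℕ.≤-trans le n≤N)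

  n≤β : ∀ {j} → j ≤ n → n ≤ β j
  n≤β {j} le = ℕ.m+n≤o⇒m≤o∸n n (ℕ.≤-trans (ℕ.+-monoʳ-≤ n le) n+n≤N)

  covering : N ≤ suc (n ℕ.+ n) → Cover id β fold
  covering N≤ = record
    { α-bound = λ j le → ℕ.≤-trans le n≤N
    ; β-bound = λ j le → ℕ.m∸n≤m N j
    ; fold-α  = fold-id
    ; fold-β  = λ j le → fold-β j le
    ; cover   = cover′ }
    where
    fold-id : ∀ j → j ≤ n → fold j ≡ j
    fold-id j le with j ℕ.≤? n
    ... | yes _ = refl
    ... | no nle = ⊥-elim (nle le)
    fold-β : ∀ j → j ≤ n → fold (β j) ≡ j
    fold-β j le with β j ℕ.≤? n
    ... | no nle = ℕ.m∸[m∸n]≡n (ℕ.≤-trans le n≤N)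
    ... | yes le' = trans (ℕ.≤-antisym le' (n≤β le)) (ℕ.≤-antisym n≤j le)
      where
      n≤j : n ≤ j
      n≤j = ℕ.+-cancelʳ-≤ (β j) n j (ℕ.≤-trans (ℕ.≤-trans (ℕ.+-monoʳ-≤ n le') n+n≤N) (ℕ.≤-reflexive (sym (β-sum le))))
    cover′ : ∀ t → t ≤ N → fold t ≤ n × (t ≡ fold t ⊎ t ≡ β (fold t))
    cover′ t t≤N with t ℕ.≤? n
    ... | yes le = le , inj₁ refl
    ... | no nle = ℕ.m≤n+o⇒m∸n≤o N t (ℕ.≤-trans N≤ (ℕ.+-monoˡ-≤ n (ℕ.≰⇒> nle))) , inj₂ (sym (ℕ.m∸[m∸n]≡n t≤N))

  -- The mirror exchanges the two generators of the block, and the combined coefficient is symmetric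
  -- in them.
  swap-symmetric : ∀ k i i' j → k ≢ one → i ℕ.+ i' ≡ N → j ≤ n → combined k i i' (β j) ≡ combined k i i' j
  swap-symmetric one i i' j ne e le = ⊥-elim (ne refl)
  swap-symmetric two i i' j ne e le = trans
    (cong₂ ℤ._+_ (mirror i' j i (β j) 2≤N (trans (ℕ.+-comm i' i) e) (β-sum le)) (mirror i j i' (β j) 2≤N e (β-sum le)))
    (ℤ.+-comm (a i' j) (a i j))
  swap-symmetric three i i' j ne e le = cong (+ 2 ℤ.*_) (swap-symmetric two i i' j (λ ()) e le)

  β≢N : ∀ {r} → 1 ≤ r → r ≤ n → β r ≢ N
  β≢N {r} 1≤r le eq = ℕ.<⇒≱ 1≤r (ℕ.≤-reflexive (ℕ.+-cancelʳ-≡ (β r) r 0 (trans (β-sum le) (sym eq))))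

  far-β : ∀ {r j} → 1 ≤ r → r ≤ n → suc j < β r → a (β r) j ≡ + 0
  far-β {r} {j} 1≤r le lt = proj₂ (far j (β r) lt (inj₂ (β≢N 1≤r le)))

  far-arm : ∀ r j → r ≤ n → j ≤ n → suc r < j ⊎ suc j < r → a r j ≡ + 0
  far-arm r j r≤n j≤n (inj₁ lt) = proj₁ (far r j lt (inj₂ (ℕ.<⇒≢ (ℕ.≤-<-trans j≤n n<N))))
  far-arm r j r≤n j≤n (inj₂ lt) = proj₂ (far j r lt (inj₂ (ℕ.<⇒≢ (ℕ.≤-<-trans r≤n n<N))))

  -- At the end 0 the circle gives an adjacent pair and thus a word of three letters, the line a
  -- commuting pair. Both blocks act on generator 1 with coefficient 2, once by the word and once by
  -- the double bond.
  data Outer : Kind → Set where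
    triple-end : up₀ ≡ + 1 → wrap ≡ + 1 → Outer three
    double-end : up₀ ≡ + 2 → wrap ≡ + 0 → Outer two

  a-N-1 : a N 1 ≡ + 0
  a-N-1 = proj₂ (far 1 N (ℕ.≤-<-trans 2≤n n<N) (inj₁ λ ()))

  first-row : ∀ {k₀} → Outer k₀ → combined k₀ 0 (β 0) 0 ≡ -[1+ 1 ] × combined k₀ 0 (β 0) 1 ≡ + 2 ×
              (∀ j → 1 < j → j ≤ n → combined k₀ 0 (β 0) j ≡ + 0) × Side k₀ 0 (β 0) × k₀ ≢ one
  first-row (triple-end refl refl) =
      cong₂ (λ x y → + 2 ℤ.* (x ℤ.+ y)) (diagonal 0) (proj₂ closing)
    , cong₂ (λ x y → + 2 ℤ.* (x ℤ.+ y)) up-first a-N-1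
    , (λ j lt le → cong₂ (λ x y → + 2 ℤ.* (x ℤ.+ y)) (far-arm 0 j z≤n le (inj₁ lt)) (far-N j lt le))
    , closing , λ ()
    where
    far-N : ∀ j → 1 < j → j ≤ n → a N j ≡ + 0
    far-N j lt le = proj₂ (far j N (ℕ.<-≤-trans (s≤s (s≤s le)) (ℕ.≤-trans (ℕ.+-monoˡ-≤ n 2≤n) n+n≤N)) (inj₁ (ℕ.>⇒≢ (ℕ.<-trans (s≤s z≤n) lt))))
  first-row (double-end refl refl) =
      cong₂ ℤ._+_ (diagonal 0) (proj₂ closing)
    , cong₂ ℤ._+_ up-first a-N-1
    , (λ j lt le → cong₂ ℤ._+_ (far-arm 0 j z≤n le (inj₁ lt)) (far-N j lt le))
    , proj₂ closing , λ ()
    where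
    far-N : ∀ j → 1 < j → j ≤ n → a N j ≡ + 0
    far-N j lt le = proj₂ (far j N (ℕ.<-≤-trans (s≤s (s≤s le)) (ℕ.≤-trans (ℕ.+-monoˡ-≤ n 2≤n) n+n≤N)) (inj₁ (ℕ.>⇒≢ (ℕ.<-trans (s≤s z≤n) lt))))

  down-n : ∀ {i} → suc i ≤ n → a (suc i) i ≡ + 1
  down-n {i} le = down i (ℕ.≤-<-trans le n<N)

  module Odd (N≡ : N ≡ suc (n ℕ.+ n)) where

    β-large : ∀ {r} → r < n → suc n < β r
    β-large {r} lt = ℕ.m+n≤o⇒m≤o∸n (suc (suc n)) (subst (suc (suc (n ℕ.+ r)) ≤_) (sym N≡) (s≤s (ℕ.+-monoʳ-< n lt)))

    β-n : β n ≡ suc n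
    β-n = trans (cong (_∸ n) N≡) (ℕ.m+n∸n≡m (suc n) n)

    sn<N : suc n < N
    sn<N = subst (suc n <_) (sym N≡) (s≤s (subst (_< n ℕ.+ n) (ℕ.+-identityʳ n) (ℕ.+-monoʳ-< n (ℕ.<-≤-trans (s≤s z≤n) 2≤n))))

    middle-zero : ∀ {r j} → 1 ≤ r → r < n → j ≤ n → a (β r) j ≡ + 0
    middle-zero 1≤r lt le = far-β 1≤r (ℕ.<⇒≤ lt) (ℕ.≤-<-trans (s≤s le) (β-large lt))

    last-zero : ∀ {j} → j < n → a (β n) j ≡ + 0
    last-zero {j} lt = far-β (ℕ.<-≤-trans (s≤s z≤n) 2≤n) ℕ.≤-refl (subst (suc j <_) (sym β-n) (s≤s lt))

    -- The word on n and n + 1 adds twice its value at n - 1, where C̃_n has coefficient 1. Scaling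
    -- by 2 everywhere except at the last generator compensates for this.
    odd-rows : ∀ {k₀} → Outer k₀ → Rows id β k₀ two three 2 2 1
    odd-rows {k₀} o with first-row o
    ... | diag , next , far₀ , side₀ , ne = record
      { first-diagonal = diag
      ; first-next = cong (+ 2 ℤ.*_) next
      ; first-far = far₀
      ; middle-diagonal = λ r 1≤r lt → cong₂ ℤ._+_ (diagonal r) (middle-zero 1≤r lt (ℕ.<⇒≤ lt))
      ; middle-first = cong (+ 2 ℤ.*_) (cong₂ ℤ._+_ (down-n 1≤n) (middle-zero ℕ.≤-refl 2≤n z≤n))
      ; middle-down = λ p 1≤p lt → cong₂ ℤ._+_ (down-n (ℕ.<⇒≤ lt)) (middle-zero (s≤s z≤n) lt (ℕ.<⇒≤ (ℕ.<-trans (ℕ.n<1+n p) lt)))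
      ; middle-up = λ r 1≤r lt → cong₂ ℤ._+_ (up r 1≤r) (middle-zero 1≤r (ℕ.<-trans (ℕ.n<1+n r) lt) (ℕ.<⇒≤ lt))
      ; middle-last = λ { r 1≤r refl → cong (+ 2 ℤ.*_) (cong₂ ℤ._+_ (up r 1≤r) (middle-zero 1≤r ℕ.≤-refl ℕ.≤-refl)) }
      ; middle-far = λ r j 1≤r lt le f → cong₂ ℤ._+_ (far-arm r j (ℕ.<⇒≤ lt) le f) (middle-zero 1≤r lt le)
      ; last-diagonal = cong₂ (λ x y → + 2 ℤ.* (x ℤ.+ y)) (diagonal n) (trans (cong (λ x → a x n) β-n) (down n sn<N))
      ; last-previous = λ { p refl → cong₂ (λ x y → + 1 ℤ.* (+ 2 ℤ.* (x ℤ.+ y))) (down-n ℕ.≤-refl) (last-zero ℕ.≤-refl) }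
      ; last-far = λ j lt → cong₂ (λ x y → + 2 ℤ.* (x ℤ.+ y)) (far-arm n j ℕ.≤-refl (ℕ.<⇒≤ (ℕ.<-trans (ℕ.n<1+n j) lt)) (inj₂ lt)) (last-zero (ℕ.<-trans (ℕ.n<1+n j) lt))
      ; first-symmetric = λ j le → swap-symmetric k₀ 0 N j ne refl le
      ; middle-symmetric = λ r j 1≤r lt le → swap-symmetric two r (β r) j (λ ()) (β-sum (ℕ.<⇒≤ lt)) le
      ; last-symmetric = λ j le → swap-symmetric three n (β n) j (λ ()) (β-sum ℕ.≤-refl) le
      ; first-side = side₀
      ; middle-side = λ r 1≤r lt → middle-zero 1≤r lt (ℕ.<⇒≤ lt)
      ; last-side = trans (cong (a n) β-n) (up n 1≤n) , trans (cong (λ x → a x n) β-n) (down n sn<N)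
      }
      where
      1≤n : 1 ≤ n
      1≤n = ℕ.<⇒≤ 2≤n

  module Even (N≡ : N ≡ n ℕ.+ n) where

    β-large : ∀ {r} → suc r < n → suc n < β r
    β-large {r} lt = ℕ.m+n≤o⇒m≤o∸n (suc (suc n)) (subst₂ _≤_ (trans (ℕ.+-suc n (suc r)) (cong suc (ℕ.+-suc n r))) (sym N≡) (ℕ.+-monoʳ-≤ n lt))

    β-above : ∀ {r} → r < n → n < β r
    β-above {r} lt = ℕ.m+n≤o⇒m≤o∸n (suc n) (subst (suc (n ℕ.+ r) ≤_) (sym N≡) (ℕ.+-monoʳ-< n lt))

    β-n : β n ≡ n
    β-n = trans (cong (_∸ n) N≡) (ℕ.m+n∸n≡m n n)

    β-previous : ∀ {r} → suc r ≡ n → β r ≡ suc n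
    β-previous {r} refl = trans (cong (_∸ r) (trans N≡ (cong suc (ℕ.+-suc r r)))) (ℕ.m+n∸n≡m (suc (suc r)) r)

    sn<N : suc n < N
    sn<N = subst (suc n <_) (sym N≡) (ℕ.+-monoˡ-≤ n 2≤n)

    middle-zero : ∀ {r j} → 1 ≤ r → r < n → j < n → a (β r) j ≡ + 0
    middle-zero 1≤r lt lt' = far-β 1≤r (ℕ.<⇒≤ lt) (ℕ.≤-<-trans lt' (β-above lt))

    even-rows : ∀ {k₀} → Outer k₀ → Rows id β k₀ two one 1 1 1
    even-rows {k₀} o with first-row o
    ... | diag , next , far₀ , side₀ , ne = record
      { first-diagonal = diag
      ; first-next = cong (+ 1 ℤ.*_) next
      ; first-far = far₀
      ; middle-diagonal = λ r 1≤r lt → cong₂ ℤ._+_ (diagonal r) (middle-zero 1≤r lt lt)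
      ; middle-first = cong (+ 1 ℤ.*_) (cong₂ ℤ._+_ (down-n 1≤n) (middle-zero ℕ.≤-refl 2≤n 1≤n))
      ; middle-down = λ p 1≤p lt → cong₂ ℤ._+_ (down-n (ℕ.<⇒≤ lt)) (middle-zero (s≤s z≤n) lt (ℕ.<-trans (ℕ.n<1+n p) lt))
      ; middle-up = λ r 1≤r lt → cong₂ ℤ._+_ (up r 1≤r) (middle-zero 1≤r (ℕ.<-trans (ℕ.n<1+n r) lt) lt)
      ; middle-last = λ { r 1≤r refl → cong (+ 1 ℤ.*_) (cong₂ ℤ._+_ (up r 1≤r)
                            (trans (cong (λ x → a x n) (β-previous refl)) (down n sn<N))) }
      ; middle-far = λ r j 1≤r lt le f → cong₂ ℤ._+_ (far-arm r j (ℕ.<⇒≤ lt) le f) (far-zero r j 1≤r lt le f)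
      ; last-diagonal = diagonal n
      ; last-previous = λ { p refl → cong (+ 1 ℤ.*_) (down-n ℕ.≤-refl) }
      ; last-far = λ j lt → far-arm n j ℕ.≤-refl (ℕ.<⇒≤ (ℕ.<-trans (ℕ.n<1+n j) lt)) (inj₂ lt)
      ; first-symmetric = λ j le → swap-symmetric k₀ 0 N j ne refl le
      ; middle-symmetric = λ r j 1≤r lt le → swap-symmetric two r (β r) j (λ ()) (β-sum (ℕ.<⇒≤ lt)) le
      ; last-symmetric = λ j le → mirror n j n (β j) 2≤N (sym N≡) (β-sum le)
      ; first-side = side₀
      ; middle-side = λ r 1≤r lt → middle-zero 1≤r lt lt
      ; last-side = tt
      }
      where
      1≤n : 1 ≤ n
      1≤n = ℕ.<⇒≤ 2≤n
      far-zero : ∀ r j → 1 ≤ r → r < n → j ≤ n → suc r < j ⊎ suc j < r → a (β r) j ≡ + 0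
      far-zero r j 1≤r lt le f with ℕ.m≤n⇒m<n∨m≡n le
      ... | inj₁ lt' = middle-zero 1≤r lt lt'
      far-zero r j 1≤r lt le (inj₁ lt') | inj₂ refl = far-β 1≤r (ℕ.<⇒≤ lt) (β-large lt')
      far-zero r j 1≤r lt le (inj₂ lt') | inj₂ refl = ⊥-elim (ℕ.<-asym lt (ℕ.<-trans (ℕ.n<1+n j) lt'))

-- the circle with 2 n vertices, folded by i ↦ 2 n - i

module Circle (n : ℕ) (2≤n : 2 ≤ n) (N : ℕ) (N≡ : suc N ≡ n ℕ.+ n) where
  2≤N : 2 ≤ N
  2≤N = ℕ.≤-pred (subst (3 ≤_) (sym N≡) (ℕ.<⇒≤ (ℕ.+-mono-≤ 2≤n 2≤n)))

  open ArmFolding n 2≤n N (eA N) hA (λ {i} {j} _ _ → eA-order N i j) public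
  open Linear (circle N 2≤N)

  -- This is j ↦ 2n - j on the circle of 2n vertices. Vertex 0 is its own image and is treated
  -- apart, since 2n is not an index.
  β : ℕ → ℕ
  β zero    = zero
  β (suc j) = N ∸ j

  fold : ℕ → ℕ
  fold t with t ℕ.≤? n
  ... | yes _ = t
  ... | no _  = suc N ∸ t

  n≤N : n ≤ N
  n≤N = ℕ.≤-pred (subst (suc n ≤_) (sym N≡) (ℕ.+-monoˡ-≤ n (ℕ.<⇒≤ 2≤n)))

  n<N : n < N
  n<N = ℕ.≤-pred (subst (suc (suc n) ≤_) (sym N≡) (ℕ.+-monoˡ-≤ n 2≤n))

  1≤n : 1 ≤ n
  1≤n = ℕ.<⇒≤ 2≤n

  β-sum : ∀ {j} → 1 ≤ j → j ≤ n → j ℕ.+ β j ≡ suc N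
  β-sum {suc j} _ le = cong suc (ℕ.m+[n∸m]≡n (ℕ.≤-trans (ℕ.n≤1+n j) (ℕ.≤-trans le n≤N)))

  β-above : ∀ {r} → 1 ≤ r → r < n → n < β r
  β-above {r} 1≤r lt = ℕ.+-cancelˡ-< r n (β r) (subst (r ℕ.+ n <_) (trans (sym N≡) (sym (β-sum 1≤r (ℕ.<⇒≤ lt)))) (ℕ.+-monoˡ-< n lt))

  β-large : ∀ {r} → 1 ≤ r → suc r < n → suc n < β r
  β-large {r} 1≤r lt = ℕ.+-cancelˡ-< r (suc n) (β r) (subst₂ _<_ (sym (ℕ.+-suc r n)) (trans (sym N≡) (sym (β-sum 1≤r (ℕ.<⇒≤ (ℕ.<-trans (ℕ.n<1+n r) lt)))))
    (ℕ.+-monoˡ-< n lt))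

  β-n : β n ≡ n
  β-n = ℕ.+-cancelˡ-≡ n (β n) n (trans (β-sum 1≤n ℕ.≤-refl) N≡)

  β-previous : ∀ {r} → 1 ≤ r → suc r ≡ n → β r ≡ suc n
  β-previous {r} 1≤r refl = ℕ.+-cancelˡ-≡ r (β r) (suc (suc r)) (trans (β-sum 1≤r (ℕ.n≤1+n r)) (trans N≡ (sym (ℕ.+-suc r (suc r)))))

  β≤N : ∀ j → j ≤ n → β j ≤ N
  β≤N zero    _ = z≤n
  β≤N (suc j) _ = ℕ.m∸n≤m N j

  β-inner : ∀ {r} → 1 < r → r ≤ n → β r < N
  β-inner {r} lt le = ℕ.+-cancelˡ-< r (β r) N (subst (_< r ℕ.+ N) (sym (β-sum (ℕ.<⇒≤ lt) le)) (ℕ.+-monoˡ-< N lt))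

  covering : Cover id β fold
  covering = record
    { α-bound = λ j le → ℕ.≤-trans le n≤N
    ; β-bound = β≤N
    ; fold-α  = fold-id
    ; fold-β  = fold-β
    ; cover   = cover′ }
    where
    fold-id : ∀ j → j ≤ n → fold j ≡ j
    fold-id j le with j ℕ.≤? n
    ... | yes _ = refl
    ... | no nle = ⊥-elim (nle le)
    fold-β : ∀ j → j ≤ n → fold (β j) ≡ j
    fold-β zero    le = fold-id 0 le
    fold-β (suc j) le with β (suc j) ℕ.≤? n
    ... | no nle = trans (cong (_∸ β (suc j)) (sym (β-sum (s≤s z≤n) le))) (ℕ.m+n∸n≡m (suc j) (β (suc j)))
    ... | yes le' with ℕ.m≤n⇒m<n∨m≡n le
    ...   | inj₁ lt = ⊥-elim (ℕ.<⇒≱ (β-above (s≤s z≤n) lt) le')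
    ...   | inj₂ refl = β-n
    cover′ : ∀ t → t ≤ N → fold t ≤ n × (t ≡ fold t ⊎ t ≡ β (fold t))
    cover′ t t≤N with t ℕ.≤? n
    ... | yes le = le , inj₁ refl
    ... | no nle = ℕ.m≤n+o⇒m∸n≤o (suc N) t (ℕ.≤-trans (ℕ.≤-reflexive N≡) (ℕ.+-monoˡ-≤ n (ℕ.<⇒≤ (ℕ.≰⇒> nle)))) ,
        inj₂ (ℕ.+-cancelˡ-≡ (suc N ∸ t) t (β (suc N ∸ t)) (trans (ℕ.m∸n+n≡m (ℕ.m≤n⇒m≤1+n t≤N))
          (sym (β-sum (ℕ.m<n⇒0<n∸m (s≤s t≤N)) (ℕ.m≤n+o⇒m∸n≤o (suc N) t (ℕ.≤-trans (ℕ.≤-reflexive N≡) (ℕ.+-monoˡ-≤ n (ℕ.<⇒≤ (ℕ.≰⇒> nle)))))))))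

  shifted-< : ∀ i j i' j' → i ℕ.+ i' ≡ suc N → j ℕ.+ j' ≡ suc N → 1 ≤ i → 1 ≤ j' → i < j → a i' j' ≡ a i j × a j' i' ≡ a j i
  shifted-< i j i' j' e e' 1≤i 1≤j' lt with ℕ.m≤n⇒m<n∨m≡n lt
  ... | inj₂ refl with ℕ.+-cancelˡ-≡ i i' (suc j') (trans e (trans (sym e') (sym (ℕ.+-suc i j'))))
  ...   | refl = trans (near-down j') (sym (up i 1≤i)) , trans (up j' 1≤j') (sym (near-down i))
    where
    near-down : ∀ p → a (suc p) p ≡ + 1
    near-down p with ℕ.<-cmp (suc p) N
    ... | tri< l _ _ = down p l
    ... | tri≈ _ q _ = down-last p q
    ... | tri> _ _ g = trans (cartan-> (eA N) hA (ℕ.n<1+n p)) (cong (λ m → coefficient m false) adjacent)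
      where
      adjacent : eA N p (suc p) ≡ 3
      adjacent rewrite ≡ᵇ-yes {p} refl = refl
  shifted-< i j i' j' e e' 1≤i 1≤j' lt | inj₁ lt' =
      trans (proj₂ mirrored) (sym (proj₁ original)) , trans (proj₁ mirrored) (sym (proj₂ original))
    where
    sj'<i' : suc j' < i'
    sj'<i' = ℕ.+-cancelˡ-< i (suc j') i' (subst (i ℕ.+ suc j' <_) (trans e' (sym e))
      (subst (_< j ℕ.+ j') (sym (ℕ.+-suc i j')) (ℕ.+-monoˡ-< j' lt')))
    mirrored = far j' i' sj'<i' (inj₁ (ℕ.>⇒≢ 1≤j'))
    original = far i j lt' (inj₁ (ℕ.>⇒≢ 1≤i))

  -- The reflection symmetry of the circle away from vertex 0, so that both partners are indices.
  shifted : ∀ i j i' j' → i ℕ.+ i' ≡ suc N → j ℕ.+ j' ≡ suc N → 1 ≤ i → 1 ≤ j → 1 ≤ i' → 1 ≤ j' → a i' j' ≡ a i j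
  shifted i j i' j' e e' 1≤i 1≤j 1≤i' 1≤j' with ℕ.<-cmp i j
  ... | tri< lt _ _ = proj₁ (shifted-< i j i' j' e e' 1≤i 1≤j' lt)
  ... | tri> _ _ gt = proj₂ (shifted-< j i j' i' e' e 1≤j 1≤i' gt)
  ... | tri≈ _ refl _ with ℕ.+-cancelˡ-≡ i i' j' (trans e (sym e'))
  ...   | refl = trans (diagonal i') (sym (diagonal i))

  1≤β : ∀ {r} → 1 ≤ r → r ≤ n → 1 ≤ β r
  1≤β {r} 1≤r le with ℕ.m≤n⇒m<n∨m≡n le
  ... | inj₁ lt = ℕ.≤-trans (ℕ.<⇒≤ (s≤s 1≤n)) (β-above 1≤r lt)
  ... | inj₂ refl = subst (1 ≤_) (sym β-n) 1≤n

  far-arm : ∀ r j → r ≤ n → j ≤ n → suc r < j ⊎ suc j < r → a r j ≡ + 0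
  far-arm r j r≤n j≤n (inj₁ lt) = proj₁ (far r j lt (inj₂ (ℕ.<⇒≢ (ℕ.≤-<-trans j≤n n<N))))
  far-arm r j r≤n j≤n (inj₂ lt) = proj₂ (far j r lt (inj₂ (ℕ.<⇒≢ (ℕ.≤-<-trans r≤n n<N))))

  middle-zero : ∀ {r j} → 1 ≤ r → r < n → 1 ≤ j → suc j < β r → a (β r) j ≡ + 0
  middle-zero 1≤r lt 1≤j l = proj₂ (far _ _ l (inj₁ (ℕ.>⇒≢ 1≤j)))

  before : ∀ {r j} → 1 ≤ r → r < n → j < n → suc j < β r
  before 1≤r lt l = ℕ.≤-<-trans l (β-above 1≤r lt)

  down-n : ∀ {i} → suc i ≤ n → a (suc i) i ≡ + 1
  down-n {i} le = down i (ℕ.≤-<-trans le n<N)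

  sn≤N : suc n ≤ N
  sn≤N = n<N

  -- Generator 0 gives its value only once to generator 1, where C̃_n has coefficient 2, and
  -- receives from both 1 and 2n - 1. Scaling by 2 at 0 accounts for both.
  circle-rows : Rows id β one two one 2 1 1
  circle-rows = record
    { first-diagonal = diagonal 0
    ; first-next = cong (+ 2 ℤ.*_) up-first
    ; first-far = λ j lt le → far-arm 0 j z≤n le (inj₁ lt)
    ; middle-diagonal = λ r 1≤r lt → cong₂ ℤ._+_ (diagonal r) (middle-zero 1≤r lt 1≤r (before 1≤r lt lt))
    ; middle-first = cong (+ 1 ℤ.*_) (cong₂ ℤ._+_ (down-n 1≤n) (proj₂ closing))
    ; middle-down = λ p 1≤p lt → cong₂ ℤ._+_ (down-n (ℕ.<⇒≤ lt)) (middle-zero (s≤s z≤n) lt 1≤p (before (s≤s z≤n) lt (ℕ.<-trans (ℕ.n<1+n p) lt)))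
    ; middle-up = λ r 1≤r lt → cong₂ ℤ._+_ (up r 1≤r) (middle-zero 1≤r (ℕ.<-trans (ℕ.n<1+n r) lt) (s≤s z≤n) (before 1≤r (ℕ.<-trans (ℕ.n<1+n r) lt) lt))
    ; middle-last = λ { r 1≤r refl → cong (+ 1 ℤ.*_) (cong₂ ℤ._+_ (up r 1≤r)
                          (trans (cong (λ x → a x n) (β-previous 1≤r refl)) near-n)) }
    ; middle-far = λ r j 1≤r lt le f → cong₂ ℤ._+_ (far-arm r j (ℕ.<⇒≤ lt) le f) (far-zero r j 1≤r lt le f)
    ; last-diagonal = diagonal n
    ; last-previous = λ { p refl → cong (+ 1 ℤ.*_) (down-n ℕ.≤-refl) }
    ; last-far = λ j lt → far-arm n j ℕ.≤-refl (ℕ.<⇒≤ (ℕ.<-trans (ℕ.n<1+n j) lt)) (inj₂ lt)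
    ; first-symmetric = first-sym
    ; middle-symmetric = middle-sym
    ; last-symmetric = λ { zero _ → refl
                         ; (suc j) le → shifted n (suc j) n (β (suc j)) (sym N≡) (β-sum (s≤s z≤n) le) 1≤n (s≤s z≤n) 1≤n (1≤β (s≤s z≤n) le) }
    ; first-side = tt
    ; middle-side = λ r 1≤r lt → middle-zero 1≤r lt 1≤r (before 1≤r lt lt)
    ; last-side = tt
    }
    where
    near-n : a (suc n) n ≡ + 1
    near-n with ℕ.m≤n⇒m<n∨m≡n sn≤N
    ... | inj₁ lt = down n lt
    ... | inj₂ e = down-last n e
    far-zero : ∀ r j → 1 ≤ r → r < n → j ≤ n → suc r < j ⊎ suc j < r → a (β r) j ≡ + 0
    far-zero r zero 1≤r lt le (inj₂ lt') = proj₂ (far 0 (β r) (before 1≤r lt 1≤n) (inj₂ (ℕ.<⇒≢ (β-inner lt' (ℕ.<⇒≤ lt)))))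
    far-zero r j@(suc _) 1≤r lt le f with ℕ.m≤n⇒m<n∨m≡n le
    ... | inj₁ lt' = middle-zero 1≤r lt (s≤s z≤n) (before 1≤r lt lt')
    far-zero r j@(suc _) 1≤r lt le (inj₁ lt') | inj₂ refl = middle-zero 1≤r lt (s≤s z≤n) (β-large 1≤r lt')
    far-zero r j@(suc _) 1≤r lt le (inj₂ lt') | inj₂ refl = ⊥-elim (ℕ.<-asym lt (ℕ.<-trans (ℕ.n<1+n j) lt'))
    first-sym : ∀ j → j ≤ n → a 0 (β j) ≡ a 0 j
    first-sym zero _ = refl
    first-sym (suc zero) _ = trans (proj₁ closing) (sym up-first)
    first-sym (suc (suc j)) le = trans (proj₁ (far 0 (β (suc (suc j))) (ℕ.<-≤-trans 2≤n n≤β) (inj₂ (ℕ.<⇒≢ (β-inner (s≤s (s≤s z≤n)) le)))))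
      (sym (far-arm 0 (suc (suc j)) z≤n le (inj₁ (s≤s (s≤s z≤n)))))
      where
      n≤β : n ≤ β (suc (suc j))
      n≤β with ℕ.m≤n⇒m<n∨m≡n le
      ... | inj₁ lt = ℕ.<⇒≤ (β-above (s≤s z≤n) lt)
      ... | inj₂ e = ℕ.≤-reflexive (sym (trans (cong β e) β-n))
    middle-sym : ∀ r j → 1 ≤ r → r < n → j ≤ n → a r (β j) ℤ.+ a (β r) (β j) ≡ a r j ℤ.+ a (β r) j
    middle-sym r zero 1≤r lt le = refl
    middle-sym r j@(suc _) 1≤r lt le = trans (cong₂ ℤ._+_
        (shifted (β r) j r (β j) (trans (ℕ.+-comm (β r) r) (β-sum 1≤r r≤n)) (β-sum (s≤s z≤n) le) (1≤β 1≤r r≤n) (s≤s z≤n) 1≤r (1≤β (s≤s z≤n) le))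
        (shifted r j (β r) (β j) (β-sum 1≤r r≤n) (β-sum (s≤s z≤n) le) 1≤r (s≤s z≤n) (1≤β 1≤r r≤n) (1≤β (s≤s z≤n) le)))
      (ℤ.+-comm (a (β r) j) (a r j))
      where r≤n = ℕ.<⇒≤ lt

-- fork at one end

eB : ℕ → ℕ → ℕ → ℕ
eB N lo hi =
  if (lo ≡ᵇ 0) ∧ (hi ≡ᵇ 1) then 4
  else if ((hi ≡ᵇ suc lo) ∧ (1 ≤ᵇ lo) ∧ (lo ≤ᵇ N ∸ 3)) ∨ ((lo ≡ᵇ N ∸ 2) ∧ ((hi ≡ᵇ N ∸ 1) ∨ (hi ≡ᵇ N)))
       then 3 else 2

eB-order : ∀ N {i j} → i < j → BondOrder (i ℕ.<ᵇ j) (j ℕ.<ᵇ i) (eB N i j)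
eB-order N {i} {j} lt with (i ≡ᵇ 0) ∧ (j ≡ᵇ 1)
... | true = four (<ᵇ-antisym lt)
... | false with ((j ≡ᵇ suc i) ∧ (1 ≤ᵇ i) ∧ (i ≤ᵇ N ∸ 3)) ∨ ((i ≡ᵇ N ∸ 2) ∧ ((j ≡ᵇ N ∸ 1) ∨ (j ≡ᵇ N)))
...   | true = three
...   | false = two

-- Writing n as m + 2 lets the truncated subtractions in the Coxeter matrix compute.
module SingleFork (m : ℕ) where
  n N : ℕ
  n = suc (suc m)
  N = suc n

  2≤n : 2 ≤ n
  2≤n = s≤s (s≤s z≤n)

  open ArmFolding n 2≤n N (eB N) ℕ._<ᵇ_ (λ lt _ → eB-order N lt) public

  value-< : ∀ {i j c} → i < j → eB N i j ≡ c → a i j ≡ coefficient c (i ℕ.<ᵇ j)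
  value-< {i} {j} lt refl = cartan-< (eB N) ℕ._<ᵇ_ lt

  value-> : ∀ {i j c} → i < j → eB N i j ≡ c → a j i ≡ coefficient c (j ℕ.<ᵇ i)
  value-> {i} {j} lt refl = cartan-> (eB N) ℕ._<ᵇ_ lt

  near : ∀ i → suc (suc i) ≤ n → eB N (suc i) (suc (suc i)) ≡ 3
  near i (s≤s le) with ℕ.m≤n⇒m<n∨m≡n le
  ... | inj₁ (s≤s lt) rewrite ≡ᵇ-yes {i} refl | <ᵇ-yes lt = refl
  ... | inj₂ refl rewrite ≡ᵇ-yes {i} refl | <ᵇ-no {i} {i} ℕ.≤-refl = refl

  prong : eB N (suc m) N ≡ 3
  prong rewrite ≡ᵇ-yes {m} refl | ≡ᵇ-no {suc m} {m} (ℕ.>⇒≢ (ℕ.n<1+n m)) = refl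

  tips : eB N n N ≡ 2
  tips rewrite ≡ᵇ-yes {m} refl | <ᵇ-no {suc m} {m} (ℕ.n≤1+n m) | ≡ᵇ-no {suc m} {m} (ℕ.>⇒≢ (ℕ.n<1+n m)) = refl

  apart : ∀ i j → suc i < j → i ≢ suc m → eB N i j ≡ 2
  apart i (suc zero) (s≤s ()) _
  apart i j@(suc (suc _)) lt ne rewrite Bool.∧-zeroʳ (i ≡ᵇ 0) | ≡ᵇ-no (ℕ.>⇒≢ lt) | ≡ᵇ-no ne = refl

  up-first : a 0 1 ≡ + 2
  up-first = value-< {0} {1} (s≤s z≤n) refl

  up : ∀ i → 1 ≤ i → suc i ≤ n → a i (suc i) ≡ + 1
  up (suc i) _ le = value-< (ℕ.n<1+n (suc i)) (near i le)

  down : ∀ i → suc i ≤ n → a (suc i) i ≡ + 1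
  down zero    le = value-> {0} {1} (s≤s z≤n) refl
  down (suc i) le = value-> (ℕ.n<1+n (suc i)) (near i le)

  far : ∀ i j → suc i < j → i ≢ suc m → a i j ≡ + 0 × a j i ≡ + 0
  far i j lt ne = value-< (ℕ.<-trans (ℕ.n<1+n i) lt) (apart i j lt ne) , value-> (ℕ.<-trans (ℕ.n<1+n i) lt) (apart i j lt ne)

  far-arm : ∀ r j → r ≤ n → j ≤ n → suc r < j ⊎ suc j < r → a r j ≡ + 0
  far-arm r j r≤n j≤n (inj₁ lt) = proj₁ (far r j lt (ℕ.<⇒≢ (ℕ.≤-pred (ℕ.<-≤-trans lt j≤n))))
  far-arm r j r≤n j≤n (inj₂ lt) = proj₂ (far j r lt (ℕ.<⇒≢ (ℕ.≤-pred (ℕ.<-≤-trans lt r≤n))))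

  tip-tip : a n N ≡ + 0 × a N n ≡ + 0
  tip-tip = value-< (ℕ.n<1+n n) tips , value-> (ℕ.n<1+n n) tips

  far-tip : ∀ i → i < suc m → a i N ≡ + 0 × a N i ≡ + 0
  far-tip i lt = far i N (ℕ.m≤n⇒m≤1+n (s≤s lt)) (ℕ.<⇒≢ lt)

  prong-tip : a (suc m) N ≡ + 1 × a N (suc m) ≡ + 1
  prong-tip = value-< (ℕ.m≤n⇒m≤1+n (ℕ.n<1+n (suc m))) prong , value-> (ℕ.m≤n⇒m≤1+n (ℕ.n<1+n (suc m))) prong

  diagonal : ∀ i → a i i ≡ -[1+ 1 ]
  diagonal = cartan-diagonal (eB N) ℕ._<ᵇ_

  β : ℕ → ℕ
  β j = if j ≡ᵇ n then N else j

  β-n : β n ≡ N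
  β-n = cong (if_then N else n) (≡ᵇ-yes {n} refl)

  β-other : ∀ {j} → j ≢ n → β j ≡ j
  β-other {j} ne = cong (if_then N else j) (≡ᵇ-no ne)

  covering : Cover id β (_⊓ n)
  covering = record
    { α-bound = λ j le → ℕ.m≤n⇒m≤1+n le
    ; β-bound = λ j le → β≤N j le
    ; fold-α  = λ j le → ℕ.m≤n⇒m⊓n≡m le
    ; fold-β  = fold-β
    ; cover   = λ t le → ℕ.m⊓n≤n t n , cover′ t le }
    where
    β≤N : ∀ j → j ≤ n → β j ≤ N
    β≤N j le with j ℕ.≟ n
    ... | yes refl = ℕ.≤-reflexive β-n
    ... | no ne = subst (_≤ N) (sym (β-other ne)) (ℕ.m≤n⇒m≤1+n le)
    fold-β : ∀ j → j ≤ n → β j ⊓ n ≡ j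
    fold-β j le with j ℕ.≟ n
    ... | yes refl = trans (cong (_⊓ n) β-n) (ℕ.m≥n⇒m⊓n≡n (ℕ.n≤1+n n))
    ... | no ne = trans (cong (_⊓ n) (β-other ne)) (ℕ.m≤n⇒m⊓n≡m le)
    cover′ : ∀ t → t ≤ N → t ≡ t ⊓ n ⊎ t ≡ β (t ⊓ n)
    cover′ t le with ℕ.m≤n⇒m<n∨m≡n le
    ... | inj₁ (s≤s lt) = inj₁ (sym (ℕ.m≤n⇒m⊓n≡m lt))
    ... | inj₂ refl = inj₂ (sym (trans (cong β (ℕ.m≥n⇒m⊓n≡n (ℕ.n≤1+n n))) β-n))

  tip-symmetric : (E : ℕ → ℤ) → E N ≡ E n → ∀ j → E (β j) ≡ E j
  tip-symmetric E e j with j ℕ.≟ n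
  ... | yes refl = trans (cong E β-n) e
  ... | no ne = cong E (β-other ne)

  -- The two tips together give twice their value to n - 1, where C̃_n has coefficient 1; the
  -- scaling 2, 2, 1 absorbs this.
  fork-rows : Rows id β one one two 2 2 1
  fork-rows = record
    { first-diagonal = diagonal 0
    ; first-next = cong (+ 2 ℤ.*_) up-first
    ; first-far = λ j lt le → far-arm 0 j z≤n le (inj₁ lt)
    ; middle-diagonal = λ r _ _ → diagonal r
    ; middle-first = cong (+ 2 ℤ.*_) (down 0 (s≤s z≤n))
    ; middle-down = λ p _ lt → down p (ℕ.<⇒≤ lt)
    ; middle-up = λ r 1≤r lt → up r 1≤r (ℕ.<⇒≤ lt)
    ; middle-last = λ { r 1≤r refl → cong (+ 2 ℤ.*_) (up r 1≤r ℕ.≤-refl) }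
    ; middle-far = λ r j _ lt le f → far-arm r j (ℕ.<⇒≤ lt) le f
    ; last-diagonal = trans (cong (λ x → a n n ℤ.+ a x n) β-n) (cong₂ ℤ._+_ (diagonal n) (proj₂ tip-tip))
    ; last-previous = λ { p refl → trans (cong (λ x → + 1 ℤ.* (a n p ℤ.+ a x p)) β-n)
                            (cong₂ (λ x y → + 1 ℤ.* (x ℤ.+ y)) (down p ℕ.≤-refl) (proj₂ prong-tip)) }
    ; last-far = λ j lt → trans (cong (λ x → a n j ℤ.+ a x j) β-n)
        (cong₂ ℤ._+_ (far-arm n j ℕ.≤-refl (ℕ.<⇒≤ (ℕ.<-trans (ℕ.n<1+n j) lt)) (inj₂ lt)) (proj₂ (far-tip j (ℕ.≤-pred lt))))
    ; first-symmetric = λ j _ → tip-symmetric (a 0) (trans (proj₁ (far-tip 0 (s≤s z≤n))) (sym (far-arm 0 n z≤n ℕ.≤-refl (inj₁ (s≤s (s≤s z≤n)))))) j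
    ; middle-symmetric = λ r j 1≤r lt _ → tip-symmetric (a r) (middle-tip r 1≤r lt) j
    ; last-symmetric = λ j _ → tip-symmetric (λ t → a n t ℤ.+ a (β n) t)
        (trans (cong (λ x → a n N ℤ.+ a x N) β-n) (trans (cong₂ ℤ._+_ (proj₁ tip-tip) (diagonal N))
          (sym (trans (cong (λ x → a n n ℤ.+ a x n) β-n) (cong₂ ℤ._+_ (diagonal n) (proj₂ tip-tip)))))) j
    ; first-side = tt
    ; middle-side = λ _ _ _ → tt
    ; last-side = trans (cong (λ x → a x n) β-n) (proj₂ tip-tip)
    }
    where
    middle-tip : ∀ r → 1 ≤ r → r < n → a r N ≡ a r n
    middle-tip r 1≤r (s≤s le) with ℕ.m≤n⇒m<n∨m≡n le
    ... | inj₁ lt = trans (proj₁ (far-tip r lt)) (sym (far-arm r n (ℕ.m≤n⇒m≤1+n le) ℕ.≤-refl (inj₁ (s≤s lt))))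
    ... | inj₂ refl = trans (proj₁ prong-tip) (sym (up (suc m) 1≤r ℕ.≤-refl))

-- forks at both ends

eD : ℕ → ℕ → ℕ → ℕ
eD N lo hi =
  if ((hi ≡ᵇ 2) ∧ ((lo ≡ᵇ 0) ∨ (lo ≡ᵇ 1)))
     ∨ ((hi ≡ᵇ suc lo) ∧ (2 ≤ᵇ lo) ∧ (lo ≤ᵇ N ∸ 3))
     ∨ ((lo ≡ᵇ N ∸ 2) ∧ ((hi ≡ᵇ N ∸ 1) ∨ (hi ≡ᵇ N)))
  then 3 else 2

eD-order : ∀ N {b b'} i j → BondOrder b b' (eD N i j)
eD-order N i j with ((j ≡ᵇ 2) ∧ ((i ≡ᵇ 0) ∨ (i ≡ᵇ 1))) ∨ ((j ≡ᵇ suc i) ∧ (2 ≤ᵇ i) ∧ (i ≤ᵇ N ∸ 3))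
                      ∨ ((i ≡ᵇ N ∸ 2) ∧ ((j ≡ᵇ N ∸ 1) ∨ (j ≡ᵇ N)))
... | true = three
... | false = two

module DoubleFork (m : ℕ) where
  n N : ℕ
  n = suc (suc m)
  N = suc (suc n)

  2≤n : 2 ≤ n
  2≤n = s≤s (s≤s z≤n)

  open ArmFolding n 2≤n N (eD N) hA (λ {i} {j} _ _ → eD-order N i j) public

  values : ∀ {i j c} → i < j → eD N i j ≡ c → a i j ≡ coefficient c false × a j i ≡ coefficient c false
  values {i} {j} lt refl = cartan-< (eD N) hA lt , cartan-> (eD N) hA lt

  near : ∀ i → suc (suc i) ≤ n → a (suc (suc i)) (suc (suc (suc i))) ≡ + 1 × a (suc (suc (suc i))) (suc (suc i)) ≡ + 1
  near i (s≤s (s≤s le)) = values {suc (suc i)} {suc (suc (suc i))} (ℕ.n<1+n _) edge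
    where
    edge : eD N (suc (suc i)) (suc (suc (suc i))) ≡ 3
    edge with ℕ.m≤n⇒m<n∨m≡n le
    ... | inj₁ lt rewrite ≡ᵇ-yes {i} refl | <ᵇ-yes lt = refl
    ... | inj₂ refl rewrite ≡ᵇ-yes {i} refl | <ᵇ-no {i} {i} ℕ.≤-refl = refl

  near-0 : a 0 2 ≡ + 1 × a 2 0 ≡ + 1
  near-0 = values {0} {2} (s≤s z≤n) refl

  near-1 : a 1 2 ≡ + 1 × a 2 1 ≡ + 1
  near-1 = values {1} {2} (s≤s (s≤s z≤n)) refl

  first-tips : a 0 1 ≡ + 0 × a 1 0 ≡ + 0
  first-tips = values {0} {1} (s≤s z≤n) refl

  prong : a n N ≡ + 1 × a N n ≡ + 1
  prong = values {n} {N} (ℕ.m≤n⇒m≤1+n (ℕ.n<1+n n)) edge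
    where
    edge : eD N n N ≡ 3
    edge rewrite ≡ᵇ-yes {m} refl | ≡ᵇ-no {suc m} {m} (ℕ.>⇒≢ (ℕ.n<1+n m)) = refl

  last-tips : a (suc n) N ≡ + 0 × a N (suc n) ≡ + 0
  last-tips = values {suc n} {N} (ℕ.n<1+n (suc n)) edge
    where
    edge : eD N (suc n) N ≡ 2
    edge rewrite ≡ᵇ-yes {m} refl | <ᵇ-no {suc m} {m} (ℕ.n≤1+n m) | ≡ᵇ-no {suc m} {m} (ℕ.>⇒≢ (ℕ.n<1+n m)) = refl

  far : ∀ i j → suc i < j → 2 < j → i ≢ n → a i j ≡ + 0 × a j i ≡ + 0
  far i j@(suc (suc (suc _))) lt _ ne = values {i} {j} (ℕ.<-trans (ℕ.n<1+n i) lt) apart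
    where
    apart : eD N i j ≡ 2
    apart rewrite ≡ᵇ-no (ℕ.>⇒≢ lt) | ≡ᵇ-no ne = refl
  far i (suc (suc zero)) lt (s≤s (s≤s ())) ne
  far i (suc zero) lt (s≤s ()) ne

  diagonal : ∀ i → a i i ≡ -[1+ 1 ]
  diagonal = cartan-diagonal (eD N) hA

  α β : ℕ → ℕ
  α zero    = zero
  α (suc j) = suc (suc j)
  β zero    = 1
  β (suc j) = if suc j ≡ᵇ n then N else suc (suc j)

  fold : ℕ → ℕ
  fold (suc (suc t)) = suc t ⊓ n
  fold _             = 0

  β-n : β n ≡ N
  β-n = cong (if_then N else suc n) (≡ᵇ-yes {n} refl)

  β-other : ∀ {j} → suc j ≢ n → β (suc j) ≡ suc (suc j)
  β-other {j} ne = cong (if_then N else suc (suc j)) (≡ᵇ-no ne)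

  covering : Cover α β fold
  covering = record
    { α-bound = α≤N
    ; β-bound = β≤N
    ; fold-α  = λ { zero _ → refl ; (suc j) le → ℕ.m≤n⇒m⊓n≡m le }
    ; fold-β  = fold-β
    ; cover   = cover′ }
    where
    α≤N : ∀ j → j ≤ n → α j ≤ N
    α≤N zero    le = z≤n
    α≤N (suc j) le = s≤s (ℕ.m≤n⇒m≤1+n le)
    β≤N : ∀ j → j ≤ n → β j ≤ N
    β≤N zero    le = s≤s z≤n
    β≤N (suc j) le with suc j ℕ.≟ n
    ... | yes refl = ℕ.≤-reflexive β-n
    ... | no ne = subst (_≤ N) (sym (β-other ne)) (s≤s (ℕ.m≤n⇒m≤1+n le))
    fold-β : ∀ j → j ≤ n → fold (β j) ≡ j
    fold-β zero    le = refl
    fold-β (suc j) le with suc j ℕ.≟ n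
    ... | yes refl = trans (cong fold β-n) (ℕ.m≥n⇒m⊓n≡n (ℕ.n≤1+n n))
    ... | no ne = trans (cong fold (β-other ne)) (ℕ.m≤n⇒m⊓n≡m le)
    cover′ : ∀ t → t ≤ N → fold t ≤ n × (t ≡ α (fold t) ⊎ t ≡ β (fold t))
    cover′ zero le = z≤n , inj₁ refl
    cover′ (suc zero) le = z≤n , inj₂ refl
    cover′ (suc (suc t)) (s≤s (s≤s le)) with ℕ.m≤n⇒m<n∨m≡n le
    ... | inj₁ lt = ℕ.m⊓n≤n (suc t) n , inj₁ (cong α (sym (ℕ.m≤n⇒m⊓n≡m lt)))
    ... | inj₂ refl = ℕ.m⊓n≤n (suc n) n , inj₂ (sym (trans (cong β (ℕ.m≥n⇒m⊓n≡n (ℕ.n≤1+n n))) β-n))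

  tip-symmetric : (E : ℕ → ℤ) → E 1 ≡ E 0 → E N ≡ E (suc n) → ∀ j → E (β j) ≡ E (α j)
  tip-symmetric E e₁ e₂ zero = e₁
  tip-symmetric E e₁ e₂ (suc j) with suc j ℕ.≟ n
  ... | yes refl = trans (cong E β-n) e₂
  ... | no ne = cong E (β-other ne)

  far-0 : ∀ j → 2 < j → a 0 j ≡ + 0 × a j 0 ≡ + 0
  far-0 j lt = far 0 j (ℕ.<-trans (s≤s (s≤s z≤n)) lt) lt λ ()

  far-1 : ∀ j → 2 < j → a 1 j ≡ + 0 × a j 1 ≡ + 0
  far-1 j lt = far 1 j lt lt λ ()

  2<sn : 2 < suc n
  2<sn = s≤s 2≤n

  2<N : 2 < N
  2<N = ℕ.m≤n⇒m≤1+n 2<sn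

  far-arm : ∀ r j → 1 ≤ r → r ≤ n → j ≤ n → suc r < j ⊎ suc j < r → a (suc r) (α j) ≡ + 0
  far-arm r zero    _ r≤n j≤n (inj₂ lt) = proj₂ (far-0 (suc r) (s≤s lt))
  far-arm r (suc j) 1≤r r≤n j≤n (inj₁ lt) = proj₁ (far (suc r) (suc (suc j)) (s≤s lt) (s≤s (ℕ.≤-trans (s≤s 1≤r) (ℕ.<⇒≤ lt)))
    (ℕ.<⇒≢ (ℕ.<-≤-trans lt j≤n)))
  far-arm r (suc j) 1≤r r≤n j≤n (inj₂ lt) = proj₂ (far (suc (suc j)) (suc r) (s≤s lt) (s≤s (ℕ.≤-trans (s≤s (s≤s z≤n)) lt))
    (ℕ.<⇒≢ (ℕ.<-≤-trans lt r≤n)))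

  far-tip : ∀ i → i < n → a i N ≡ + 0 × a N i ≡ + 0
  far-tip i lt = far i N (ℕ.m≤n⇒m≤1+n (s≤s lt)) 2<N (ℕ.<⇒≢ lt)

  -- The end n behaves as for a single fork. At the end 0 the two tips together supply the
  -- coefficient 2 from `r_0` to `r_1`, and that end needs no scaling relative to the middle.
  double-rows : Rows α β two one two 2 2 1
  double-rows = record
    { first-diagonal = cong₂ ℤ._+_ (diagonal 0) (proj₂ first-tips)
    ; first-next = cong₂ (λ x y → + 2 ℤ.* (x ℤ.+ y)) (proj₁ near-0) (proj₁ near-1)
    ; first-far = λ { (suc j) lt le → cong₂ ℤ._+_ (proj₁ (far-0 (suc (suc j)) (s≤s lt))) (proj₁ (far-1 (suc (suc j)) (s≤s lt))) }
    ; middle-diagonal = λ r _ _ → diagonal (α r)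
    ; middle-first = cong (+ 2 ℤ.*_) (proj₂ near-0)
    ; middle-down = λ { (suc p) _ lt → proj₂ (near p (ℕ.<⇒≤ lt)) }
    ; middle-up = λ { (suc r) _ lt → proj₁ (near r (ℕ.<⇒≤ lt)) }
    ; middle-last = λ { (suc r) _ refl → cong (+ 2 ℤ.*_) (proj₁ (near r ℕ.≤-refl)) }
    ; middle-far = λ { r@(suc _) j 1≤r lt le f → far-arm r j 1≤r (ℕ.<⇒≤ lt) le f }
    ; last-diagonal = trans (cong (λ x → a (suc n) (suc n) ℤ.+ a x (suc n)) β-n) (cong₂ ℤ._+_ (diagonal (suc n)) (proj₂ last-tips))
    ; last-previous = λ { (suc p) refl → trans (cong (λ x → + 1 ℤ.* (a (suc n) n ℤ.+ a x n)) β-n)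
                            (cong₂ (λ x y → + 1 ℤ.* (x ℤ.+ y)) (proj₂ (near p ℕ.≤-refl)) (proj₂ prong)) }
    ; last-far = λ j lt → trans (cong (λ x → a (suc n) (α j) ℤ.+ a x (α j)) β-n)
        (cong₂ ℤ._+_ (far-arm n j (s≤s z≤n) ℕ.≤-refl (ℕ.<⇒≤ (ℕ.<-trans (ℕ.n<1+n j) lt)) (inj₂ lt)) (proj₂ (far-tip (α j) (α< j lt))))
    ; first-symmetric = λ j _ → tip-symmetric (λ t → a 0 t ℤ.+ a 1 t)
        (trans (cong₂ ℤ._+_ (proj₁ first-tips) (diagonal 1)) (sym (cong₂ ℤ._+_ (diagonal 0) (proj₂ first-tips))))
        (trans (cong₂ ℤ._+_ (proj₁ (far-0 N 2<N)) (proj₁ (far-1 N 2<N))) (sym (cong₂ ℤ._+_ (proj₁ (far-0 (suc n) 2<sn)) (proj₁ (far-1 (suc n) 2<sn))))) j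
    ; middle-symmetric = λ { (suc r) j 1≤r lt _ → tip-symmetric (a (suc (suc r))) (middle-first-tip r) (middle-tip r lt) j }
    ; last-symmetric = λ j _ → tip-symmetric (λ t → a (suc n) t ℤ.+ a (β n) t)
        (trans (cong (λ x → a (suc n) 1 ℤ.+ a x 1) β-n) (trans (cong₂ ℤ._+_ (proj₂ (far-1 (suc n) 2<sn)) (proj₂ (far-1 N 2<N)))
          (sym (trans (cong (λ x → a (suc n) 0 ℤ.+ a x 0) β-n) (cong₂ ℤ._+_ (proj₂ (far-0 (suc n) 2<sn)) (proj₂ (far-0 N 2<N)))))))
        (trans (cong (λ x → a (suc n) N ℤ.+ a x N) β-n) (trans (cong₂ ℤ._+_ (proj₁ last-tips) (diagonal N))
          (sym (trans (cong (λ x → a (suc n) (suc n) ℤ.+ a x (suc n)) β-n) (cong₂ ℤ._+_ (diagonal (suc n)) (proj₂ last-tips)))))) j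
    ; first-side = proj₂ first-tips
    ; middle-side = λ _ _ _ → tt
    ; last-side = trans (cong (λ x → a x (suc n)) β-n) (proj₂ last-tips)
    }
    where
    α< : ∀ j → suc j < n → α j < n
    α< zero    lt = s≤s z≤n
    α< (suc j) lt = lt
    middle-first-tip : ∀ r → a (suc (suc r)) 1 ≡ a (suc (suc r)) 0
    middle-first-tip zero    = trans (proj₂ near-1) (sym (proj₂ near-0))
    middle-first-tip (suc r) = trans (proj₂ (far-1 (suc (suc (suc r))) (s≤s (s≤s (s≤s z≤n))))) (sym (proj₂ (far-0 (suc (suc (suc r))) (s≤s (s≤s (s≤s z≤n))))))
    middle-tip : ∀ r → suc r < n → a (suc (suc r)) N ≡ a (suc (suc r)) (suc n)
    middle-tip r lt with ℕ.m≤n⇒m<n∨m≡n lt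
    ... | inj₁ lt' = trans (proj₁ (far-tip (suc (suc r)) lt')) (sym (proj₁ (far (suc (suc r)) (suc n) (s≤s lt') 2<sn (ℕ.<⇒≢ lt'))))
    ... | inj₂ refl = trans (proj₁ prong) (sym (proj₁ (near r ℕ.≤-refl)))

-- The seven foldings and their weights

Length : ∀ {n l} → CoxMatrix l → (Fin (suc n) → Word l) → Word (suc n) → ℕ → Set
Length MW φ w m = HasLength MW (hom φ w) m

≡ᵇ⇒≡ : ∀ {i j} → (i ≡ᵇ j) ≡ true → i ≡ j
≡ᵇ⇒≡ {i} {j} e = ℕ.≡ᵇ⇒≡ i j (subst Data.Bool.T (sym e) _)

2n+1 : ∀ n → 2 ℕ.* n ℕ.+ 1 ≡ suc (n ℕ.+ n)
2n+1 n = trans (ℕ.+-comm (2 ℕ.* n) 1) (cong (suc ∘ (n ℕ.+_)) (ℕ.+-identityʳ n))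

2n : ∀ n → 2 ℕ.* n ≡ n ℕ.+ n
2n n = cong (n ℕ.+_) (ℕ.+-identityʳ n)

module _ (n : ℕ) (2≤n : 2 ≤ n) where

  n≢0 : n ≢ 0
  n≢0 = ℕ.>⇒≢ (ℕ.<-≤-trans (s≤s z≤n) 2≤n)

  private
    N₁ = 2 ℕ.* n ℕ.+ 1
    N₂ = 2 ℕ.* n
    N₃ = 2 ℕ.* n ∸ 1

    1≤2n : 1 ≤ 2 ℕ.* n
    1≤2n = ℕ.≤-trans (ℕ.<⇒≤ 2≤n) (ℕ.m≤m+n n _)

    2≤N₁ : 2 ≤ N₁
    2≤N₁ = ℕ.≤-trans 2≤n (ℕ.≤-trans (ℕ.m≤m+n n _) (ℕ.m≤m+n _ 1))

    2≤N₂ : 2 ≤ N₂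
    2≤N₂ = ℕ.≤-trans 2≤n (ℕ.m≤m+n n _)

    odd-≤ : n ℕ.+ n ≤ N₁
    odd-≤ = ℕ.≤-trans (ℕ.n≤1+n _) (ℕ.≤-reflexive (sym (2n+1 n)))

    even-≤ : n ℕ.+ n ≤ N₂
    even-≤ = ℕ.≤-reflexive (sym (2n n))

  groupLength₁ : GroupLength n 3 2 3 (Length (At N₁) (φ1 n))
  groupLength₁ = Fold.Group.groupLength {kₘ = two} {kₙ = three} (s≤s z≤n) (s≤s z≤n) (s≤s z≤n)
      (odd-rows (triple-end refl refl)) (covering (ℕ.≤-reflexive (2n+1 n))) (φ1 n) (λ r → cong (gens N₁) (word (toℕ r)))
    where
    open Doubled n 2≤n N₁ (eA N₁) hA (λ {i} {j} _ _ → eA-order N₁ i j) (circle N₁ 2≤N₁) odd-≤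
    open Odd (2n+1 n)
    word : ∀ i → (if i ≡ᵇ 0 then 0 ∷ N₁ ∷ 0 ∷ [] else if i ≡ᵇ n then n ∷ (n ℕ.+ 1) ∷ n ∷ [] else i ∷ (N₁ ∸ i) ∷ [])
               ≡ letters (choose three two three i) i (β i)
    word zero = refl
    word i@(suc _) with i ≡ᵇ n in eq
    ... | false = refl
    ... | true with ≡ᵇ⇒≡ {i} {n} eq
    ...   | refl = cong (λ x → n ∷ x ∷ n ∷ []) (trans (ℕ.+-comm n 1) (sym β-n))

  groupLength₂ : GroupLength n 3 2 1 (Length (At N₂) (φ2 n))
  groupLength₂ = Fold.Group.groupLength {kₘ = two} {kₙ = one} (s≤s z≤n) (s≤s z≤n) (s≤s z≤n)
      (even-rows (triple-end refl refl)) (covering (ℕ.m≤n⇒m≤1+n (ℕ.≤-reflexive (2n n)))) (φ2 n) (λ r → cong (gens N₂) (word (toℕ r)))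
    where
    open Doubled n 2≤n N₂ (eA N₂) hA (λ {i} {j} _ _ → eA-order N₂ i j) (circle N₂ 2≤N₂) even-≤
    open Even (2n n)
    word : ∀ i → (if i ≡ᵇ 0 then 0 ∷ N₂ ∷ 0 ∷ [] else if i ≡ᵇ n then n ∷ [] else i ∷ (N₂ ∸ i) ∷ [])
               ≡ letters (choose three two one i) i (β i)
    word zero = refl
    word i@(suc _) with i ≡ᵇ n in eq
    ... | false = refl
    ... | true with ≡ᵇ⇒≡ {i} {n} eq
    ...   | refl = refl

  groupLength₃ : GroupLength n 1 2 1 (Length (At N₃) (φ3 n))
  groupLength₃ = Fold.Group.groupLength {kₘ = two} {kₙ = one} (s≤s z≤n) (s≤s z≤n) (s≤s z≤n)
      circle-rows covering (φ3 n) (λ r → cong (gens N₃) (word (toℕ r)))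
    where
    sucN₃ : suc N₃ ≡ 2 ℕ.* n
    sucN₃ = ℕ.m+[n∸m]≡n 1≤2n
    open Circle n 2≤n N₃ (trans sucN₃ (2n n))
    word : ∀ i → (if i ≡ᵇ 0 then 0 ∷ [] else if i ≡ᵇ n then n ∷ [] else i ∷ (2 ℕ.* n ∸ i) ∷ [])
               ≡ letters (choose one two one i) i (β i)
    word zero = refl
    word i@(suc j) with i ≡ᵇ n in eq
    ... | false = cong (λ x → i ∷ x ∷ []) (cong (_∸ i) (sym sucN₃))
    ... | true with ≡ᵇ⇒≡ {i} {n} eq
    ...   | refl = refl

  groupLength₆ : GroupLength n 2 2 3 (Length (Ct N₁) (φ6 n))
  groupLength₆ = Fold.Group.groupLength {kₘ = two} {kₙ = three} (s≤s z≤n) (s≤s z≤n) (s≤s z≤n)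
      (odd-rows (double-end refl refl)) (covering (ℕ.≤-reflexive (2n+1 n))) (φ6 n) (λ r → cong (gens N₁) (word (toℕ r)))
    where
    open Doubled n 2≤n N₁ (eC N₁) (hC N₁) (eC-order′ N₁ 2≤N₁) (line N₁ 2≤N₁) odd-≤
    open Odd (2n+1 n)
    word : ∀ i → (if i ≡ᵇ n then n ∷ (n ℕ.+ 1) ∷ n ∷ [] else i ∷ (N₁ ∸ i) ∷ [])
               ≡ letters (choose two two three i) i (β i)
    word zero rewrite ≡ᵇ-no (n≢0 ∘ sym) = refl
    word i@(suc _) with i ≡ᵇ n in eq
    ... | false = refl
    ... | true with ≡ᵇ⇒≡ {i} {n} eq
    ...   | refl = cong (λ x → n ∷ x ∷ n ∷ []) (trans (ℕ.+-comm n 1) (sym β-n))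

  groupLength₇ : GroupLength n 2 2 1 (Length (Ct N₂) (φ7 n))
  groupLength₇ = Fold.Group.groupLength {kₘ = two} {kₙ = one} (s≤s z≤n) (s≤s z≤n) (s≤s z≤n)
      (even-rows (double-end refl refl)) (covering (ℕ.m≤n⇒m≤1+n (ℕ.≤-reflexive (2n n)))) (φ7 n) (λ r → cong (gens N₂) (word (toℕ r)))
    where
    open Doubled n 2≤n N₂ (eC N₂) (hC N₂) (eC-order′ N₂ 2≤N₂) (line N₂ 2≤N₂) even-≤
    open Even (2n n)
    word : ∀ i → (if i ≡ᵇ n then n ∷ [] else i ∷ (N₂ ∸ i) ∷ [])
               ≡ letters (choose two two one i) i (β i)
    word zero rewrite ≡ᵇ-no (n≢0 ∘ sym) = refl
    word i@(suc _) with i ≡ᵇ n in eq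
    ... | false = refl
    ... | true with ≡ᵇ⇒≡ {i} {n} eq
    ...   | refl = refl

-- φ4 and φ5 with the rank of the big group as an explicit argument, since n + 1 and n + 2 are
-- not successors by computation.
φ4′ : (n N : ℕ) → Fin (suc n) → Word (suc N)
φ4′ n N r = gens N (if toℕ r ≡ᵇ n then n ∷ N ∷ [] else toℕ r ∷ [])

φ5′ : (n n₁ N : ℕ) → Fin (suc n) → Word (suc N)
φ5′ n n₁ N r = gens N (if toℕ r ≡ᵇ 0 then 0 ∷ 1 ∷ [] else if toℕ r ≡ᵇ n then n₁ ∷ N ∷ [] else (toℕ r ℕ.+ 1) ∷ [])

groupLength₄ : ∀ n → 2 ≤ n → GroupLength n 1 1 2 (Length (Bt (n ℕ.+ 1)) (φ4 n))
groupLength₄ n@(suc (suc m)) 2≤n = subst (λ N → GroupLength n 1 1 2 (Length (Bt N) (φ4′ n N))) (ℕ.+-comm 1 n)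
  (Fold.Group.groupLength {kₘ = one} {kₙ = two} (s≤s z≤n) (s≤s z≤n) (s≤s z≤n)
    fork-rows covering (φ4′ n N) (λ r → cong (gens N) (word (toℕ r))))
  where
  open SingleFork m hiding (n; 2≤n)
  word : ∀ i → (if i ≡ᵇ n then n ∷ N ∷ [] else i ∷ []) ≡ letters (choose one one two i) i (β i)
  word zero = refl
  word i@(suc _) with i ≡ᵇ n in eq
  ... | false = refl
  ... | true with ≡ᵇ⇒≡ {i} {n} eq
  ...   | refl = refl
groupLength₄ (suc zero) (s≤s ())

groupLength₅ : ∀ n → 2 ≤ n → GroupLength n 2 1 2 (Length (Dt (n ℕ.+ 2)) (φ5 n))
groupLength₅ n@(suc (suc m)) 2≤n =
  subst (λ n₁ → GroupLength n 2 1 2 (Length (Dt (n ℕ.+ 2)) (φ5′ n n₁ (n ℕ.+ 2)))) (ℕ.+-comm 1 n)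
  (subst (λ N → GroupLength n 2 1 2 (Length (Dt N) (φ5′ n (suc n) N))) (ℕ.+-comm 2 n)
  (Fold.Group.groupLength {kₘ = one} {kₙ = two} (s≤s z≤n) (s≤s z≤n) (s≤s z≤n)
    double-rows covering (φ5′ n (suc n) N) (λ r → cong (gens N) (word (toℕ r)))))
  where
  open DoubleFork m hiding (n; 2≤n)
  word : ∀ i → (if i ≡ᵇ 0 then 0 ∷ 1 ∷ [] else if i ≡ᵇ n then suc n ∷ N ∷ [] else (i ℕ.+ 1) ∷ [])
             ≡ letters (choose two one two i) (α i) (β i)
  word zero = refl
  word i@(suc j) with i ≡ᵇ n in eq
  ... | false = cong (_∷ []) (ℕ.+-comm i 1)
  ... | true with ≡ᵇ⇒≡ {i} {n} eq
  ...   | refl = refl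
groupLength₅ (suc zero) (s≤s ())

-- Rewriting the product into the seven formulas

p m : ℕ → Series
p k = 𝟙 ⊕ X k
m k = 𝟙 ⊖ X k

p-cong : ∀ {i j} → i ≡ j → p i ≋ p j
p-cong e = ≡⇒≋ (cong p e)

m-cong : ∀ {i j} → i ≡ j → m i ≋ m j
m-cong e = ≡⇒≋ (cong m e)

m-double : ∀ k → m (k ℕ.+ k) ≋ m k ⊗ p k
m-double k = ≋-trans (⊕-congˡ 𝟙 (⊝-cong (^s-+ q k k)))
  (solve 1 (λ x → con (+ 1) :- x :* x := (con (+ 1) :- x) :* (con (+ 1) :+ x)) (X k))
  where open SeriesSolver

-- units

Unit : Series → Set
Unit f = f 0 ≡ + 1

m-unit : ∀ k → 1 ≤ k → Unit (m k)
m-unit k le = cong (λ x → + 1 ℤ.+ ℤ.- x) (X-off (1≤⇒≢0 le))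

p-unit : ∀ k → 1 ≤ k → Unit (p k)
p-unit k le = cong (ℤ._+_ (+ 1)) (X-off (1≤⇒≢0 le))

⊗-unit : ∀ f g → Unit f → Unit g → Unit (f ⊗ g)
⊗-unit f g u v = trans (⊗-zero f g) (cong₂ ℤ._*_ u v)

Unit-≋ : ∀ {f g} → f ≋ g → Unit g → Unit f
Unit-≋ e u = trans (at e 0) u

div-≋ : ∀ a b c d → Unit b → Unit d → a ⊗ d ≋ c ⊗ b → a ⊗ inv b ≋ c ⊗ inv d
div-≋ a b c d ub ud e = ⊗-cancelˡ (b ⊗ d) (⊗-unit b d ub ud) (begin
  b ⊗ d ⊗ (a ⊗ inv b) ≈⟨ solve 4 (λ a b d i → b :* d :* (a :* i) := (a :* d) :* (b :* i)) a b d (inv b) ⟩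
  a ⊗ d ⊗ (b ⊗ inv b) ≈⟨ ⊗-cong {a ⊗ d} {c ⊗ b} e (⊗-inverseʳ b ub) ⟩
  c ⊗ b ⊗ 𝟙 ≈⟨ ⊗-congˡ (c ⊗ b) (⊗-inverseʳ d ud) ⟨
  c ⊗ b ⊗ (d ⊗ inv d) ≈⟨ solve 4 (λ c b d i → c :* b :* (d :* i) := b :* d :* (c :* i)) c b d (inv d) ⟩
  b ⊗ d ⊗ (c ⊗ inv d) ∎)
  where open ≋-Reasoning
        open SeriesSolver

inv-unique : ∀ f g → Unit f → f ⊗ g ≋ 𝟙 → g ≋ inv f
inv-unique f g u e = ⊗-cancelˡ f u (≋-trans e (≋-sym (⊗-inverseʳ f u)))

inv-⊗ : ∀ f g → Unit f → Unit g → inv f ⊗ inv g ≋ inv (f ⊗ g)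
inv-⊗ f g u v = inv-unique (f ⊗ g) (inv f ⊗ inv g) (⊗-unit f g u v) (begin
  f ⊗ g ⊗ (inv f ⊗ inv g) ≈⟨ solve 4 (λ f g i j → f :* g :* (i :* j) := (f :* i) :* (g :* j)) f g (inv f) (inv g) ⟩
  f ⊗ inv f ⊗ (g ⊗ inv g) ≈⟨ ⊗-cong {f ⊗ inv f} {𝟙} (⊗-inverseʳ f u) (⊗-inverseʳ g v) ⟩
  𝟙 ⊗ 𝟙 ≈⟨ SR.*-identityˡ 𝟙 ⟩ 𝟙 ∎)
  where open ≋-Reasoning
        open SeriesSolver

inv-cong : ∀ f g → Unit g → f ≋ g → inv f ≋ inv g
inv-cong f g u e = inv-unique g (inv f) u (≋-trans (⊗-congʳ (inv f) (≋-sym e)) (⊗-inverseʳ f (Unit-≋ e u)))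

div-⊗ : ∀ a b c d → Unit b → Unit d → a ⊗ inv b ⊗ (c ⊗ inv d) ≋ a ⊗ c ⊗ inv (b ⊗ d)
div-⊗ a b c d u v = ≋-trans
  (solve 4 (λ a i c j → a :* i :* (c :* j) := a :* c :* (i :* j)) a (inv b) c (inv d))
  (⊗-congˡ (a ⊗ c) (inv-⊗ b d u v))
  where open SeriesSolver

-- finite products

ΠS : ℕ → (ℕ → Series) → Series
ΠS zero    F = 𝟙
ΠS (suc n) F = F 0 ⊗ ΠS n (F ∘ suc)

ΠS-cong : ∀ n {F G} → (∀ i → F i ≋ G i) → ΠS n F ≋ ΠS n G
ΠS-cong zero    e = ≋-refl
ΠS-cong (suc n) {F} {G} e = ⊗-cong {F 0} {G 0} (e 0) (ΠS-cong n (e ∘ suc))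

ΠS-⊗ : ∀ n F G → ΠS n (λ i → F i ⊗ G i) ≋ ΠS n F ⊗ ΠS n G
ΠS-⊗ zero    F G = ≋-sym (SR.*-identityˡ 𝟙)
ΠS-⊗ (suc n) F G = ≋-trans (⊗-congˡ (F 0 ⊗ G 0) (ΠS-⊗ n (F ∘ suc) (G ∘ suc)))
  (solve 4 (λ a b c d → a :* b :* (c :* d) := a :* c :* (b :* d)) (F 0) (G 0) (ΠS n (F ∘ suc)) (ΠS n (G ∘ suc)))
  where open SeriesSolver

ΠS-last : ∀ n F → ΠS (suc n) F ≋ ΠS n F ⊗ F n
ΠS-last zero    F = SR.*-comm (F 0) 𝟙
ΠS-last (suc n) F = ≋-trans (⊗-congˡ (F 0) (ΠS-last n (F ∘ suc))) (≋-sym (SR.*-assoc (F 0) (ΠS n (F ∘ suc)) (F (suc n))))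

ΠS-pairs : ∀ n F → ΠS (n ℕ.+ n) F ≋ ΠS n (λ d → F (d ℕ.+ d) ⊗ F (suc (d ℕ.+ d)))
ΠS-pairs zero    F = ≋-refl
ΠS-pairs (suc n) F = begin
  F 0 ⊗ ΠS (n ℕ.+ suc n) (F ∘ suc) ≡⟨ cong (λ k → F 0 ⊗ ΠS k (F ∘ suc)) (ℕ.+-suc n n) ⟩
  F 0 ⊗ (F 1 ⊗ ΠS (n ℕ.+ n) (F ∘ suc ∘ suc)) ≈⟨ SR.*-assoc (F 0) (F 1) (ΠS (n ℕ.+ n) (F ∘ suc ∘ suc)) ⟨
  F 0 ⊗ F 1 ⊗ ΠS (n ℕ.+ n) (F ∘ suc ∘ suc) ≈⟨ ⊗-congˡ (F 0 ⊗ F 1) (ΠS-pairs n (F ∘ suc ∘ suc)) ⟩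
  F 0 ⊗ F 1 ⊗ ΠS n (λ d → F (suc (suc (d ℕ.+ d))) ⊗ F (suc (suc (suc (d ℕ.+ d)))))
    ≈⟨ ⊗-congˡ (F 0 ⊗ F 1) (ΠS-cong n λ d → ≡⇒≋ (cong (λ k → F (suc k) ⊗ F (suc (suc k))) (sym (ℕ.+-suc d d)))) ⟩
  F 0 ⊗ F 1 ⊗ ΠS n (λ d → F (suc d ℕ.+ suc d) ⊗ F (suc (suc d ℕ.+ suc d))) ∎
  where open ≋-Reasoning

ΠS-unit : ∀ n F → (∀ i → Unit (F i)) → Unit (ΠS n F)
ΠS-unit zero    F u = refl
ΠS-unit (suc n) F u = ⊗-unit (F 0) (ΠS n (F ∘ suc)) (u 0) (ΠS-unit n (F ∘ suc) (u ∘ suc))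

ΠS-inv : ∀ n F → (∀ i → Unit (F i)) → ΠS n (λ i → inv (F i)) ≋ inv (ΠS n F)
ΠS-inv zero    F u = inv-unique 𝟙 𝟙 refl (SR.*-identityˡ 𝟙)
ΠS-inv (suc n) F u = ≋-trans (⊗-congˡ (inv (F 0)) (ΠS-inv n (F ∘ suc) (u ∘ suc)))
  (inv-⊗ (F 0) (ΠS n (F ∘ suc)) (u 0) (ΠS-unit n (F ∘ suc) (u ∘ suc)))

ΠS-div : ∀ n F G → (∀ i → Unit (G i)) → ΠS n (λ i → F i ⊘ G i) ≋ ΠS n F ⊗ inv (ΠS n G)
ΠS-div n F G u = ≋-trans (ΠS-⊗ n F (λ i → inv (G i))) (⊗-congˡ (ΠS n F) (ΠS-inv n G u))

prodR-ΠS : ∀ a b F → prodR a b F ≡ ΠS (suc b ∸ a) (λ i → F (a ℕ.+ i))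
prodR-ΠS a b F = trans (cong (foldr (λ k acc → F k ⊗ acc) 𝟙) (List.map-upTo (a ℕ.+_) (suc b ∸ a))) (go (suc b ∸ a) (a ℕ.+_))
  where
  go : ∀ n g → foldr (λ k acc → F k ⊗ acc) 𝟙 (applyUpTo g n) ≡ ΠS n (F ∘ g)
  go zero    g = refl
  go (suc n) g = cong (F (g 0) ⊗_) (go n (g ∘ suc))

qint-ΣS : ∀ k x → qint k x ≡ ΣS k (x ^s_)
qint-ΣS k x = go k id
  where
  go : ∀ n g → foldr (λ j acc → (x ^s j) ⊕ acc) 𝟘 (applyUpTo g n) ≡ ΣS n (λ j → x ^s g j)
  go zero    g = refl
  go (suc n) g = cong ((x ^s g 0) ⊕_) (go n (g ∘ suc))

-- geometric sums

geometric : ∀ k x → qint k x ⊗ (𝟙 ⊖ x) ≋ 𝟙 ⊖ x ^s k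
geometric k x = ≋-trans (≡⇒≋ (cong (_⊗ (𝟙 ⊖ x)) (qint-ΣS k x))) (go k)
  where
  open SeriesSolver
  go : ∀ k → ΣS k (x ^s_) ⊗ (𝟙 ⊖ x) ≋ 𝟙 ⊖ x ^s k
  go zero = solve 1 (λ x → con (+ 0) :* (con (+ 1) :- x) := con (+ 1) :- con (+ 1)) x
  go (suc k) = ≋-trans (⊗-congʳ (𝟙 ⊖ x) (⊕-congˡ 𝟙 (ΣS-⊗ k x (x ^s_))))
    (≋-trans (solve 2 (λ x s → (con (+ 1) :+ x :* s) :* (con (+ 1) :- x) := (con (+ 1) :- x) :+ x :* (s :* (con (+ 1) :- x))) x (ΣS k (x ^s_)))
      (≋-trans (⊕-congˡ (𝟙 ⊖ x) (⊗-congˡ x (go k)))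
        (solve 2 (λ x y → (con (+ 1) :- x) :+ x :* (con (+ 1) :- y) := con (+ 1) :- x :* y) x (x ^s k))))

^s-cong : ∀ k {f g} → f ≋ g → f ^s k ≋ g ^s k
^s-cong zero    e = ≋-refl
^s-cong (suc k) {f} {g} e = ⊗-cong {f} {g} e (^s-cong k e)

qint-cong : ∀ k {x y} → x ≋ y → qint k x ≋ qint k y
qint-cong k {x} {y} e = ≋-trans (≡⇒≋ (qint-ΣS k x)) (≋-trans (ΣS-cong k λ i _ → ^s-cong i e) (≡⇒≋ (sym (qint-ΣS k y))))

sgn-even : ∀ d → sgn (d ℕ.+ d) ≡ + 1
sgn-even zero = refl
sgn-even (suc d) rewrite ℕ.+-suc d d | sgn-even d = refl

sq-even : ∀ d → sq (d ℕ.+ d) ≋ q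
sq-even d .at i = trans (cong (ℤ._* q i) (sgn-even d)) (ℤ.*-identityˡ (q i))

sq-odd : ∀ d → sq (suc (d ℕ.+ d)) ≋ ⊝ q
sq-odd d .at i = trans (cong (λ s → -[1+ 0 ] ℤ.* s ℤ.* q i) (sgn-even d)) (ℤ.-1*i≡-i (q i))

power-even : ∀ d → (⊝ q) ^s (d ℕ.+ d) ≋ X (d ℕ.+ d)
power-even zero = ≋-refl
power-even (suc d) = begin
  (⊝ q) ⊗ (⊝ q) ^s (d ℕ.+ suc d) ≡⟨ cong (λ k → (⊝ q) ⊗ (⊝ q) ^s k) (ℕ.+-suc d d) ⟩
  (⊝ q) ⊗ ((⊝ q) ⊗ (⊝ q) ^s (d ℕ.+ d)) ≈⟨ ⊗-congˡ (⊝ q) (⊗-congˡ (⊝ q) (power-even d)) ⟩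
  (⊝ q) ⊗ ((⊝ q) ⊗ X (d ℕ.+ d)) ≈⟨ solve 2 (λ q x → :- q :* (:- q :* x) := q :* (q :* x)) q (X (d ℕ.+ d)) ⟩
  q ⊗ (q ⊗ X (d ℕ.+ d)) ≡⟨ cong (λ k → q ⊗ X k) (ℕ.+-suc d d) ⟨
  X (suc d ℕ.+ suc d) ∎
  where open ≋-Reasoning
        open SeriesSolver

power-odd : ∀ d → (⊝ q) ^s suc (d ℕ.+ d) ≋ ⊝ X (suc (d ℕ.+ d))
power-odd d = ≋-trans (⊗-congˡ (⊝ q) (power-even d)) (solve 2 (λ q x → :- q :* x := :- (q :* x)) q (X (d ℕ.+ d)))
  where open SeriesSolver

1⊖⊝q : 𝟙 ⊖ (⊝ q) ≋ p 1
1⊖⊝q = solve 1 (λ q → con (+ 1) :- (:- q) := con (+ 1) :+ q :* con (+ 1)) q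
  where open SeriesSolver

1⊖q : 𝟙 ⊖ q ≋ m 1
1⊖q = solve 1 (λ q → con (+ 1) :- q := con (+ 1) :- q :* con (+ 1)) q
  where open SeriesSolver

qint-even : ∀ d → qint (d ℕ.+ d) (sq (d ℕ.+ d)) ⊗ m 1 ≋ m (d ℕ.+ d)
qint-even d = ≋-trans (⊗-cong {qint (d ℕ.+ d) (sq (d ℕ.+ d))} {qint (d ℕ.+ d) q} (qint-cong (d ℕ.+ d) (sq-even d)) (≋-sym 1⊖q))
  (geometric (d ℕ.+ d) q)

qint-odd : ∀ d → qint (suc (d ℕ.+ d)) (sq (suc (d ℕ.+ d))) ⊗ p 1 ≋ p (suc (d ℕ.+ d))
qint-odd d = ≋-trans (⊗-cong {qint k (sq k)} {qint k (⊝ q)} (qint-cong k (sq-odd d)) (≋-sym 1⊖⊝q))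
  (≋-trans (geometric k (⊝ q)) (≋-trans (⊕-congˡ 𝟙 (⊝-cong (power-odd d)))
    (solve 1 (λ x → con (+ 1) :- (:- x) := con (+ 1) :+ x) (X k))))
  where open SeriesSolver
        k = suc (d ℕ.+ d)

tint-m : ∀ T k → tint T k ⊗ m T ≋ m (k ℕ.* T)
tint-m T zero = solve 1 (λ x → con (+ 0) :* (con (+ 1) :- x) := con (+ 1) :- con (+ 1)) (X T)
  where open SeriesSolver
tint-m T (suc k) = begin
  (𝟙 ⊕ ΣS k (λ j → X (suc j ℕ.* T))) ⊗ m T
    ≈⟨ ⊗-congʳ (m T) (⊕-congˡ 𝟙 (≋-trans (ΣS-cong k λ j _ → ^s-+ q T (j ℕ.* T)) (ΣS-⊗ k (X T) (λ j → X (j ℕ.* T))))) ⟩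
  (𝟙 ⊕ X T ⊗ tint T k) ⊗ m T
    ≈⟨ solve 2 (λ x s → (con (+ 1) :+ x :* s) :* (con (+ 1) :- x) := (con (+ 1) :- x) :+ x :* (s :* (con (+ 1) :- x))) (X T) (tint T k) ⟩
  m T ⊕ X T ⊗ (tint T k ⊗ m T) ≈⟨ ⊕-congˡ (m T) (⊗-congˡ (X T) (tint-m T k)) ⟩
  m T ⊕ X T ⊗ m (k ℕ.* T)
    ≈⟨ solve 2 (λ x y → (con (+ 1) :- x) :+ x :* (con (+ 1) :- y) := con (+ 1) :- x :* y) (X T) (X (k ℕ.* T)) ⟩
  𝟙 ⊖ X T ⊗ X (k ℕ.* T) ≈⟨ ⊕-congˡ 𝟙 (⊝-cong (^s-+ q T (k ℕ.* T))) ⟨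
  m (T ℕ.+ k ℕ.* T) ∎
  where open ≋-Reasoning
        open SeriesSolver

double-*2 : ∀ d → d ℕ.* 2 ≡ d ℕ.+ d
double-*2 d = trans (ℕ.*-comm d 2) (cong (d ℕ.+_) (ℕ.+-identityʳ d))

-- [2e]_q [2d+1]_{-q} = (1 + q^{2d+1}) [e]_{q²}
qint-pair : ∀ e d → qint (e ℕ.+ e) (sq (e ℕ.+ e)) ⊗ qint (suc (d ℕ.+ d)) (sq (suc (d ℕ.+ d))) ≋ p (suc (d ℕ.+ d)) ⊗ tint 2 e
qint-pair e d = ⊗-cancelˡ (m 2) (m-unit 2 (s≤s z≤n)) (begin
  m 2 ⊗ (a ⊗ b) ≈⟨ ⊗-congʳ (a ⊗ b) (m-double 1) ⟩
  m 1 ⊗ p 1 ⊗ (a ⊗ b) ≈⟨ solve 4 (λ m p a b → m :* p :* (a :* b) := (a :* m) :* (b :* p)) (m 1) (p 1) a b ⟩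
  a ⊗ m 1 ⊗ (b ⊗ p 1) ≈⟨ ⊗-cong {a ⊗ m 1} {m (e ℕ.+ e)} (qint-even e) (qint-odd d) ⟩
  m (e ℕ.+ e) ⊗ p (suc (d ℕ.+ d)) ≈⟨ ⊗-congʳ (p (suc (d ℕ.+ d))) (≋-trans (m-cong (sym (double-*2 e))) (≋-sym (tint-m 2 e))) ⟩
  tint 2 e ⊗ m 2 ⊗ p (suc (d ℕ.+ d)) ≈⟨ solve 3 (λ t m p → t :* m :* p := m :* (p :* t)) (tint 2 e) (m 2) (p (suc (d ℕ.+ d))) ⟩
  m 2 ⊗ (p (suc (d ℕ.+ d)) ⊗ tint 2 e) ∎)
  where open ≋-Reasoning
        open SeriesSolver
        a = qint (e ℕ.+ e) (sq (e ℕ.+ e))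
        b = qint (suc (d ℕ.+ d)) (sq (suc (d ℕ.+ d)))

plus-ΠS : ∀ T c n → plus T c n ≋ ΠS n (λ i → p (c ℕ.+ i ℕ.* T))
plus-ΠS T c zero = ≋-refl
plus-ΠS T c (suc n) = ⊗-cong {p c} {p (c ℕ.+ 0)} (p-cong (sym (ℕ.+-identityʳ c)))
  (≋-trans (plus-ΠS T (c ℕ.+ T) n) (ΠS-cong n λ i → p-cong (ℕ.+-assoc c T (i ℕ.* T))))

minus-unit : ∀ T c n → 1 ≤ c → Unit (minus T c n)
minus-unit T c zero    le = refl
minus-unit T c (suc n) le = ⊗-unit (m c) (minus T (c ℕ.+ T) n) (m-unit c le) (minus-unit T (c ℕ.+ T) n (ℕ.≤-trans le (ℕ.m≤m+n c T)))

seriesB-ΠS : ∀ A T n → seriesB A T n ≋ ΠS n (λ i → p (A ℕ.+ i ℕ.* T) ⊗ tint T (suc i))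
seriesB-ΠS A T zero    = ≋-refl
seriesB-ΠS A T (suc n) = ≋-trans (⊗-congˡ F (seriesB-ΠS A T n)) (≋-trans (SR.*-comm F (ΠS n G)) (≋-sym (ΠS-last n G)))
  where
  F = p (A ℕ.+ n ℕ.* T) ⊗ tint T (suc n)
  G : ℕ → Series
  G i = p (A ℕ.+ i ℕ.* T) ⊗ tint T (suc i)

target : (A T B : ℕ) → ℕ → Series
target A T B n = plus T B n ⊗ inv (minus T (A ℕ.+ B ℕ.+ (n ∸ 1) ℕ.* T) n) ⊗ seriesB A T n

ps : (T c n : ℕ) → Series
ps T c n = ΠS n (λ i → p (c ℕ.+ i ℕ.* T))

ts : (T n : ℕ) → Series
ts T n = ΠS n (λ i → tint T (suc i))

target-form : ∀ A T B D n → A ℕ.+ B ℕ.+ (n ∸ 1) ℕ.* T ≡ D →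
              target A T B n ≋ ps T B n ⊗ (ps T A n ⊗ ts T n) ⊗ inv (minus T D n)
target-form A T B D n refl = begin
  plus T B n ⊗ I ⊗ seriesB A T n
    ≈⟨ ⊗-cong {plus T B n ⊗ I} {ps T B n ⊗ I} (⊗-congʳ I (plus-ΠS T B n))
         (≋-trans (seriesB-ΠS A T n) (ΠS-⊗ n (λ i → p (A ℕ.+ i ℕ.* T)) (λ i → tint T (suc i)))) ⟩
  ps T B n ⊗ I ⊗ (ps T A n ⊗ ts T n)
    ≈⟨ solve 3 (λ a i b → a :* i :* b := a :* b :* i) (ps T B n) I (ps T A n ⊗ ts T n) ⟩
  ps T B n ⊗ (ps T A n ⊗ ts T n) ⊗ I ∎
  where open ≋-Reasoning
        open SeriesSolver
        I = inv (minus T D n)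

minus-ΠS : ∀ T c n → minus T c n ≋ ΠS n (λ i → m (c ℕ.+ i ℕ.* T))
minus-ΠS T c zero = ≋-refl
minus-ΠS T c (suc n) = ⊗-cong {m c} {m (c ℕ.+ 0)} (m-cong (sym (ℕ.+-identityʳ c)))
  (≋-trans (minus-ΠS T (c ℕ.+ T) n) (ΠS-cong n λ i → m-cong (ℕ.+-assoc c T (i ℕ.* T))))

minus-last : ∀ T c n → minus T c (suc n) ≋ minus T c n ⊗ m (c ℕ.+ n ℕ.* T)
minus-last T c n = ≋-trans (minus-ΠS T c (suc n)) (≋-trans (ΠS-last n (λ i → m (c ℕ.+ i ℕ.* T)))
  (⊗-congʳ (m (c ℕ.+ n ℕ.* T)) (≋-sym (minus-ΠS T c n))))

-- Raising the starting exponent by T removes the factor `m c` and appends two factors at the far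
-- end; R is what these leave after division by `m c`. The inductive steps of `minus-step1` and
-- `minus-step2` have this form.
minus-slide : ∀ T c k R → 1 ≤ c → m (c ℕ.+ k ℕ.* T) ⊗ m (c ℕ.+ suc k ℕ.* T) ≋ m c ⊗ R →
              minus T (c ℕ.+ T) (suc k) ≋ minus T c k ⊗ R
minus-slide T c k R 1≤c e = ⊗-cancelˡ (m c) (m-unit c 1≤c) (begin
  m c ⊗ minus T (c ℕ.+ T) (suc k) ≈⟨ minus-last T c (suc k) ⟩
  minus T c (suc k) ⊗ b ≈⟨ ⊗-congʳ b (minus-last T c k) ⟩
  minus T c k ⊗ a ⊗ b ≈⟨ SR.*-assoc (minus T c k) a b ⟩
  minus T c k ⊗ (a ⊗ b) ≈⟨ ⊗-congˡ (minus T c k) e ⟩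
  minus T c k ⊗ (m c ⊗ R) ≈⟨ solve 3 (λ x y z → x :* (y :* z) := y :* (x :* z)) (minus T c k) (m c) R ⟩
  m c ⊗ (minus T c k ⊗ R) ∎)
  where open ≋-Reasoning
        open SeriesSolver
        a = m (c ℕ.+ k ℕ.* T)
        b = m (c ℕ.+ suc k ℕ.* T)

-- Cases 6, 7 and 5, where the denominators agree.
assemble : ∀ T A B n D M N → Unit (minus T D n) → A ℕ.+ B ℕ.+ (n ∸ 1) ℕ.* T ≡ D →
  M ≋ ps T B n ⊗ ts T n → N ≋ ps T A n ⊗ inv (minus T D n) → M ⊗ N ≋ target A T B n
assemble T A B n D M N u d eM eN = ≋-trans (⊗-cong {M} {ps T B n ⊗ ts T n} eM eN)
  (≋-trans (solve 4 (λ b t a i → b :* t :* (a :* i) := b :* (a :* t) :* i) (ps T B n) (ts T n) (ps T A n) (inv (minus T D n)))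
    (≋-sym (target-form A T B D n d)))
  where open SeriesSolver

quotients : ∀ T c D n (F : ℕ → ℕ) (G : ℕ → ℕ) → (∀ i → F (suc i) ≡ c ℕ.+ i ℕ.* T) → (∀ i → G (suc i) ≡ D ℕ.+ i ℕ.* T) → 1 ≤ D →
  prodR 1 n (λ k → p (F k) ⊘ m (G k)) ≋ ps T c n ⊗ inv (minus T D n)
quotients T c D n F G eF eG 1≤D = ≋-trans (≡⇒≋ (prodR-ΠS 1 n (λ k → p (F k) ⊘ m (G k))))
  (≋-trans (ΠS-div n (λ i → p (F (suc i))) (λ i → m (G (suc i)))
      (λ i → m-unit (G (suc i)) (subst (1 ≤_) (sym (eG i)) (ℕ.≤-trans 1≤D (ℕ.m≤m+n D (i ℕ.* T))))))
    (⊗-cong {ΠS n (λ i → p (F (suc i)))} {ps T c n} (ΠS-cong n (p-cong ∘ eF))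
      (inv-cong (ΠS n (λ i → m (G (suc i)))) (minus T D n) (minus-unit T D n 1≤D)
        (≋-trans (ΠS-cong n (m-cong ∘ eG)) (≋-sym (minus-ΠS T D n))))))

Qs : ℕ → Series
Qs k = qint k (sq k)

Qs-cong : ∀ {i j} → i ≡ j → Qs i ≋ Qs j
Qs-cong e = ≡⇒≋ (cong Qs e)

Qs-one : Qs 1 ≋ 𝟙
Qs-one = SR.+-identityʳ 𝟙

double-suc : ∀ d → suc (suc (d ℕ.+ d)) ≡ suc d ℕ.+ suc d
double-suc d = cong suc (sym (ℕ.+-suc d d))

odd-2 : ∀ d → suc (d ℕ.+ d) ≡ 1 ℕ.+ d ℕ.* 2
odd-2 d = cong suc (sym (double-*2 d))

2*-double : ∀ n → 2 ℕ.* n ≡ n ℕ.+ n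
2*-double n = cong (n ℕ.+_) (ℕ.+-identityʳ n)

case7 : ∀ n → 1 ≤ n → U7 n ≋ target 2 2 1 n
case7 n@(suc n') _ = assemble 2 2 1 n (1 ℕ.+ n ℕ.* 2) _ _ (minus-unit 2 (1 ℕ.+ n ℕ.* 2) n (s≤s z≤n)) refl first
    (quotients 2 2 (1 ℕ.+ n ℕ.* 2) n (2 ℕ.*_) (λ k → 2 ℕ.* (n ℕ.+ k) ∸ 1)
      (λ i → N.solve 1 (λ i → N.con 2 N.:* (N.con 1 N.:+ i) N.:= N.con 2 N.:+ i N.:* N.con 2) i)
      (λ i → cong (_∸ 1) (N.solve 2 (λ n i → N.con 2 N.:* (n N.:+ (N.con 1 N.:+ i)) N.:= N.con 2 N.:+ (n N.:* N.con 2 N.:+ i N.:* N.con 2)) n i))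
      (s≤s z≤n))
  where
  open ≋-Reasoning
  first : prodR 1 (2 ℕ.* n) Qs ≋ ps 2 1 n ⊗ ts 2 n
  first = begin
    prodR 1 (2 ℕ.* n) Qs ≡⟨ prodR-ΠS 1 (2 ℕ.* n) Qs ⟩
    ΠS (2 ℕ.* n) (Qs ∘ suc) ≡⟨ cong (λ k → ΠS k (Qs ∘ suc)) (2*-double n) ⟩
    ΠS (n ℕ.+ n) (Qs ∘ suc) ≈⟨ ΠS-pairs n (Qs ∘ suc) ⟩
    ΠS n (λ d → Qs (suc (d ℕ.+ d)) ⊗ Qs (suc (suc (d ℕ.+ d)))) ≈⟨ ΠS-cong n pair ⟩
    ΠS n (λ d → p (1 ℕ.+ d ℕ.* 2) ⊗ tint 2 (suc d)) ≈⟨ ΠS-⊗ n (λ d → p (1 ℕ.+ d ℕ.* 2)) (λ d → tint 2 (suc d)) ⟩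
    ps 2 1 n ⊗ ts 2 n ∎
    where
    pair : ∀ d → Qs (suc (d ℕ.+ d)) ⊗ Qs (suc (suc (d ℕ.+ d))) ≋ p (1 ℕ.+ d ℕ.* 2) ⊗ tint 2 (suc d)
    pair d = begin
      Qs (suc (d ℕ.+ d)) ⊗ Qs (suc (suc (d ℕ.+ d))) ≈⟨ SR.*-comm (Qs (suc (d ℕ.+ d))) (Qs (suc (suc (d ℕ.+ d)))) ⟩
      Qs (suc (suc (d ℕ.+ d))) ⊗ Qs (suc (d ℕ.+ d)) ≈⟨ ⊗-congʳ (Qs (suc (d ℕ.+ d))) (Qs-cong (double-suc d)) ⟩
      Qs (suc d ℕ.+ suc d) ⊗ Qs (suc (d ℕ.+ d)) ≈⟨ qint-pair (suc d) d ⟩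
      p (suc (d ℕ.+ d)) ⊗ tint 2 (suc d) ≈⟨ ⊗-congʳ (tint 2 (suc d)) (p-cong (odd-2 d)) ⟩
      p (1 ℕ.+ d ℕ.* 2) ⊗ tint 2 (suc d) ∎

next-pair : ∀ d → Qs (suc (suc (d ℕ.+ d))) ⊗ Qs (suc (suc (suc (d ℕ.+ d)))) ≋ p (3 ℕ.+ d ℕ.* 2) ⊗ tint 2 (suc d)
next-pair d = begin
  Qs (suc (suc (d ℕ.+ d))) ⊗ Qs (suc (suc (suc (d ℕ.+ d))))
    ≡⟨ cong₂ (λ i j → Qs i ⊗ Qs j) (double-suc d) (cong suc (double-suc d)) ⟩
  Qs (suc d ℕ.+ suc d) ⊗ Qs (suc (suc d ℕ.+ suc d)) ≈⟨ qint-pair (suc d) (suc d) ⟩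
  p (suc (suc d ℕ.+ suc d)) ⊗ tint 2 (suc d) ≈⟨ ⊗-congʳ (tint 2 (suc d)) (p-cong (odd-2 (suc d))) ⟩
  p (3 ℕ.+ d ℕ.* 2) ⊗ tint 2 (suc d) ∎
  where open ≋-Reasoning

2n+1-double : ∀ n → 2 ℕ.* n ℕ.+ 1 ≡ suc (n ℕ.+ n)
2n+1-double n = trans (ℕ.+-comm (2 ℕ.* n) 1) (cong suc (2*-double n))

case6 : ∀ n → 1 ≤ n → U6 n ≋ target 2 2 3 n
case6 n@(suc n') _ = assemble 2 2 3 n (3 ℕ.+ n ℕ.* 2) _ _ (minus-unit 2 (3 ℕ.+ n ℕ.* 2) n (s≤s z≤n)) refl first
    (quotients 2 2 (3 ℕ.+ n ℕ.* 2) n (2 ℕ.*_) (λ k → 2 ℕ.* (n ℕ.+ k) ℕ.+ 1)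
      (λ i → N.solve 1 (λ i → N.con 2 N.:* (N.con 1 N.:+ i) N.:= N.con 2 N.:+ i N.:* N.con 2) i)
      (λ i → N.solve 2 (λ n i → N.con 2 N.:* (n N.:+ (N.con 1 N.:+ i)) N.:+ N.con 1 N.:= N.con 3 N.:+ n N.:* N.con 2 N.:+ i N.:* N.con 2) n i)
      (s≤s z≤n))
  where
  open ≋-Reasoning
  first : prodR 1 (2 ℕ.* n ℕ.+ 1) Qs ≋ ps 2 3 n ⊗ ts 2 n
  first = begin
    prodR 1 (2 ℕ.* n ℕ.+ 1) Qs ≡⟨ prodR-ΠS 1 (2 ℕ.* n ℕ.+ 1) Qs ⟩
    ΠS (2 ℕ.* n ℕ.+ 1) (Qs ∘ suc) ≡⟨ cong (λ k → ΠS k (Qs ∘ suc)) (2n+1-double n) ⟩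
    Qs 1 ⊗ ΠS (n ℕ.+ n) (Qs ∘ suc ∘ suc) ≈⟨ ⊗-cong {Qs 1} {𝟙} Qs-one (ΠS-pairs n (Qs ∘ suc ∘ suc)) ⟩
    𝟙 ⊗ ΠS n (λ d → Qs (suc (suc (d ℕ.+ d))) ⊗ Qs (suc (suc (suc (d ℕ.+ d)))))
      ≈⟨ SR.*-identityˡ (ΠS n (λ d → Qs (suc (suc (d ℕ.+ d))) ⊗ Qs (suc (suc (suc (d ℕ.+ d)))))) ⟩
    ΠS n (λ d → Qs (suc (suc (d ℕ.+ d))) ⊗ Qs (suc (suc (suc (d ℕ.+ d))))) ≈⟨ ΠS-cong n next-pair ⟩
    ΠS n (λ d → p (3 ℕ.+ d ℕ.* 2) ⊗ tint 2 (suc d)) ≈⟨ ΠS-⊗ n (λ d → p (3 ℕ.+ d ℕ.* 2)) (λ d → tint 2 (suc d)) ⟩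
    ps 2 3 n ⊗ ts 2 n ∎

-- the factors [2k+1]_q - q^k = (1 + q^(k+1)) [k]_q

gap : ∀ k → qint (2 ℕ.* k ℕ.+ 1) q ⊖ q ^s k ≋ p (k ℕ.+ 1) ⊗ tint 1 k
gap k = begin
  qint (2 ℕ.* k ℕ.+ 1) q ⊖ X k ≡⟨ cong (_⊖ X k) (trans (qint-ΣS (2 ℕ.* k ℕ.+ 1) q) (cong (λ i → ΣS i X) split)) ⟩
  ΣS (k ℕ.+ suc k) X ⊖ X k
    ≈⟨ ⊕-congʳ (⊝ X k) (≋-trans (ΣS-+ k (suc k) X) (⊕-congˡ (ΣS k X)
         (⊕-cong {X (k ℕ.+ 0)} {X k} (≡⇒≋ (cong X (ℕ.+-identityʳ k)))
           (≋-trans (ΣS-cong k λ i _ → ≋-trans (≡⇒≋ (cong X (trans (ℕ.+-suc k i) (cong (ℕ._+ i) (ℕ.+-comm 1 k))))) (^s-+ q (k ℕ.+ 1) i))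
                    (ΣS-⊗ k (X (k ℕ.+ 1)) X))))) ⟩
  ΣS k X ⊕ (X k ⊕ X (k ℕ.+ 1) ⊗ ΣS k X) ⊖ X k
    ≈⟨ solve 3 (λ s x y → s :+ (x :+ y :* s) :- x := (con (+ 1) :+ y) :* s) (ΣS k X) (X k) (X (k ℕ.+ 1)) ⟩
  p (k ℕ.+ 1) ⊗ ΣS k X ≈⟨ ⊗-congˡ (p (k ℕ.+ 1)) (ΣS-cong k λ j _ → ≡⇒≋ (cong X (sym (ℕ.*-identityʳ j)))) ⟩
  p (k ℕ.+ 1) ⊗ tint 1 k ∎
  where
  open ≋-Reasoning
  open SeriesSolver
  split : 2 ℕ.* k ℕ.+ 1 ≡ k ℕ.+ suc k
  split = N.solve 1 (λ k → N.con 2 N.:* k N.:+ N.con 1 N.:= k N.:+ (N.con 1 N.:+ k)) k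

-- The irregular prefactor consists of the factors [2k+1] - q^k for k = 1 and k = 2.
prefix : qint 2 q ⊗ qint 3 (⊝ q) ⊗ qint 4 q ≋ (p 2 ⊗ tint 1 1) ⊗ (p 3 ⊗ tint 1 2)
prefix = solve 1 (λ q →
    let z = con (+ 0) ; o = con (+ 1) in
    (o :+ (q :* o :+ z)) :* (o :+ ((:- q) :* o :+ ((:- q) :* ((:- q) :* o) :+ z))) :*
      (o :+ (q :* o :+ (q :* (q :* o) :+ (q :* (q :* (q :* o)) :+ z))))
    := ((o :+ q :* (q :* o)) :* (o :+ z)) :* ((o :+ q :* (q :* (q :* o))) :* (o :+ (q :* o :+ z)))) q
  where open SeriesSolver

gaps : ℕ → Series
gaps i = p (2 ℕ.+ i ℕ.* 1) ⊗ tint 1 (suc i)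

prefixed : ∀ n' → qint 2 q ⊗ qint 3 (⊝ q) ⊗ qint 4 q ⊗ ΠS n' (λ i → qint (2 ℕ.* (3 ℕ.+ i) ℕ.+ 1) q ⊖ q ^s (3 ℕ.+ i)) ≋ ΠS (2 ℕ.+ n') gaps
prefixed n' = ≋-trans (⊗-cong {qint 2 q ⊗ qint 3 (⊝ q) ⊗ qint 4 q} {gaps 0 ⊗ gaps 1} prefix
    (ΠS-cong n' λ i → ≋-trans (gap (3 ℕ.+ i)) (⊗-congʳ (tint 1 (3 ℕ.+ i)) (p-cong
      (N.solve 1 (λ i → N.con 3 N.:+ i N.:+ N.con 1 N.:= N.con 4 N.:+ i N.:* N.con 1) i)))))
  (SR.*-assoc (gaps 0) (gaps 1) (ΠS n' (gaps ∘ suc ∘ suc)))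

case5 : ∀ n → 2 ≤ n → U5 n ≋ target 2 1 2 n
case5 n@(suc (suc n')) _ = assemble 1 2 2 n (3 ℕ.+ n) _ _ (minus-unit 1 (3 ℕ.+ n) n (s≤s z≤n)) (cong (4 ℕ.+_) (ℕ.*-identityʳ (suc n')))
    (≋-trans (⊗-congˡ (qint 2 q ⊗ qint 3 (⊝ q) ⊗ qint 4 q) (≡⇒≋ (prodR-ΠS 3 n (λ k → qint (2 ℕ.* k ℕ.+ 1) q ⊖ q ^s k))))
      (≋-trans (prefixed n') (ΠS-⊗ n (λ i → p (2 ℕ.+ i ℕ.* 1)) (λ i → tint 1 (suc i)))))
    (quotients 1 2 (3 ℕ.+ n) n (ℕ._+ 1) (λ k → n ℕ.+ k ℕ.+ 2)
      (λ i → N.solve 1 (λ i → N.con 1 N.:+ i N.:+ N.con 1 N.:= N.con 2 N.:+ i N.:* N.con 1) i)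
      (λ i → N.solve 2 (λ n i → n N.:+ (N.con 1 N.:+ i) N.:+ N.con 2 N.:= N.con 3 N.:+ n N.:+ i N.:* N.con 1) n i)
      (s≤s z≤n))
case5 (suc zero) (s≤s ())

-- case 4

-- An Euler-type identity: by 1 - q^(2k) = (1 - q^k)(1 + q^k) the even exponents among n + 1, ...,
-- 2n + 1 are halved repeatedly, leaving all odd exponents up to 2n + 1 and the factors 1 + q^k for
-- k ≤ n.
minus-step1 : ∀ n → minus 1 (suc n) (suc n) ≋ m 1 ⊗ ΠS n (λ i → p (1 ℕ.+ i ℕ.* 1) ⊗ m (3 ℕ.+ i ℕ.* 2))
minus-step1 zero = ≋-refl
minus-step1 (suc n) = begin
  minus 1 (suc (suc n)) (suc (suc n)) ≡⟨ cong (λ c → minus 1 c (suc (suc n))) (ℕ.+-comm 1 (suc n)) ⟩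
  minus 1 (suc n ℕ.+ 1) (suc (suc n)) ≈⟨ minus-slide 1 (suc n) (suc n) (p (suc n) ⊗ m (3 ℕ.+ n ℕ.* 2)) (s≤s z≤n) double ⟩
  minus 1 (suc n) (suc n) ⊗ (p (suc n) ⊗ m (3 ℕ.+ n ℕ.* 2))
    ≈⟨ ⊗-cong {minus 1 (suc n) (suc n)} {m 1 ⊗ ΠS n F} (minus-step1 n) (⊗-congʳ (m (3 ℕ.+ n ℕ.* 2)) (p-cong (cong suc (sym (ℕ.*-identityʳ n))))) ⟩
  m 1 ⊗ ΠS n F ⊗ F n ≈⟨ SR.*-assoc (m 1) (ΠS n F) (F n) ⟩
  m 1 ⊗ (ΠS n F ⊗ F n) ≈⟨ ⊗-congˡ (m 1) (ΠS-last n F) ⟨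
  m 1 ⊗ ΠS (suc n) F ∎
  where
  open ≋-Reasoning
  F : ℕ → Series
  F i = p (1 ℕ.+ i ℕ.* 1) ⊗ m (3 ℕ.+ i ℕ.* 2)
  double : m (suc n ℕ.+ suc n ℕ.* 1) ⊗ m (suc n ℕ.+ suc (suc n) ℕ.* 1) ≋ m (suc n) ⊗ (p (suc n) ⊗ m (3 ℕ.+ n ℕ.* 2))
  double = ≋-trans (⊗-cong {m (suc n ℕ.+ suc n ℕ.* 1)} {m (suc n) ⊗ p (suc n)}
      (≋-trans (m-cong (cong (suc n ℕ.+_) (ℕ.*-identityʳ (suc n)))) (m-double (suc n)))
      (m-cong (N.solve 1 (λ n → N.con 1 N.:+ n N.:+ (N.con 2 N.:+ n) N.:* N.con 1 N.:= N.con 3 N.:+ n N.:* N.con 2) n)))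
    (SR.*-assoc (m (suc n)) (p (suc n)) (m (3 ℕ.+ n ℕ.* 2)))

qint-two : ∀ x → qint 2 x ≋ 𝟙 ⊕ x
qint-two = solve 1 (λ x → con (+ 1) :+ (x :* con (+ 1) :+ con (+ 0)) := con (+ 1) :+ x)
  where open SeriesSolver

-- The product has denominators with exponents n + 2, ..., 2n + 1, the formula has the odd ones up
-- to 2n + 1. `minus-step1` relates them once 1 - q^(n+1) is available, and this is the last factor
-- of the numerator.
case4 : ∀ n → 2 ≤ n → U4 n ≋ target 1 1 2 n
case4 n@(suc (suc n')) _ = begin
  U4 n ≈⟨ ⊗-congˡ (pre ⊗ two- ⊗ inv den₀) (≋-trans (≡⇒≋ (prodR-ΠS 3 n (λ k → H k ⊘ m (2 ℕ.* k ℕ.+ 1))))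
            (ΠS-div n' (λ i → H (3 ℕ.+ i)) M (λ i → m-unit (2 ℕ.* (3 ℕ.+ i) ℕ.+ 1) (ℕ.m≤n+m 1 (2 ℕ.* (3 ℕ.+ i)))))) ⟩
  pre ⊗ two- ⊗ inv den₀ ⊗ (ΠS n' (λ i → H (3 ℕ.+ i)) ⊗ inv (ΠS n' M))
    ≈⟨ div-⊗ (pre ⊗ two-) den₀ (ΠS n' (λ i → H (3 ℕ.+ i))) (ΠS n' M) den₀-unit M-unit ⟩
  pre ⊗ two- ⊗ ΠS n' (λ i → H (3 ℕ.+ i)) ⊗ inv (den₀ ⊗ ΠS n' M)
    ≈⟨ div-≋ (pre ⊗ two- ⊗ ΠS n' (λ i → H (3 ℕ.+ i))) (den₀ ⊗ ΠS n' M) (ps 1 2 n ⊗ (ps 1 1 n ⊗ ts 1 n)) (minus 1 (2 ℕ.+ n) n)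
         (⊗-unit den₀ (ΠS n' M) den₀-unit M-unit) (minus-unit 1 (2 ℕ.+ n) n (s≤s z≤n)) cross ⟩
  ps 1 2 n ⊗ (ps 1 1 n ⊗ ts 1 n) ⊗ inv (minus 1 (2 ℕ.+ n) n)
    ≈⟨ target-form 1 1 2 (2 ℕ.+ n) n (cong (3 ℕ.+_) (ℕ.*-identityʳ (suc n'))) ⟨
  target 1 1 2 n ∎
  where
  open ≋-Reasoning
  open SeriesSolver using (solve; _:*_; _:=_)
  pre two- den₀ : Series
  pre = qint 2 q ⊗ qint 3 (⊝ q) ⊗ qint 4 q
  two- = qint 2 (⊝ (q ^s (n ℕ.+ 1)))
  den₀ = (𝟙 ⊖ q) ⊗ (𝟙 ⊖ q ^s 3) ⊗ (𝟙 ⊖ q ^s 5)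
  H M D : ℕ → Series
  H k = qint (2 ℕ.* k ℕ.+ 1) q ⊖ q ^s k
  M i = m (2 ℕ.* (3 ℕ.+ i) ℕ.+ 1)
  D i = m (3 ℕ.+ i ℕ.* 2)
  den₀-unit : Unit den₀
  den₀-unit = refl
  M-unit : Unit (ΠS n' M)
  M-unit = ΠS-unit n' M (λ i → m-unit (2 ℕ.* (3 ℕ.+ i) ℕ.+ 1) (ℕ.m≤n+m 1 (2 ℕ.* (3 ℕ.+ i))))
  two-≋ : two- ≋ m (suc n)
  two-≋ = ≋-trans (qint-two (⊝ (q ^s (n ℕ.+ 1)))) (m-cong (ℕ.+-comm n 1))
  denominators : den₀ ⊗ ΠS n' M ≋ m 1 ⊗ ΠS n D
  denominators = ≋-trans (⊗-cong {den₀} {m 1 ⊗ D 0 ⊗ D 1} (⊗-congʳ (D 1) (⊗-congʳ (D 0) 1⊖q))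
      (ΠS-cong n' λ i → m-cong (N.solve 1 (λ i → N.con 2 N.:* (N.con 3 N.:+ i) N.:+ N.con 1 N.:= N.con 7 N.:+ i N.:* N.con 2) i)))
    (solve 4 (λ a b c d → a :* b :* c :* d := a :* (b :* (c :* d))) (m 1) (D 0) (D 1) (ΠS n' (D ∘ suc ∘ suc)))
  numerators : pre ⊗ two- ⊗ ΠS n' (λ i → H (3 ℕ.+ i)) ≋ ps 1 2 n ⊗ ts 1 n ⊗ m (suc n)
  numerators = ≋-trans (solve 3 (λ a b c → a :* b :* c := a :* c :* b) pre two- (ΠS n' (λ i → H (3 ℕ.+ i))))
    (⊗-cong {pre ⊗ ΠS n' (λ i → H (3 ℕ.+ i))} {ps 1 2 n ⊗ ts 1 n}
      (≋-trans (prefixed n') (ΠS-⊗ n (λ i → p (2 ℕ.+ i ℕ.* 1)) (λ i → tint 1 (suc i)))) two-≋)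
  closing : m (suc n) ⊗ minus 1 (2 ℕ.+ n) n ≋ m 1 ⊗ (ps 1 1 n ⊗ ΠS n D)
  closing = ≋-trans (⊗-congˡ (m (suc n)) (≡⇒≋ (cong (λ c → minus 1 c n) (ℕ.+-comm 1 (suc n)))))
    (≋-trans (minus-step1 n) (⊗-congˡ (m 1) (ΠS-⊗ n (λ i → p (1 ℕ.+ i ℕ.* 1)) D)))
  cross : pre ⊗ two- ⊗ ΠS n' (λ i → H (3 ℕ.+ i)) ⊗ minus 1 (2 ℕ.+ n) n ≋ ps 1 2 n ⊗ (ps 1 1 n ⊗ ts 1 n) ⊗ (den₀ ⊗ ΠS n' M)
  cross = begin
    pre ⊗ two- ⊗ ΠS n' (λ i → H (3 ℕ.+ i)) ⊗ minus 1 (2 ℕ.+ n) n ≈⟨ ⊗-congʳ (minus 1 (2 ℕ.+ n) n) numerators ⟩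
    ps 1 2 n ⊗ ts 1 n ⊗ m (suc n) ⊗ minus 1 (2 ℕ.+ n) n ≈⟨ SR.*-assoc (ps 1 2 n ⊗ ts 1 n) (m (suc n)) (minus 1 (2 ℕ.+ n) n) ⟩
    ps 1 2 n ⊗ ts 1 n ⊗ (m (suc n) ⊗ minus 1 (2 ℕ.+ n) n) ≈⟨ ⊗-congˡ (ps 1 2 n ⊗ ts 1 n) closing ⟩
    ps 1 2 n ⊗ ts 1 n ⊗ (m 1 ⊗ (ps 1 1 n ⊗ ΠS n D))
      ≈⟨ solve 5 (λ a t x b d → a :* t :* (x :* (b :* d)) := a :* (b :* t) :* (x :* d)) (ps 1 2 n) (ts 1 n) (m 1) (ps 1 1 n) (ΠS n D) ⟩
    ps 1 2 n ⊗ (ps 1 1 n ⊗ ts 1 n) ⊗ (m 1 ⊗ ΠS n D) ≈⟨ ⊗-congˡ (ps 1 2 n ⊗ (ps 1 1 n ⊗ ts 1 n)) denominators ⟨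
    ps 1 2 n ⊗ (ps 1 1 n ⊗ ts 1 n) ⊗ (den₀ ⊗ ΠS n' M) ∎
case4 (suc zero) (s≤s ())

-- cases 1, 2 and 3

quad : ℕ → Series
quad d = m ((2 ℕ.+ d ℕ.* 2) ℕ.+ d ℕ.* 2)

-- The same halving argument in q²; here the exponents that remain are the odd multiples of 2.
minus-step2 : ∀ n → minus 2 (2 ℕ.+ n ℕ.* 2) n ≋ ΠS n quad ⊗ ps 2 2 n
minus-step2 zero = ≋-sym (SR.*-identityˡ 𝟙)
minus-step2 (suc n) = begin
  minus 2 (4 ℕ.+ n ℕ.* 2) (suc n) ≡⟨ cong (λ c → minus 2 c (suc n)) (ℕ.+-comm 2 c) ⟩
  minus 2 (c ℕ.+ 2) (suc n) ≈⟨ minus-slide 2 c n (quad n ⊗ p c) (s≤s z≤n) double ⟩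
  minus 2 c n ⊗ (quad n ⊗ p c) ≈⟨ ⊗-congʳ (quad n ⊗ p c) (minus-step2 n) ⟩
  ΠS n quad ⊗ ps 2 2 n ⊗ (quad n ⊗ p c)
    ≈⟨ solve 4 (λ a b c d → a :* b :* (c :* d) := (a :* c) :* (b :* d)) (ΠS n quad) (ps 2 2 n) (quad n) (p c) ⟩
  ΠS n quad ⊗ quad n ⊗ (ps 2 2 n ⊗ p c)
    ≈⟨ ⊗-cong {ΠS n quad ⊗ quad n} {ΠS (suc n) quad} (≋-sym (ΠS-last n quad)) (≋-sym (ΠS-last n (λ i → p (2 ℕ.+ i ℕ.* 2)))) ⟩
  ΠS (suc n) quad ⊗ ps 2 2 (suc n) ∎
  where
  open ≋-Reasoning
  open SeriesSolver
  c = 2 ℕ.+ n ℕ.* 2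
  double : m (c ℕ.+ n ℕ.* 2) ⊗ m (c ℕ.+ suc n ℕ.* 2) ≋ m c ⊗ (quad n ⊗ p c)
  double = ≋-trans (⊗-congˡ (quad n) (m-double c))
    (solve 3 (λ a b c → a :* (b :* c) := b :* (a :* c)) (quad n) (m c) (p c))

quad-split : ∀ n → ΠS n quad ≋ ΠS n (λ i → m (1 ℕ.+ i ℕ.* 2)) ⊗ ps 2 1 n
quad-split n = ≋-trans (ΠS-cong n λ d → ≋-trans (m-cong (cong suc (sym (ℕ.+-suc (d ℕ.* 2) (d ℕ.* 2))))) (m-double (1 ℕ.+ d ℕ.* 2)))
  (ΠS-⊗ n (λ i → m (1 ℕ.+ i ℕ.* 2)) (λ i → p (1 ℕ.+ i ℕ.* 2)))

even-power : ∀ d → 𝟙 ⊕ (⊝ q) ^s suc (suc (d ℕ.+ d)) ≋ p (2 ℕ.+ d ℕ.* 2)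
even-power d = ≋-trans (≡⇒≋ (cong (λ k → 𝟙 ⊕ (⊝ q) ^s k) (double-suc d)))
  (≋-trans (⊕-congˡ 𝟙 (power-even (suc d))) (p-cong (sym (double-*2 (suc d)))))

odd-power : ∀ d → 𝟙 ⊕ (⊝ q) ^s suc (d ℕ.+ d) ≋ m (1 ℕ.+ d ℕ.* 2)
odd-power d = ≋-trans (⊕-congˡ 𝟙 (power-odd d)) (m-cong (odd-2 d))

factor-pair : ∀ a b a' b' n₁ d₁ → a ⊗ a' ≋ n₁ → b ⊗ b' ≋ d₁ → Unit b → Unit b' → (a ⊘ b) ⊗ (a' ⊘ b') ≋ n₁ ⊘ d₁
factor-pair a b a' b' n₁ d₁ en ed u u' = ≋-trans (div-⊗ a b a' b' u u')
  (⊗-cong {a ⊗ a'} {n₁} en (inv-cong (b ⊗ b') d₁ (Unit-≋ (≋-sym ed) (⊗-unit b b' u u')) ed))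

G₂ : ℕ → Series
G₂ k = qint (k ℕ.+ 1) (sq (k ℕ.+ 1)) ⊘ (𝟙 ⊕ ((⊝ q) ^s k))

-- The factors k = 2d + 1 and k = 2d + 2 are taken together: only such a pair of signed q-integers
-- is a polynomial in the shape of the product.
U2-form : ∀ n → U2 n ≋ ps 2 3 n ⊗ ts 2 n ⊗ inv (ΠS n (λ i → m (1 ℕ.+ i ℕ.* 2)) ⊗ ps 2 2 n)
U2-form n = begin
  U2 n ≡⟨ prodR-ΠS 1 (2 ℕ.* n) G₂ ⟩
  ΠS (2 ℕ.* n) (G₂ ∘ suc) ≡⟨ cong (λ k → ΠS k (G₂ ∘ suc)) (2*-double n) ⟩
  ΠS (n ℕ.+ n) (G₂ ∘ suc) ≈⟨ ΠS-pairs n (G₂ ∘ suc) ⟩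
  ΠS n (λ d → G₂ (suc (d ℕ.+ d)) ⊗ G₂ (suc (suc (d ℕ.+ d)))) ≈⟨ ΠS-cong n pair ⟩
  ΠS n (λ d → F d ⊘ D d) ≈⟨ ΠS-div n F D D-unit ⟩
  ΠS n F ⊗ inv (ΠS n D)
    ≈⟨ ⊗-cong {ΠS n F} {ps 2 3 n ⊗ ts 2 n} (ΠS-⊗ n (λ d → p (3 ℕ.+ d ℕ.* 2)) (λ d → tint 2 (suc d)))
         (inv-cong (ΠS n D) (ΠS n (λ i → m (1 ℕ.+ i ℕ.* 2)) ⊗ ps 2 2 n)
           (Unit-≋ (≋-sym D-split) (ΠS-unit n D D-unit)) D-split) ⟩
  ps 2 3 n ⊗ ts 2 n ⊗ inv (ΠS n (λ i → m (1 ℕ.+ i ℕ.* 2)) ⊗ ps 2 2 n) ∎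
  where
  open ≋-Reasoning
  F D : ℕ → Series
  F d = p (3 ℕ.+ d ℕ.* 2) ⊗ tint 2 (suc d)
  D d = m (1 ℕ.+ d ℕ.* 2) ⊗ p (2 ℕ.+ d ℕ.* 2)
  D-unit : ∀ i → Unit (D i)
  D-unit i = ⊗-unit (m (1 ℕ.+ i ℕ.* 2)) (p (2 ℕ.+ i ℕ.* 2)) (m-unit (1 ℕ.+ i ℕ.* 2) (s≤s z≤n)) (p-unit (2 ℕ.+ i ℕ.* 2) (s≤s z≤n))
  D-split : ΠS n D ≋ ΠS n (λ i → m (1 ℕ.+ i ℕ.* 2)) ⊗ ps 2 2 n
  D-split = ΠS-⊗ n (λ i → m (1 ℕ.+ i ℕ.* 2)) (λ i → p (2 ℕ.+ i ℕ.* 2))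
  pair : ∀ d → G₂ (suc (d ℕ.+ d)) ⊗ G₂ (suc (suc (d ℕ.+ d))) ≋ F d ⊘ D d
  pair d = factor-pair (Qs (suc (d ℕ.+ d) ℕ.+ 1)) (𝟙 ⊕ (⊝ q) ^s suc (d ℕ.+ d)) (Qs (suc (suc (d ℕ.+ d)) ℕ.+ 1)) (𝟙 ⊕ (⊝ q) ^s suc (suc (d ℕ.+ d)))
    (F d) (D d)
    (≋-trans (≡⇒≋ (cong₂ (λ i j → Qs i ⊗ Qs j) (ℕ.+-comm (suc (d ℕ.+ d)) 1) (ℕ.+-comm (suc (suc (d ℕ.+ d))) 1))) (next-pair d))
    (⊗-cong {𝟙 ⊕ (⊝ q) ^s suc (d ℕ.+ d)} {m (1 ℕ.+ d ℕ.* 2)} (odd-power d) (even-power d))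
    (Unit-≋ (odd-power d) (m-unit (1 ℕ.+ d ℕ.* 2) (s≤s z≤n)))
    (Unit-≋ (even-power d) (p-unit (2 ℕ.+ d ℕ.* 2) (s≤s z≤n)))

ms : ℕ → Series
ms n = ΠS n (λ i → m (1 ℕ.+ i ℕ.* 2))

ms-unit : ∀ n → Unit (ms n)
ms-unit n = ΠS-unit n (λ i → m (1 ℕ.+ i ℕ.* 2)) (λ i → m-unit (1 ℕ.+ i ℕ.* 2) (s≤s z≤n))

ps-unit : ∀ T c n → 1 ≤ c → Unit (ps T c n)
ps-unit T c n le = ΠS-unit n (λ i → p (c ℕ.+ i ℕ.* T)) (λ i → p-unit (c ℕ.+ i ℕ.* T) (ℕ.≤-trans le (ℕ.m≤m+n c (i ℕ.* T))))

case2 : ∀ n → 1 ≤ n → U2 n ≋ target 3 2 1 n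
case2 n@(suc n') _ = begin
  U2 n ≈⟨ U2-form n ⟩
  ps 2 3 n ⊗ ts 2 n ⊗ inv (ms n ⊗ ps 2 2 n)
    ≈⟨ div-≋ (ps 2 3 n ⊗ ts 2 n) (ms n ⊗ ps 2 2 n) (ps 2 1 n ⊗ (ps 2 3 n ⊗ ts 2 n)) (minus 2 D n)
         (⊗-unit (ms n) (ps 2 2 n) (ms-unit n) (ps-unit 2 2 n (s≤s z≤n))) (minus-unit 2 D n (s≤s z≤n)) cross ⟩
  ps 2 1 n ⊗ (ps 2 3 n ⊗ ts 2 n) ⊗ inv (minus 2 D n) ≈⟨ target-form 3 2 1 D n refl ⟨
  target 3 2 1 n ∎
  where
  open ≋-Reasoning
  open SeriesSolver using (solve; _:*_; _:=_)
  D = 2 ℕ.+ n ℕ.* 2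
  cross : ps 2 3 n ⊗ ts 2 n ⊗ minus 2 D n ≋ ps 2 1 n ⊗ (ps 2 3 n ⊗ ts 2 n) ⊗ (ms n ⊗ ps 2 2 n)
  cross = ≋-trans (⊗-congˡ (ps 2 3 n ⊗ ts 2 n) (≋-trans (minus-step2 n) (⊗-congʳ (ps 2 2 n) (quad-split n))))
    (solve 4 (λ a x b c → a :* (x :* b :* c) := b :* a :* (x :* c)) (ps 2 3 n ⊗ ts 2 n) (ms n) (ps 2 1 n) (ps 2 2 n))

-- `U3` lacks only the last factor f of `U2`, and the product for A = 3 is f times the one for A =
-- 1. So this case follows from the previous one by cancelling f.
case3 : ∀ n → 1 ≤ n → U3 n ≋ target 1 2 1 n
case3 n@(suc n') 1≤n = ⊗-cancelˡ f f-unit (≋-trans (SR.*-comm f (U3 n)) (≋-trans (≋-sym U2-last) (≋-trans (case2 n 1≤n)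
    (≋-trans relate (SR.*-comm (target 1 2 1 n) f)))))
  where
  open ≋-Reasoning
  open SeriesSolver using (solve; _:*_; _:=_)
  c = n ℕ.* 2
  a = Qs (suc (n ℕ.+ n))
  f = a ⊗ inv (p c)
  a-p : a ⊗ p 1 ≋ p (suc c)
  a-p = ≋-trans (qint-odd n) (p-cong (cong suc (sym (double-*2 n))))
  a-unit : Unit a
  -- The constant term is read off after multiplication by 1 + q, which does not change it.
  a-unit = trans (sym (ℤ.*-identityʳ (a 0))) (trans (sym (⊗-zero a (p 1))) (trans (at a-p 0) (p-unit (suc c) (s≤s z≤n))))
  f-unit : Unit f
  f-unit = ⊗-unit a (inv (p c)) a-unit refl
  G₃ : ℕ → Series
  G₃ k = qint k (sq k) ⊘ (𝟙 ⊕ ((⊝ q) ^s (k ∸ 1)))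
  U2-last : U2 n ≋ U3 n ⊗ f
  U2-last = begin
    U2 n ≡⟨ prodR-ΠS 1 (2 ℕ.* n) G₂ ⟩
    ΠS (2 ℕ.* n) (G₂ ∘ suc) ≈⟨ ΠS-last (2 ℕ.* n ∸ 1) (G₂ ∘ suc) ⟩
    ΠS (2 ℕ.* n ∸ 1) (G₂ ∘ suc) ⊗ G₂ (2 ℕ.* n)
      ≈⟨ ⊗-cong {ΠS (2 ℕ.* n ∸ 1) (G₂ ∘ suc)} {U3 n}
           (≋-trans (ΠS-cong (2 ℕ.* n ∸ 1) λ i → ≡⇒≋ (cong (λ k → Qs k ⊘ (𝟙 ⊕ (⊝ q) ^s suc i)) (ℕ.+-comm (suc i) 1)))
                    (≡⇒≋ (sym (prodR-ΠS 2 (2 ℕ.* n) G₃))))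
           last-factor ⟩
    U3 n ⊗ f ∎
    where
    even : 𝟙 ⊕ (⊝ q) ^s (2 ℕ.* n) ≋ p c
    even = ≋-trans (≡⇒≋ (cong (λ k → 𝟙 ⊕ (⊝ q) ^s k) (2*-double n))) (≋-trans (⊕-congˡ 𝟙 (power-even n)) (p-cong (sym (double-*2 n))))
    last-factor : G₂ (2 ℕ.* n) ≋ f
    last-factor = ⊗-cong {Qs (2 ℕ.* n ℕ.+ 1)} {a} (Qs-cong (2n+1-double n)) (inv-cong (𝟙 ⊕ (⊝ q) ^s (2 ℕ.* n)) (p c) (p-unit c (s≤s z≤n)) even)
  slide : minus 2 c n ⊗ p c ≋ minus 2 (2 ℕ.+ c) n
  slide = ⊗-cancelˡ (m c) (m-unit c (s≤s z≤n)) (begin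
    m c ⊗ (minus 2 c n ⊗ p c) ≈⟨ solve 3 (λ x y z → x :* (y :* z) := y :* (x :* z)) (m c) (minus 2 c n) (p c) ⟩
    minus 2 c n ⊗ (m c ⊗ p c) ≈⟨ ⊗-congˡ (minus 2 c n) (m-double c) ⟨
    minus 2 c n ⊗ m (c ℕ.+ c) ≈⟨ minus-last 2 c n ⟨
    m c ⊗ minus 2 (c ℕ.+ 2) n ≡⟨ cong (λ k → m c ⊗ minus 2 k n) (ℕ.+-comm c 2) ⟩
    m c ⊗ minus 2 (2 ℕ.+ c) n ∎)
  telescope : p 1 ⊗ ps 2 3 n ≋ ps 2 1 n ⊗ p (suc c)
  telescope = ΠS-last n (λ i → p (1 ℕ.+ i ℕ.* 2))
  relate : target 3 2 1 n ≋ target 1 2 1 n ⊗ f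
  relate = begin
    target 3 2 1 n ≈⟨ target-form 3 2 1 (2 ℕ.+ c) n refl ⟩
    ps 2 1 n ⊗ (ps 2 3 n ⊗ ts 2 n) ⊗ inv (minus 2 (2 ℕ.+ c) n)
      ≈⟨ div-≋ (ps 2 1 n ⊗ (ps 2 3 n ⊗ ts 2 n)) (minus 2 (2 ℕ.+ c) n) (ps 2 1 n ⊗ (ps 2 1 n ⊗ ts 2 n) ⊗ a) (minus 2 c n ⊗ p c)
           (minus-unit 2 (2 ℕ.+ c) n (s≤s z≤n)) (⊗-unit (minus 2 c n) (p c) (minus-unit 2 c n (s≤s z≤n)) (p-unit c (s≤s z≤n)))
           (⊗-cong {ps 2 1 n ⊗ (ps 2 3 n ⊗ ts 2 n)} {ps 2 1 n ⊗ (ps 2 1 n ⊗ ts 2 n) ⊗ a} numerators slide) ⟩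
    ps 2 1 n ⊗ (ps 2 1 n ⊗ ts 2 n) ⊗ a ⊗ inv (minus 2 c n ⊗ p c)
      ≈⟨ div-⊗ (ps 2 1 n ⊗ (ps 2 1 n ⊗ ts 2 n)) (minus 2 c n) a (p c) (minus-unit 2 c n (s≤s z≤n)) (p-unit c (s≤s z≤n)) ⟨
    ps 2 1 n ⊗ (ps 2 1 n ⊗ ts 2 n) ⊗ inv (minus 2 c n) ⊗ f ≈⟨ ⊗-congʳ f (target-form 1 2 1 c n refl) ⟨
    target 1 2 1 n ⊗ f ∎
    where
    numerators : ps 2 1 n ⊗ (ps 2 3 n ⊗ ts 2 n) ≋ ps 2 1 n ⊗ (ps 2 1 n ⊗ ts 2 n) ⊗ a
    numerators = ⊗-cancelˡ (p 1) refl (begin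
      p 1 ⊗ (ps 2 1 n ⊗ (ps 2 3 n ⊗ ts 2 n))
        ≈⟨ solve 4 (λ x y z t → x :* (y :* (z :* t)) := y :* (x :* z) :* t) (p 1) (ps 2 1 n) (ps 2 3 n) (ts 2 n) ⟩
      ps 2 1 n ⊗ (p 1 ⊗ ps 2 3 n) ⊗ ts 2 n ≈⟨ ⊗-congʳ (ts 2 n) (⊗-congˡ (ps 2 1 n) telescope) ⟩
      ps 2 1 n ⊗ (ps 2 1 n ⊗ p (suc c)) ⊗ ts 2 n ≈⟨ ⊗-congʳ (ts 2 n) (⊗-congˡ (ps 2 1 n) (⊗-congˡ (ps 2 1 n) a-p)) ⟨
      ps 2 1 n ⊗ (ps 2 1 n ⊗ (a ⊗ p 1)) ⊗ ts 2 n
        ≈⟨ solve 4 (λ y a x t → y :* (y :* (a :* x)) :* t := x :* (y :* (y :* t) :* a)) (ps 2 1 n) a (p 1) (ts 2 n) ⟩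
      p 1 ⊗ (ps 2 1 n ⊗ (ps 2 1 n ⊗ ts 2 n) ⊗ a) ∎)

ΠS-omit : ∀ N j (F : ℕ → Series) → j < N → ΠS N (λ i → if i ≡ᵇ j then 𝟙 else F i) ⊗ F j ≋ ΠS N F
ΠS-omit (suc N) zero    F _        = solve 2 (λ a b → con (+ 1) :* a :* b := b :* a) (ΠS N (F ∘ suc)) (F 0)
  where open SeriesSolver
ΠS-omit (suc N) (suc j) F (s≤s lt) = ≋-trans (SR.*-assoc (F 0) (ΠS N (λ i → if i ≡ᵇ j then 𝟙 else F (suc i))) (F (suc j)))
  (⊗-congˡ (F 0) (ΠS-omit N j (F ∘ suc) lt))

-- The gap at k = n + 1 prevents the pairing of consecutive factors, and its parity varies with n.
-- So the missing factor is put back first, at the price of 1 - q^(2n+2). This extends the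
-- denominator of the product downwards by one factor, to a form that `minus-step2` splits.
case1 : ∀ n → 1 ≤ n → U1 n ≋ target 3 2 3 n
case1 n@(suc n') _ = ⊗-cancelˡ (p 1) refl (begin
  p 1 ⊗ U1 n ≈⟨ restore ⟩
  m (2 ℕ.+ c) ⊗ full ≈⟨ ⊗-congˡ (m (2 ℕ.+ c)) full-form ⟩
  m (2 ℕ.+ c) ⊗ (ps 2 3 n ⊗ ts 2 n ⊗ inv (m 1 ⊗ (ps 2 2 n ⊗ ΠS n D)))
    ≈⟨ SR.*-assoc (m (2 ℕ.+ c)) (ps 2 3 n ⊗ ts 2 n) (inv (m 1 ⊗ (ps 2 2 n ⊗ ΠS n D))) ⟨
  m (2 ℕ.+ c) ⊗ (ps 2 3 n ⊗ ts 2 n) ⊗ inv (m 1 ⊗ (ps 2 2 n ⊗ ΠS n D))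
    ≈⟨ div-≋ (m (2 ℕ.+ c) ⊗ (ps 2 3 n ⊗ ts 2 n)) (m 1 ⊗ (ps 2 2 n ⊗ ΠS n D)) (p 1 ⊗ (ps 2 3 n ⊗ (ps 2 3 n ⊗ ts 2 n))) (minus 2 (4 ℕ.+ c) n)
         den-unit (minus-unit 2 (4 ℕ.+ c) n (s≤s z≤n)) cross ⟩
  p 1 ⊗ (ps 2 3 n ⊗ (ps 2 3 n ⊗ ts 2 n)) ⊗ inv (minus 2 (4 ℕ.+ c) n)
    ≈⟨ SR.*-assoc (p 1) (ps 2 3 n ⊗ (ps 2 3 n ⊗ ts 2 n)) (inv (minus 2 (4 ℕ.+ c) n)) ⟩
  p 1 ⊗ (ps 2 3 n ⊗ (ps 2 3 n ⊗ ts 2 n) ⊗ inv (minus 2 (4 ℕ.+ c) n)) ≈⟨ ⊗-congˡ (p 1) (target-form 3 2 3 (4 ℕ.+ c) n refl) ⟨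
  p 1 ⊗ target 3 2 3 n ∎)
  where
  open ≋-Reasoning
  open SeriesSolver using (solve; _:*_; _:=_; _:+_; _:-_; con)
  c = n ℕ.* 2
  D G₁ : ℕ → Series
  D i = m (3 ℕ.+ i ℕ.* 2)
  G₁ k = Qs k ⊘ (𝟙 ⊕ ((⊝ q) ^s k))
  full : Series
  full = ΠS (suc (n ℕ.+ n)) (G₁ ∘ suc)
  D-unit : ∀ i → Unit (D i)
  D-unit i = m-unit (3 ℕ.+ i ℕ.* 2) (s≤s z≤n)
  den-unit : Unit (m 1 ⊗ (ps 2 2 n ⊗ ΠS n D))
  den-unit = ⊗-unit (m 1) (ps 2 2 n ⊗ ΠS n D) refl (⊗-unit (ps 2 2 n) (ΠS n D) (ps-unit 2 2 n (s≤s z≤n)) (ΠS-unit n D D-unit))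

  full-form : full ≋ ps 2 3 n ⊗ ts 2 n ⊗ inv (m 1 ⊗ (ps 2 2 n ⊗ ΠS n D))
  full-form = begin
    G₁ 1 ⊗ ΠS (n ℕ.+ n) (G₁ ∘ suc ∘ suc)
      ≈⟨ ⊗-cong {G₁ 1} {𝟙 ⊘ m 1} (⊗-cong {Qs 1} {𝟙} Qs-one (inv-cong (𝟙 ⊕ (⊝ q) ^s 1) (m 1) refl (odd-power 0)))
           (≋-trans (ΠS-pairs n (G₁ ∘ suc ∘ suc)) (≋-trans (ΠS-cong n pair) (ΠS-div n F E E-unit))) ⟩
    𝟙 ⊘ m 1 ⊗ (ΠS n F ⊗ inv (ΠS n E)) ≈⟨ div-⊗ 𝟙 (m 1) (ΠS n F) (ΠS n E) refl (ΠS-unit n E E-unit) ⟩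
    𝟙 ⊗ ΠS n F ⊗ inv (m 1 ⊗ ΠS n E)
      ≈⟨ ⊗-cong {𝟙 ⊗ ΠS n F} {ps 2 3 n ⊗ ts 2 n} (≋-trans (SR.*-identityˡ (ΠS n F)) (ΠS-⊗ n (λ d → p (3 ℕ.+ d ℕ.* 2)) (λ d → tint 2 (suc d))))
           (inv-cong (m 1 ⊗ ΠS n E) (m 1 ⊗ (ps 2 2 n ⊗ ΠS n D)) den-unit (⊗-congˡ (m 1) (ΠS-⊗ n (λ i → p (2 ℕ.+ i ℕ.* 2)) D))) ⟩
    ps 2 3 n ⊗ ts 2 n ⊗ inv (m 1 ⊗ (ps 2 2 n ⊗ ΠS n D)) ∎
    where
    F E : ℕ → Series
    F d = p (3 ℕ.+ d ℕ.* 2) ⊗ tint 2 (suc d)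
    E d = p (2 ℕ.+ d ℕ.* 2) ⊗ D d
    E-unit : ∀ i → Unit (E i)
    E-unit i = ⊗-unit (p (2 ℕ.+ i ℕ.* 2)) (D i) (p-unit (2 ℕ.+ i ℕ.* 2) (s≤s z≤n)) (D-unit i)
    odd : ∀ d → 𝟙 ⊕ (⊝ q) ^s suc (suc (suc (d ℕ.+ d))) ≋ D d
    odd d = ≋-trans (≡⇒≋ (cong (λ k → 𝟙 ⊕ (⊝ q) ^s suc k) (double-suc d))) (odd-power (suc d))
    pair : ∀ d → G₁ (suc (suc (d ℕ.+ d))) ⊗ G₁ (suc (suc (suc (d ℕ.+ d)))) ≋ F d ⊘ E d
    pair d = factor-pair (Qs (suc (suc (d ℕ.+ d)))) (𝟙 ⊕ (⊝ q) ^s suc (suc (d ℕ.+ d))) (Qs (suc (suc (suc (d ℕ.+ d))))) (𝟙 ⊕ (⊝ q) ^s suc (suc (suc (d ℕ.+ d))))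
      (F d) (E d) (next-pair d) (⊗-cong {𝟙 ⊕ (⊝ q) ^s suc (suc (d ℕ.+ d))} {p (2 ℕ.+ d ℕ.* 2)} (even-power d) (odd d))
      (Unit-≋ (even-power d) (p-unit (2 ℕ.+ d ℕ.* 2) (s≤s z≤n))) (Unit-≋ (odd d) (D-unit d))

  -- (1 + q) [n+1]_{-q} (1 + (-q)^(n+1)) = 1 - q^(2n+2)
  restore : p 1 ⊗ U1 n ≋ m (2 ℕ.+ c) ⊗ full
  restore = begin
    p 1 ⊗ (qint (n ℕ.+ 1) (⊝ q) ⊗ qint (n ℕ.+ 1) (sq (n ℕ.+ 1)) ⊗ prodR 1 (2 ℕ.* n ℕ.+ 1) (λ k → if k ≡ᵇ n ℕ.+ 1 then 𝟙 else G₁ k))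
      ≡⟨ cong₂ (λ k l → p 1 ⊗ (qint k (⊝ q) ⊗ Qs k ⊗ l)) (ℕ.+-comm n 1)
           (trans (cong (λ k → prodR 1 (2 ℕ.* n ℕ.+ 1) (λ i → if i ≡ᵇ k then 𝟙 else G₁ i)) (ℕ.+-comm n 1))
             (trans (prodR-ΠS 1 (2 ℕ.* n ℕ.+ 1) (λ i → if i ≡ᵇ suc n then 𝟙 else G₁ i))
               (cong (λ k → ΠS k (λ i → if i ≡ᵇ n then 𝟙 else G₁ (suc i))) (2n+1-double n)))) ⟩
    p 1 ⊗ (a ⊗ b ⊗ omitted)
      ≈⟨ ⊗-cong {p 1} {𝟙 ⊖ (⊝ q)} (≋-sym 1⊖⊝q) (≋-refl {a ⊗ b ⊗ omitted}) ⟩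
    (𝟙 ⊖ (⊝ q)) ⊗ (a ⊗ b ⊗ omitted)
      ≈⟨ solve 4 (λ x a b o → x :* (a :* b :* o) := (a :* x) :* (o :* b)) (𝟙 ⊖ (⊝ q)) a b omitted ⟩
    a ⊗ (𝟙 ⊖ (⊝ q)) ⊗ (omitted ⊗ b) ≈⟨ ⊗-cong {a ⊗ (𝟙 ⊖ (⊝ q))} {𝟙 ⊖ y} (geometric (suc n) (⊝ q)) omitted-b ⟩
    (𝟙 ⊖ y) ⊗ ((𝟙 ⊕ y) ⊗ full)
      ≈⟨ solve 2 (λ y f → (con (+ 1) :- y) :* ((con (+ 1) :+ y) :* f) := (con (+ 1) :- y :* y) :* f) y full ⟩
    (𝟙 ⊖ y ⊗ y) ⊗ full ≈⟨ ⊗-congʳ full (⊕-congˡ 𝟙 (⊝-cong square)) ⟩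
    m (2 ℕ.+ c) ⊗ full ∎
    where
    a b y omitted : Series
    a = qint (suc n) (⊝ q)
    b = Qs (suc n)
    y = (⊝ q) ^s suc n
    omitted = ΠS (suc (n ℕ.+ n)) (λ i → if i ≡ᵇ n then 𝟙 else G₁ (suc i))
    square : y ⊗ y ≋ X (2 ℕ.+ c)
    square = ≋-trans (≋-sym (^s-+ (⊝ q) (suc n) (suc n))) (≋-trans (power-even (suc n)) (≡⇒≋ (cong X (sym (double-*2 (suc n))))))
    y-unit : Unit (𝟙 ⊕ y)
    y-unit = cong (ℤ._+_ (+ 1)) (⊗-zero (⊝ q) ((⊝ q) ^s n))
    omitted-b : omitted ⊗ b ≋ (𝟙 ⊕ y) ⊗ full
    omitted-b = begin
      omitted ⊗ b ≈⟨ SR.*-identityʳ (omitted ⊗ b) ⟨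
      omitted ⊗ b ⊗ 𝟙 ≈⟨ ⊗-congˡ (omitted ⊗ b) (⊗-inverseʳ (𝟙 ⊕ y) y-unit) ⟨
      omitted ⊗ b ⊗ ((𝟙 ⊕ y) ⊗ inv (𝟙 ⊕ y))
        ≈⟨ solve 4 (λ o b y i → o :* b :* (y :* i) := y :* (o :* (b :* i))) omitted b (𝟙 ⊕ y) (inv (𝟙 ⊕ y)) ⟩
      (𝟙 ⊕ y) ⊗ (omitted ⊗ G₁ (suc n)) ≈⟨ ⊗-congˡ (𝟙 ⊕ y) (ΠS-omit (suc (n ℕ.+ n)) n (G₁ ∘ suc) (s≤s (ℕ.m≤m+n n n))) ⟩
      (𝟙 ⊕ y) ⊗ full ∎

  cross : m (2 ℕ.+ c) ⊗ (ps 2 3 n ⊗ ts 2 n) ⊗ minus 2 (4 ℕ.+ c) n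
          ≋ p 1 ⊗ (ps 2 3 n ⊗ (ps 2 3 n ⊗ ts 2 n)) ⊗ (m 1 ⊗ (ps 2 2 n ⊗ ΠS n D))
  cross = begin
    m (2 ℕ.+ c) ⊗ P ⊗ minus 2 (4 ℕ.+ c) n
      ≈⟨ solve 3 (λ x y z → x :* y :* z := y :* (x :* z)) (m (2 ℕ.+ c)) P (minus 2 (4 ℕ.+ c) n) ⟩
    P ⊗ (m (2 ℕ.+ c) ⊗ minus 2 (4 ℕ.+ c) n) ≡⟨ cong (λ k → P ⊗ (m (2 ℕ.+ c) ⊗ minus 2 k n)) (ℕ.+-comm 2 (2 ℕ.+ c)) ⟩
    P ⊗ minus 2 (2 ℕ.+ c) (suc n) ≈⟨ ⊗-congˡ P (≋-trans (minus-last 2 (2 ℕ.+ c) n) (⊗-congʳ (quad n) (minus-step2 n))) ⟩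
    P ⊗ (ΠS n quad ⊗ ps 2 2 n ⊗ quad n)
      ≈⟨ solve 4 (λ a b c d → a :* (b :* c :* d) := a :* (c :* (b :* d))) P (ΠS n quad) (ps 2 2 n) (quad n) ⟩
    P ⊗ (ps 2 2 n ⊗ (ΠS n quad ⊗ quad n)) ≈⟨ ⊗-congˡ P (⊗-congˡ (ps 2 2 n) (≋-trans (≋-sym (ΠS-last n quad)) quads)) ⟩
    P ⊗ (ps 2 2 n ⊗ (m 1 ⊗ p 1 ⊗ (ΠS n D ⊗ ps 2 3 n)))
      ≈⟨ solve 6 (λ P b x y d a → P :* (b :* (x :* y :* (d :* a))) := y :* (a :* P) :* (x :* (b :* d)))
           P (ps 2 2 n) (m 1) (p 1) (ΠS n D) (ps 2 3 n) ⟩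
    p 1 ⊗ (ps 2 3 n ⊗ P) ⊗ (m 1 ⊗ (ps 2 2 n ⊗ ΠS n D)) ∎
    where
    P = ps 2 3 n ⊗ ts 2 n
    quads : ΠS (suc n) quad ≋ m 1 ⊗ p 1 ⊗ (ΠS n D ⊗ ps 2 3 n)
    quads = ≋-trans (quad-split (suc n))
      (solve 4 (λ x d y a → (x :* d) :* (y :* a) := x :* y :* (d :* a)) (m 1) (ΠS n D) (p 1) (ps 2 3 n))

-- The growth series

GF⇒growthIs : ∀ {n l} {MW : CoxMatrix l} {φ : Fin (suc n) → Word l} {U : Series} → GF (CoxEq (Ct n)) (Length MW φ) U → GrowthIs n MW φ U
GF⇒growthIs gf m with gf m
... | counted ws size sound distinct complete = length ws , (ws , refl , sound , distinct , complete) , size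

growthIs : ∀ {n A T B l} {MW : CoxMatrix l} {φ : Fin (suc n) → Word l} {U : Series} → 2 ≤ n → 1 ≤ A → 1 ≤ T → 1 ≤ B →
  GroupLength n A T B (Length MW φ) → U ≋ target A T B n → GrowthIs n MW φ U
growthIs {n} {A} {T} {B} 2≤n 1≤A 1≤T 1≤B groupLength match = GF⇒growthIs (GF-≋ {F = target A T B n} (≋-sym match)
  (Affine.growth 2≤n 1≤A 1≤T 1≤B groupLength (SeriesIdentities.lattice-GF T 1≤T A B 1≤A 1≤B n)))

theorem1p9 : (n : ℕ) → 2 ≤ n →
    GrowthIs n (At (2 * n + 1)) (φ1 n) (U1 n)
    × GrowthIs n (At (2 * n)) (φ2 n) (U2 n)
    × GrowthIs n (At (2 * n ∸ 1)) (φ3 n) (U3 n)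
    × GrowthIs n (Bt (n + 1)) (φ4 n) (U4 n)
    × GrowthIs n (Dt (n + 2)) (φ5 n) (U5 n)
    × GrowthIs n (Ct (2 * n + 1)) (φ6 n) (U6 n)
    × GrowthIs n (Ct (2 * n)) (φ7 n) (U7 n)
theorem1p9 n 2≤n =
    growthIs 2≤n pos pos pos (groupLength₁ n 2≤n) (case1 n 1≤n)
  , growthIs 2≤n pos pos pos (groupLength₂ n 2≤n) (case2 n 1≤n)
  , growthIs 2≤n pos pos pos (groupLength₃ n 2≤n) (case3 n 1≤n)
  , growthIs 2≤n pos pos pos (groupLength₄ n 2≤n) (case4 n 2≤n)
  , growthIs 2≤n pos pos pos (groupLength₅ n 2≤n) (case5 n 2≤n)
  , growthIs 2≤n pos pos pos (groupLength₆ n 2≤n) (case6 n 1≤n)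
  , growthIs 2≤n pos pos pos (groupLength₇ n 2≤n) (case7 n 1≤n)
  where
  1≤n : 1 ≤ n
  1≤n = ℕ.<⇒≤ 2≤n
  pos : ∀ {k} → 1 ≤ suc k
  pos = s≤s z≤n
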